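{- Let $\mathcal{H}$ be a hereditary $3$-graph property. Then $\mathcal{H}$ admits zero $\mathrm{disc}_{2,3}$-error if and only if $\mathcal{H}$ admits zero $\mathrm{vdisc}_3$-error.
   Context: For distinct $x,y,z$ write $xy=\{x,y\}$, $xyz=\{x,y,z\}$; $[n]=\{1,\dots,n\}$. $K_2[X,Y]=\{xy: x\in X,y\in Y,x\neq y\}$, $K_3[X,Y,Z]=\{xyz:x\in X,y\in Y,z\in Z\text{ pairwise distinct}\}$. A $3$-graph is a pair $H=(V,F)$ with $F\subseteq\binom{V}{3}$. A hereditary $3$-graph property is a class of finite $3$-graphs closed under isomorphism and induced sub-$3$-graphs. An equipartition is a partition whose parts differ in size by at most $1$. A $3$-partite $3$-graph $(U\cup V\cup W,F)$ with $|F|=d|U||V||W|$ has $\mathrm{vdisc}_3(\epsilon)$ if for all $U'\subseteq U$, $V'\subseteq V$, $W'\subseteq W$, $\big||F\cap K_3[U',V',W']|-d|U'||V'||W'|\big|\leq\epsilon|U||V||W|$. $\mathcal{H}$ admits zero $\mathrm{vdisc}_3$-error if for all $\epsilon>0$ and $t_0\geq1$ there are $T,N$ such that for every $H=(V,F)\in\mathcal{H}$ with $|V|\geq N$ there is an equipartition $\mathcal{P}$ of $V$ into $t$ parts, $t_0\leq t\leq T$, such that for every three distinct parts $X,Y,Z\in\mathcal{P}$ the $3$-graph $(X\cup Y\cup Z,F\cap K_3[X,Y,Z])$ has $\mathrm{vdisc}_3(\epsilon)$. A bipartite graph $(U\cup W,E)$ with $|E|=d|U||W|$ has $\mathrm{disc}_2(\epsilon)$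 if for all $U'\subseteq U$, $W'\subseteq W$, $\big||E\cap K_2[U',W']|-d|U'||W'|\big|\leq\epsilon|U||W|$; it has $\mathrm{disc}_2(\epsilon;d')$ if moreover $\big||E|-d'|U||W|\big|\leq\epsilon|U||W|$. For a graph $G$, $K_3^{(2)}(G)$ is the set of vertex sets of triangles of $G$. If $G=(V_1\cup V_2\cup V_3,E)$ is a $3$-partite graph and $H'=(V_1\cup V_2\cup V_3,F')$ is a $3$-graph with $F'\subseteq K_3^{(2)}(G)$ and $|F'|=d_3|K_3^{(2)}(G)|$, then $(H',G)$ has $\mathrm{disc}_{2,3}(\epsilon_1,\epsilon_2)$ if there is $d_2\in(0,1]$ such that each bipartite graph $G[V_i,V_j]$ ($1\leq i<j\leq3$) has $\mathrm{disc}_2(\epsilon_2;d_2)$ and for every (not necessarily induced) subgraph $G'\subseteq G$, $\big||F'\cap K_3^{(2)}(G')|-d_3|K_3^{(2)}(G')|\big|\leq\epsilon_1d_2^3|V_1||V_2||V_3|$. A $(t,\ell,\epsilon_1,\epsilon_2)$-decomposition $\mathcal{P}$ of a set $V$ consists of a partition $V=V_1\cup\dots\cup V_t$ with $|V_1|\leq\dots\leq|V_t|\leq|V_1|+1$ and for each $ij\in\binom{[t]}{2}$ a partition $K_2[V_i,V_j]=\bigcup_{\alpha\leq\ell}P_{ij}^\alpha$, such that for all but at most $\epsilon_1|V|^3$ triples $xyz\in\binom V3$ there are $ijk\in\binom{[t]}{3}$ and $\alpha,\beta,\gamma\in[\ell]$ with $xy\in P^\alpha_{ij}$, $xz\in P^\beta_{ik}$,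 $yz\in P^\gamma_{jk}$, and each of $P^\alpha_{ij},P^\beta_{ik},P^\gamma_{jk}$ (as bipartite graphs) has $\mathrm{disc}_2(\epsilon_2;1/\ell)$. A triad of $\mathcal{P}$ is a $3$-partite graph $G_{ijk}^{\alpha,\beta,\gamma}=(V_i\cup V_j\cup V_k,P_{ij}^\alpha\cup P_{ik}^\beta\cup P_{jk}^\gamma)$ with $ijk\in\binom{[t]}{3}$, $\alpha,\beta,\gamma\in[\ell]$. For $H=(V,F)$, a triad $G$ of $\mathcal{P}$ has $\mathrm{disc}_{2,3}(\epsilon_1,\epsilon_2)$ with respect to $H$ if $(H',G)$ does, where $H'=(V_i\cup V_j\cup V_k,F\cap K_3^{(2)}(G))$. $\mathcal{H}$ admits zero $\mathrm{disc}_{2,3}$-error if for all $t_0,\ell_0\geq1$, $\epsilon_1>0$, $\epsilon_2:\mathbb{N}\to(0,1]$ there are $N,T,L$ such that for every $H=(V,F)\in\mathcal{H}$ with $|V|\geq N$ there are $t_0\leq t\leq T$, $\ell_0\leq\ell\leq L$ and a $(t,\ell,\epsilon_1,\epsilon_2(\ell))$-decomposition $\mathcal{P}$ of $V$ such that every triad of $\mathcal{P}$ has $\mathrm{disc}_{2,3}(\epsilon_1,\epsilon_2(\ell))$ with respect to $H$. -}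

module Defs where

open import Level using (Level)
open import Data.Bool.Base using (Bool; false; T; _∧_)
open import Data.Fin.Base as Fin using (Fin)
import Data.Fin.Properties as Finₚ
open import Data.Fin.Subset using (Subset; _⊆_; ∣_∣)
open import Data.Integer.Base using (+_)
open import Data.List.Base using (List; length; filterᵇ; allFin; cartesianProduct)
open import Data.List.Membership.Propositional using (_∉_)
open import Data.Nat.Base as ℕ using (ℕ; NonZero)
open import Data.Product.Base using (Σ; Σ-syntax; ∃; ∃-syntax; _×_; _,_)
open import Data.Rational.Base as ℚ using (ℚ; 0ℚ; 1ℚ; _/_)
open import Data.Vec.Base using (lookup; tabulate)
open import Function.Definitions using (Injective)
open import Relation.Binary.PropositionalEquality.Core using (_≡_; _≢_)
open import Relation.Nullary.Decidable.Core using (does)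

private
  variable
    p : Level
    n : ℕ

infix 4 _≈_within_ _⊆ᵍ_
infixl 7 _∩₃_

fromℕ : ℕ → ℚ
fromℕ m = + m / 1

_≈_within_ : ℚ → ℚ → ℚ → Set
a ≈ b within e = ℚ.∣ a ℚ.- b ∣ ℚ.≤ e

-- A 3-graph on the vertex set Fin n: a set of unordered triples of distinct
-- vertices, given by its symmetric characteristic function.
record ThreeGraph (n : ℕ) : Set where
  field
    edge     : Fin n → Fin n → Fin n → Bool
    swap₁₂   : ∀ x y z → edge x y z ≡ edge y x z
    swap₂₃   : ∀ x y z → edge x y z ≡ edge x z y
    loopless : ∀ x z → edge x x z ≡ false

open ThreeGraph public

-- Classes of finite 3-graphs, up to isomorphism.
Property : (p : Level) → Set (Level.suc p)
Property p = {n : ℕ} → ThreeGraph n → Set p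

-- G is isomorphic to the sub-3-graph of H induced on the image of f.  A
-- bijective f is an isomorphism, so closure under isomorphism is included.
Hereditary : Property p → Set p
Hereditary 𝓗 =
  ∀ {m n} (G : ThreeGraph m) (H : ThreeGraph n) (f : Fin m → Fin n) →
  Injective _≡_ _≡_ f →
  (∀ x y z → edge G x y z ≡ edge H (f x) (f y) (f z)) →
  𝓗 H → 𝓗 G

-- Bipartite graphs and 3-partite 3-graphs.  Their parts are given separately,
-- as pairwise disjoint subsets of Fin n.  An edge is listed with its vertices
-- in the order of the parts, and values at tuples not running through the parts
-- in order are never read.  Disjointness makes counting ordered tuples the
-- same as counting edges.
Rel₂ Rel₃ : ℕ → Set
Rel₂ n = Fin n → Fin n → Bool
Rel₃ n = Fin n → Fin n → Fin n → Bool

-- The number of edges in E ∩ K₂[U,W].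
count₂ : Rel₂ n → (U W : Subset n) → ℕ
count₂ {n} E U W =
  length (filterᵇ (λ { (x , y) → lookup U x ∧ lookup W y ∧ E x y })
    (cartesianProduct (allFin n) (allFin n)))

-- The number of edges in F ∩ K₃[U,V,W].
count₃ : Rel₃ n → (U V W : Subset n) → ℕ
count₃ {n} F U V W =
  length (filterᵇ (λ { (x , y , z) → lookup U x ∧ lookup V y ∧ lookup W z ∧ F x y z })
    (cartesianProduct (allFin n) (cartesianProduct (allFin n) (allFin n))))

-- The density d is unique, unless a part is empty and the condition is vacuous.
vdisc₃ : ℚ → (U V W : Subset n) → Rel₃ n → Set
vdisc₃ {n} ε U V W F =
  ∃[ d ] (fromℕ (count₃ F U V W) ≡ d ℚ.* vol U V W) ×
    (∀ (U′ V′ W′ : Subset n) → U′ ⊆ U → V′ ⊆ V → W′ ⊆ W →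
      fromℕ (count₃ F U′ V′ W′) ≈ d ℚ.* vol U′ V′ W′ within (ε ℚ.* vol U V W))
  where
  vol : (A B C : Subset n) → ℚ
  vol A B C = fromℕ (∣ A ∣ ℕ.* ∣ B ∣ ℕ.* ∣ C ∣)

disc₂ : ℚ → (U W : Subset n) → Rel₂ n → Set
disc₂ {n} ε U W E =
  ∃[ d ] (fromℕ (count₂ E U W) ≡ d ℚ.* area U W) ×
    (∀ (U′ W′ : Subset n) → U′ ⊆ U → W′ ⊆ W →
      fromℕ (count₂ E U′ W′) ≈ d ℚ.* area U′ W′ within (ε ℚ.* area U W))
  where
  area : (A B : Subset n) → ℚ
  area A B = fromℕ (∣ A ∣ ℕ.* ∣ B ∣)

disc₂[_⨾_] : ℚ → ℚ → (U W : Subset n) → Rel₂ n → Set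
disc₂[ ε ⨾ d′ ] U W E =
  disc₂ ε U W E ×
  (fromℕ (count₂ E U W) ≈ d′ ℚ.* fromℕ (∣ U ∣ ℕ.* ∣ W ∣)
    within (ε ℚ.* fromℕ (∣ U ∣ ℕ.* ∣ W ∣)))

-- The edge set of a 3-partite graph on parts V₁, V₂, V₃.
record Edges (n : ℕ) : Set where
  field
    E₁₂ E₁₃ E₂₃ : Rel₂ n

open Edges public

_⊆ᵍ_ : Edges n → Edges n → Set
G′ ⊆ᵍ G =
  (∀ x y → T (E₁₂ G′ x y) → T (E₁₂ G x y)) ×
  (∀ x z → T (E₁₃ G′ x z) → T (E₁₃ G x z)) ×
  (∀ y z → T (E₂₃ G′ y z) → T (E₂₃ G y z))

-- K₃⁽²⁾(G)
triangles : Edges n → Rel₃ n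
triangles G x y z = E₁₂ G x y ∧ E₁₃ G x z ∧ E₂₃ G y z

_∩₃_ : Rel₃ n → Rel₃ n → Rel₃ n
(F ∩₃ F′) x y z = F x y z ∧ F′ x y z

-- The pair (H′, G), where H′ has edge set F′ ⊆ K₃⁽²⁾(G).
disc₂,₃ : ℚ → ℚ → (V₁ V₂ V₃ : Subset n) → Rel₃ n → Edges n → Set
disc₂,₃ {n} ε₁ ε₂ V₁ V₂ V₃ F′ G =
  ∃[ d₃ ] (fromℕ (# F′) ≡ d₃ ℚ.* fromℕ (# (triangles G))) ×
  ∃[ d₂ ] (0ℚ ℚ.< d₂) × (d₂ ℚ.≤ 1ℚ) ×
    disc₂[ ε₂ ⨾ d₂ ] V₁ V₂ (E₁₂ G) ×
    disc₂[ ε₂ ⨾ d₂ ] V₁ V₃ (E₁₃ G) ×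
    disc₂[ ε₂ ⨾ d₂ ] V₂ V₃ (E₂₃ G) ×
    (∀ (G′ : Edges n) → G′ ⊆ᵍ G →
      fromℕ (# (F′ ∩₃ triangles G′)) ≈ d₃ ℚ.* fromℕ (# (triangles G′))
        within (ε₁ ℚ.* (d₂ ℚ.* d₂ ℚ.* d₂) ℚ.* fromℕ (∣ V₁ ∣ ℕ.* ∣ V₂ ∣ ℕ.* ∣ V₃ ∣)))
  where
  # : Rel₃ n → ℕ
  # F = count₃ F V₁ V₂ V₃

Distinct : {t : ℕ} → Fin t → Fin t → Fin t → Set
Distinct i j k = i ≢ j × i ≢ k × j ≢ k

-- A partition of Fin n into t labelled parts is a map Fin n → Fin t.
class : {t : ℕ} → (Fin n → Fin t) → Fin t → Subset n
class part i = tabulate (λ x → does (part x Finₚ.≟ i))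

IsEquipartition : {t : ℕ} → (Fin n → Fin t) → Set
IsEquipartition part = ∀ i j → ∣ class part i ∣ ℕ.≤ ∣ class part j ∣ ℕ.+ 1

ZeroVdisc₃Error : Property p → Set p
ZeroVdisc₃Error 𝓗 =
  ∀ (ε : ℚ) (t₀ : ℕ) → 0ℚ ℚ.< ε → 1 ℕ.≤ t₀ →
  ∃[ T ] ∃[ N ] ∀ {n} (H : ThreeGraph n) → 𝓗 H → N ℕ.≤ n →
    ∃[ t ] (t₀ ℕ.≤ t) × (t ℕ.≤ T) ×
    (Σ[ part ∈ (Fin n → Fin t) ] IsEquipartition part ×
      (∀ i j k → Distinct i j k →
        vdisc₃ ε (class part i) (class part j) (class part k) (edge H)))

-- The partitions of the K₂[Vᵢ,Vⱼ] into ℓ (possibly empty) pieces are given by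
-- one symmetric colouring of the pairs of vertices.  Only the colours of pairs
-- with ends in different parts matter.
module _ {t ℓ : ℕ} (part : Fin n → Fin t) (colour : Fin n → Fin n → Fin ℓ) where

  -- P i j α is the bipartite graph Pᵢⱼᵅ, listed from Vᵢ to Vⱼ; by symmetry of
  -- the colouring, P j i α is the same graph listed from Vⱼ to Vᵢ.
  P : Fin t → Fin t → Fin ℓ → Rel₂ n
  P i j α x y =
    does (part x Finₚ.≟ i) ∧ does (part y Finₚ.≟ j) ∧ does (colour x y Finₚ.≟ α)

  triad : (i j k : Fin t) (α β γ : Fin ℓ) → Edges n
  triad i j k α β γ = record { E₁₂ = P i j α ; E₁₃ = P i k β ; E₂₃ = P j k γ }

  InRegularTriad : ℚ → .{{_ : NonZero ℓ}} → (x y z : Fin n) → Set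
  InRegularTriad ε₂ x y z =
    ∃[ i ] ∃[ j ] ∃[ k ] Distinct i j k × ∃[ α ] ∃[ β ] ∃[ γ ]
      (T (P i j α x y) × T (P i k β x z) × T (P j k γ y z)) ×
      disc₂[ ε₂ ⨾ + 1 / ℓ ] (class part i) (class part j) (P i j α) ×
      disc₂[ ε₂ ⨾ + 1 / ℓ ] (class part i) (class part k) (P i k β) ×
      disc₂[ ε₂ ⨾ + 1 / ℓ ] (class part j) (class part k) (P j k γ)

record Decomposition (n t ℓ : ℕ) (ε₁ ε₂ : ℚ) : Set where
  field
    part          : Fin n → Fin t
    parts-ordered : ∀ i j → i Fin.≤ j → ∣ class part i ∣ ℕ.≤ ∣ class part j ∣
    equipartition : IsEquipartition part
    colour        : Fin n → Fin n → Fin ℓ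
    colour-sym    : ∀ x y → colour x y ≡ colour y x
    {{ℓ-nonZero}} : NonZero ℓ
    -- An unordered triple is listed in increasing order.
    exceptional   : List (Fin n × Fin n × Fin n)
    few           : fromℕ (length exceptional) ℚ.≤ ε₁ ℚ.* fromℕ (n ℕ.^ 3)
    regular       : ∀ x y z → x Fin.< y → y Fin.< z → (x , y , z) ∉ exceptional →
                    InRegularTriad part colour ε₂ x y z

TriadsRegular : {t ℓ : ℕ} {ε₁ ε₂ : ℚ} → ThreeGraph n → Decomposition n t ℓ ε₁ ε₂ → Set
TriadsRegular {ε₁ = ε₁} {ε₂ = ε₂} H 𝓟 =
  ∀ i j k → Distinct i j k → ∀ α β γ →
  let G = triad part colour i j k α β γ in
  disc₂,₃ ε₁ ε₂ (class part i) (class part j) (class part k)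
    (edge H ∩₃ triangles G) G
  where open Decomposition 𝓟

ZeroDisc₂,₃Error : Property p → Set p
ZeroDisc₂,₃Error 𝓗 =
  ∀ (t₀ ℓ₀ : ℕ) (ε₁ : ℚ) (ε₂ : ℕ → ℚ) →
  1 ℕ.≤ t₀ → 1 ℕ.≤ ℓ₀ → 0ℚ ℚ.< ε₁ → (∀ m → (0ℚ ℚ.< ε₂ m) × (ε₂ m ℚ.≤ 1ℚ)) →
  ∃[ N ] ∃[ T ] ∃[ L ] ∀ {n} (H : ThreeGraph n) → 𝓗 H → N ℕ.≤ n →
    ∃[ t ] ∃[ ℓ ] (t₀ ℕ.≤ t) × (t ℕ.≤ T) × (ℓ₀ ℕ.≤ ℓ) × (ℓ ℕ.≤ L) ×
    Σ (Decomposition n t ℓ ε₁ (ε₂ ℓ)) (TriadsRegular H)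

{-# OPTIONS --safe #-}

-- (⇒) In a triad with disc₂,₃, triangle counting makes the edges inside any box
-- X′ × Y′ × Z′ number about d₃ · |X′||Y′||Z′| / ℓ³.  Summing over the ℓ³ triads of
-- a triple of parts, the density in every box is about the average of the d₃, so
-- the vertex partition of the decomposition is already vdisc₃-regular.
--
-- (⇐) A blow-up of the 3-graph on a₁,…,aₘ, b₁,…,bₘ, c with edges aᵢbⱼc (i ≤ j) has no
-- vdisc₃-regular equipartition into boundedly many parts, so by heredity it is not an
-- induced sub-3-graph of a member of 𝓗.  By Erdős's theorem on complete partite
-- subgraphs and by Sauer–Shelah, the links of a vertex then have boundedly many
-- neighbourhoods up to a small Hamming distance.  Applying this to slices
-- in the three directions, a triple whose density is bounded away from 0 and 1
-- contains a large box of visibly different density.  Hence all vdisc₃-regular triples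
-- are nearly empty or nearly complete, and then every triad with quasirandom
-- bipartite parts has disc₂,₃.  Quasirandom ℓ-colourings of the pairs are
-- obtained from pairwise independent colours, without randomness.

module Submission where

open import Defs using (Property; Hereditary; ZeroDisc₂,₃Error; ZeroVdisc₃Error)
open import Level using (Level)
open import Function.Bundles using (_⇔_; mk⇔)

open import Data.Empty using (⊥; ⊥-elim)
import Data.Fin.Properties as Finₚ
import Data.List.Properties as Listₚ
import Data.Nat.Properties as ℕₚ
import Data.Nat.Tactic.RingSolver as ℕ-Solver
open import Data.Product.Base using (Σ; Σ-syntax; ∃; ∃-syntax; _×_; _,_; proj₁; proj₂)
import Data.Rational.Properties as ℚₚ
open import Data.Sum.Base using (_⊎_; inj₁; inj₂; [_,_]′)
import Data.Vec.Properties as Vecₚ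
open import Relation.Binary.PropositionalEquality hiding ([_])
open import Relation.Nullary using (¬_; Dec; yes; no; ¬?)
open import Relation.Nullary.Decidable using (does; dec-true; dec-false; decidable-stable; from-yes)
import Tactic.RingSolver as RS
open import Algebra.Structures using (IsCommutativeSemiring)
open import Data.Fin.Base using (Fin; zero; suc; _↑ˡ_; _↑ʳ_; combine)
open import Data.Nat.Base as ℕ using (ℕ; zero; suc)
open import Function.Base using (_∘_)

-- The two notions measure errors on different scales. In `disc₂,₃` each triad may err by ε₁ d₂³,
-- and ε₁ is fixed before ℓ is known. In (⇒) the errors of ℓ³ triads therefore add up to about ε₁
-- only if d₂ is kept close to the density of each colour class. In (⇐) a vdisc₃-regular triple of
-- intermediate density may behave arbitrarily on the triangles of a subgraph G′; a density within
-- ε₁ / ℓ³ of 0 or 1 controls every G′ at once. This is why (⇐) aims at nearly empty or nearly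
-- complete triples, and why ℓ = ℓ₀ is settled before the vertex partition is requested.
--
-- Of a blow-up of the forbidden half graph only the triples across its three sides are known.
-- Irregular boxes must respect the sides and lie in three different parts, although one part may
-- meet several sides.
--
-- Densities in ℕ are written without division: |D| ≤ q · count says that the density is at least 1
-- / q, and e · dist ≤ |Y| that the distance is at most |Y| / e. Averaging then just multiplies
-- natural constants; ℚ enters with signed deviations and second moments.

-- Finite sums in a commutative semiring, shared by ℕ and ℚ.

module Summation {A : Set} {_+_ _*_ : A → A → A} {0# 1# : A}
  (isCSR : IsCommutativeSemiring _≡_ _+_ _*_ 0# 1#) where

  open IsCommutativeSemiring isCSR
    using (+-assoc; +-comm; +-identityˡ; *-comm; zeroʳ; distribˡ)

  sum : ∀ {n} → (Fin n → A) → A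
  sum {zero} f = 0#
  sum {suc n} f = f zero + sum (f ∘ suc)

  sum-cong : ∀ {n} {f g : Fin n → A} → (∀ x → f x ≡ g x) → sum f ≡ sum g
  sum-cong {zero} h = refl
  sum-cong {suc n} h = cong₂ _+_ (h zero) (sum-cong (h ∘ suc))

  sum-0 : ∀ n → sum {n} (λ _ → 0#) ≡ 0#
  sum-0 zero = refl
  sum-0 (suc n) = trans (+-identityˡ _) (sum-0 n)

  private
    interchange : ∀ a b c d → (a + b) + (c + d) ≡ (a + c) + (b + d)
    interchange a b c d = begin
      (a + b) + (c + d)  ≡⟨ +-assoc a b (c + d) ⟩
      a + (b + (c + d))  ≡⟨ cong (a +_) (sym (+-assoc b c d)) ⟩
      a + ((b + c) + d)  ≡⟨ cong (λ e → a + (e + d)) (+-comm b c) ⟩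
      a + ((c + b) + d)  ≡⟨ cong (a +_) (+-assoc c b d) ⟩
      a + (c + (b + d))  ≡⟨ sym (+-assoc a c (b + d)) ⟩
      (a + c) + (b + d)  ∎
      where open ≡-Reasoning

  sum-+ : ∀ {n} (f g : Fin n → A) → sum (λ x → f x + g x) ≡ sum f + sum g
  sum-+ {zero} f g = sym (+-identityˡ 0#)
  sum-+ {suc n} f g =
    trans (cong ((f zero + g zero) +_) (sum-+ (f ∘ suc) (g ∘ suc))) (interchange _ _ _ _)

  sum-*ˡ : ∀ {n} c (f : Fin n → A) → sum (λ x → c * f x) ≡ c * sum f
  sum-*ˡ {zero} c f = sym (zeroʳ c)
  sum-*ˡ {suc n} c f = trans (cong ((c * f zero) +_) (sum-*ˡ c (f ∘ suc))) (sym (distribˡ c _ _))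

  sum-*ʳ : ∀ {n} c (f : Fin n → A) → sum (λ x → f x * c) ≡ sum f * c
  sum-*ʳ c f = trans (sum-cong (λ x → *-comm (f x) c)) (trans (sum-*ˡ c f) (*-comm c _))

  sum-swap : ∀ {m n} (f : Fin m → Fin n → A) →
    sum (λ x → sum (λ y → f x y)) ≡ sum (λ y → sum (λ x → f x y))
  sum-swap {zero} {n} f = sym (sum-0 n)
  sum-swap {suc m} f =
    trans (cong (sum (f zero) +_) (sum-swap (f ∘ suc))) (sym (sum-+ (f zero) _))

  sum-↑ : ∀ m {n} (f : Fin (m ℕ.+ n) → A) → sum f ≡ sum (λ i → f (i ↑ˡ n)) + sum (λ j → f (m ↑ʳ j))
  sum-↑ zero f = sym (+-identityˡ _)
  sum-↑ (suc m) f = trans (cong (f zero +_) (sum-↑ m (f ∘ suc))) (sym (+-assoc (f zero) _ _))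

  sum-combine : ∀ m {n} (f : Fin (m ℕ.* n) → A) → sum f ≡ sum (λ i → sum (λ j → f (combine {m} {n} i j)))
  sum-combine zero f = refl
  sum-combine (suc m) {n} f = trans (sum-↑ n f) (cong (sum (λ i → f (i ↑ˡ (m ℕ.* n))) +_) (sum-combine m (λ j → f (n ↑ʳ j))))

-- Counting points of boxes.

module Counting where
  open import Data.Bool.Base using (Bool; true; false; T; _∧_; not)
  open import Data.Fin.Base using (Fin; zero; suc)
  open import Data.Nat.Base
  open import Data.Nat.Properties
  open import Data.Nat.Tactic.RingSolver using (solve-∀)
  open import Data.Vec.Base using (Vec; []; _∷_)
  open import Data.Vec.Relation.Unary.All using ([]; _∷_)
  open import Function.Base using (_∘_)

  open Summation +-*-isCommutativeSemiring public

  ⟦_⟧ : Bool → ℕ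
  ⟦ true ⟧ = 1
  ⟦ false ⟧ = 0

  ⟦⟧≤1 : ∀ b → ⟦ b ⟧ ≤ 1
  ⟦⟧≤1 true = ≤-refl
  ⟦⟧≤1 false = z≤n

  ⟦∧⟧ : ∀ a b → ⟦ a ∧ b ⟧ ≡ ⟦ a ⟧ * ⟦ b ⟧
  ⟦∧⟧ true b = sym (+-identityʳ _)
  ⟦∧⟧ false b = refl

  ∧-elim : ∀ {a b} → a ∧ b ≡ true → a ≡ true × b ≡ true
  ∧-elim {true} {true} _ = refl , refl

  true≢false : ∀ {b} → b ≡ true → b ≡ false → ⊥
  true≢false refl ()

  sum-mono : ∀ {n} {f g : Fin n → ℕ} → (∀ x → f x ≤ g x) → sum f ≤ sum g
  sum-mono {zero} h = z≤n
  sum-mono {suc n} h = +-mono-≤ (h zero) (sum-mono (h ∘ suc))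

  sum-exists-< : ∀ {n} {f g : Fin n → ℕ} → sum f < sum g → ∃[ x ] f x < g x
  sum-exists-< {suc n} {f} {g} lt with f zero <? g zero
  ... | yes p = zero , p
  ... | no ¬p with sum-exists-< {n} {f ∘ suc} {g ∘ suc}
                   (+-cancelˡ-< (g zero) _ _ (≤-<-trans (+-monoˡ-≤ _ (≮⇒≥ ¬p)) lt))
  ... | x , q = suc x , q

  # : ∀ {n} → (Fin n → Bool) → ℕ
  # P = sum (λ x → ⟦ P x ⟧)

  T⇒≡ : ∀ {c} → T c → c ≡ true
  T⇒≡ {true} _ = refl

  ≡⇒T : ∀ {c} → c ≡ true → T c
  ≡⇒T refl = _

  private
    variable
      N r : ℕ

  -- `tot`, `cnt` and `size` are the sum, the count and the volume over the box D₁ × ... × Dᵣ. The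
  -- first coordinate is summed outermost, so fixing it leaves by definition the same situation with
  -- one coordinate fewer.
  tot : Vec (Fin N → Bool) r → (Vec (Fin N) r → ℕ) → ℕ
  tot [] f = f []
  tot (D ∷ Ds) f = sum (λ x → ⟦ D x ⟧ * tot Ds (λ v → f (x ∷ v)))

  cnt : Vec (Fin N → Bool) r → (Vec (Fin N) r → Bool) → ℕ
  cnt Ds Q = tot Ds (λ v → ⟦ Q v ⟧)

  size : Vec (Fin N → Bool) r → ℕ
  size [] = 1
  size (D ∷ Ds) = # D * size Ds

  tot-cong : ∀ (Ds : Vec (Fin N → Bool) r) {f g : Vec (Fin N) r → ℕ} →
    (∀ v → f v ≡ g v) → tot Ds f ≡ tot Ds g
  tot-cong [] h = h []
  tot-cong (D ∷ Ds) h = sum-cong (λ x → cong (⟦ D x ⟧ *_) (tot-cong Ds (λ v → h (x ∷ v))))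

  tot-mono : ∀ (Ds : Vec (Fin N → Bool) r) {f g : Vec (Fin N) r → ℕ} →
    (∀ v → f v ≤ g v) → tot Ds f ≤ tot Ds g
  tot-mono [] h = h []
  tot-mono (D ∷ Ds) h = sum-mono (λ x → *-monoʳ-≤ ⟦ D x ⟧ (tot-mono Ds (λ v → h (x ∷ v))))

  tot-+ : ∀ (Ds : Vec (Fin N → Bool) r) (f g : Vec (Fin N) r → ℕ) →
    tot Ds (λ v → f v + g v) ≡ tot Ds f + tot Ds g
  tot-+ [] f g = refl
  tot-+ {N} (D ∷ Ds) f g = trans
    (sum-cong (λ x → trans (cong (⟦ D x ⟧ *_) (tot-+ Ds (λ v → f (x ∷ v)) (λ v → g (x ∷ v))))
      (*-distribˡ-+ ⟦ D x ⟧ (tot Ds (λ v → f (x ∷ v))) _)))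
    (sum-+ (λ x → ⟦ D x ⟧ * tot Ds (λ v → f (x ∷ v))) (λ x → ⟦ D x ⟧ * tot Ds (λ v → g (x ∷ v))))

  tot-* : ∀ (Ds : Vec (Fin N → Bool) r) c (f : Vec (Fin N) r → ℕ) →
    tot Ds (λ v → c * f v) ≡ c * tot Ds f
  tot-* [] c f = refl
  tot-* (D ∷ Ds) c f = trans
    (sum-cong (λ x → trans (cong (⟦ D x ⟧ *_) (tot-* Ds c (λ v → f (x ∷ v))))
      (l ⟦ D x ⟧ c (tot Ds (λ v → f (x ∷ v))))))
    (sum-*ˡ c (λ x → ⟦ D x ⟧ * tot Ds (λ v → f (x ∷ v))))
    where
    l : ∀ a b c → a * (b * c) ≡ b * (a * c)
    l = solve-∀

  tot-const : ∀ (Ds : Vec (Fin N → Bool) r) c → tot Ds (λ _ → c) ≡ size Ds * c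
  tot-const [] c = sym (*-identityˡ c)
  tot-const (D ∷ Ds) c = trans (sum-cong (λ x → cong (⟦ D x ⟧ *_) (tot-const Ds c)))
    (trans (sum-*ʳ (size Ds * c) (λ x → ⟦ D x ⟧)) (sym (*-assoc (# D) (size Ds) c)))

  tot-sum : ∀ {n} (Ds : Vec (Fin N → Bool) r) (f : Fin n → Vec (Fin N) r → ℕ) →
    tot Ds (λ v → sum (λ x → f x v)) ≡ sum (λ x → tot Ds (f x))
  tot-sum [] f = refl
  tot-sum (D ∷ Ds) f = trans
    (sum-cong (λ y → trans (cong (⟦ D y ⟧ *_) (tot-sum Ds (λ x v → f x (y ∷ v))))
      (sym (sum-*ˡ ⟦ D y ⟧ (λ x → tot Ds (λ v → f x (y ∷ v)))))))
    (sum-swap (λ y x → ⟦ D y ⟧ * tot Ds (λ v → f x (y ∷ v))))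

  -- Points with f < b / 2q contribute at most half of the guaranteed total. The others contribute
  -- at most b each, so they make up a fraction 1 / 2q of the box.
  reverse-markov-tot : ∀ (Ds : Vec (Fin N → Bool) r) q b (f : Vec (Fin N) r → ℕ) →
    (∀ v → f v ≤ b) → 1 ≤ b → b * size Ds ≤ q * tot Ds f →
    size Ds ≤ (2 * q) * cnt Ds (λ v → b ≤ᵇ 2 * q * f v)
  reverse-markov-tot Ds q b f f≤b 1≤b h = *-cancelˡ-≤ b {{>-nonZero 1≤b}} goal
    where
    open ≤-Reasoning
    big : _ → Bool
    big v = b ≤ᵇ 2 * q * f v
    pt : ∀ v → 2 * q * f v ≤ b * (2 * q) * ⟦ big v ⟧ + b
    pt v with b ≤ᵇ 2 * q * f v in eq
    ... | true = begin
      2 * q * f v                    ≤⟨ *-monoʳ-≤ (2 * q) (f≤b v) ⟩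
      2 * q * b                      ≡⟨ l q b ⟩
      b * (2 * q) * 1                ≤⟨ m≤m+n _ _ ⟩
      b * (2 * q) * 1 + b            ∎
      where
      l : ∀ q b → 2 * q * b ≡ b * (2 * q) * 1
      l = solve-∀
    ... | false = begin
      2 * q * f v                    ≤⟨ <⇒≤ (≰⇒> (λ le → true≢false (T⇒≡ (≤⇒≤ᵇ le)) eq)) ⟩
      b                              ≤⟨ m≤n+m _ _ ⟩
      b * (2 * q) * 0 + b            ∎
    goal : b * size Ds ≤ b * (2 * q * cnt Ds big)
    goal = +-cancelʳ-≤ (b * size Ds) _ _ (begin
      b * size Ds + b * size Ds                      ≡⟨ l₁ (b * size Ds) ⟩
      2 * (b * size Ds)                              ≤⟨ *-monoʳ-≤ 2 h ⟩
      2 * (q * tot Ds f)                             ≡⟨ sym (*-assoc 2 q _) ⟩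
      2 * q * tot Ds f                               ≡⟨ sym (tot-* Ds (2 * q) f) ⟩
      tot Ds (λ v → 2 * q * f v)                     ≤⟨ tot-mono Ds pt ⟩
      tot Ds (λ v → b * (2 * q) * ⟦ big v ⟧ + b)     ≡⟨ tot-+ Ds (λ v → b * (2 * q) * ⟦ big v ⟧) (λ _ → b) ⟩
      tot Ds (λ v → b * (2 * q) * ⟦ big v ⟧) + tot Ds (λ _ → b)
        ≡⟨ cong₂ _+_ (tot-* Ds (b * (2 * q)) (λ v → ⟦ big v ⟧)) (tot-const Ds b) ⟩
      b * (2 * q) * cnt Ds big + size Ds * b         ≡⟨ l₂ b (2 * q) (cnt Ds big) (size Ds) ⟩
      b * (2 * q * cnt Ds big) + b * size Ds         ∎)
      where
      l₁ : ∀ c → c + c ≡ 2 * c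
      l₁ = solve-∀
      l₂ : ∀ b q c s → b * q * c + s * b ≡ b * (q * c) + b * s
      l₂ = solve-∀

  reverse-markov : ∀ q b (D : Fin N → Bool) (f : Fin N → ℕ) →
    (∀ x → f x ≤ b) → 1 ≤ b → b * # D ≤ q * sum (λ x → ⟦ D x ⟧ * f x) →
    # D ≤ (2 * q) * # (λ x → D x ∧ (b ≤ᵇ 2 * q * f x))
  reverse-markov q b D f f≤b 1≤b h = begin
    # D                        ≡⟨ sym (*-identityʳ (# D)) ⟩
    size (D ∷ [])              ≤⟨ reverse-markov-tot (D ∷ []) q b (λ { (x ∷ []) → f x })
                                    (λ { (x ∷ []) → f≤b x }) 1≤b
                                    (≤-trans (≤-reflexive (cong (b *_) (*-identityʳ (# D)))) h) ⟩
    2 * q * sum (λ x → ⟦ D x ⟧ * ⟦ b ≤ᵇ 2 * q * f x ⟧)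
      ≡⟨ cong (2 * q *_) (sum-cong (λ x → sym (⟦∧⟧ (D x) _))) ⟩
    2 * q * # (λ x → D x ∧ (b ≤ᵇ 2 * q * f x))  ∎
    where open ≤-Reasoning

  -- Each test splits the current set in two and the larger half is kept. Thus k tests cost a factor
  -- 2 ^ k, and all surviving points give the same answers μ.
  pigeonhole : ∀ (Ds : Vec (Fin N → Bool) r) k (test : Fin k → Vec (Fin N) r → Bool) Q q →
    size Ds ≤ q * cnt Ds Q →
    Σ[ μ ∈ (Fin k → Bool) ] Σ[ Q′ ∈ (Vec (Fin N) r → Bool) ]
      size Ds ≤ q * 2 ^ k * cnt Ds Q′ ×
      (∀ v → Q′ v ≡ true → Q v ≡ true × (∀ i → test i v ≡ μ i))
  pigeonhole Ds zero test Q q h = (λ ()) , Q ,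
    subst (λ q → size Ds ≤ q * cnt Ds Q) (sym (*-identityʳ q)) h , λ v e → e , λ ()
  pigeonhole {N} {r} Ds (suc k) test Q q h = answer (≤-total (cnt Ds Qᵗ) (cnt Ds Qᶠ))
    where
    Qᵗ Qᶠ : Vec (Fin N) r → Bool
    Qᵗ v = Q v ∧ test zero v
    Qᶠ v = Q v ∧ not (test zero v)
    split : ∀ a b → ⟦ a ⟧ ≡ ⟦ a ∧ b ⟧ + ⟦ a ∧ not b ⟧
    split false b = refl
    split true true = refl
    split true false = refl
    eq : cnt Ds Q ≡ cnt Ds Qᵗ + cnt Ds Qᶠ
    eq = trans (tot-cong Ds (λ v → split (Q v) (test zero v)))
           (tot-+ Ds (λ v → ⟦ Qᵗ v ⟧) (λ v → ⟦ Qᶠ v ⟧))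
    l : ∀ q a → q * (a + a) ≡ q * 2 * a
    l = solve-∀
    bound : ∀ {a b} → a ≤ b → cnt Ds Q ≤ a + b → size Ds ≤ q * 2 * b
    bound {a} {b} a≤b le = ≤-trans h (≤-trans (*-monoʳ-≤ q (≤-trans le (+-monoˡ-≤ b a≤b)))
      (≤-reflexive (l q b)))
    Result : Set
    Result = Σ[ μ ∈ (Fin (suc k) → Bool) ] Σ[ Q′ ∈ (Vec (Fin N) r → Bool) ]
      size Ds ≤ q * 2 ^ suc k * cnt Ds Q′ ×
      (∀ v → Q′ v ≡ true → Q v ≡ true × (∀ i → test i v ≡ μ i))
    extend : ∀ b (Q″ : Vec (Fin N) r → Bool) → size Ds ≤ q * 2 * cnt Ds Q″ →
      (∀ v → Q″ v ≡ true → Q v ≡ true × test zero v ≡ b) → Result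
    extend b Q″ h″ imp with pigeonhole Ds k (test ∘ suc) Q″ (q * 2) h″
    ... | μ , Q′ , h′ , imp′ =
      (λ { zero → b ; (suc i) → μ i }) , Q′ ,
      subst (λ q → size Ds ≤ q * cnt Ds Q′) (*-assoc q 2 (2 ^ k)) h′ ,
      λ v e → let e″ = imp′ v e ; e‴ = imp v (proj₁ e″) in
        proj₁ e‴ , λ { zero → proj₂ e‴ ; (suc i) → proj₂ e″ i }
    not-true : ∀ {b} → not b ≡ true → b ≡ false
    not-true {false} _ = refl
    answer : cnt Ds Qᵗ ≤ cnt Ds Qᶠ ⊎ cnt Ds Qᶠ ≤ cnt Ds Qᵗ → Result
    answer (inj₁ le) = extend false Qᶠ (bound le (≤-reflexive eq))
      (λ v e → let p = ∧-elim e in proj₁ p , not-true (proj₂ p))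
    answer (inj₂ le) = extend true Qᵗ (bound le (≤-reflexive (trans eq (+-comm (cnt Ds Qᵗ) _))))
      (λ v e → ∧-elim e)

-- Complete partite subhypergraphs of dense partite hypergraphs.

module ErdősTheorem where
  open Counting
  open import Data.Bool.Base using (Bool; true; false; _∧_)
  open import Data.Fin.Base using (Fin; zero; suc)
  open import Data.Nat.Base
  open import Data.Nat.Properties
  open import Data.Nat.Tactic.RingSolver using (solve-∀)
  open import Data.Vec.Base using (Vec; []; _∷_; zipWith; lookup)
  open import Data.Vec.Relation.Unary.All using (All; []; _∷_)
  import Data.Vec.Relation.Unary.All as All
  open import Function.Base using (_∘_; _$_)

  private
    variable
      N r : ℕ

  sum-indicator≤1 : (y : Fin N) → sum (λ x → ⟦ does (y Finₚ.≟ x) ⟧) ≤ 1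
  sum-indicator≤1 {suc N} zero = s≤s (≤-reflexive (sum-0 N))
  sum-indicator≤1 {suc N} (suc y) = ≤-trans (≤-reflexive (sum-cong (λ x → cong ⟦_⟧ (lem y x)))) (sum-indicator≤1 y)
    where
    lem : ∀ {n} (y x : Fin n) → does (suc y Finₚ.≟ suc x) ≡ does (y Finₚ.≟ x)
    lem y x with y Finₚ.≟ x
    ... | yes _ = refl
    ... | no _ = refl

  sum-indicator-swap : ∀ {j} (s : Fin j → Fin N) → sum (λ x → sum (λ i → ⟦ does (s i Finₚ.≟ x) ⟧)) ≤ j
  sum-indicator-swap {j = j} s = begin
    sum (λ x → sum (λ i → ⟦ does (s i Finₚ.≟ x) ⟧))  ≡⟨ sum-swap (λ x i → ⟦ does (s i Finₚ.≟ x) ⟧) ⟩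
    sum (λ i → sum (λ x → ⟦ does (s i Finₚ.≟ x) ⟧))  ≤⟨ sum-mono (λ i → sum-indicator≤1 (s i)) ⟩
    sum {j} (λ _ → 1)                                ≡⟨ ones j ⟩
    j                                                ∎
    where
    open ≤-Reasoning
    ones : ∀ j → sum {j} (λ _ → 1) ≡ j
    ones zero = refl
    ones (suc j) = cong suc (ones j)

  term≤sum : (f : Fin N → ℕ) (x : Fin N) → f x ≤ sum f
  term≤sum f zero = m≤m+n _ _
  term≤sum f (suc x) = ≤-trans (term≤sum (f ∘ suc) x) (m≤n+m _ _)

  weight-positive : ∀ b {a c} → a < ⟦ b ⟧ * c → b ≡ true
  weight-positive true _ = refl

  -- The m vertices of one coordinate are distinct, while different coordinates may share vertices.
  -- Disjointness comes later, from the sets in `Ds` or from the edge pattern.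
  BlowUp : Vec (Fin N → Bool) r → (Vec (Fin N) r → Bool) → ℕ → Set
  BlowUp {N} {r} Ds Q m = Σ[ S ∈ Vec (Fin m → Fin N) r ]
    (∀ i a → lookup Ds i (lookup S i a) ≡ true) ×
    (∀ i a b → lookup S i a ≡ lookup S i b → a ≡ b) ×
    (∀ (c : Vec (Fin m) r) → Q (zipWith _$_ S c) ≡ true)

  private
    module Step (D : Fin N → Bool) (Ds : Vec (Fin N → Bool) r) (Q : Vec (Fin N) (suc r) → Bool)
      (q : ℕ) (size>0 : 1 ≤ size Ds) where

      deg : Vec (Fin N) r → ℕ
      deg v = sum (λ x → ⟦ D x ⟧ * ⟦ Q (x ∷ v) ⟧)

      P₀ : Vec (Fin N) r → Bool
      P₀ v = # D ≤ᵇ 2 * q * deg v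

      -- The state of a greedy choice: j vertices in the first coordinate and a set P of points
      -- joined to all of them. Staying inside `P₀` matters: each point of P keeps degree at least
      -- |D| / 2q, so that a further common neighbour can be found by averaging.
      record Chosen (q₀ j : ℕ) : Set where
        field
          s : Fin j → Fin N
          inD : ∀ i → D (s i) ≡ true
          inj : ∀ a b → s a ≡ s b → a ≡ b
          P : Vec (Fin N) r → Bool
          P⇒P₀ : ∀ v → P v ≡ true → P₀ v ≡ true
          P⇒Q : ∀ v → P v ≡ true → ∀ i → Q (s i ∷ v) ≡ true
          dense : size Ds ≤ q₀ * (4 * q) ^ j * cnt Ds P

      -- The sum of `g` is at least twice the main term of the sum of `f`, because every v in P has
      -- degree at least |D| / 2q. The `hit` term is a penalty that makes f ≥ g at vertices already
      -- chosen; its total stays below cnt P · |D| while j is small. A vertex with f < g is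
      -- therefore in D, new, and joined to a fraction 1 / 4q of P.
      grow : ∀ q₀ j → 4 * q * j < # D → Chosen q₀ j → Chosen q₀ (suc j)
      grow q₀ j small ch = result
        where
        open Chosen ch
        PQ : Fin N → Vec (Fin N) r → Bool
        PQ x v = P v ∧ Q (x ∷ v)
        hit : Fin N → ℕ
        hit x = sum (λ i → ⟦ does (s i Finₚ.≟ x) ⟧)
        f g : Fin N → ℕ
        f x = cnt Ds P * ⟦ D x ⟧ + (4 * q * cnt Ds P) * hit x
        g x = ⟦ D x ⟧ * (4 * q * cnt Ds (PQ x))
        cnt>0 : 0 < cnt Ds P
        cnt>0 with cnt Ds P in eq
        ... | suc _ = z<s
        ... | zero = ⊥-elim (n≮0 (≤-trans size>0 (≤-trans dense (≤-reflexive
                       (trans (cong (q₀ * (4 * q) ^ j *_) eq) (*-zeroʳ (q₀ * (4 * q) ^ j)))))))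
        swap : sum g ≡ 2 * tot Ds (λ v → ⟦ P v ⟧ * (2 * q * deg v))
        swap = begin
          sum g
            ≡⟨ sum-cong (λ x → trans (cong (λ e → ⟦ D x ⟧ * (4 * q * e)) (tot-cong Ds (λ v → ⟦∧⟧ (P v) (Q (x ∷ v)))))
                 (trans (l₁ ⟦ D x ⟧ (4 * q) _) (sym (tot-* Ds (⟦ D x ⟧ * (4 * q)) (λ v → ⟦ P v ⟧ * ⟦ Q (x ∷ v) ⟧))))) ⟩
          sum (λ x → tot Ds (λ v → ⟦ D x ⟧ * (4 * q) * (⟦ P v ⟧ * ⟦ Q (x ∷ v) ⟧)))
            ≡⟨ sym (tot-sum Ds (λ x v → ⟦ D x ⟧ * (4 * q) * (⟦ P v ⟧ * ⟦ Q (x ∷ v) ⟧))) ⟩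
          tot Ds (λ v → sum (λ x → ⟦ D x ⟧ * (4 * q) * (⟦ P v ⟧ * ⟦ Q (x ∷ v) ⟧)))
            ≡⟨ tot-cong Ds (λ v → trans (sum-cong (λ x → l₂ ⟦ D x ⟧ q ⟦ P v ⟧ ⟦ Q (x ∷ v) ⟧))
                 (trans (sum-*ˡ (2 * (⟦ P v ⟧ * (2 * q))) (λ x → ⟦ D x ⟧ * ⟦ Q (x ∷ v) ⟧)) (l₃ ⟦ P v ⟧ q (deg v)))) ⟩
          tot Ds (λ v → 2 * (⟦ P v ⟧ * (2 * q * deg v)))
            ≡⟨ tot-* Ds 2 (λ v → ⟦ P v ⟧ * (2 * q * deg v)) ⟩
          2 * tot Ds (λ v → ⟦ P v ⟧ * (2 * q * deg v))  ∎
          where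
          open ≡-Reasoning
          l₁ : ∀ a b c → a * (b * c) ≡ a * b * c
          l₁ = solve-∀
          l₂ : ∀ d q p e → d * (4 * q) * (p * e) ≡ 2 * (p * (2 * q)) * (d * e)
          l₂ = solve-∀
          l₃ : ∀ p q d → 2 * (p * (2 * q)) * d ≡ 2 * (p * (2 * q * d))
          l₃ = solve-∀
        large : 2 * (cnt Ds P * # D) ≤ sum g
        large = begin
          2 * (cnt Ds P * # D)                             ≡⟨ cong (2 *_) (*-comm (cnt Ds P) (# D)) ⟩
          2 * (# D * cnt Ds P)                             ≡⟨ cong (2 *_) (sym (tot-* Ds (# D) (λ v → ⟦ P v ⟧))) ⟩
          2 * tot Ds (λ v → # D * ⟦ P v ⟧)                 ≤⟨ *-monoʳ-≤ 2 (tot-mono Ds pt) ⟩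
          2 * tot Ds (λ v → ⟦ P v ⟧ * (2 * q * deg v))     ≡⟨ sym swap ⟩
          sum g                                            ∎
          where
          open ≤-Reasoning
          pt : ∀ v → # D * ⟦ P v ⟧ ≤ ⟦ P v ⟧ * (2 * q * deg v)
          pt v with P v in e
          ... | false = ≤-reflexive (*-zeroʳ (# D))
          ... | true = ≤-trans (≤-reflexive (*-identityʳ (# D)))
            (≤-trans (≤ᵇ⇒≤ (# D) _ (≡⇒T (P⇒P₀ v e))) (≤-reflexive (sym (*-identityˡ _))))
        f<g : sum f < sum g
        f<g = begin-strict
          sum f
            ≡⟨ sum-+ (λ x → cnt Ds P * ⟦ D x ⟧) (λ x → (4 * q * cnt Ds P) * hit x) ⟩
          sum (λ x → cnt Ds P * ⟦ D x ⟧) + sum (λ x → (4 * q * cnt Ds P) * hit x)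
            ≡⟨ cong₂ _+_ (sum-*ˡ (cnt Ds P) (λ x → ⟦ D x ⟧)) (sum-*ˡ (4 * q * cnt Ds P) hit) ⟩
          cnt Ds P * # D + (4 * q * cnt Ds P) * sum hit
            ≤⟨ +-monoʳ-≤ (cnt Ds P * # D) (*-monoʳ-≤ (4 * q * cnt Ds P) (sum-indicator-swap s)) ⟩
          cnt Ds P * # D + (4 * q * cnt Ds P) * j
            ≡⟨ l₁ (cnt Ds P) (# D) (4 * q) j ⟩
          cnt Ds P * # D + cnt Ds P * (4 * q * j)
            <⟨ +-monoʳ-< (cnt Ds P * # D) (*-monoʳ-< (cnt Ds P) {{>-nonZero cnt>0}} small) ⟩
          cnt Ds P * # D + cnt Ds P * # D
            ≡⟨ l₂ (cnt Ds P * # D) ⟩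
          2 * (cnt Ds P * # D)
            ≤⟨ large ⟩
          sum g ∎
          where
          open ≤-Reasoning
          l₁ : ∀ a b c d → a * b + c * a * d ≡ a * b + a * (c * d)
          l₁ = solve-∀
          l₂ : ∀ a → a + a ≡ 2 * a
          l₂ = solve-∀
        ex = sum-exists-< f<g
        x = proj₁ ex
        fx<gx : f x < g x
        fx<gx = proj₂ ex
        Dx : D x ≡ true
        Dx = weight-positive (D x) fx<gx
        fresh : ∀ i → s i ≡ x → ⊥
        fresh i e = <⇒≱ fx<gx (begin
          g x                                     ≤⟨ *-monoˡ-≤ (4 * q * cnt Ds (PQ x)) (⟦⟧≤1 (D x)) ⟩
          1 * (4 * q * cnt Ds (PQ x))             ≡⟨ *-identityˡ _ ⟩
          4 * q * cnt Ds (PQ x)                   ≤⟨ *-monoʳ-≤ (4 * q) (tot-mono Ds (λ v → ∧≤ (P v) _)) ⟩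
          4 * q * cnt Ds P                        ≡⟨ sym (*-identityʳ _) ⟩
          4 * q * cnt Ds P * 1                    ≡⟨ cong (λ b → 4 * q * cnt Ds P * ⟦ b ⟧) (sym (dec-true (s i Finₚ.≟ x) e)) ⟩
          4 * q * cnt Ds P * ⟦ does (s i Finₚ.≟ x) ⟧
                                                  ≤⟨ *-monoʳ-≤ (4 * q * cnt Ds P) (term≤sum (λ i → ⟦ does (s i Finₚ.≟ x) ⟧) i) ⟩
          4 * q * cnt Ds P * hit x                ≤⟨ m≤n+m _ _ ⟩
          f x                                     ∎)
          where
          open ≤-Reasoning
          ∧≤ : ∀ a b → ⟦ a ∧ b ⟧ ≤ ⟦ a ⟧
          ∧≤ true b = ⟦⟧≤1 b
          ∧≤ false b = z≤n
        shrink : cnt Ds P ≤ 4 * q * cnt Ds (PQ x)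
        shrink = begin
          cnt Ds P                                ≡⟨ sym (*-identityʳ _) ⟩
          cnt Ds P * 1                            ≡⟨ cong (λ b → cnt Ds P * ⟦ b ⟧) (sym Dx) ⟩
          cnt Ds P * ⟦ D x ⟧                      ≤⟨ m≤m+n _ _ ⟩
          f x                                     ≤⟨ <⇒≤ fx<gx ⟩
          g x                                     ≡⟨ trans (cong (λ b → ⟦ b ⟧ * (4 * q * cnt Ds (PQ x))) Dx) (*-identityˡ _) ⟩
          4 * q * cnt Ds (PQ x)                   ∎
          where open ≤-Reasoning
        result : Chosen q₀ (suc j)
        result = record
          { s = λ { zero → x ; (suc i) → s i }
          ; inD = λ { zero → Dx ; (suc i) → inD i }
          ; inj = λ { zero zero _ → refl
                    ; zero (suc b) e → ⊥-elim (fresh b (sym e))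
                    ; (suc a) zero e → ⊥-elim (fresh a e)
                    ; (suc a) (suc b) e → cong suc (inj a b e) }
          ; P = PQ x
          ; P⇒P₀ = λ v e → P⇒P₀ v (proj₁ (∧-elim e))
          ; P⇒Q = λ v e → λ { zero → proj₂ (∧-elim {P v} e) ; (suc i) → P⇒Q v (proj₁ (∧-elim e)) i }
          ; dense = ≤-trans dense (≤-trans (*-monoʳ-≤ (q₀ * (4 * q) ^ j) shrink)
                      (≤-reflexive (l q₀ ((4 * q) ^ j) (4 * q) (cnt Ds (PQ x)))))
          }
          where
          l : ∀ a b c d → a * b * (c * d) ≡ a * (c * b) * d
          l = solve-∀

      iterate : ∀ q₀ m → 4 * q * m < # D → size Ds ≤ q₀ * cnt Ds P₀ → Chosen q₀ m
      iterate q₀ zero _ h = record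
        { s = λ () ; inD = λ () ; inj = λ () ; P = P₀ ; P⇒P₀ = λ v e → e ; P⇒Q = λ v e ()
        ; dense = ≤-trans h (≤-reflexive (cong (_* cnt Ds P₀) (sym (*-identityʳ q₀)))) }
      iterate q₀ (suc m) small h = grow q₀ m small′ (iterate q₀ m small′ h)
        where
        small′ = ≤-<-trans (*-monoʳ-≤ (4 * q) (n≤1+n m)) small

  size-positive : ∀ (Ds : Vec (Fin N → Bool) r) {n} → 1 ≤ n → All (λ D → n ≤ # D) Ds → 1 ≤ size Ds
  size-positive [] 1≤n [] = ≤-refl
  size-positive (D ∷ Ds) 1≤n (p ∷ ps) = *-mono-≤ (≤-trans 1≤n p) (size-positive Ds 1≤n ps)

  -- Erdős's theorem on complete r-partite subhypergraphs of dense r-partite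
  -- r-uniform hypergraphs.
  erdős : ∀ r m q → Σ[ N₀ ∈ ℕ ] 1 ≤ N₀ × (∀ {N} (Ds : Vec (Fin N → Bool) r) Q →
    All (λ D → N₀ ≤ # D) Ds → size Ds ≤ q * cnt Ds Q → BlowUp Ds Q m)
  erdős zero m q = 1 , ≤-refl , λ { [] Q [] h → [] , (λ ()) , (λ ()) , λ { [] → pos (Q []) h } }
    where
    pos : ∀ b → 1 ≤ q * ⟦ b ⟧ → b ≡ true
    pos true _ = refl
    pos false h = ⊥-elim (n≮0 (≤-trans h (≤-reflexive (*-zeroʳ q))))
  erdős (suc r) m q = N₀ , ≤-trans (proj₁ (proj₂ rec)) (m≤m⊔n _ _) , main
    where
    -- Passing from Q to `P₀` costs 2q, and each of the m vertices chosen in the first coordinate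
    -- costs 4q. What is left is a dense r-partite hypergraph, and any blow-up in it is joined to
    -- all m vertices.
    q′ = 2 * q * (4 * q) ^ m
    rec = erdős r m q′
    N₀ = proj₁ rec ⊔ suc (4 * q * m)
    main : ∀ {N} (Ds : Vec (Fin N → Bool) (suc r)) Q →
      All (λ D → N₀ ≤ # D) Ds → size Ds ≤ q * cnt Ds Q → BlowUp Ds Q m
    main {N} (D ∷ Ds) Q (big ∷ bigs) h = build (iterate (2 * q) m (≤-trans (m≤n⊔m _ _) big) P₀-dense)
      where
      bigs′ : All (λ D → proj₁ rec ≤ # D) Ds
      bigs′ = All.map (≤-trans (m≤m⊔n _ _)) bigs
      open Step D Ds Q q (size-positive Ds (proj₁ (proj₂ rec)) bigs′)
      count-swap : cnt (D ∷ Ds) Q ≡ tot Ds deg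
      count-swap = trans (sum-cong (λ x → sym (tot-* Ds ⟦ D x ⟧ (λ v → ⟦ Q (x ∷ v) ⟧))))
        (sym (tot-sum Ds (λ x v → ⟦ D x ⟧ * ⟦ Q (x ∷ v) ⟧)))
      deg≤ : ∀ v → deg v ≤ # D
      deg≤ v = sum-mono (λ x → ≤-trans (*-monoʳ-≤ ⟦ D x ⟧ (⟦⟧≤1 (Q (x ∷ v)))) (≤-reflexive (*-identityʳ _)))
      P₀-dense : size Ds ≤ 2 * q * cnt Ds P₀
      P₀-dense = reverse-markov-tot Ds q (# D) deg deg≤ (≤-trans (s≤s z≤n) (≤-trans (m≤n⊔m _ _) big))
        (≤-trans h (≤-reflexive (cong (q *_) count-swap)))
      build : Chosen (2 * q) m → BlowUp (D ∷ Ds) Q m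
      build ch = blow (proj₂ (proj₂ rec) Ds P bigs′ dense)
        where
        open Chosen ch
        blow : BlowUp Ds P m → BlowUp (D ∷ Ds) Q m
        blow (S , inDs , injs , allP) =
          s ∷ S
          , (λ { zero a → inD a ; (suc i) a → inDs i a })
          , (λ { zero a b → inj a b ; (suc i) a b → injs i a b })
          , λ { (a ∷ c) → P⇒Q (zipWith _$_ S c) (allP c) a }

-- Shattered columns and half graphs in 0/1 matrices.

module SauerShelah where
  open import Data.Bool.Base using (Bool; true; false)
  import Data.Bool.Properties as Boolₚ
  open import Data.Fin.Base using (Fin; zero; suc)
  open import Data.List.Base as List using (List; []; _∷_; _++_; length; filter)
  open import Data.List.Membership.Propositional using (_∈_; _∉_)
  import Data.List.Membership.Propositional.Properties as ∈ₚ
  import Data.List.Membership.DecPropositional as DecMembership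
  open import Data.List.Relation.Unary.Any using (here; there)
  open import Data.List.Relation.Unary.All as All using (All; []; _∷_)
  open import Data.List.Relation.Unary.AllPairs using ([]; _∷_)
  open import Data.List.Relation.Unary.Unique.Propositional using (Unique)
  import Data.List.Relation.Unary.Unique.Propositional.Properties as Uniqueₚ
  open import Data.Nat.Base
  open import Data.Nat.Properties
  open import Data.Nat.Tactic.RingSolver using (solve-∀)
  open import Data.Vec.Base using (Vec; []; _∷_; lookup; map; tabulate)
  open import Function.Base using (_∘_)

  private
    variable
      s : ℕ

  -- The Sauer–Shelah function Σ_{i<h} (s choose i).
  φ : ℕ → ℕ → ℕ
  φ s zero = 0
  φ zero (suc h) = 1
  φ (suc s) (suc h) = φ s (suc h) + φ s h

  -- The columns in c are automatically distinct, since a repeated one could not show two different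
  -- values.
  Shatters : List (Vec Bool s) → ℕ → Set
  Shatters {s} rows h =
    Σ[ c ∈ Vec (Fin s) h ] ∀ (p : Vec Bool h) → ∃[ row ] row ∈ rows × map (lookup row) c ≡ p

  tails : Bool → List (Vec Bool (suc s)) → List (Vec Bool s)
  tails b [] = []
  tails false ((false ∷ v) ∷ rows) = v ∷ tails false rows
  tails false ((true ∷ v) ∷ rows) = tails false rows
  tails true ((false ∷ v) ∷ rows) = tails true rows
  tails true ((true ∷ v) ∷ rows) = v ∷ tails true rows

  ∈-tails : ∀ b (rows : List (Vec Bool (suc s))) {v} → v ∈ tails b rows → (b ∷ v) ∈ rows
  ∈-tails false ((false ∷ v) ∷ rows) (here refl) = here refl
  ∈-tails false ((false ∷ v) ∷ rows) (there i) = there (∈-tails false rows i)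
  ∈-tails false ((true ∷ v) ∷ rows) i = there (∈-tails false rows i)
  ∈-tails true ((false ∷ v) ∷ rows) i = there (∈-tails true rows i)
  ∈-tails true ((true ∷ v) ∷ rows) (here refl) = here refl
  ∈-tails true ((true ∷ v) ∷ rows) (there i) = there (∈-tails true rows i)

  length-tails : (rows : List (Vec Bool (suc s))) →
    length rows ≡ length (tails false rows) + length (tails true rows)
  length-tails [] = refl
  length-tails ((false ∷ v) ∷ rows) = cong suc (length-tails rows)
  length-tails ((true ∷ v) ∷ rows) = trans (cong suc (length-tails rows)) (sym (+-suc _ _))

  unique-tails : ∀ b (rows : List (Vec Bool (suc s))) → Unique rows → Unique (tails b rows)
  unique-tails b [] [] = []
  unique-tails false ((false ∷ v) ∷ rows) (v∉ ∷ u) =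
    All.tabulate (λ i e → All.lookup v∉ (∈-tails false rows i) (cong (false ∷_) e)) ∷ unique-tails false rows u
  unique-tails false ((true ∷ v) ∷ rows) (_ ∷ u) = unique-tails false rows u
  unique-tails true ((false ∷ v) ∷ rows) (_ ∷ u) = unique-tails true rows u
  unique-tails true ((true ∷ v) ∷ rows) (v∉ ∷ u) =
    All.tabulate (λ i e → All.lookup v∉ (∈-tails true rows i) (cong (true ∷_) e)) ∷ unique-tails true rows u

  length-filter-¬ : ∀ {A : Set} {P : A → Set} (P? : ∀ a → Dec (P a)) (xs : List A) →
    length xs ≡ length (filter (λ a → ¬? (P? a)) xs) + length (filter P? xs)
  length-filter-¬ P? [] = refl
  length-filter-¬ P? (x ∷ xs) with P? x
  ... | yes _ = trans (cong suc (length-filter-¬ P? xs)) (sym (+-suc _ _))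
  ... | no _ = cong suc (length-filter-¬ P? xs)

  map-suc : ∀ {h} b (row : Vec Bool s) (c : Vec (Fin s) h) →
    map (lookup (b ∷ row)) (map suc c) ≡ map (lookup row) c
  map-suc b row [] = refl
  map-suc b row (i ∷ c) = cong (lookup row i ∷_) (map-suc b row c)

  -- After deletion of the first column, `either` collects the distinct tails and `both` the tails
  -- that occur with both first entries, so |rows| = |either| + |both|. By the recursion for φ one
  -- of the two exceeds its bound. Columns shattered by `either` are shattered by `rows`; columns
  -- shattered by `both` stay so when the first column is added.
  sauer-shelah : ∀ s h (rows : List (Vec Bool s)) → Unique rows → φ s h < length rows → Shatters rows h
  sauer-shelah s zero (row ∷ rows) u lt = [] , λ { [] → row , here refl , refl }
  sauer-shelah zero (suc h) ([] ∷ []) u (s≤s ())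
  sauer-shelah zero (suc h) ([] ∷ [] ∷ rows) ((neq ∷ _) ∷ _) lt = ⊥-elim (neq refl)
  sauer-shelah (suc s) (suc h) rows u lt with φ s (suc h) <? length (tails false rows ++
      filter (λ v → ¬? (DecMembership._∈?_ (Vecₚ.≡-dec Boolₚ._≟_) v (tails false rows))) (tails true rows))
  ... | yes p = widen (sauer-shelah s (suc h) _ unique-either p)
    where
    _∈?_ = DecMembership._∈?_ (Vecₚ.≡-dec {n = s} Boolₚ._≟_)
    A₀ = tails false rows
    A₁ = tails true rows
    either = A₀ ++ filter (λ v → ¬? (v ∈? A₀)) A₁
    unique-either : Unique either
    unique-either = Uniqueₚ.++⁺ (unique-tails false rows u)
      (Uniqueₚ.filter⁺ (λ v → ¬? (v ∈? A₀)) (unique-tails true rows u))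
      (λ (i , j) → proj₂ (∈ₚ.∈-filter⁻ (λ v → ¬? (v ∈? A₀)) {xs = A₁} j) i)
    from : ∀ {row} → row ∈ either → ∃[ b ] (b ∷ row) ∈ rows
    from i with ∈ₚ.∈-++⁻ A₀ i
    ... | inj₁ j = false , ∈-tails false rows j
    ... | inj₂ j = true , ∈-tails true rows (proj₁ (∈ₚ.∈-filter⁻ (λ v → ¬? (v ∈? A₀)) {xs = A₁} j))
    widen : Shatters either (suc h) → Shatters rows (suc h)
    widen (c , shatter) = map suc c , λ p →
      let (row , i , e) = shatter p ; (b , j) = from i in
      b ∷ row , j , trans (map-suc b row c) e
  ... | no ¬p = add (sauer-shelah s h _ unique-both enough)
    where
    _∈?_ = DecMembership._∈?_ (Vecₚ.≡-dec {n = s} Boolₚ._≟_)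
    A₀ = tails false rows
    A₁ = tails true rows
    rest = filter (λ v → ¬? (v ∈? A₀)) A₁
    both = filter (_∈? A₀) A₁
    unique-both : Unique both
    unique-both = Uniqueₚ.filter⁺ (_∈? A₀) (unique-tails true rows u)
    enough : φ s h < length both
    enough = +-cancelˡ-< (φ s (suc h)) _ _ (begin-strict
      φ s (suc h) + φ s h                       <⟨ lt ⟩
      length rows                               ≡⟨ length-tails rows ⟩
      length A₀ + length A₁                     ≡⟨ cong (length A₀ +_) (length-filter-¬ (_∈? A₀) A₁) ⟩
      length A₀ + (length rest + length both)   ≡⟨ sym (+-assoc (length A₀) _ _) ⟩
      length A₀ + length rest + length both     ≡⟨ cong (_+ length both) (sym (Listₚ.length-++ A₀)) ⟩
      length (A₀ ++ rest) + length both         ≤⟨ +-monoˡ-≤ _ (≮⇒≥ ¬p) ⟩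
      φ s (suc h) + length both                 ∎)
      where open ≤-Reasoning
    add : Shatters both h → Shatters rows (suc h)
    add (c , shatter) = (zero ∷ map suc c) , λ { (b ∷ p) →
      let (row , i , e) = shatter p ; (j₁ , j₀) = ∈ₚ.∈-filter⁻ (_∈? A₀) {xs = A₁} i in
      b ∷ row , pick b j₀ j₁ , cong (b ∷_) (trans (map-suc b row c) e) }
      where
      pick : ∀ b {row} → row ∈ A₀ → row ∈ A₁ → (b ∷ row) ∈ rows
      pick false i _ = ∈-tails false rows i
      pick true _ i = ∈-tails true rows i

  half : ∀ {h} → Fin h → Fin h → Bool
  half i j = does (i Finₚ.≤? j)

  -- A shattered set of h columns shows every pattern, in particular the h rows of a half graph.
  half-graph : ∀ {K s} h (μ : Fin K → Fin s → Bool) →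
    (∀ i i′ → (∀ j → μ i j ≡ μ i′ j) → i ≡ i′) → φ s h < K →
    Σ[ ι ∈ (Fin h → Fin K) ] Σ[ ȷ ∈ (Fin h → Fin s) ] (∀ i j → μ (ι i) (ȷ j) ≡ half i j)
  half-graph {K} {s} h μ inj lt = ι , lookup c , correct
    where
    row : Fin K → Vec Bool s
    row i = tabulate (μ i)
    rows = List.tabulate row
    row-inj : ∀ {i i′} → row i ≡ row i′ → i ≡ i′
    row-inj {i} {i′} e = inj i i′ (λ j → trans (sym (Vecₚ.lookup∘tabulate (μ i) j))
      (trans (cong (λ v → lookup v j) e) (Vecₚ.lookup∘tabulate (μ i′) j)))
    sh = sauer-shelah s h rows (Uniqueₚ.tabulate⁺ row-inj)
      (<-≤-trans lt (≤-reflexive (sym (Listₚ.length-tabulate row))))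
    c = proj₁ sh
    found : ∀ i → ∃[ v ] v ∈ rows × map (lookup v) c ≡ tabulate (half i)
    found i = proj₂ sh (tabulate (half i))
    index : ∀ i → ∃[ k ] proj₁ (found i) ≡ row k
    index i = ∈ₚ.∈-tabulate⁻ (proj₁ (proj₂ (found i)))
    ι : Fin h → Fin K
    ι i = proj₁ (index i)
    correct : ∀ i j → μ (ι i) (lookup c j) ≡ half i j
    correct i j = begin
      μ (ι i) (lookup c j)                        ≡⟨ sym (Vecₚ.lookup∘tabulate (μ (ι i)) (lookup c j)) ⟩
      lookup (row (ι i)) (lookup c j)             ≡⟨ cong (λ v → lookup v (lookup c j)) (sym (proj₂ (index i))) ⟩
      lookup (proj₁ (found i)) (lookup c j)       ≡⟨ sym (Vecₚ.lookup-map j (lookup (proj₁ (found i))) c) ⟩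
      lookup (map (lookup (proj₁ (found i))) c) j ≡⟨ cong (λ v → lookup v j) (proj₂ (proj₂ (found i))) ⟩
      lookup (tabulate (half i)) j                ≡⟨ Vecₚ.lookup∘tabulate (half i) j ⟩
      half i j                                    ∎
      where open ≡-Reasoning

  φ≤ : ∀ s h → φ s h ≤ suc s ^ h
  φ≤ s zero = z≤n
  φ≤ zero (suc h) = ≤-reflexive (sym (^-zeroˡ (suc h)))
  φ≤ (suc s) (suc h) = begin
    φ s (suc h) + φ s h                 ≤⟨ +-mono-≤ (φ≤ s (suc h)) (φ≤ s h) ⟩
    suc s * suc s ^ h + suc s ^ h       ≡⟨ l (suc s) (suc s ^ h) ⟩
    suc (suc s) * suc s ^ h             ≤⟨ *-monoʳ-≤ (suc (suc s)) (^-monoˡ-≤ h (n≤1+n (suc s))) ⟩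
    suc (suc s) * suc (suc s) ^ h       ∎
    where
    open ≤-Reasoning
    l : ∀ a b → a * b + b ≡ (1 + a) * b
    l = solve-∀

  n<2^n : ∀ n → n < 2 ^ n
  n<2^n zero = s≤s z≤n
  n<2^n (suc n) = begin
    suc (suc n)        ≤⟨ +-mono-≤ (≤-trans (s≤s z≤n) (n<2^n n)) (n<2^n n) ⟩
    2 ^ n + 2 ^ n      ≡⟨ cong (2 ^ n +_) (sym (+-identityʳ _)) ⟩
    2 ^ suc n          ∎
    where open ≤-Reasoning

  polynomial<exponential : ∀ c h → ∃[ i ] (c * suc i) ^ h < 2 ^ i
  polynomial<exponential c h = suc (j * 2 * h) , (begin-strict
    (c * suc (suc (j * 2 * h))) ^ h    ≤⟨ ^-monoˡ-≤ h base ⟩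
    (2 ^ (j * 2)) ^ h                  ≡⟨ ^-*-assoc 2 (j * 2) h ⟩
    2 ^ (j * 2 * h)                    <⟨ ^-monoʳ-< 2 ≤-refl (n<1+n (j * 2 * h)) ⟩
    2 ^ suc (j * 2 * h)                ∎)
    where
    open ≤-Reasoning
    -- With i = 2jh + 1, the number c (i + 1) is at most c (2h + 2) · j, a product of two numbers
    -- below 2 ^ j.
    j = suc (c * (2 * h + 2))
    base : c * suc (suc (j * 2 * h)) ≤ 2 ^ (j * 2)
    base = begin
      c * suc (suc (j * 2 * h))         ≤⟨ *-monoʳ-≤ c (≤-trans (m≤m+n _ (2 * c * (2 * h + 2))) (≤-reflexive (l c h))) ⟩
      c * ((2 * h + 2) * j)             ≡⟨ sym (*-assoc c (2 * h + 2) j) ⟩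
      c * (2 * h + 2) * j               ≤⟨ *-mono-≤ (≤-trans (n≤1+n _) (<⇒≤ (n<2^n j))) (<⇒≤ (n<2^n j)) ⟩
      2 ^ j * 2 ^ j                     ≡⟨ sym (^-distribˡ-+-* 2 j j) ⟩
      2 ^ (j + j)                       ≡⟨ cong (2 ^_) (l₂ j) ⟩
      2 ^ (j * 2)                       ∎
      where
      l : ∀ c h → (2 + (1 + c * (2 * h + 2)) * 2 * h) + 2 * c * (2 * h + 2) ≡ (2 * h + 2) * (1 + c * (2 * h + 2))
      l = solve-∀
      l₂ : ∀ j → j + j ≡ j * 2
      l₂ = solve-∀

  bernoulli : ∀ a n → a ^ n * (a + n) ≤ suc a ^ n * a
  bernoulli a zero = ≤-reflexive (cong (1 *_) (+-identityʳ a))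
  bernoulli a (suc n) = begin
    a * a ^ n * (a + suc n)               ≤⟨ m≤m+n _ (a ^ n * n) ⟩
    a * a ^ n * (a + suc n) + a ^ n * n   ≡⟨ l a n (a ^ n) ⟩
    suc a * (a ^ n * (a + n))             ≤⟨ *-monoʳ-≤ (suc a) (bernoulli a n) ⟩
    suc a * (suc a ^ n * a)               ≡⟨ sym (*-assoc (suc a) (suc a ^ n) a) ⟩
    suc a * suc a ^ n * a                 ∎
    where
    open ≤-Reasoning
    l : ∀ a n p → a * p * (a + (1 + n)) + p * n ≡ (1 + a) * (p * (a + n))
    l = solve-∀

  -- Bernoulli's inequality for 1 + 1 / a with exponent a + 1 gives (1 + 1 / a) ^ (a + 1) ≥ 2 + 1 /
  -- a.
  double : ∀ a → a ^ suc a * 2 ≤ suc a ^ suc a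
  double zero = z≤n
  double a@(suc a-1) = *-cancelʳ-≤ _ _ a (begin
    a ^ suc a * 2 * a          ≤⟨ m≤m+n _ (a ^ suc a) ⟩
    a ^ suc a * 2 * a + a ^ suc a  ≡⟨ l (a ^ suc a) a ⟩
    a ^ suc a * (a + suc a)    ≤⟨ bernoulli a (suc a) ⟩
    suc a ^ suc a * a          ∎)
    where
    open ≤-Reasoning
    l : ∀ p a → p * 2 * a + p ≡ p * (a + (1 + a))
    l = solve-∀

  *-^-distrib : ∀ a b j → (a * b) ^ j ≡ a ^ j * b ^ j
  *-^-distrib a b zero = refl
  *-^-distrib a b (suc j) = trans (cong (a * b *_) (*-^-distrib a b j)) (l a b (a ^ j) (b ^ j))
    where
    l : ∀ a b c d → a * b * (c * d) ≡ a * c * (b * d)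
    l = solve-∀

  -- With s a large multiple of i, K = 2 ^ i beats the Sauer–Shelah bound, polynomial
  -- in s, while K² (a / (a + 1)) ^ s is still less than 1.
  rows-and-columns : ∀ h a → 1 ≤ a → ∃[ K ] ∃[ s ] φ s h < K × K * K * a ^ s < suc a ^ s
  rows-and-columns h a 1≤a = 2 ^ i , m , poly , sep
    where
    open ≤-Reasoning
    c = 2 * (a + 2)
    i = proj₁ (polynomial<exponential c h)
    -- By `double` every a + 1 columns gain a factor 2, so j such blocks beat K² = 2 ^ (i + i) as
    -- soon as j > i + i.
    j = suc (i + i)
    m = suc a * j
    poly : φ m h < 2 ^ i
    poly = begin-strict
      φ m h               ≤⟨ φ≤ m h ⟩
      suc m ^ h           ≤⟨ ^-monoˡ-≤ h (≤-trans (m≤m+n _ (2 * i + a + 2)) (≤-reflexive (l a i))) ⟩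
      (c * suc i) ^ h     <⟨ proj₂ (polynomial<exponential c h) ⟩
      2 ^ i               ∎
      where
      l : ∀ a i → (1 + (1 + a) * (1 + (i + i))) + (2 * i + a + 2) ≡ 2 * (a + 2) * (1 + i)
      l = solve-∀
    powers : ∀ j → a ^ (suc a * j) * 2 ^ j ≤ suc a ^ (suc a * j)
    powers j = begin
      a ^ (suc a * j) * 2 ^ j       ≡⟨ cong (_* 2 ^ j) (sym (^-*-assoc a (suc a) j)) ⟩
      (a ^ suc a) ^ j * 2 ^ j       ≡⟨ sym (*-^-distrib (a ^ suc a) 2 j) ⟩
      (a ^ suc a * 2) ^ j           ≤⟨ ^-monoˡ-≤ j (double a) ⟩
      (suc a ^ suc a) ^ j           ≡⟨ ^-*-assoc (suc a) (suc a) j ⟩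
      suc a ^ (suc a * j)           ∎
    sep : 2 ^ i * 2 ^ i * a ^ m < suc a ^ m
    sep = begin-strict
      2 ^ i * 2 ^ i * a ^ m      ≡⟨ cong (_* a ^ m) (sym (^-distribˡ-+-* 2 i i)) ⟩
      2 ^ (i + i) * a ^ m        <⟨ *-monoˡ-< (a ^ m) {{m^n≢0 a m {{>-nonZero 1≤a}}}} (^-monoʳ-< 2 ≤-refl (n<1+n (i + i))) ⟩
      2 ^ j * a ^ m              ≡⟨ *-comm (2 ^ j) (a ^ m) ⟩
      a ^ m * 2 ^ j              ≤⟨ powers j ⟩
      suc a ^ m                  ∎

-- Pairwise distant rows and columns that tell them apart.

module RowsAndColumns where
  open Counting
  open ErdősTheorem
  open SauerShelah
  open import Data.Bool.Base using (Bool; true; false; _∧_; _xor_; not)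
  open import Data.Fin.Base using (Fin; zero; suc; _↑ˡ_; _↑ʳ_)
  open import Data.List.Base as List using (List; []; _∷_; _++_; length; filterᵇ; null)
  open import Data.Bool.ListAction using (all)
  open import Data.Nat.ListAction using () renaming (sum to List-sum)
  open import Data.List.Membership.Propositional using (_∈_)
  import Data.List.Membership.Propositional.Properties as ∈ₚ
  open import Data.List.Relation.Unary.Any using (here; there)
  open import Data.Nat.Base
  open import Data.Nat.Properties
  open import Data.Nat.Tactic.RingSolver using (solve-∀)
  open import Data.Vec.Base using (Vec; []; _∷_; lookup; replicate)
  open import Data.Vec.Relation.Unary.All using ([]; _∷_)
  open import Function.Base using (_∘_)

  private
    variable
      N r : ℕ

  dist : (Fin N → Bool) → (Fin N → Bool) → (Fin N → Bool) → ℕ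
  dist Y f g = # (λ y → Y y ∧ (f y xor g y))

  close : ℕ → (Fin N → Bool) → (Fin N → Bool) → (Fin N → Bool) → Bool
  close e Y f g = e * dist Y f g ≤ᵇ # Y

  -- The copies of one aᵢ are distinct by `a-inj`; copies for different i are distinct because of
  -- `edges`, as the rows of a half graph differ. The same holds for bⱼ. In F the vertex of Z comes
  -- first, since the construction takes place in slices of Z.
  record HalfGraph (Z X Y : Fin N → Bool) (F : Fin N → Fin N → Fin N → Bool) (h m : ℕ) : Set where
    field
      a b : Fin h → Fin m → Fin N
      c : Fin m → Fin N
      a∈ : ∀ i s → X (a i s) ≡ true
      b∈ : ∀ i s → Y (b i s) ≡ true
      c∈ : ∀ s → Z (c s) ≡ true
      a-inj : ∀ i s t → a i s ≡ a i t → s ≡ t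
      b-inj : ∀ i s t → b i s ≡ b i t → s ≡ t
      c-inj : ∀ s t → c s ≡ c t → s ≡ t
      edges : ∀ i j s t u → F (c u) (a i s) (b j t) ≡ half i j

  ⟦⟧-mono : ∀ {a b} → (a ≡ true → b ≡ true) → ⟦ a ⟧ ≤ ⟦ b ⟧
  ⟦⟧-mono {true} h = ≤-reflexive (cong ⟦_⟧ (sym (h refl)))
  ⟦⟧-mono {false} h = z≤n

  ≰ᵇ⇒> : ∀ {a b} → (a ≤ᵇ b) ≡ false → b < a
  ≰ᵇ⇒> {a} {b} e = ≰⇒> (λ le → true≢false (T⇒≡ (≤⇒≤ᵇ le)) e)

  ∧-intro : ∀ {a b} → a ≡ true → b ≡ true → a ∧ b ≡ true
  ∧-intro refl refl = refl

  not-true : ∀ {b} → not b ≡ true → b ≡ false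
  not-true {false} _ = refl

  -- Densities multiply along fibres: the induction step whenever tuples are chosen one coordinate
  -- at a time.
  extend-count : ∀ (D good : Fin N → Bool) (Ds : Vec (Fin N → Bool) r) (Q : Vec (Fin N) (suc r) → Bool) q q′ →
    # D ≤ q * # (λ y → D y ∧ good y) →
    (∀ y → good y ≡ true → size Ds ≤ q′ * cnt Ds (λ v → Q (y ∷ v))) →
    size (D ∷ Ds) ≤ q * q′ * cnt (D ∷ Ds) Q
  extend-count D good Ds Q q q′ many each = begin
    # D * size Ds                                           ≤⟨ *-monoˡ-≤ (size Ds) many ⟩
    q * # (λ y → D y ∧ good y) * size Ds                    ≡⟨ *-assoc q _ (size Ds) ⟩
    q * (# (λ y → D y ∧ good y) * size Ds)                  ≡⟨ cong (q *_) (sym (sum-*ʳ (size Ds) (λ y → ⟦ D y ∧ good y ⟧))) ⟩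
    q * sum (λ y → ⟦ D y ∧ good y ⟧ * size Ds)              ≤⟨ *-monoʳ-≤ q (sum-mono pt) ⟩
    q * sum (λ y → q′ * (⟦ D y ⟧ * cnt Ds (λ v → Q (y ∷ v))))
      ≡⟨ cong (q *_) (sum-*ˡ q′ (λ y → ⟦ D y ⟧ * cnt Ds (λ v → Q (y ∷ v)))) ⟩
    q * (q′ * cnt (D ∷ Ds) Q)                               ≡⟨ sym (*-assoc q q′ _) ⟩
    q * q′ * cnt (D ∷ Ds) Q                                 ∎
    where
    open ≤-Reasoning
    pt : ∀ y → ⟦ D y ∧ good y ⟧ * size Ds ≤ q′ * (⟦ D y ⟧ * cnt Ds (λ v → Q (y ∷ v)))
    pt y with D y | good y in e
    ... | false | _ = z≤n
    ... | true | false = z≤n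
    ... | true | true = begin
      1 * size Ds                              ≡⟨ *-identityˡ (size Ds) ⟩
      size Ds                                  ≤⟨ each y e ⟩
      q′ * cnt Ds (λ v → Q (y ∷ v))            ≡⟨ cong (q′ *_) (sym (*-identityˡ _)) ⟩
      q′ * (1 * cnt Ds (λ v → Q (y ∷ v)))      ∎

  length-filterᵇ : ∀ {A : Set} (p : A → Bool) (xs : List A) →
    length xs ≡ length (filterᵇ (not ∘ p) xs) + length (filterᵇ p xs)
  length-filterᵇ p [] = refl
  length-filterᵇ p (x ∷ xs) with p x
  ... | true = trans (cong suc (length-filterᵇ p xs)) (sym (+-suc _ _))
  ... | false = cong suc (length-filterᵇ p xs)

  ∈-filterᵇ : ∀ {A : Set} (p : A → Bool) (xs : List A) {x} → x ∈ xs → p x ≡ true → x ∈ filterᵇ p xs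
  ∈-filterᵇ p (y ∷ xs) (here refl) e rewrite e = here refl
  ∈-filterᵇ p (y ∷ xs) (there i) e with p y
  ... | true = there (∈-filterᵇ p xs i e)
  ... | false = ∈-filterᵇ p xs i e

  ∈-filterᵇ⁻ : ∀ {A : Set} (p : A → Bool) (xs : List A) {x} → x ∈ filterᵇ p xs → x ∈ xs
  ∈-filterᵇ⁻ p (y ∷ xs) i with p y
  ∈-filterᵇ⁻ p (y ∷ xs) (here refl) | true = here refl
  ∈-filterᵇ⁻ p (y ∷ xs) (there i) | true = there (∈-filterᵇ⁻ p xs i)
  ∈-filterᵇ⁻ p (y ∷ xs) i | false = there (∈-filterᵇ⁻ p xs i)

  xor-false : ∀ a b → not (a xor b) ≡ false → a ≢ b
  xor-false true false _ ()
  xor-false false true _ ()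

  -- U lists the pairs of rows that agree on all columns read so far. A pair at distance more than
  -- |Y| / e is told apart by a fraction 1 / e of the columns. The parameter a = 2e - 1 is chosen so
  -- that a good column leaves at most a fraction a / (a + 1) of U.
  module Columns (Y : Fin N → Bool) (f : Fin N → Fin N → Bool) (a : ℕ) (e : ℕ) (2e : 2 * e ≡ suc a) where

    same : Fin N → Fin N × Fin N → Bool
    same y (x , x′) = not (f x y xor f x′ y)

    cols : ∀ {s} → List (Fin N × Fin N) → Vec (Fin N) s → Bool
    cols U [] = null U
    cols U (y ∷ v) = cols (filterᵇ (same y) U) v

    Far : Fin N × Fin N → Set
    Far (x , x′) = # Y < e * dist Y (f x) (f x′)

    resolved : List (Fin N × Fin N) → Fin N → ℕ
    resolved U y = length (filterᵇ (not ∘ same y) U)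

    resolved-total : ∀ U → (∀ {p} → p ∈ U → Far p) →
      length U * # Y ≤ e * sum (λ y → ⟦ Y y ⟧ * resolved U y)
    resolved-total [] far = z≤n
    resolved-total ((x , x′) ∷ U) far = begin
      # Y + length U * # Y
        ≤⟨ +-mono-≤ (<⇒≤ (far (here refl))) (resolved-total U (far ∘ there)) ⟩
      e * dist Y (f x) (f x′) + e * sum (λ y → ⟦ Y y ⟧ * resolved U y)
        ≡⟨ sym (*-distribˡ-+ e (dist Y (f x) (f x′)) _) ⟩
      e * (dist Y (f x) (f x′) + sum (λ y → ⟦ Y y ⟧ * resolved U y))
        ≡⟨ cong (e *_) (sym (sum-+ (λ y → ⟦ Y y ∧ (f x y xor f x′ y) ⟧) (λ y → ⟦ Y y ⟧ * resolved U y))) ⟩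
      e * sum (λ y → ⟦ Y y ∧ (f x y xor f x′ y) ⟧ + ⟦ Y y ⟧ * resolved U y)
        ≡⟨ cong (e *_) (sum-cong pt) ⟩
      e * sum (λ y → ⟦ Y y ⟧ * resolved ((x , x′) ∷ U) y) ∎
      where
      open ≤-Reasoning
      pt : ∀ y → ⟦ Y y ∧ (f x y xor f x′ y) ⟧ + ⟦ Y y ⟧ * resolved U y ≡ ⟦ Y y ⟧ * resolved ((x , x′) ∷ U) y
      pt y with Y y | f x y xor f x′ y
      ... | false | _ = refl
      ... | true | true = refl
      ... | true | false = refl

    resolved≤ : ∀ U y → resolved U y ≤ length U
    resolved≤ U y = ≤-trans (m≤m+n _ _) (≤-reflexive (sym (length-filterᵇ (same y) U)))

    -- By reverse Markov, a fraction 1 / 2e of the columns resolves a fraction 1 / 2e of U. After s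
    -- such columns at most |U| (a / (a + 1)) ^ s < 1 pairs are left, hence none.
    columns-count : ∀ s U → (∀ {p} → p ∈ U → Far p) → length U * a ^ s < suc a ^ s →
      size (replicate s Y) ≤ suc a ^ s * cnt (replicate s Y) (cols U)
    columns-count zero [] far small = ≤-refl
    columns-count zero (_ ∷ U) far (s≤s ())
    columns-count (suc s) [] far small = ≤-trans all-true (m≤n*m _ (suc a ^ suc s) {{m^n≢0 (suc a) (suc s)}})
      where
      cols-[] : ∀ {s} (v : Vec (Fin N) s) → cols [] v ≡ true
      cols-[] [] = refl
      cols-[] (y ∷ v) = cols-[] v
      all-true : size (replicate (suc s) Y) ≤ cnt (replicate (suc s) Y) (cols [])
      all-true = ≤-reflexive (sym (trans (tot-cong (replicate (suc s) Y) (λ v → cong ⟦_⟧ (cols-[] v)))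
        (trans (tot-const (replicate (suc s) Y) 1) (*-identityʳ _))))
    columns-count (suc s) U@(_ ∷ _) far small =
      extend-count Y good (replicate s Y) (cols U) (suc a) (suc a ^ s) many each
      where
      open ≤-Reasoning
      good : Fin N → Bool
      good y = length U ≤ᵇ 2 * e * resolved U y
      many : # Y ≤ suc a * # (λ y → Y y ∧ good y)
      many = subst (λ b → # Y ≤ b * # (λ y → Y y ∧ good y)) 2e
        (reverse-markov e (length U) Y (resolved U) (resolved≤ U) (s≤s z≤n) (resolved-total U far))
      each : ∀ y → good y ≡ true →
        size (replicate s Y) ≤ suc a ^ s * cnt (replicate s Y) (λ v → cols U (y ∷ v))
      each y gy = columns-count s (filterᵇ (same y) U) (λ i → far (∈-filterᵇ⁻ (same y) U i))
        (*-cancelˡ-< (suc a) _ _ (begin-strict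
          suc a * (L′ * a ^ s)     ≡⟨ sym (*-assoc (suc a) L′ (a ^ s)) ⟩
          suc a * L′ * a ^ s       ≤⟨ *-monoˡ-≤ (a ^ s) shrink ⟩
          a * L * a ^ s            ≡⟨ l₁ a L (a ^ s) ⟩
          L * (a * a ^ s)          <⟨ small ⟩
          suc a * suc a ^ s        ∎))
        where
        L = length U
        L′ = length (filterᵇ (same y) U)
        l₁ : ∀ a b c → a * b * c ≡ b * (a * c)
        l₁ = solve-∀
        shrink : suc a * L′ ≤ a * L
        shrink = +-cancelˡ-≤ L _ _ (begin
          L + suc a * L′                           ≤⟨ +-monoˡ-≤ (suc a * L′) (≤ᵇ⇒≤ L (2 * e * resolved U y) (≡⇒T gy)) ⟩
          2 * e * resolved U y + suc a * L′        ≡⟨ cong (λ b → b * resolved U y + suc a * L′) 2e ⟩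
          suc a * resolved U y + suc a * L′        ≡⟨ sym (*-distribˡ-+ (suc a) (resolved U y) L′) ⟩
          suc a * (resolved U y + L′)              ≡⟨ cong (suc a *_) (sym (length-filterᵇ (same y) U)) ⟩
          suc a * L                                ∎)

    cols-resolve : ∀ {s} U (v : Vec (Fin N) s) → cols U v ≡ true →
      ∀ {x x′} → (x , x′) ∈ U → ∃[ j ] f x (lookup v j) ≢ f x′ (lookup v j)
    cols-resolve (_ ∷ _) [] () i
    cols-resolve U (y ∷ v) e {x} {x′} i with same y (x , x′) in eq
    ... | false = zero , xor-false _ _ eq
    ... | true = let (j , ne) = cols-resolve (filterᵇ (same y) U) v e (∈-filterᵇ (same y) U i eq) in suc j , ne

  all-lookup : ∀ {A : Set} (p : A → Bool) xs {x} → x ∈ xs → all p xs ≡ true → p x ≡ true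
  all-lookup p (y ∷ xs) (here refl) e = proj₁ (∧-elim e)
  all-lookup p (y ∷ xs) (there i) e = all-lookup p xs i (proj₂ (∧-elim {p y} e))

  module Rows (X Y : Fin N → Bool) (f : Fin N → Fin N → Bool) (R : Fin N → Bool) (a e g K s : ℕ)
    (2e : 2 * e ≡ suc a) (0<K : 0 < K) where

    open Columns Y f a e 2e

    ball : Fin N → ℕ
    ball x = # (λ x′ → R x′ ∧ close e Y (f x) (f x′))

    R′ : Fin N → Bool
    R′ x = R x ∧ (8 * g * K * ball x ≤ᵇ # X)

    ext : List (Fin N) → Fin N → Bool
    ext xs x = R′ x ∧ all (λ x′ → not (close e Y (f x′) (f x))) xs

    -- The first K′ coordinates extend `xs` by rows far from all earlier ones. Each new row adds its
    -- pairs with the earlier rows to U, and the last s coordinates must resolve all of U.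
    rows : ∀ K′ → List (Fin N × Fin N) → List (Fin N) → Vec (Fin N) (K′ + s) → Bool
    rows zero U xs v = cols U v
    rows (suc K′) U xs (x ∷ v) = ext xs x ∧ rows K′ (List.map (_, x) xs ++ U) (x ∷ xs) v

    dom : ∀ K′ → Vec (Fin N → Bool) (K′ + s)
    dom zero = replicate s Y
    dom (suc K′) = X ∷ dom K′

    module _ (R⊆X : ∀ x → R x ≡ true → X x ≡ true) (deg : # X ≤ 2 * (2 * g) * # R′) where

      -- `R′` is a fraction 1 / 4g of X, and the balls around at most K chosen rows, each of size at
      -- most |X| / 8gK, cover only |X| / 8g. At least as much of `R′` remains for the next row.
      ext-count : ∀ xs → length xs ≤ K → (∀ {x} → x ∈ xs → R′ x ≡ true) →
        # X ≤ 8 * g * # (λ x → X x ∧ ext xs x)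
      ext-count xs short light = *-cancelˡ-≤ K {{>-nonZero 0<K}} (+-cancelʳ-≤ (K * # X) _ _ (begin
        K * # X + K * # X                         ≡⟨ l₁ K (# X) ⟩
        2 * K * # X                               ≤⟨ *-monoʳ-≤ (2 * K) deg ⟩
        2 * K * (2 * (2 * g) * # R′)              ≡⟨ l₂ K g (# R′) ⟩
        8 * g * K * # R′                          ≤⟨ *-monoʳ-≤ (8 * g * K) (cover xs) ⟩
        8 * g * K * (# E + List-sum (List.map ball xs))  ≡⟨ *-distribˡ-+ (8 * g * K) (# E) _ ⟩
        8 * g * K * # E + 8 * g * K * List-sum (List.map ball xs) ≤⟨ +-monoʳ-≤ (8 * g * K * # E) (balls xs light) ⟩
        8 * g * K * # E + length xs * # X         ≤⟨ +-monoʳ-≤ (8 * g * K * # E) (*-monoˡ-≤ (# X) short) ⟩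
        8 * g * K * # E + K * # X                 ≡⟨ cong (_+ K * # X) (l₃ g K (# E)) ⟩
        K * (8 * g * # E) + K * # X               ∎))
        where
        open ≤-Reasoning
        E : Fin N → Bool
        E x = X x ∧ ext xs x
        l₁ : ∀ a b → a * b + a * b ≡ 2 * a * b
        l₁ = solve-∀
        l₂ : ∀ a b c → 2 * a * (2 * (2 * b) * c) ≡ 8 * b * a * c
        l₂ = solve-∀
        l₃ : ∀ a b c → 8 * a * b * c ≡ b * (8 * a * c)
        l₃ = solve-∀
        balls : ∀ xs → (∀ {x} → x ∈ xs → R′ x ≡ true) → 8 * g * K * List-sum (List.map ball xs) ≤ length xs * # X
        balls [] _ = ≤-reflexive (*-zeroʳ (8 * g * K))
        balls (x ∷ xs) light = ≤-trans (≤-reflexive (*-distribˡ-+ (8 * g * K) (ball x) _))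
          (+-mono-≤ (≤ᵇ⇒≤ _ _ (≡⇒T (proj₂ (∧-elim {R x} (light (here refl)))))) (balls xs (light ∘ there)))
        cover : ∀ xs → # R′ ≤ # (λ x → X x ∧ ext xs x) + List-sum (List.map ball xs)
        cover [] = ≤-trans (sum-mono (λ x → ⟦⟧-mono λ t → ∧-intro (R⊆X x (proj₁ (∧-elim t))) (∧-intro t refl)))
          (≤-reflexive (sym (+-identityʳ _)))
        cover (x₀ ∷ xs) = begin
          # R′                                                    ≤⟨ cover xs ⟩
          # (λ x → X x ∧ ext xs x) + B                            ≤⟨ +-monoˡ-≤ B (sum-mono pt) ⟩
          sum (λ x → ⟦ X x ∧ ext (x₀ ∷ xs) x ⟧ + ⟦ R x ∧ close e Y (f x₀) (f x) ⟧) + B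
            ≡⟨ cong (_+ B) (sum-+ (λ x → ⟦ X x ∧ ext (x₀ ∷ xs) x ⟧) (λ x → ⟦ R x ∧ close e Y (f x₀) (f x) ⟧)) ⟩
          # (λ x → X x ∧ ext (x₀ ∷ xs) x) + ball x₀ + B           ≡⟨ +-assoc (# (λ x → X x ∧ ext (x₀ ∷ xs) x)) (ball x₀) B ⟩
          # (λ x → X x ∧ ext (x₀ ∷ xs) x) + (ball x₀ + B)         ∎
          where
          B = List-sum (List.map ball xs)
          pt : ∀ x → ⟦ X x ∧ ext xs x ⟧ ≤ ⟦ X x ∧ ext (x₀ ∷ xs) x ⟧ + ⟦ R x ∧ close e Y (f x₀) (f x) ⟧
          pt x = lem (X x) (R x) _ (close e Y (f x₀) (f x)) _
            where
            lem : ∀ X R l c A → ⟦ X ∧ ((R ∧ l) ∧ A) ⟧ ≤ ⟦ X ∧ ((R ∧ l) ∧ (not c ∧ A)) ⟧ + ⟦ R ∧ c ⟧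
            lem false R l c A = z≤n
            lem true false l c A = z≤n
            lem true true false c A = z≤n
            lem true true true true A = ⟦⟧≤1 A
            lem true true true false A = m≤m+n _ _

      -- Each of the K rows puts at most K new pairs into U, so at most K² pairs are left to the
      -- columns; hence K * K in the last hypothesis. A row costs a factor 8g in density, a column a
      -- factor a + 1.
      rows-count : ∀ K′ U xs → (∀ {p} → p ∈ U → Far p) → (∀ {x} → x ∈ xs → R′ x ≡ true) →
        length xs + K′ ≤ K → length U ≤ length xs * K → K * K * a ^ s < suc a ^ s →
        size (dom K′) ≤ (8 * g) ^ K′ * suc a ^ s * cnt (dom K′) (rows K′ U xs)
      rows-count zero U xs far light len lenU small =
        subst (λ q → size (dom zero) ≤ q * cnt (dom zero) (cols U)) (sym (*-identityˡ (suc a ^ s)))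
          (columns-count s U far (≤-<-trans (*-monoˡ-≤ (a ^ s) (≤-trans lenU (*-monoˡ-≤ K
            (≤-trans (≤-reflexive (sym (+-identityʳ _))) len)))) small))
      rows-count (suc K′) U xs far light len lenU small =
        subst (λ q → size (dom (suc K′)) ≤ q * cnt (dom (suc K′)) (rows (suc K′) U xs))
          (sym (*-assoc (8 * g) ((8 * g) ^ K′) (suc a ^ s)))
          (extend-count X (ext xs) (dom K′) (rows (suc K′) U xs) (8 * g) ((8 * g) ^ K′ * suc a ^ s)
            (ext-count xs (≤-trans (m≤m+n _ _) len) light) each)
        where
        each : ∀ x → ext xs x ≡ true → size (dom K′) ≤
          (8 * g) ^ K′ * suc a ^ s * cnt (dom K′) (λ v → ext xs x ∧ rows K′ (List.map (_, x) xs ++ U) (x ∷ xs) v)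
        each x ex rewrite ex = rows-count K′ (List.map (_, x) xs ++ U) (x ∷ xs) far′ light′
          (≤-trans (≤-reflexive (sym (+-suc (length xs) K′))) len) lenU′ small
          where
          far′ : ∀ {p} → p ∈ List.map (_, x) xs ++ U → Far p
          far′ i with ∈ₚ.∈-++⁻ (List.map (_, x) xs) i
          ... | inj₂ j = far j
          ... | inj₁ j with ∈ₚ.∈-map⁻ (_, x) j
          ...   | x′ , k , refl = ≰ᵇ⇒> (not-true (all-lookup _ xs k (proj₂ (∧-elim {R′ x} ex))))
          light′ : ∀ {y} → y ∈ x ∷ xs → R′ y ≡ true
          light′ (here refl) = proj₁ (∧-elim ex)
          light′ (there i) = light i
          lenU′ : length (List.map (_, x) xs ++ U) ≤ suc (length xs) * K
          lenU′ = begin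
            length (List.map (_, x) xs ++ U)          ≡⟨ Listₚ.length-++ (List.map (_, x) xs) ⟩
            length (List.map (_, x) xs) + length U    ≡⟨ cong (_+ length U) (Listₚ.length-map (_, x) xs) ⟩
            length xs + length U                      ≤⟨ +-mono-≤ (≤-trans (m≤m+n _ _) len) lenU ⟩
            K + length xs * K                         ∎
            where open ≤-Reasoning

    Resolved : ∀ {K′} → Vec (Fin N) (K′ + s) → Fin N → Fin N → Set
    Resolved {K′} v x x′ = ∃[ j ] f x (lookup v (K′ ↑ʳ j)) ≢ f x′ (lookup v (K′ ↑ʳ j))

    -- The three claims feed each other: the pairs of a new row with `xs` fall under the claim on U,
    -- and its pairs with later rows under the claim on `xs`.
    rows-resolve : ∀ K′ U xs v → rows K′ U xs v ≡ true →
      (∀ {x x′} → (x , x′) ∈ U → Resolved {K′} v x x′) ×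
      (∀ {x} → x ∈ xs → ∀ i → Resolved {K′} v x (lookup v (i ↑ˡ s))) ×
      (∀ i i′ → i ≢ i′ → Resolved {K′} v (lookup v (i ↑ˡ s)) (lookup v (i′ ↑ˡ s)))
    rows-resolve zero U xs v t = cols-resolve U v t , (λ _ ()) , λ ()
    rows-resolve (suc K′) U xs (x ∷ v) t =
      (λ i → proj₁ ih (∈ₚ.∈-++⁺ʳ (List.map (_, x) xs) i))
      , (λ { i zero → proj₁ ih (∈ₚ.∈-++⁺ˡ (∈ₚ.∈-map⁺ (_, x) i)) ; i (suc k) → proj₁ (proj₂ ih) (there i) k })
      , λ { zero zero ne → ⊥-elim (ne refl)
          ; zero (suc i′) _ → proj₁ (proj₂ ih) (here refl) i′
          ; (suc i) zero _ → let (j , ne) = proj₁ (proj₂ ih) (here refl) i in j , ne ∘ sym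
          ; (suc i) (suc i′) ne → proj₂ (proj₂ ih) i i′ (ne ∘ cong suc) }
      where
      ih = rows-resolve K′ (List.map (_, x) xs ++ U) (x ∷ xs) v (proj₂ (∧-elim {ext xs x} t))

-- Neighbourhoods cluster, or a half graph appears.

module ClusterLemma where
  open Counting
  open ErdősTheorem
  open SauerShelah
  open RowsAndColumns
  open import Data.Bool.Base using (Bool; true; false; _∧_; if_then_else_)
  open import Data.Fin.Base as Fin using (Fin; zero; suc; _↑ˡ_; _↑ʳ_; remQuot; combine)
  open import Data.List.Base using ([]; _∷_)
  open import Data.Nat.Base
  open import Data.Nat.Properties
  open import Data.Nat.Tactic.RingSolver using (solve-∀)
  open import Data.Vec.Base using (Vec; []; _∷_; zipWith; lookup; replicate; tabulate)
  open import Data.Vec.Relation.Unary.All using (All; []; _∷_)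
  open import Function.Base using (_∘_; _$_)

  closePairs : ∀ {N} (Z Y : Fin N → Bool) (F : Fin N → Fin N → Fin N → Bool) (R : Fin N → Fin N → Bool) (e : ℕ) → ℕ
  closePairs Z Y F R e =
    sum (λ z → ⟦ Z z ⟧ * sum (λ x → ⟦ R z x ⟧ * # (λ x′ → R z x′ ∧ close e Y (F z x) (F z x′))))

  ↑ʳ≢↑ˡ : ∀ K {s} (i : Fin K) (j : Fin s) → K ↑ʳ j ≢ i ↑ˡ s
  ↑ʳ≢↑ˡ (suc K) zero j ()
  ↑ʳ≢↑ˡ (suc K) (suc i) j eq = ↑ʳ≢↑ˡ K i j (Finₚ.suc-injective eq)

  private
    -- If few pairs are close, then for most (z, x) few x′ are close to x.  Hence many z have
    -- many K-tuples of pairwise distant x's, which s typical y's tell apart.  By pigeonhole and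
    -- Erdős's theorem one K × s pattern of adjacencies has a blow-up.  Its K > φ s h distinct
    -- rows shatter h of its columns, so it contains a half graph.
    module Cluster (h m g a e K s N₀ : ℕ) (2e : 2 * e ≡ suc a) (1≤m : 1 ≤ m) (φ<K : φ s h < K)
      (sep : K * K * a ^ s < suc a ^ s) (1≤N₀ : 1 ≤ N₀)
      (blow-up : ∀ {N} (Ds : Vec (Fin N → Bool) (suc (K + s))) Q → All (λ D → N₀ ≤ # D) Ds →
        size Ds ≤ 2 * (2 * g) * ((8 * g) ^ K * suc a ^ s) * 2 ^ (K * s) * cnt Ds Q → BlowUp Ds Q m)
      {N : ℕ} (Z X Y : Fin N → Bool) (F : Fin N → Fin N → Fin N → Bool) (R : Fin N → Fin N → Bool)
      (R⊆X : ∀ z x → R z x ≡ true → X x ≡ true)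
      (bigZ : N₀ ≤ # Z) (bigX : N₀ ≤ # X) (bigY : N₀ ≤ # Y)
      (dense : # Z * # X ≤ g * sum (λ z → ⟦ Z z ⟧ * # (R z)))
      (few : 2 * g * (8 * g * K) * closePairs Z Y F R e ≤ # Z * (# X * # X)) where

      0<K : 0 < K
      0<K = ≤-<-trans z≤n φ<K
      -- A pair (z, x) is heavy if more than |X| / k′ rows are close to x. With k = 2g k′, the bound
      -- on the close pairs allows at most |Z| |X| / 2g heavy pairs, half of what R guarantees, so
      -- the light ones still have density 1 / 2g.
      k′ = 8 * g * K
      k = 2 * g * k′
      q₁ = 2 * (2 * g) * ((8 * g) ^ K * suc a ^ s)
      V = Fin N
      module Z-slice (z : V) = Rows X Y (F z) (R z) a e g K s 2e 0<K
      R′ : V → V → Bool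
      R′ z = Z-slice.R′ z
      R′⊆X : ∀ z x → R′ z x ≡ true → X x ≡ true
      R′⊆X z x t = R⊆X z x (proj₁ (∧-elim t))
      0<X : 0 < # X
      0<X = ≤-trans 1≤N₀ bigX
      light-dense : # Z * # X ≤ 2 * g * sum (λ z → ⟦ Z z ⟧ * # (R′ z))
      light-dense = *-cancelˡ-≤ (# X) {{>-nonZero 0<X}} (+-cancelʳ-≤ (# X * (# Z * # X)) _ _ (begin
        # X * (# Z * # X) + # X * (# Z * # X)       ≡⟨ l₁ (# X * (# Z * # X)) ⟩
        2 * (# X * (# Z * # X))                     ≤⟨ *-monoʳ-≤ 2 (*-monoʳ-≤ (# X) dense) ⟩
        2 * (# X * (g * tot₁))                         ≡⟨ l₂ (# X) g tot₁ ⟩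
        2 * g * (# X * tot₁)                           ≤⟨ *-monoʳ-≤ (2 * g) split ⟩
        2 * g * (# X * tot₁′ + k′ * C)                 ≡⟨ *-distribˡ-+ (2 * g) (# X * tot₁′) (k′ * C) ⟩
        2 * g * (# X * tot₁′) + 2 * g * (k′ * C)       ≡⟨ cong₂ _+_ (l₃ g (# X) tot₁′) (sym (*-assoc (2 * g) k′ C)) ⟩
        # X * (2 * g * tot₁′) + k * C                  ≤⟨ +-monoʳ-≤ (# X * (2 * g * tot₁′)) few ⟩
        # X * (2 * g * tot₁′) + # Z * (# X * # X)      ≡⟨ cong (# X * (2 * g * tot₁′) +_) (l₄ (# Z) (# X)) ⟩
        # X * (2 * g * tot₁′) + # X * (# Z * # X)      ∎))
        where
        open ≤-Reasoning
        tot₁ = sum (λ z → ⟦ Z z ⟧ * # (R z))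
        tot₁′ = sum (λ z → ⟦ Z z ⟧ * # (R′ z))
        C = closePairs Z Y F R e
        l₁ : ∀ a → a + a ≡ 2 * a
        l₁ = solve-∀
        l₂ : ∀ a b c → 2 * (a * (b * c)) ≡ 2 * b * (a * c)
        l₂ = solve-∀
        l₃ : ∀ a b c → 2 * a * (b * c) ≡ b * (2 * a * c)
        l₃ = solve-∀
        l₄ : ∀ a b → a * (b * b) ≡ b * (a * b)
        l₄ = solve-∀
        pt₁ : ∀ z x → # X * ⟦ R z x ⟧ ≤ # X * ⟦ R′ z x ⟧ + k′ * (⟦ R z x ⟧ * Z-slice.ball z x)
        pt₁ z x with R z x | k′ * Z-slice.ball z x ≤ᵇ # X in eq
        ... | false | _ = ≤-trans (≤-reflexive (*-zeroʳ (# X))) z≤n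
        ... | true | true = m≤m+n _ _
        ... | true | false = ≤-trans (≤-reflexive (*-identityʳ (# X)))
          (≤-trans (<⇒≤ (≰ᵇ⇒> eq)) (≤-trans (≤-reflexive (cong (k′ *_) (sym (*-identityˡ _)))) (m≤n+m _ _)))
        pt₂ : ∀ z → # X * # (R z) ≤ # X * # (R′ z) + k′ * sum (λ x → ⟦ R z x ⟧ * Z-slice.ball z x)
        pt₂ z = begin
          # X * # (R z)                                                ≡⟨ sym (sum-*ˡ (# X) (λ x → ⟦ R z x ⟧)) ⟩
          sum (λ x → # X * ⟦ R z x ⟧)                                  ≤⟨ sum-mono (pt₁ z) ⟩
          sum (λ x → # X * ⟦ R′ z x ⟧ + k′ * (⟦ R z x ⟧ * Z-slice.ball z x))
            ≡⟨ sum-+ (λ x → # X * ⟦ R′ z x ⟧) (λ x → k′ * (⟦ R z x ⟧ * Z-slice.ball z x)) ⟩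
          sum (λ x → # X * ⟦ R′ z x ⟧) + sum (λ x → k′ * (⟦ R z x ⟧ * Z-slice.ball z x))
            ≡⟨ cong₂ _+_ (sum-*ˡ (# X) (λ x → ⟦ R′ z x ⟧)) (sum-*ˡ k′ (λ x → ⟦ R z x ⟧ * Z-slice.ball z x)) ⟩
          # X * # (R′ z) + k′ * sum (λ x → ⟦ R z x ⟧ * Z-slice.ball z x) ∎
        l₅ : ∀ a b c → a * (b * c) ≡ b * (a * c)
        l₅ = solve-∀
        l₆ : ∀ a b c d e → a * (b * c + d * e) ≡ b * (a * c) + d * (a * e)
        l₆ = solve-∀
        S : V → ℕ
        S z = sum (λ x → ⟦ R z x ⟧ * Z-slice.ball z x)
        split : # X * tot₁ ≤ # X * tot₁′ + k′ * C
        split = begin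
          # X * tot₁                                        ≡⟨ sym (sum-*ˡ (# X) (λ z → ⟦ Z z ⟧ * # (R z))) ⟩
          sum (λ z → # X * (⟦ Z z ⟧ * # (R z)))          ≡⟨ sum-cong (λ z → l₅ (# X) ⟦ Z z ⟧ (# (R z))) ⟩
          sum (λ z → ⟦ Z z ⟧ * (# X * # (R z)))          ≤⟨ sum-mono (λ z → *-monoʳ-≤ ⟦ Z z ⟧ (pt₂ z)) ⟩
          sum (λ z → ⟦ Z z ⟧ * (# X * # (R′ z) + k′ * S z))
            ≡⟨ sum-cong (λ z → l₆ ⟦ Z z ⟧ (# X) (# (R′ z)) k′ (S z)) ⟩
          sum (λ z → # X * (⟦ Z z ⟧ * # (R′ z)) + k′ * (⟦ Z z ⟧ * S z))
            ≡⟨ sum-+ (λ z → # X * (⟦ Z z ⟧ * # (R′ z))) (λ z → k′ * (⟦ Z z ⟧ * S z)) ⟩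
          sum (λ z → # X * (⟦ Z z ⟧ * # (R′ z))) + sum (λ z → k′ * (⟦ Z z ⟧ * S z))
            ≡⟨ cong₂ _+_ (sum-*ˡ (# X) (λ z → ⟦ Z z ⟧ * # (R′ z))) (sum-*ˡ k′ (λ z → ⟦ Z z ⟧ * S z)) ⟩
          # X * tot₁′ + k′ * C                              ∎
      good : V → Bool
      good z = # X ≤ᵇ 2 * (2 * g) * # (R′ z)
      many : # Z ≤ 2 * (2 * g) * # (λ z → Z z ∧ good z)
      many = reverse-markov (2 * g) (# X) Z (λ z → # (R′ z)) (λ z → sum-mono (λ x → ⟦⟧-mono (R′⊆X z x))) 0<X
        (≤-trans (≤-reflexive (*-comm (# X) (# Z))) light-dense)
      dom : ∀ K′ → Vec (V → Bool) (K′ + s)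
      dom zero = replicate s Y
      dom (suc K′) = X ∷ dom K′
      dom≡ : ∀ z K′ → Z-slice.dom z K′ ≡ dom K′
      dom≡ z zero = refl
      dom≡ z (suc K′) = cong (X ∷_) (dom≡ z K′)
      Ds : Vec (V → Bool) (suc (K + s))
      Ds = Z ∷ dom K
      Q : Vec V (suc (K + s)) → Bool
      Q (z ∷ v) = good z ∧ Z-slice.rows z K [] [] v
      Q-dense : size Ds ≤ q₁ * cnt Ds Q
      Q-dense = extend-count Z good (dom K) Q (2 * (2 * g)) ((8 * g) ^ K * suc a ^ s) many each
        where
        each : ∀ z → good z ≡ true →
          size (dom K) ≤ (8 * g) ^ K * suc a ^ s * cnt (dom K) (λ v → good z ∧ Z-slice.rows z K [] [] v)
        each z gz rewrite gz = subst
          (λ D → size D ≤ (8 * g) ^ K * suc a ^ s * cnt D (Z-slice.rows z K [] []))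
          (dom≡ z K)
          (Z-slice.rows-count z (R⊆X z) (≤ᵇ⇒≤ _ _ (≡⇒T gz)) K [] [] (λ ()) (λ ()) ≤-refl z≤n sep)
      test : Fin (K * s) → Vec V (suc (K + s)) → Bool
      test t (z ∷ v) = F z (lookup v (proj₁ (remQuot {K} s t) ↑ˡ s)) (lookup v (K ↑ʳ proj₂ (remQuot {K} s t)))
      pg = pigeonhole Ds (K * s) test Q q₁ Q-dense
      μ : Fin K → Fin s → Bool
      μ i j = proj₁ pg (combine i j)
      Q′ = proj₁ (proj₂ pg)
      Q′-dense : size Ds ≤ q₁ * 2 ^ (K * s) * cnt Ds Q′
      Q′-dense = proj₁ (proj₂ (proj₂ pg))
      bigDs : All (λ D → N₀ ≤ # D) Ds
      bigDs = bigZ ∷ bigDom K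
        where
        bigY′ : ∀ s → All (λ D → N₀ ≤ # D) (replicate s Y)
        bigY′ zero = []
        bigY′ (suc s) = bigY ∷ bigY′ s
        bigDom : ∀ K′ → All (λ D → N₀ ≤ # D) (dom K′)
        bigDom zero = bigY′ s
        bigDom (suc K′) = bigX ∷ bigDom K′
      entries : ∀ z v → Q′ (z ∷ v) ≡ true → ∀ i j → F z (lookup v (i ↑ˡ s)) (lookup v (K ↑ʳ j)) ≡ μ i j
      entries z v t i j = subst
        (λ p → F z (lookup v (proj₁ p ↑ˡ s)) (lookup v (K ↑ʳ proj₂ p)) ≡ μ i j)
        (Finₚ.remQuot-combine i j) (proj₂ (proj₂ (proj₂ (proj₂ pg)) (z ∷ v) t) (combine i j))
      extract : BlowUp Ds Q′ m → HalfGraph Z X Y F h m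
      extract (C ∷ S , inDs , injs , allQ) = record
        { a = λ i → lookup S (ι i ↑ˡ s)
        ; b = λ j → lookup S (K ↑ʳ ȷ j)
        ; c = C
        ; a∈ = λ i t → trans (sym (cong-app (lookup-rows K (ι i)) (lookup S (ι i ↑ˡ s) t))) (inDs (suc (ι i ↑ˡ s)) t)
        ; b∈ = λ j t → trans (sym (cong-app (lookup-cols K (ȷ j)) (lookup S (K ↑ʳ ȷ j) t))) (inDs (suc (K ↑ʳ ȷ j)) t)
        ; c∈ = inDs zero
        ; a-inj = λ i → injs (suc (ι i ↑ˡ s))
        ; b-inj = λ j → injs (suc (K ↑ʳ ȷ j))
        ; c-inj = injs zero
        ; edges = edges
        }
        where
        lookup-rows : ∀ K′ (i : Fin K′) → lookup (dom K′) (i ↑ˡ s) ≡ X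
        lookup-rows (suc K′) zero = refl
        lookup-rows (suc K′) (suc i) = lookup-rows K′ i
        lookup-cols : ∀ K′ (j : Fin s) → lookup (dom K′) (K′ ↑ʳ j) ≡ Y
        lookup-cols zero j = Vecₚ.lookup-replicate j Y
        lookup-cols (suc K′) j = lookup-cols K′ j
        o : Fin m
        o = Fin.fromℕ< 1≤m
        transversal : Vec V (K + s)
        transversal = zipWith _$_ S (replicate (K + s) o)
        -- One transversal suffices: its columns separate its rows, and its pattern is μ, so the
        -- rows of μ are distinct.
        separated : ∀ i i′ → (∀ j → μ i j ≡ μ i′ j) → i ≡ i′
        separated i i′ same = decidable-stable (i Finₚ.≟ i′) λ ne →
          let qo = allQ (o ∷ replicate (K + s) o)
              rw = proj₂ (∧-elim {good (C o)} (proj₁ (proj₂ (proj₂ (proj₂ pg)) (C o ∷ transversal) qo)))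
              (j , dif) = proj₂ (proj₂ (Z-slice.rows-resolve (C o) K [] [] transversal rw)) i i′ ne
          in dif (trans (entries (C o) transversal qo i j) (trans (same j) (sym (entries (C o) transversal qo i′ j))))
        hg = half-graph h μ separated φ<K
        ι = proj₁ hg
        ȷ = proj₁ (proj₂ hg)
        edges : ∀ i j t u w → F (C w) (lookup S (ι i ↑ˡ s) t) (lookup S (K ↑ʳ ȷ j) u) ≡ half i j
        edges i j t u w = begin
          F (C w) (lookup S pa t) (lookup S pb u)
            ≡⟨ cong₂ (F (C w)) (sym (value pa t at-a)) (sym (value pb u at-b)) ⟩
          F (C w) (lookup v pa) (lookup v pb)
            ≡⟨ entries (C w) v (allQ (w ∷ choice)) (ι i) (ȷ j) ⟩
          μ (ι i) (ȷ j)
            ≡⟨ proj₂ (proj₂ hg) i j ⟩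
          half i j ∎
          where
          open ≡-Reasoning
          pa pb : Fin (K + s)
          pa = ι i ↑ˡ s
          pb = K ↑ʳ ȷ j
          -- Copy t in the coordinate of aᵢ and copy u in all others, among them that of bⱼ. Thus
          -- any two copies occur together in some transversal, and every transversal has the
          -- pattern μ.
          choose : Fin (K + s) → Fin m
          choose p = if does (p Finₚ.≟ pa) then t else u
          choice = tabulate choose
          v : Vec V (K + s)
          v = zipWith _$_ S choice
          at-a : choose pa ≡ t
          at-a = cong (if_then t else u) (dec-true (pa Finₚ.≟ pa) refl)
          pb≢pa : pb ≢ pa
          pb≢pa = ↑ʳ≢↑ˡ K (ι i) (ȷ j)
          at-b : choose pb ≡ u
          at-b = cong (if_then t else u) (dec-false (pb Finₚ.≟ pa) pb≢pa)
          value : ∀ p r → choose p ≡ r → lookup v p ≡ lookup S p r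
          value p r eq = trans (Vecₚ.lookup-zipWith _$_ p S choice)
            (cong (lookup S p) (trans (Vecₚ.lookup∘tabulate choose p) eq))

      conclusion : HalfGraph Z X Y F h m
      conclusion = extract (blow-up Ds Q′ bigDs Q′-dense)

  -- Without a half graph, a fixed fraction of the pairs x, x′, on average over z, have nearly equal
  -- neighbourhoods in Y. The relation R is arbitrary of density 1 / g, because later applications
  -- use relations produced by earlier ones; k and N₀ depend on R through g alone.
  cluster : ∀ h m g e → 1 ≤ e → 1 ≤ m → Σ[ k ∈ ℕ ] Σ[ N₀ ∈ ℕ ] 1 ≤ N₀ ×
    (∀ {N} (Z X Y : Fin N → Bool) (F : Fin N → Fin N → Fin N → Bool) (R : Fin N → Fin N → Bool) →
      (∀ z x → R z x ≡ true → X x ≡ true) → N₀ ≤ # Z → N₀ ≤ # X → N₀ ≤ # Y →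
      # Z * # X ≤ g * sum (λ z → ⟦ Z z ⟧ * # (R z)) →
      # Z * (# X * # X) ≤ k * closePairs Z Y F R e ⊎ HalfGraph Z X Y F h m)
  -- With the distance parameter written as a successor, its double reduces to the successor of a,
  -- so the equation `2e` holds by `refl`.
  cluster h m g (suc e) 1≤e 1≤m = pack (rows-and-columns h (e + suc (e + 0)) (≤-trans (s≤s z≤n) (m≤n+m _ e)))
    where
    Result : Set
    Result = Σ[ k ∈ ℕ ] Σ[ N₀ ∈ ℕ ] 1 ≤ N₀ ×
      (∀ {N} (Z X Y : Fin N → Bool) (F : Fin N → Fin N → Fin N → Bool) (R : Fin N → Fin N → Bool) →
        (∀ z x → R z x ≡ true → X x ≡ true) → N₀ ≤ # Z → N₀ ≤ # X → N₀ ≤ # Y →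
        # Z * # X ≤ g * sum (λ z → ⟦ Z z ⟧ * # (R z)) →
        # Z * (# X * # X) ≤ k * closePairs Z Y F R (suc e) ⊎ HalfGraph Z X Y F h m)
    pack : ∃[ K ] ∃[ s ] φ s h < K × K * K * (e + suc (e + 0)) ^ s < suc (e + suc (e + 0)) ^ s → Result
    pack (K , s , φ<K , sep) =
      pack′ (erdős (suc (K + s)) m (2 * (2 * g) * ((8 * g) ^ K * suc (e + suc (e + 0)) ^ s) * 2 ^ (K * s)))
      where
      pack′ : _ → Result
      pack′ (N₀ , 1≤N₀ , blow-up) = 2 * g * (8 * g * K) , N₀ , 1≤N₀ , λ Z X Y F R R⊆X bigZ bigX bigY dense →
        [ inj₁ , (λ few → inj₂ (Cluster.conclusion h m g (e + suc (e + 0)) (suc e) K s N₀ refl 1≤m φ<K sep 1≤N₀ blow-up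
                    Z X Y F R R⊆X bigZ bigX bigY dense few)) ]′
        (≤-total (# Z * (# X * # X)) (2 * g * (8 * g * K) * closePairs Z Y F R (suc e)))

-- Sizes of classes and cuts of a half graph.

module Partitions where
  open Counting
  open RowsAndColumns using (⟦⟧-mono; ∧-intro; not-true)
  open import Data.Bool.Base using (Bool; true; false; _∧_; not)
  open import Data.Fin.Base using (Fin; zero; suc)
  open import Data.Nat.Base
  open import Data.Nat.Properties
  open import Data.Nat.Tactic.RingSolver using (solve-∀)
  open import Function.Base using (_∘_)

  private
    variable
      n : ℕ

  does⇒ : ∀ {P : Set} (d : Dec P) → does d ≡ true → P
  does⇒ (yes p) _ = p

  #-cong : {P Q : Fin n → Bool} → (∀ x → P x ≡ Q x) → # P ≡ # Q
  #-cong h = sum-cong (λ x → cong ⟦_⟧ (h x))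

  #-mono : {P Q : Fin n → Bool} → (∀ x → P x ≡ true → Q x ≡ true) → # P ≤ # Q
  #-mono h = sum-mono (λ x → ⟦⟧-mono (h x))

  #≤n : (P : Fin n → Bool) → # P ≤ n
  #≤n {zero} P = z≤n
  #≤n {suc n} P = +-mono-≤ (⟦⟧≤1 (P zero)) (#≤n (P ∘ suc))

  sum-const : ∀ n c → sum {n} (λ _ → c) ≡ n * c
  sum-const zero c = refl
  sum-const (suc n) c = cong (c +_) (sum-const n c)

  sum-indicator : (y : Fin n) → sum (λ x → ⟦ does (y Finₚ.≟ x) ⟧) ≡ 1
  sum-indicator {suc n} zero = cong suc (sum-0 n)
  sum-indicator {suc n} (suc y) = sum-indicator y

  cls : ∀ {t} → (Fin n → Fin t) → Fin t → Fin n → Bool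
  cls part i x = does (part x Finₚ.≟ i)

  #-partition : ∀ {t} (part : Fin n → Fin t) (P : Fin n → Bool) →
    # P ≡ sum (λ i → # (λ x → cls part i x ∧ P x))
  #-partition part P = begin
    # P                                                 ≡⟨ sum-cong (λ x → sym (*-identityˡ ⟦ P x ⟧)) ⟩
    sum (λ x → 1 * ⟦ P x ⟧)                             ≡⟨ sum-cong (λ x → cong (_* ⟦ P x ⟧) (sym (sum-indicator (part x)))) ⟩
    sum (λ x → sum (λ i → ⟦ cls part i x ⟧) * ⟦ P x ⟧)  ≡⟨ sum-cong (λ x → sym (sum-*ʳ ⟦ P x ⟧ (λ i → ⟦ cls part i x ⟧))) ⟩
    sum (λ x → sum (λ i → ⟦ cls part i x ⟧ * ⟦ P x ⟧))  ≡⟨ sum-swap (λ x i → ⟦ cls part i x ⟧ * ⟦ P x ⟧) ⟩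
    sum (λ i → sum (λ x → ⟦ cls part i x ⟧ * ⟦ P x ⟧))  ≡⟨ sum-cong (λ i → sum-cong (λ x → sym (⟦∧⟧ (cls part i x) (P x)))) ⟩
    sum (λ i → # (λ x → cls part i x ∧ P x))            ∎
    where open ≡-Reasoning

  #-true : ∀ n → # {n} (λ _ → true) ≡ n
  #-true n = trans (sum-const n 1) (*-identityʳ n)

  #-classes : ∀ {t} (part : Fin n → Fin t) → sum (λ i → # (cls part i)) ≡ n
  #-classes {n} part = trans (sum-cong (λ i → #-cong (λ x → ∧-true (cls part i x))))
    (trans (sym (#-partition part (λ _ → true))) (#-true n))
    where
    ∧-true : ∀ b → b ≡ b ∧ true
    ∧-true true = refl
    ∧-true false = refl

  Equi : ∀ {t} → (Fin n → Fin t) → Set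
  Equi part = ∀ i j → # (cls part i) ≤ # (cls part j) + 1

  class-upper : ∀ {t} (part : Fin n → Fin t) → Equi part → ∀ i → t * # (cls part i) ≤ n + t
  class-upper {n} {t} part eq i = begin
    t * # (cls part i)                            ≡⟨ sym (sum-const t _) ⟩
    sum {t} (λ _ → # (cls part i))                ≤⟨ sum-mono (eq i) ⟩
    sum (λ j → # (cls part j) + 1)                ≡⟨ sum-+ (λ j → # (cls part j)) (λ _ → 1) ⟩
    sum (λ j → # (cls part j)) + sum {t} (λ _ → 1) ≡⟨ cong₂ _+_ (#-classes part) (trans (sum-const t 1) (*-identityʳ t)) ⟩
    n + t                                         ∎
    where open ≤-Reasoning

  class-lower : ∀ {t} (part : Fin n → Fin t) → Equi part → ∀ i → n ≤ t * # (cls part i) + t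
  class-lower {n} {t} part eq i = begin
    n                                             ≡⟨ sym (#-classes part) ⟩
    sum (λ j → # (cls part j))                    ≤⟨ sum-mono (λ j → eq j i) ⟩
    sum {t} (λ _ → # (cls part i) + 1)            ≡⟨ sum-const t _ ⟩
    t * (# (cls part i) + 1)                      ≡⟨ l t (# (cls part i)) ⟩
    t * # (cls part i) + t                        ∎
    where
    open ≤-Reasoning
    l : ∀ a b → a * (b + 1) ≡ a * b + a
    l = solve-∀

  -- A is one side of a half graph, with its vertices in the order of pos.
  module Cuts (A : Fin n → Bool) (pos : Fin n → ℕ) (q m : ℕ) where

    lo hi : (Fin n → Bool) → ℕ → Fin n → Bool
    lo S p v = S v ∧ (A v ∧ (pos v <ᵇ p))
    hi S p v = S v ∧ (A v ∧ not (pos v <ᵇ p))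

    few-lo few-hi : (Fin n → Bool) → ℕ → Bool
    few-lo S p = q * # (lo S p) ≤ᵇ # S
    few-hi S p = q * # (hi S p) ≤ᵇ # S

    module _ (layer : ∀ p → # (λ v → A v ∧ (pos v ≡ᵇ p)) ≤ m) (S : Fin n → Bool) where

      <suc : ∀ a p → ⟦ a <ᵇ suc p ⟧ ≤ ⟦ a <ᵇ p ⟧ + ⟦ a ≡ᵇ p ⟧
      <suc zero zero = ≤-refl
      <suc zero (suc p) = ≤-refl
      <suc (suc a) zero = z≤n
      <suc (suc a) (suc p) = <suc a p

      -- Let p′ be the last position below p with `few-lo S p′`. The vertices counted have positions
      -- up to p′, so they lie before p′, where there are at most |S| / q of them, or in layer p′,
      -- of size at most m.
      few-lo-count : ∀ p → q * # (λ v → lo S p v ∧ few-lo S (pos v)) ≤ # S + q * m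
      few-lo-count zero = ≤-trans (≤-reflexive (trans (cong (q *_) empty) (*-zeroʳ q))) z≤n
        where
        none : ∀ a b c → ⟦ (a ∧ (b ∧ false)) ∧ c ⟧ ≡ 0
        none false b c = refl
        none true false c = refl
        none true true c = refl
        empty : # (λ v → lo S zero v ∧ few-lo S (pos v)) ≡ 0
        empty = trans (sum-cong (λ v → none (S v) (A v) (few-lo S (pos v)))) (sum-0 n)
      few-lo-count (suc p) = by-cases (few-lo S p) refl
        where
        open ≤-Reasoning
        by-cases : ∀ b → few-lo S p ≡ b → q * # (λ v → lo S (suc p) v ∧ few-lo S (pos v)) ≤ # S + q * m
        by-cases true e = begin
          q * # (λ v → lo S (suc p) v ∧ few-lo S (pos v))  ≤⟨ *-monoʳ-≤ q (sum-mono (λ v → pt (S v) (A v) (few-lo S (pos v)) (<suc (pos v) p))) ⟩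
          q * sum (λ v → ⟦ lo S p v ⟧ + ⟦ A v ∧ (pos v ≡ᵇ p) ⟧)
            ≡⟨ cong (q *_) (sum-+ (λ v → ⟦ lo S p v ⟧) (λ v → ⟦ A v ∧ (pos v ≡ᵇ p) ⟧)) ⟩
          q * (# (lo S p) + # (λ v → A v ∧ (pos v ≡ᵇ p)))  ≤⟨ *-monoʳ-≤ q (+-monoʳ-≤ (# (lo S p)) (layer p)) ⟩
          q * (# (lo S p) + m)                             ≡⟨ *-distribˡ-+ q (# (lo S p)) m ⟩
          q * # (lo S p) + q * m                           ≤⟨ +-monoˡ-≤ (q * m) (≤ᵇ⇒≤ _ (# S) (≡⇒T e)) ⟩
          # S + q * m                                      ∎
          where
          pt : ∀ s a f {l l′ k} → ⟦ l ⟧ ≤ ⟦ l′ ⟧ + ⟦ k ⟧ → ⟦ (s ∧ (a ∧ l)) ∧ f ⟧ ≤ ⟦ s ∧ (a ∧ l′) ⟧ + ⟦ a ∧ k ⟧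
          pt false a f _ = z≤n
          pt true false f _ = z≤n
          pt true true true {true} h = h
          pt true true true {false} h = z≤n
          pt true true false {true} h = z≤n
          pt true true false {false} h = z≤n
        by-cases false e = ≤-trans (*-monoʳ-≤ q (#-mono λ v t → pt v (<suc (pos v) p) t)) (few-lo-count p)
          where
          pt : ∀ v → ⟦ pos v <ᵇ suc p ⟧ ≤ ⟦ pos v <ᵇ p ⟧ + ⟦ pos v ≡ᵇ p ⟧ →
            lo S (suc p) v ∧ few-lo S (pos v) ≡ true → lo S p v ∧ few-lo S (pos v) ≡ true
          pt v le t = ∧-intro (∧-intro (proj₁ t₂) (∧-intro (proj₁ t₃) (below (pos v <ᵇ p) (pos v ≡ᵇ p) refl refl))) (proj₂ t₁)
            where
            t₁ = ∧-elim {lo S (suc p) v} t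
            t₂ = ∧-elim {S v} (proj₁ t₁)
            t₃ = ∧-elim {A v} (proj₂ t₂)
            below : ∀ b c → (pos v <ᵇ p) ≡ b → (pos v ≡ᵇ p) ≡ c → b ≡ true
            below true c _ _ = refl
            below false true _ e′ = ⊥-elim (true≢false
              (subst (λ p → few-lo S p ≡ true) (≡ᵇ⇒≡ (pos v) p (≡⇒T e′)) (proj₂ t₁)) e)
            below false false e₁ e₂ = ⊥-elim (n≮0 (≤-trans (≤-reflexive (cong ⟦_⟧ (sym (proj₂ t₃))))
              (≤-trans le (≤-reflexive (cong₂ (λ a b → ⟦ a ⟧ + ⟦ b ⟧) e₁ e₂)))))

      -- The mirror image, by downward induction on p from h. No term q * m arises, because the
      -- final segment at p contains layer p itself.
      few-hi-count : ∀ h k → (∀ v → pos v < h) → ∀ p → p + k ≡ h →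
        q * # (λ v → hi S p v ∧ few-hi S (pos v)) ≤ # S
      few-hi-count h zero pos<h p eq = ≤-trans (≤-reflexive (trans (cong (q *_) empty) (*-zeroʳ q))) z≤n
        where
        none : ∀ a b c → ⟦ (a ∧ (b ∧ false)) ∧ c ⟧ ≡ 0
        none false b c = refl
        none true false c = refl
        none true true c = refl
        empty : # (λ v → hi S p v ∧ few-hi S (pos v)) ≡ 0
        empty = trans (sum-cong (λ v → trans
          (cong (λ b → ⟦ (S v ∧ (A v ∧ not b)) ∧ few-hi S (pos v) ⟧)
            (T⇒≡ (<⇒<ᵇ (<-≤-trans (pos<h v) (≤-reflexive (trans (sym eq) (+-identityʳ p)))))))
          (none (S v) (A v) (few-hi S (pos v))))) (sum-0 n)
      few-hi-count h (suc k) pos<h p eq = by-cases (few-hi S p) refl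
        where
        by-cases : ∀ b → few-hi S p ≡ b → q * # (λ v → hi S p v ∧ few-hi S (pos v)) ≤ # S
        by-cases true e = ≤-trans (*-monoʳ-≤ q (#-mono λ v t → proj₁ (∧-elim {hi S p v} t))) (≤ᵇ⇒≤ _ (# S) (≡⇒T e))
        by-cases false e = ≤-trans (*-monoʳ-≤ q (#-mono pt))
          (few-hi-count h k pos<h (suc p) (trans (sym (+-suc p k)) eq))
          where
          pt : ∀ v → hi S p v ∧ few-hi S (pos v) ≡ true → hi S (suc p) v ∧ few-hi S (pos v) ≡ true
          pt v t = ∧-intro (∧-intro (proj₁ t₂) (∧-intro (proj₁ t₃) (above (pos v <ᵇ suc p) refl))) (proj₂ t₁)
            where
            t₁ = ∧-elim {hi S p v} t
            t₂ = ∧-elim {S v} (proj₁ t₁)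
            t₃ = ∧-elim {A v} (proj₂ t₂)
            above : ∀ b → (pos v <ᵇ suc p) ≡ b → not b ≡ true
            above false _ = refl
            above true e′ = ⊥-elim (true≢false (subst (λ p → few-hi S p ≡ true) pos≡p (proj₂ t₁)) e)
              where
              pos≡p : pos v ≡ p
              pos≡p = ≤-antisym (s≤s⁻¹ (<ᵇ⇒< (pos v) (suc p) (≡⇒T e′)))
                (≮⇒≥ (λ lt → true≢false (T⇒≡ (<⇒<ᵇ lt)) (not-true (proj₂ t₃))))

      few-count : ∀ h → (∀ v → pos v < h) →
        q * # (λ v → S v ∧ (A v ∧ not (not (few-lo S (pos v)) ∧ not (few-hi S (pos v))))) ≤ 2 * # S + q * m
      few-count h pos<h = begin
        q * # (λ v → S v ∧ (A v ∧ not (not (few-lo S (pos v)) ∧ not (few-hi S (pos v)))))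
          ≤⟨ *-monoʳ-≤ q (sum-mono λ v → pt (S v) (A v) (few-lo S (pos v)) (few-hi S (pos v)) (T⇒≡ (<⇒<ᵇ (pos<h v)))) ⟩
        q * sum (λ v → ⟦ lo S h v ∧ few-lo S (pos v) ⟧ + ⟦ hi S 0 v ∧ few-hi S (pos v) ⟧)
          ≡⟨ cong (q *_) (sum-+ (λ v → ⟦ lo S h v ∧ few-lo S (pos v) ⟧) (λ v → ⟦ hi S 0 v ∧ few-hi S (pos v) ⟧)) ⟩
        q * (# (λ v → lo S h v ∧ few-lo S (pos v)) + # (λ v → hi S 0 v ∧ few-hi S (pos v)))
          ≡⟨ *-distribˡ-+ q (# (λ v → lo S h v ∧ few-lo S (pos v))) _ ⟩
        q * # (λ v → lo S h v ∧ few-lo S (pos v)) + q * # (λ v → hi S 0 v ∧ few-hi S (pos v))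
          ≤⟨ +-mono-≤ (few-lo-count h) (few-hi-count h h pos<h 0 refl) ⟩
        # S + q * m + # S
          ≡⟨ l (# S) (q * m) ⟩
        2 * # S + q * m ∎
        where
        open ≤-Reasoning
        l : ∀ a b → a + b + a ≡ 2 * a + b
        l = solve-∀
        pt : ∀ s a l h {b} → b ≡ true →
          ⟦ s ∧ (a ∧ not (not l ∧ not h)) ⟧ ≤ ⟦ (s ∧ (a ∧ b)) ∧ l ⟧ + ⟦ (s ∧ (a ∧ true)) ∧ h ⟧
        pt false a l h refl = z≤n
        pt true false l h refl = z≤n
        pt true true false false refl = z≤n
        pt true true false true refl = ≤-refl
        pt true true true h refl = s≤s z≤n

-- Blow-ups of long half graphs have no regular equipartition.

module HalfGraphPartitions where
  open Counting
  open ErdősTheorem using (term≤sum; weight-positive)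
  open RowsAndColumns using (≰ᵇ⇒>; ∧-intro; not-true)
  open Partitions
  open import Data.Bool.Base using (Bool; true; false; T; _∧_; not)
  open import Data.Fin.Base as Fin using (Fin; zero; suc; toℕ)
  open import Data.Nat.Base
  open import Data.Nat.Properties
  open import Data.Nat.Tactic.RingSolver using (solve-∀)

  private
    variable
      n : ℕ

  _⊆ᵇ_ : (P Q : Fin n → Bool) → Set
  P ⊆ᵇ Q = ∀ x → P x ≡ true → Q x ≡ true

  -- Both boxes have more than a fraction 1 / 48³ of the volume of the same triple of parts, so no
  -- density fits both up to a small error. They share the side in C, which carries no order that
  -- could be cut.
  record Irregular {n t : ℕ} (F : Fin n → Fin n → Fin n → Bool) (part : Fin n → Fin t) : Set where
    field
      i j k : Fin t
      i≢j : i ≢ j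
      i≢k : i ≢ k
      j≢k : j ≢ k
      U U′ V V′ W : Fin n → Bool
      U⊆ : U ⊆ᵇ cls part i
      U′⊆ : U′ ⊆ᵇ cls part i
      V⊆ : V ⊆ᵇ cls part j
      V′⊆ : V′ ⊆ᵇ cls part j
      W⊆ : W ⊆ᵇ cls part k
      bigU : # (cls part i) < 48 * # U
      bigU′ : # (cls part i) < 48 * # U′
      bigV : # (cls part j) < 48 * # V
      bigV′ : # (cls part j) < 48 * # V′
      bigW : # (cls part k) < 48 * # W
      full : ∀ x y z → U x ≡ true → V y ≡ true → W z ≡ true → F x y z ≡ true
      empty : ∀ x y z → U′ x ≡ true → V′ y ≡ true → W z ≡ true → F x y z ≡ false

  -- A part is split at p in A if both {pos < p} and {pos ≥ p} within A take up more than
  -- 1/48 of it.  As h is large compared with T, for most p some part other than a given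
  -- one is split at p in A, and some such part in B.  If these are different parts, they
  -- have a full and an empty box with a third part in C.  Otherwise the common part is
  -- excluded to find a second threshold p′.
  module HalfGraphPartition {n t : ℕ} (T m : ℕ) (1≤m : 1 ≤ m) (48≤t : 48 ≤ t) (t≤T : t ≤ T)
    (part : Fin n → Fin t) (equi : Equi part)
    (h : ℕ) (h≡ : h ≡ 8 * suc T) (n≡ : n ≡ 3 * (h * m))
    (A B C : Fin n → Bool) (pos : Fin n → ℕ) (pos<h : ∀ v → pos v < h)
    (A-layer≤ : ∀ p → # (λ v → A v ∧ (pos v ≡ᵇ p)) ≤ m)
    (B-layer≤ : ∀ p → # (λ v → B v ∧ (pos v ≡ᵇ p)) ≤ m)
    (A-layer≥ : ∀ (p : Fin h) → m ≤ # (λ v → A v ∧ (pos v ≡ᵇ toℕ p)))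
    (B-layer≥ : ∀ (p : Fin h) → m ≤ # (λ v → B v ∧ (pos v ≡ᵇ toℕ p)))
    (C-size : # C ≡ h * m) where

    private
      X : Fin t → Fin n → Bool
      X = cls part

      8≤h : 8 ≤ h
      8≤h = ≤-trans (m≤m*n 8 (suc T)) (≤-reflexive (sym h≡))

      class-small : ∀ k → 48 * # (X k) ≤ n + 48
      class-small k = lem 48 t (# (X k)) n 48≤t (class-upper part equi k)
        where
        lem : ∀ q t x n → q ≤ t → t * x ≤ n + t → q * x ≤ n + q
        lem q t zero n q≤t h = ≤-trans (≤-reflexive (*-zeroʳ q)) z≤n
        lem q t (suc x) n q≤t h = begin
          q * suc x       ≡⟨ *-suc q x ⟩
          q + q * x       ≤⟨ +-monoʳ-≤ q (*-monoˡ-≤ x q≤t) ⟩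
          q + t * x       ≤⟨ +-monoʳ-≤ q (+-cancelˡ-≤ t _ _ (begin
            t + t * x       ≡⟨ sym (*-suc t x) ⟩
            t * suc x       ≤⟨ h ⟩
            n + t           ≡⟨ +-comm n t ⟩
            t + n           ∎)) ⟩
          q + n           ≡⟨ +-comm q n ⟩
          n + q           ∎
          where open ≤-Reasoning

    module Side (S : Fin n → Bool) (layer≤ : ∀ p → # (λ v → S v ∧ (pos v ≡ᵇ p)) ≤ m)
      (layer≥ : ∀ (p : Fin h) → m ≤ # (λ v → S v ∧ (pos v ≡ᵇ toℕ p))) where

      open Cuts S pos 48 m public

      split : Fin t → ℕ → Bool
      split i p = not (few-lo (X i) p) ∧ not (few-hi (X i) p)

      cover : Fin t → ℕ → Fin t → Bool
      cover k p i = not (does (i Finₚ.≟ k)) ∧ split i p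

      bad : Fin t → ℕ → Bool
      bad k p = # (cover k p) <ᵇ 1

      not-bad : ∀ k p → bad k p ≡ false → ∃[ i ] i ≢ k × split i p ≡ true
      not-bad k p e = i , i≢k , proj₂ (∧-elim {not (does (i Finₚ.≟ k))} covered)
        where
        1≤# : 1 ≤ # (cover k p)
        1≤# = ≮⇒≥ (λ lt → true≢false (T⇒≡ (<⇒<ᵇ lt)) e)
        ex = sum-exists-< {f = λ _ → 0} {g = λ i → ⟦ cover k p i ⟧} (≤-<-trans (≤-reflexive (sum-0 t)) 1≤#)
        i = proj₁ ex
        covered : cover k p i ≡ true
        covered = weight-positive (cover k p i) {c = 1} (<-≤-trans (proj₂ ex) (≤-reflexive (sym (*-identityʳ _))))
        i≢k : i ≢ k
        i≢k eq = true≢false (dec-true (i Finₚ.≟ k) eq) (not-true (proj₁ (∧-elim covered)))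

      bad-layers : ∀ k → # {h} (λ p → bad k (toℕ p)) * m ≤ # (λ v → S v ∧ bad k (pos v))
      bad-layers k = begin
        # {h} (λ p → bad k (toℕ p)) * m
          ≡⟨ sym (sum-*ʳ {h} m (λ p → ⟦ bad k (toℕ p) ⟧)) ⟩
        sum {h} (λ p → ⟦ bad k (toℕ p) ⟧ * m)
          ≤⟨ sum-mono (λ p → *-monoʳ-≤ ⟦ bad k (toℕ p) ⟧ (layer≥ p)) ⟩
        sum {h} (λ p → ⟦ bad k (toℕ p) ⟧ * # (λ v → S v ∧ (pos v ≡ᵇ toℕ p)))
          ≡⟨ sum-cong {h} (λ p → sym (sum-*ˡ ⟦ bad k (toℕ p) ⟧ (λ v → ⟦ S v ∧ (pos v ≡ᵇ toℕ p) ⟧))) ⟩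
        sum {h} (λ p → sum (λ v → ⟦ bad k (toℕ p) ⟧ * ⟦ S v ∧ (pos v ≡ᵇ toℕ p) ⟧))
          ≡⟨ sum-swap {h} (λ p v → ⟦ bad k (toℕ p) ⟧ * ⟦ S v ∧ (pos v ≡ᵇ toℕ p) ⟧) ⟩
        sum (λ v → sum {h} (λ p → ⟦ bad k (toℕ p) ⟧ * ⟦ S v ∧ (pos v ≡ᵇ toℕ p) ⟧))
          ≤⟨ sum-mono (λ v → sum-mono (λ p → pt v p (pos v ≡ᵇ toℕ p) refl)) ⟩
        sum (λ v → sum {h} (λ p → ⟦ S v ∧ bad k (pos v) ⟧ * ⟦ pos v ≡ᵇ toℕ p ⟧))
          ≡⟨ sum-cong (λ v → sum-*ˡ {h} ⟦ S v ∧ bad k (pos v) ⟧ (λ p → ⟦ pos v ≡ᵇ toℕ p ⟧)) ⟩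
        sum (λ v → ⟦ S v ∧ bad k (pos v) ⟧ * sum {h} (λ p → ⟦ pos v ≡ᵇ toℕ p ⟧))
          ≤⟨ sum-mono (λ v → ≤-trans (*-monoʳ-≤ ⟦ S v ∧ bad k (pos v) ⟧ (once h (pos v))) (≤-reflexive (*-identityʳ _))) ⟩
        # (λ v → S v ∧ bad k (pos v)) ∎
        where
        open ≤-Reasoning
        once : ∀ h a → sum {h} (λ p → ⟦ a ≡ᵇ toℕ p ⟧) ≤ 1
        once zero a = z≤n
        once (suc h) zero = s≤s (≤-reflexive (sum-0 h))
        once (suc h) (suc a) = once h a
        pt : ∀ v (p : Fin h) b → (pos v ≡ᵇ toℕ p) ≡ b →
          ⟦ bad k (toℕ p) ⟧ * ⟦ S v ∧ b ⟧ ≤ ⟦ S v ∧ bad k (pos v) ⟧ * ⟦ b ⟧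
        pt v p true e = subst (λ a → ⟦ bad k a ⟧ * ⟦ S v ∧ true ⟧ ≤ ⟦ S v ∧ bad k (pos v) ⟧ * 1)
          {pos v} {toℕ p} (≡ᵇ⇒≡ (pos v) (toℕ p) (≡⇒T e)) (≤-reflexive (lem (bad k (pos v)) (S v)))
          where
          lem : ∀ a b → ⟦ a ⟧ * ⟦ b ∧ true ⟧ ≡ ⟦ b ∧ a ⟧ * 1
          lem true true = refl
          lem true false = refl
          lem false true = refl
          lem false false = refl
        pt v p false e = ≤-trans (≤-reflexive (lem (bad k (toℕ p)) (S v))) z≤n
          where
          lem : ∀ a b → ⟦ a ⟧ * ⟦ b ∧ false ⟧ ≡ 0
          lem true true = refl
          lem true false = refl
          lem false true = refl
          lem false false = refl

      -- A part other than k is not split at a bad position, so `few-count` bounds the vertices it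
      -- has at such positions. Part k may be split there and is counted in full.
      bad-vertices : ∀ k → 48 * # (λ v → S v ∧ bad k (pos v)) ≤ 2 * n + t * (48 * m) + 48 * # (X k)
      bad-vertices k = begin
        48 * # (λ v → S v ∧ bad k (pos v))
          ≡⟨ cong (48 *_) (#-partition part (λ v → S v ∧ bad k (pos v))) ⟩
        48 * sum (λ i → # (λ v → X i v ∧ (S v ∧ bad k (pos v))))
          ≡⟨ sym (sum-*ˡ 48 (λ i → # (λ v → X i v ∧ (S v ∧ bad k (pos v))))) ⟩
        sum (λ i → 48 * # (λ v → X i v ∧ (S v ∧ bad k (pos v))))
          ≤⟨ sum-mono (λ i → each i (i Finₚ.≟ k)) ⟩
        sum (λ i → 2 * # (X i) + 48 * m + 48 * (# (X k) * ⟦ does (k Finₚ.≟ i) ⟧))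
          ≡⟨ sum-+ (λ i → 2 * # (X i) + 48 * m) (λ i → 48 * (# (X k) * ⟦ does (k Finₚ.≟ i) ⟧)) ⟩
        sum (λ i → 2 * # (X i) + 48 * m) + sum (λ i → 48 * (# (X k) * ⟦ does (k Finₚ.≟ i) ⟧))
          ≡⟨ cong₂ _+_
               (trans (sum-+ (λ i → 2 * # (X i)) (λ _ → 48 * m))
                 (cong₂ _+_ (trans (sum-*ˡ 2 (λ i → # (X i))) (cong (2 *_) (#-classes part))) (sum-const t (48 * m))))
               (trans (sum-*ˡ 48 (λ i → # (X k) * ⟦ does (k Finₚ.≟ i) ⟧))
                 (cong (48 *_) (trans (sum-*ˡ (# (X k)) (λ i → ⟦ does (k Finₚ.≟ i) ⟧))
                   (trans (cong (# (X k) *_) (sum-indicator k)) (*-identityʳ (# (X k))))))) ⟩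
        2 * n + t * (48 * m) + 48 * # (X k) ∎
        where
        open ≤-Reasoning
        each : ∀ i → Dec (i ≡ k) → 48 * # (λ v → X i v ∧ (S v ∧ bad k (pos v))) ≤
          2 * # (X i) + 48 * m + 48 * (# (X k) * ⟦ does (k Finₚ.≟ i) ⟧)
        each i (yes refl) = ≤-trans (*-monoʳ-≤ 48 (≤-trans
            (#-mono λ v e → proj₁ (∧-elim {X i v} e))
            (≤-reflexive (trans (sym (*-identityʳ (# (X i)))) (cong (λ b → # (X i) * ⟦ b ⟧) (sym (dec-true (i Finₚ.≟ i) refl)))))))
          (m≤n+m (48 * (# (X i) * ⟦ does (i Finₚ.≟ i) ⟧)) (2 * # (X i) + 48 * m))
        each i (no i≢k) = ≤-trans (*-monoʳ-≤ 48 (#-mono pt))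
          (≤-trans (few-count layer≤ (X i) h pos<h) (m≤m+n _ _))
          where
          pt : ∀ v → X i v ∧ (S v ∧ bad k (pos v)) ≡ true →
            X i v ∧ (S v ∧ not (not (few-lo (X i) (pos v)) ∧ not (few-hi (X i) (pos v)))) ≡ true
          pt v e = ∧-intro (proj₁ e₁) (∧-intro (proj₁ e₂) (uncovered (split i (pos v)) refl))
            where
            e₁ = ∧-elim {X i v} e
            e₂ = ∧-elim {S v} (proj₂ e₁)
            uncovered : ∀ b → split i (pos v) ≡ b → not b ≡ true
            uncovered false _ = refl
            uncovered true s = ⊥-elim (<⇒≱ (<ᵇ⇒< (# (cover k (pos v))) 1 (≡⇒T (proj₂ e₂)))
              (≤-trans (≤-reflexive (cong ⟦_⟧ (sym (∧-intro (cong not (dec-false (i Finₚ.≟ k) i≢k)) s))))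
                (term≤sum (λ i → ⟦ cover k (pos v) i ⟧) i)))

      -- As n = 3hm and a part has at most n / 48 + 1 vertices, the three terms are at most 6hm,
      -- 48Tm and 3hm + 48m. With h = 8 (T + 1) they add up to 15hm. So less than a third of the
      -- positions is bad on each side, and some position is good on both.
      few-bad : ∀ k → 48 * (# {h} (λ p → bad k (toℕ p)) * m) ≤ 15 * (h * m)
      few-bad k = begin
        48 * (# {h} (λ p → bad k (toℕ p)) * m)    ≤⟨ *-monoʳ-≤ 48 (bad-layers k) ⟩
        48 * # (λ v → S v ∧ bad k (pos v))        ≤⟨ bad-vertices k ⟩
        2 * n + t * (48 * m) + 48 * # (X k)       ≤⟨ +-mono-≤ (+-monoʳ-≤ (2 * n) (*-monoˡ-≤ (48 * m) t≤T)) (class-small k) ⟩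
        2 * n + T * (48 * m) + (n + 48)           ≤⟨ +-monoʳ-≤ (2 * n + T * (48 * m)) (+-monoʳ-≤ n (*-monoʳ-≤ 48 1≤m)) ⟩
        2 * n + T * (48 * m) + (n + 48 * m)       ≡⟨ cong (λ n → 2 * n + T * (48 * m) + (n + 48 * m)) n≡ ⟩
        2 * (3 * (h * m)) + T * (48 * m) + (3 * (h * m) + 48 * m)
          ≡⟨ subst (λ h → 2 * (3 * (h * m)) + T * (48 * m) + (3 * (h * m) + 48 * m) ≡ 15 * (h * m)) (sym h≡) (l T m) ⟩
        15 * (h * m)                              ∎
        where
        open ≤-Reasoning
        l : ∀ T m → 2 * (3 * (8 * (1 + T) * m)) + T * (48 * m) + (3 * (8 * (1 + T) * m) + 48 * m) ≡ 15 * (8 * (1 + T) * m)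
        l = solve-∀

      bigs : ∀ i p → split i p ≡ true → # (X i) < 48 * # (lo (X i) p) × # (X i) < 48 * # (hi (X i) p)
      bigs i p s = ≰ᵇ⇒> (not-true (proj₁ (∧-elim s))) , ≰ᵇ⇒> (not-true (proj₂ (∧-elim {not (few-lo (X i) p)} s)))

    module SA = Side A A-layer≤ A-layer≥
    module SB = Side B B-layer≤ B-layer≥

    common-cut : ∀ k → ∃[ p ] (∃[ i ] i ≢ k × SA.split i p ≡ true) × (∃[ i ] i ≢ k × SB.split i p ≡ true)
    common-cut k = toℕ p , SA.not-bad k (toℕ p) (proj₁ both) , SB.not-bad k (toℕ p) (proj₂ both)
      where
      a b : Fin h → ℕ
      a p = ⟦ SA.bad k (toℕ p) ⟧
      b p = ⟦ SB.bad k (toℕ p) ⟧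
      less-than-h : sum (λ p → a p + b p) < sum {h} (λ _ → 1)
      less-than-h = *-cancelˡ-< (48 * m) _ _ (begin-strict
        48 * m * sum (λ p → a p + b p)       ≡⟨ cong (48 * m *_) (sum-+ a b) ⟩
        48 * m * (sum a + sum b)             ≡⟨ l m (sum a) (sum b) ⟩
        48 * (sum a * m) + 48 * (sum b * m)  ≤⟨ +-mono-≤ (SA.few-bad k) (SB.few-bad k) ⟩
        15 * (h * m) + 15 * (h * m)          ≡⟨ l₂ (h * m) ⟩
        30 * (h * m)                         <⟨ *-monoˡ-< (h * m) {{>-nonZero (*-mono-≤ {1} {h} (≤-trans (s≤s z≤n) 8≤h) 1≤m)}} {30} {48} (m≤m+n 31 17) ⟩
        48 * (h * m)                         ≡⟨ l₃ h m ⟩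
        48 * m * (h * 1)                     ≡⟨ cong (48 * m *_) (sym (sum-const h 1)) ⟩
        48 * m * sum {h} (λ _ → 1)           ∎)
        where
        open ≤-Reasoning
        l : ∀ m a b → 48 * m * (a + b) ≡ 48 * (a * m) + 48 * (b * m)
        l = solve-∀
        l₂ : ∀ a → 15 * a + 15 * a ≡ 30 * a
        l₂ = solve-∀
        l₃ : ∀ h m → 48 * (h * m) ≡ 48 * m * (h * 1)
        l₃ = solve-∀
      ex = sum-exists-< {f = λ p → a p + b p} {g = λ _ → 1} less-than-h
      p = proj₁ ex
      both : SA.bad k (toℕ p) ≡ false × SB.bad k (toℕ p) ≡ false
      both = zero-zero (SA.bad k (toℕ p)) (SB.bad k (toℕ p)) (proj₂ ex)
        where
        zero-zero : ∀ a b → ⟦ a ⟧ + ⟦ b ⟧ < 1 → a ≡ false × b ≡ false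
        zero-zero false false _ = refl , refl
        zero-zero true b (s≤s ())
        zero-zero false true (s≤s ())

    -- C is a third of all vertices, so it fills more than 1 / 48 of some part. The weights `δ`
    -- exclude i and j: they lift f to at least g there, at a total cost of about 2n.
    third-part : ∀ i j → ∃[ k ] i ≢ k × j ≢ k × # (X k) < 48 * # (λ v → X k v ∧ C v)
    third-part i j = finish (sum-exists-< f<g)
      where
      δ : Fin t → Fin t → ℕ
      δ i k = 48 * # (X i) * ⟦ does (i Finₚ.≟ k) ⟧
      δ-sum : ∀ i → sum (δ i) ≡ 48 * # (X i)
      δ-sum i = trans (sum-*ˡ (48 * # (X i)) (λ k → ⟦ does (i Finₚ.≟ k) ⟧))
        (trans (cong (48 * # (X i) *_) (sum-indicator i)) (*-identityʳ _))
      f g : Fin t → ℕ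
      f k = # (X k) + δ i k + δ j k
      g k = 48 * # (λ v → X k v ∧ C v)
      f<g : sum f < sum g
      f<g = begin-strict
        sum f                                     ≡⟨ sum-+ (λ k → # (X k) + δ i k) (δ j) ⟩
        sum (λ k → # (X k) + δ i k) + sum (δ j)   ≡⟨ cong₂ _+_ (trans (sum-+ (λ k → # (X k)) (δ i)) (cong₂ _+_ (#-classes part) (δ-sum i))) (δ-sum j) ⟩
        n + 48 * # (X i) + 48 * # (X j)           ≤⟨ +-mono-≤ (+-monoʳ-≤ n (class-small i)) (class-small j) ⟩
        n + (n + 48) + (n + 48)                   ≡⟨ cong (λ n → n + (n + 48) + (n + 48)) n≡ ⟩
        3 * (h * m) + (3 * (h * m) + 48) + (3 * (h * m) + 48) ≡⟨ l (h * m) ⟩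
        9 * (h * m) + 12 * 8                      ≤⟨ +-monoʳ-≤ (9 * (h * m)) (*-monoʳ-≤ 12 8≤hm) ⟩
        9 * (h * m) + 12 * (h * m)                ≡⟨ sym (*-distribʳ-+ (h * m) 9 12) ⟩
        21 * (h * m)                              <⟨ *-monoˡ-< (h * m) {{>-nonZero (≤-trans (s≤s z≤n) 8≤hm)}} {21} {48} (m≤m+n 22 26) ⟩
        48 * (h * m)                              ≡⟨ cong (48 *_) (trans (sym C-size) (#-partition part C)) ⟩
        48 * sum (λ k → # (λ v → X k v ∧ C v))    ≡⟨ sym (sum-*ˡ 48 (λ k → # (λ v → X k v ∧ C v))) ⟩
        sum g                                     ∎
        where
        open ≤-Reasoning
        l : ∀ a → 3 * a + (3 * a + 48) + (3 * a + 48) ≡ 9 * a + 12 * 8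
        l = solve-∀
        8≤hm : 8 ≤ h * m
        8≤hm = *-mono-≤ {8} {h} {1} 8≤h 1≤m
      δ-diagonal : ∀ i → 48 * # (X i) ≤ δ i i
      δ-diagonal i = ≤-reflexive (sym (trans
        (cong (λ b → 48 * # (X i) * ⟦ b ⟧) (dec-true (i Finₚ.≟ i) refl)) (*-identityʳ (48 * # (X i)))))
      g≤ : ∀ k → g k ≤ 48 * # (X k)
      g≤ k = *-monoʳ-≤ 48 {# (λ v → X k v ∧ C v)} {# (X k)} (#-mono λ v e → proj₁ (∧-elim {X k v} e))
      differ : ∀ i k → f k < g k → δ i k ≤ f k → i ≢ k
      differ i .i lt le refl = <⇒≱ lt (≤-trans (g≤ i) (≤-trans (δ-diagonal i) le))
      finish : ∃[ k ] f k < g k → ∃[ k ] i ≢ k × j ≢ k × # (X k) < 48 * # (λ v → X k v ∧ C v)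
      finish (k , lt) =
        k , differ i k lt (≤-trans (m≤n+m (δ i k) (# (X k))) (m≤m+n (# (X k) + δ i k) (δ j k)))
          , differ j k lt (m≤n+m (δ j k) (# (X k) + δ i k))
          , ≤-<-trans (≤-trans (m≤m+n (# (X k)) (δ i k)) (m≤m+n (# (X k) + δ i k) (δ j k))) lt

    module _ (F : Fin n → Fin n → Fin n → Bool) (F-sym : ∀ x y z → F x y z ≡ F y x z)
      (F-true : ∀ x y z → A x ≡ true → B y ≡ true → C z ≡ true → pos x ≤ pos y → F x y z ≡ true)
      (F-false : ∀ x y z → A x ≡ true → B y ≡ true → C z ≡ true → pos y < pos x → F x y z ≡ false) where

      private
        <-true : ∀ {a p} → (a <ᵇ p) ≡ true → a < p
        <-true {a} {p} e = <ᵇ⇒< a p (≡⇒T e)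
        <-false : ∀ {a p} → not (a <ᵇ p) ≡ true → p ≤ a
        <-false e = ≮⇒≥ (λ lt → true≢false (T⇒≡ (<⇒<ᵇ lt)) (not-true e))
        parts : ∀ {a b c} → a ∧ (b ∧ c) ≡ true → b ≡ true × c ≡ true
        parts {a} e = ∧-elim (proj₂ (∧-elim {a} e))

      same-cut : ∀ p i j → i ≢ j → SA.split i p ≡ true → SB.split j p ≡ true → Irregular F part
      same-cut p i j i≢j si sj = record
        { i = i ; j = j ; k = proj₁ third ; i≢j = i≢j
        ; i≢k = proj₁ (proj₂ third) ; j≢k = proj₁ (proj₂ (proj₂ third))
        ; U = SA.lo (X i) p ; U′ = SA.hi (X i) p ; V = SB.hi (X j) p ; V′ = SB.lo (X j) p
        ; W = λ v → X (proj₁ third) v ∧ C v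
        ; U⊆ = λ x e → proj₁ (∧-elim e) ; U′⊆ = λ x e → proj₁ (∧-elim e)
        ; V⊆ = λ x e → proj₁ (∧-elim e) ; V′⊆ = λ x e → proj₁ (∧-elim e)
        ; W⊆ = λ x e → proj₁ (∧-elim e)
        ; bigU = proj₁ (SA.bigs i p si) ; bigU′ = proj₂ (SA.bigs i p si)
        ; bigV = proj₂ (SB.bigs j p sj) ; bigV′ = proj₁ (SB.bigs j p sj)
        ; bigW = proj₂ (proj₂ (proj₂ third))
        ; full = λ x y z u v w → let (a , lx) = parts {X i x} u ; (b , hy) = parts {X j y} v in
            F-true x y z a b (proj₂ (∧-elim {X (proj₁ third) z} w)) (≤-trans (<⇒≤ (<-true {pos x} {p} lx)) (<-false {pos y} {p} hy))
        ; empty = λ x y z u v w → let (a , hx) = parts {X i x} u ; (b , ly) = parts {X j y} v in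
            F-false x y z a b (proj₂ (∧-elim {X (proj₁ third) z} w)) (<-≤-trans (<-true {pos y} {p} ly) (<-false {pos x} {p} hx))
        }
        where third = third-part i j

      -- Both thresholds cut both sides. Vertices of A in part i before p precede vertices of B in
      -- part j from p′ on, which gives the full box. With the sides exchanged, vertices of B in
      -- part i precede vertices of A in part j, and the symmetry of F turns this into the empty
      -- box.
      cross-cut : ∀ p p′ i j → i ≢ j → p ≤ p′ → SA.split i p ≡ true → SB.split i p ≡ true →
        SA.split j p′ ≡ true → SB.split j p′ ≡ true → Irregular F part
      cross-cut p p′ i j i≢j p≤p′ ai bi aj bj = record
        { i = i ; j = j ; k = proj₁ third ; i≢j = i≢j
        ; i≢k = proj₁ (proj₂ third) ; j≢k = proj₁ (proj₂ (proj₂ third))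
        ; U = SA.lo (X i) p ; U′ = SB.lo (X i) p ; V = SB.hi (X j) p′ ; V′ = SA.hi (X j) p′
        ; W = λ v → X (proj₁ third) v ∧ C v
        ; U⊆ = λ x e → proj₁ (∧-elim e) ; U′⊆ = λ x e → proj₁ (∧-elim e)
        ; V⊆ = λ x e → proj₁ (∧-elim e) ; V′⊆ = λ x e → proj₁ (∧-elim e)
        ; W⊆ = λ x e → proj₁ (∧-elim e)
        ; bigU = proj₁ (SA.bigs i p ai) ; bigU′ = proj₁ (SB.bigs i p bi)
        ; bigV = proj₂ (SB.bigs j p′ bj) ; bigV′ = proj₂ (SA.bigs j p′ aj)
        ; bigW = proj₂ (proj₂ (proj₂ third))
        ; full = λ x y z u v w → let (a , lx) = parts {X i x} u ; (b , hy) = parts {X j y} v in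
            F-true x y z a b (proj₂ (∧-elim {X (proj₁ third) z} w))
              (≤-trans (<⇒≤ (<-true {pos x} {p} lx)) (≤-trans p≤p′ (<-false {pos y} {p′} hy)))
        ; empty = λ x y z u v w → let (b , lx) = parts {X i x} u ; (a , hy) = parts {X j y} v in
            trans (F-sym x y z) (F-false y x z a b (proj₂ (∧-elim {X (proj₁ third) z} w))
              (<-≤-trans (<-true {pos x} {p} lx) (≤-trans p≤p′ (<-false {pos y} {p′} hy))))
        }
        where third = third-part i j

      irregular : Irregular F part
      -- The part excluded at first is arbitrary; the second application excludes the part i that
      -- was found.
      irregular = first (common-cut (Fin.fromℕ< {0} (≤-trans (s≤s z≤n) 48≤t)))
        where
        Cut : Fin t → Set
        Cut k = ∃[ p ] (∃[ i ] i ≢ k × SA.split i p ≡ true) × (∃[ i ] i ≢ k × SB.split i p ≡ true)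
        second : ∀ p i → SA.split i p ≡ true → SB.split i p ≡ true → Cut i → Irregular F part
        second p i ai bi (p′ , (j , j≢i , aj) , (j′ , j′≢i , bj′)) with j Finₚ.≟ j′
        ... | no j≢j′ = same-cut p′ j j′ j≢j′ aj bj′
        ... | yes refl with ≤-total p p′
        ...   | inj₁ p≤p′ = cross-cut p p′ i j (≢-sym j≢i) p≤p′ ai bi aj bj′
        ...   | inj₂ p′≤p = cross-cut p′ p j i j≢i p′≤p aj bj′ ai bi
        first : ∀ {k} → Cut k → Irregular F part
        first (p , (i , _ , ai) , (j , _ , bj)) with i Finₚ.≟ j
        ... | no i≢j = same-cut p i j i≢j ai bj
        ... | yes refl = second p i ai bj (common-cut i)

-- Averaging and double counting.

module Averaging where
  open Counting
  open ErdősTheorem using (weight-positive)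
  open RowsAndColumns using (close; dist)
  open ClusterLemma using (closePairs)
  open import Data.Bool.Base using (Bool; true; false; _∧_; not; _xor_)
  open import Data.Fin.Base using (Fin; suc)
  open import Data.Nat.Base
  open import Data.Nat.Properties
  open import Data.Nat.Tactic.RingSolver using (solve-∀)
  open import Data.Vec.Base using (Vec; []; _∷_)

  private
    variable
      N : ℕ

  average : ∀ (D : Fin N → Bool) (f : Fin N → ℕ) b q → 0 < # D → # D * b ≤ q * sum (λ x → ⟦ D x ⟧ * f x) →
    ∃[ x ] D x ≡ true × b ≤ q * f x
  -- Adding 1 to q f x makes the inequality between the sums strict, and the weight D on both sides
  -- forces x into D.
  average {N} D f b q 0<D h = finish (sum-exists-< {f = λ x → ⟦ D x ⟧ * b} {g = λ x → ⟦ D x ⟧ * suc (q * f x)} weighted-<)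
    where
    open ≤-Reasoning
    l : ∀ d q f → d * (1 + q * f) ≡ d + q * (d * f)
    l = solve-∀
    weighted-< : sum (λ x → ⟦ D x ⟧ * b) < sum (λ x → ⟦ D x ⟧ * suc (q * f x))
    weighted-< = begin-strict
      sum (λ x → ⟦ D x ⟧ * b)                           ≡⟨ sum-*ʳ b (λ x → ⟦ D x ⟧) ⟩
      # D * b                                           ≤⟨ h ⟩
      q * sum (λ x → ⟦ D x ⟧ * f x)                     <⟨ +-monoˡ-< (q * sum (λ x → ⟦ D x ⟧ * f x)) 0<D ⟩
      # D + q * sum (λ x → ⟦ D x ⟧ * f x)               ≡⟨ cong (# D +_) (sym (sum-*ˡ q (λ x → ⟦ D x ⟧ * f x))) ⟩
      # D + sum (λ x → q * (⟦ D x ⟧ * f x))             ≡⟨ sym (sum-+ (λ x → ⟦ D x ⟧) (λ x → q * (⟦ D x ⟧ * f x))) ⟩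
      sum (λ x → ⟦ D x ⟧ + q * (⟦ D x ⟧ * f x))         ≡⟨ sum-cong (λ x → sym (l ⟦ D x ⟧ q (f x))) ⟩
      sum (λ x → ⟦ D x ⟧ * suc (q * f x))               ∎
    finish : ∃[ x ] ⟦ D x ⟧ * b < ⟦ D x ⟧ * suc (q * f x) → ∃[ x ] D x ≡ true × b ≤ q * f x
    finish (x , lt) = x , Dx , s≤s⁻¹ (*-cancelˡ-< ⟦ D x ⟧ b (suc (q * f x)) lt)
      where
      Dx = weight-positive (D x) {c = suc (q * f x)} lt

  popular : ∀ (Z X Y : Fin N → Bool) F R e k → (∀ z x → R z x ≡ true → X x ≡ true) → 0 < # Z → 0 < # X →
    # Z * (# X * # X) ≤ k * closePairs Z Y F R e →
    ∃[ z ] ∃[ x ] Z z ≡ true × R z x ≡ true × # X ≤ k * # (λ x′ → R z x′ ∧ close e Y (F z x) (F z x′))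
  popular {N} Z X Y F R e k R⊆X 0<Z 0<X h = finish (average Z (λ z → sum (λ x → ⟦ R z x ⟧ * ball z x)) (# X * # X) k 0<Z h)
    where
    ball : Fin N → Fin N → ℕ
    ball z x = # (λ x′ → R z x′ ∧ close e Y (F z x) (F z x′))
    Result : Set
    Result = ∃[ z ] ∃[ x ] Z z ≡ true × R z x ≡ true × # X ≤ k * ball z x
    absorb : ∀ z x → ⟦ R z x ⟧ * ball z x ≡ ⟦ X x ⟧ * (⟦ R z x ⟧ * ball z x)
    absorb z x = lem (R z x) (X x) (ball z x) (R⊆X z x)
      where
      lem : ∀ r x b → (r ≡ true → x ≡ true) → ⟦ r ⟧ * b ≡ ⟦ x ⟧ * (⟦ r ⟧ * b)
      lem false x b _ = sym (*-zeroʳ ⟦ x ⟧)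
      lem true false b h with () ← h refl
      lem true true b _ = sym (*-identityˡ _)
    finish : ∃[ z ] Z z ≡ true × # X * # X ≤ k * sum (λ x → ⟦ R z x ⟧ * ball z x) → Result
    finish (z , Zz , h′) = finish′ (average X (λ x → ⟦ R z x ⟧ * ball z x) (# X) k 0<X
        (subst (λ s → # X * # X ≤ k * s) (sum-cong (absorb z)) h′))
      where
      finish′ : ∃[ x ] X x ≡ true × # X ≤ k * (⟦ R z x ⟧ * ball z x) → Result
      finish′ (x , _ , le) = z , x , Zz , Rzx , ≤-trans le (*-monoʳ-≤ k (≤-trans (*-monoˡ-≤ (ball z x) (⟦⟧≤1 (R z x)))
          (≤-reflexive (*-identityˡ (ball z x)))))
        where
        Rzx : R z x ≡ true
        Rzx = weight-positive (R z x) {0} {k * ball z x} (<-≤-trans 0<X (≤-trans le (≤-reflexive (l k ⟦ R z x ⟧ (ball z x)))))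
          where
          l : ∀ a b c → a * (b * c) ≡ b * (a * c)
          l = solve-∀

  -- Reverse Markov on the pairs (z, x), followed by an exchange of the sums: what is typical in
  -- slices of z becomes a dense relation in slices of x, the form in which `cluster` is applied
  -- next.
  swap-density : ∀ (Z X : Fin N → Bool) (f : Fin N → Fin N → ℕ) k → (∀ z x → f z x ≤ # X) → 0 < # X →
    # Z * (# X * # X) ≤ k * sum (λ z → ⟦ Z z ⟧ * sum (λ x → ⟦ X x ⟧ * f z x)) →
    # X * # Z ≤ (2 * k) * sum (λ x → ⟦ X x ⟧ * # (λ z → Z z ∧ (# X ≤ᵇ 2 * k * f z x)))
  swap-density {N} Z X f k f≤ 0<X h = begin
    # X * # Z                             ≡⟨ l₁ (# X) (# Z) ⟩
    size (Z ∷ X ∷ [])                     ≤⟨ reverse-markov-tot (Z ∷ X ∷ []) k (# X) g g≤ 0<X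
                                               (≤-trans (≤-reflexive (l₂ (# X) (# Z))) h) ⟩
    2 * k * cnt (Z ∷ X ∷ []) (λ v → # X ≤ᵇ 2 * k * g v)   ≡⟨ cong (2 * k *_) swap ⟩
    2 * k * sum (λ x → ⟦ X x ⟧ * # (λ z → Z z ∧ G z x))   ∎
    where
    open ≤-Reasoning
    l₁ : ∀ a b → a * b ≡ b * (a * 1)
    l₁ = solve-∀
    l₂ : ∀ a b → a * (b * (a * 1)) ≡ b * (a * a)
    l₂ = solve-∀
    l₃ : ∀ a b c → a * (b * c) ≡ b * (a * c)
    l₃ = solve-∀
    g : Vec (Fin N) 2 → ℕ
    g (z ∷ x ∷ []) = f z x
    g≤ : ∀ v → g v ≤ # X
    g≤ (z ∷ x ∷ []) = f≤ z x
    G : Fin N → Fin N → Bool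
    G z x = # X ≤ᵇ 2 * k * f z x
    swap : sum (λ z → ⟦ Z z ⟧ * sum (λ x → ⟦ X x ⟧ * ⟦ G z x ⟧)) ≡ sum (λ x → ⟦ X x ⟧ * # (λ z → Z z ∧ G z x))
    swap = trans (sum-cong (λ z → sym (sum-*ˡ ⟦ Z z ⟧ (λ x → ⟦ X x ⟧ * ⟦ G z x ⟧))))
      (trans (sum-swap (λ z x → ⟦ Z z ⟧ * (⟦ X x ⟧ * ⟦ G z x ⟧)))
        (sum-cong (λ x → trans (sum-cong (λ z → trans (l₃ ⟦ Z z ⟧ ⟦ X x ⟧ ⟦ G z x ⟧) (cong (⟦ X x ⟧ *_) (sym (⟦∧⟧ (Z z) (G z x))))))
          (sum-*ˡ ⟦ X x ⟧ (λ z → ⟦ Z z ∧ G z x ⟧)))))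

  -- Equality of truth values, so that a majority of edges and a majority of non-edges are treated
  -- alike.
  _≐_ : Bool → Bool → Bool
  true ≐ s = s
  false ≐ s = not s

  majority : ∀ (Y f : Fin N → Bool) → ∃[ s ] # Y ≤ 2 * # (λ y → Y y ∧ (f y ≐ s))
  majority {N} Y f = choose (≤-total (half true) (half false))
    where
    half : Bool → ℕ
    half s = # (λ y → Y y ∧ (f y ≐ s))
    split : # Y ≡ half true + half false
    split = trans (sum-cong (λ y → pt (Y y) (f y))) (sum-+ (λ y → ⟦ Y y ∧ (f y ≐ true) ⟧) (λ y → ⟦ Y y ∧ (f y ≐ false) ⟧))
      where
      pt : ∀ a b → ⟦ a ⟧ ≡ ⟦ a ∧ (b ≐ true) ⟧ + ⟦ a ∧ (b ≐ false) ⟧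
      pt false b = refl
      pt true true = refl
      pt true false = refl
    l : ∀ a → a + a ≡ 2 * a
    l = solve-∀
    choose : half true ≤ half false ⊎ half false ≤ half true → ∃[ s ] # Y ≤ 2 * half s
    choose (inj₁ le) = false , ≤-trans (≤-reflexive split) (≤-trans (+-monoˡ-≤ (half false) le) (≤-reflexive (l (half false))))
    choose (inj₂ le) = true , ≤-trans (≤-reflexive split) (≤-trans (+-monoʳ-≤ (half true) le) (≤-reflexive (l (half true))))

  close⇒ : ∀ e (Y f g : Fin N → Bool) → close e Y f g ≡ true → e * dist Y f g ≤ # Y
  close⇒ e Y f g c = ≤ᵇ⇒≤ (e * dist Y f g) (# Y) (≡⇒T c)

  -- Where f₀ takes the value s and f₂ does not, f₁ differs from one of them. Both distances are at
  -- most |Y| / e, and |Y| is at most twice the majority set.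
  disagreement : ∀ e (Y f₀ f₁ f₂ : Fin N → Bool) s → close e Y f₀ f₁ ≡ true → close e Y f₁ f₂ ≡ true →
    # Y ≤ 2 * # (λ y → Y y ∧ (f₀ y ≐ s)) →
    e * # (λ y → (Y y ∧ (f₀ y ≐ s)) ∧ not (f₂ y ≐ s)) ≤ 4 * # (λ y → Y y ∧ (f₀ y ≐ s))
  disagreement e Y f₀ f₁ f₂ s c₁ c₂ maj = begin
    e * # (λ y → (Y y ∧ (f₀ y ≐ s)) ∧ not (f₂ y ≐ s))
      ≤⟨ *-monoʳ-≤ e (sum-mono (λ y → pt (Y y) (f₀ y) (f₁ y) (f₂ y) s)) ⟩
    e * sum (λ y → ⟦ Y y ∧ (f₀ y xor f₁ y) ⟧ + ⟦ Y y ∧ (f₁ y xor f₂ y) ⟧)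
      ≡⟨ cong (e *_) (sum-+ (λ y → ⟦ Y y ∧ (f₀ y xor f₁ y) ⟧) (λ y → ⟦ Y y ∧ (f₁ y xor f₂ y) ⟧)) ⟩
    e * (dist Y f₀ f₁ + dist Y f₁ f₂)
      ≡⟨ *-distribˡ-+ e (dist Y f₀ f₁) (dist Y f₁ f₂) ⟩
    e * dist Y f₀ f₁ + e * dist Y f₁ f₂
      ≤⟨ +-mono-≤ (close⇒ e Y f₀ f₁ c₁) (close⇒ e Y f₁ f₂ c₂) ⟩
    # Y + # Y
      ≤⟨ +-mono-≤ maj maj ⟩
    2 * b + 2 * b
      ≡⟨ l b ⟩
    4 * b ∎
    where
    open ≤-Reasoning
    b = # (λ y → Y y ∧ (f₀ y ≐ s))
    l : ∀ b → 2 * b + 2 * b ≡ 4 * b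
    l = solve-∀
    pt : ∀ y a b c s → ⟦ (y ∧ (a ≐ s)) ∧ not (c ≐ s) ⟧ ≤ ⟦ y ∧ (a xor b) ⟧ + ⟦ y ∧ (b xor c) ⟧
    pt false a b c s = z≤n
    pt true true true true true = z≤n
    pt true true true true false = z≤n
    pt true true true false true = ≤-refl
    pt true true true false false = z≤n
    pt true true false true true = z≤n
    pt true true false true false = z≤n
    pt true true false false true = ≤-refl
    pt true true false false false = z≤n
    pt true false true true true = z≤n
    pt true false true true false = ≤-refl
    pt true false true false true = z≤n
    pt true false true false false = z≤n
    pt true false false true true = z≤n
    pt true false false true false = ≤-refl
    pt true false false false true = z≤n
    pt true false false false false = z≤n

-- Inequalities and counts over ℚ.

module Rationals where
  open Counting
  open Partitions using (#-cong)
  open import Defs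
  open import Data.Bool.Base using (Bool; true; false; _∧_)
  open import Data.Fin.Base using (Fin; zero; suc)
  open import Data.Fin.Subset using (Subset; _⊆_; ∣_∣)
  open import Data.Integer.Base as ℤ using (+_)
  import Data.Integer.Properties as ℤₚ
  open import Data.List.Base as List using (List; []; _∷_; _++_; length; filterᵇ; allFin; cartesianProduct)
  open import Data.Nat.Base as ℕ using (ℕ; zero; suc)
  open import Data.Nat.Coprimality using (1-coprimeTo)
  import Data.Nat.Coprimality as Coprime
  open import Data.Rational.Base as ℚ using (ℚ; 0ℚ; 1ℚ; mkℚ; _+_; _*_; _-_; -_; _≤_; _<_; *≤*; *<*)
  import Data.Rational.Unnormalised.Base as ℚᵘ
  import Data.Rational.Unnormalised.Properties as ℚᵘₚ
  open import Data.Vec.Base using ([]; _∷_; lookup; tabulate)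
  open import Function.Base using (_∘_; id)
  open import Level using (0ℓ)
  open import Relation.Nullary.Decidable.Core using (dec⇒maybe)
  open import Tactic.RingSolver.Core.AlmostCommutativeRing using (AlmostCommutativeRing; fromCommutativeRing)
  open import Algebra.Structures using (module IsCommutativeRing)

  ℚ-ring : AlmostCommutativeRing 0ℓ 0ℓ
  ℚ-ring = fromCommutativeRing ℚₚ.+-*-commutativeRing (λ x → dec⇒maybe (0ℚ ℚₚ.≟ x))

  open Summation (IsCommutativeRing.isCommutativeSemiring ℚₚ.+-*-isCommutativeRing) public
    renaming (sum to ∑; sum-cong to ∑-cong; sum-0 to ∑-0; sum-+ to ∑-+; sum-*ˡ to ∑-*ˡ; sum-*ʳ to ∑-*ʳ; sum-swap to ∑-swap;
      sum-↑ to ∑-↑; sum-combine to ∑-combine)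

  ≤⇒0≤ : ∀ {a b} → a ≤ b → 0ℚ ≤ b - a
  ≤⇒0≤ {a} {b} h = subst (_≤ b - a) (ℚₚ.+-inverseʳ a) (ℚₚ.+-monoˡ-≤ (- a) h)

  -- The pattern of the inequalities below: b - a is displayed as a sum of products of nonnegative
  -- terms, each one a hypothesis, and the identity is left to the ring solver.
  0≤⇒≤ : ∀ {a b} s → 0ℚ ≤ s → b - a ≡ s → a ≤ b
  0≤⇒≤ {a} {b} s h e = subst₂ _≤_ (ℚₚ.+-identityʳ a) (l a b) (ℚₚ.+-monoʳ-≤ a (subst (0ℚ ≤_) (sym e) h))
    where
    l : ∀ a b → a + (b - a) ≡ b
    l = RS.solve-∀ ℚ-ring

  0≤+ : ∀ {a b} → 0ℚ ≤ a → 0ℚ ≤ b → 0ℚ ≤ a + b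
  0≤+ {a} {b} p q = subst (_≤ a + b) (ℚₚ.+-identityˡ 0ℚ) (ℚₚ.+-mono-≤ p q)

  0≤* : ∀ {a b} → 0ℚ ≤ a → 0ℚ ≤ b → 0ℚ ≤ a * b
  0≤* {a} {b} p q = subst (_≤ a * b) (ℚₚ.*-zeroʳ a) (ℚₚ.*-monoˡ-≤-nonNeg a {{ℚ.nonNegative p}} q)

  *-monoˡ : ∀ c {a b} → 0ℚ ≤ c → a ≤ b → c * a ≤ c * b
  *-monoˡ c p q = ℚₚ.*-monoˡ-≤-nonNeg c {{ℚ.nonNegative p}} q

  *-monoʳ : ∀ c {a b} → 0ℚ ≤ c → a ≤ b → a * c ≤ b * c
  *-monoʳ c p q = ℚₚ.*-monoʳ-≤-nonNeg c {{ℚ.nonNegative p}} q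

  *-mono : ∀ {a b c d} → 0ℚ ≤ a → 0ℚ ≤ d → a ≤ b → c ≤ d → a * c ≤ b * d
  *-mono {a} {b} {c} {d} 0≤a 0≤d p q = ℚₚ.≤-trans (*-monoˡ a 0≤a q) (*-monoʳ d 0≤d p)

  *-cancel : ∀ c {a b} → 0ℚ < c → c * a ≤ c * b → a ≤ b
  *-cancel c p q = ℚₚ.*-cancelˡ-≤-pos c {{ℚ.positive p}} q

  0<* : ∀ {a b} → 0ℚ < a → 0ℚ < b → 0ℚ < a * b
  0<* {a} {b} p q = subst (_< a * b) (ℚₚ.*-zeroʳ a) (ℚₚ.*-monoʳ-<-pos a {{ℚ.positive p}} q)

  0≤-square : ∀ a → 0ℚ ≤ a * a
  0≤-square a with ℚₚ.≤-total 0ℚ a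
  ... | inj₁ p = 0≤* p p
  ... | inj₂ p = subst (0ℚ ≤_) (l a) (0≤* (ℚₚ.neg-antimono-≤ p) (ℚₚ.neg-antimono-≤ p))
    where
    l : ∀ a → - a * - a ≡ a * a
    l = RS.solve-∀ ℚ-ring

  within⇒ : ∀ {a b e} → a ≈ b within e → a ≤ b + e × b ≤ a + e
  within⇒ {a} {b} {e} h = upper , lower
    where
    l₁ : ∀ a b e → b + e - a ≡ e - (a - b)
    l₁ = RS.solve-∀ ℚ-ring
    l₂ : ∀ a b e → a + e - b ≡ e - (- (a - b))
    l₂ = RS.solve-∀ ℚ-ring
    p≤∣p∣ : ∀ p → p ≤ ℚ.∣ p ∣
    p≤∣p∣ p with ℚₚ.≤-total 0ℚ p
    ... | inj₁ q = ℚₚ.≤-reflexive (sym (ℚₚ.0≤p⇒∣p∣≡p q))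
    ... | inj₂ q = ℚₚ.≤-trans q (ℚₚ.0≤∣p∣ p)
    upper : a ≤ b + e
    upper = 0≤⇒≤ (e - (a - b)) (≤⇒0≤ (ℚₚ.≤-trans (p≤∣p∣ (a - b)) h)) (l₁ a b e)
    lower : b ≤ a + e
    lower = 0≤⇒≤ (e - (- (a - b))) (≤⇒0≤ (ℚₚ.≤-trans (p≤∣p∣ (- (a - b))) (subst (_≤ e) (sym (ℚₚ.∣-p∣≡∣p∣ (a - b))) h))) (l₂ a b e)

  ⇒within : ∀ {a b e} → a ≤ b + e → b ≤ a + e → a ≈ b within e
  ⇒within {a} {b} {e} p q with ℚₚ.∣p∣≡p∨∣p∣≡-p (a - b)
  ... | inj₁ eq = subst (_≤ e) (sym eq) (0≤⇒≤ (b + e - a) (≤⇒0≤ p) (l a b e))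
    where
    l : ∀ a b e → e - (a - b) ≡ b + e - a
    l = RS.solve-∀ ℚ-ring
  ... | inj₂ eq = subst (_≤ e) (sym eq) (0≤⇒≤ (a + e - b) (≤⇒0≤ q) (l a b e))
    where
    l : ∀ a b e → e - - (a - b) ≡ a + e - b
    l = RS.solve-∀ ℚ-ring

  fromℕ-mk : ∀ m → fromℕ m ≡ mkℚ (+ m) 0 (Coprime.sym (1-coprimeTo m))
  fromℕ-mk m = ℚₚ.normalize-coprime (Coprime.sym (1-coprimeTo m))

  toℚᵘ-fromℕ : ∀ m → ℚ.toℚᵘ (fromℕ m) ≡ ℚᵘ.mkℚᵘ (+ m) 0
  toℚᵘ-fromℕ m = cong ℚ.toℚᵘ (fromℕ-mk m)

  fromℕ-+ : ∀ a b → fromℕ (a ℕ.+ b) ≡ fromℕ a + fromℕ b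
  fromℕ-+ a b = ℚₚ.toℚᵘ-injective (ℚᵘₚ.≃-trans (ℚᵘₚ.≃-reflexive (toℚᵘ-fromℕ (a ℕ.+ b)))
    (ℚᵘₚ.≃-trans (ℚᵘ.*≡* (cong (ℤ._* (+ 1)) (trans (ℤₚ.pos-+ a b)
        (cong₂ ℤ._+_ (sym (ℤₚ.*-identityʳ (+ a))) (sym (ℤₚ.*-identityʳ (+ b)))))))
      (ℚᵘₚ.≃-trans (ℚᵘₚ.≃-reflexive (cong₂ ℚᵘ._+_ (sym (toℚᵘ-fromℕ a)) (sym (toℚᵘ-fromℕ b))))
        (ℚᵘₚ.≃-sym (ℚₚ.toℚᵘ-homo-+ (fromℕ a) (fromℕ b))))))

  fromℕ-* : ∀ a b → fromℕ (a ℕ.* b) ≡ fromℕ a * fromℕ b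
  fromℕ-* a b = ℚₚ.toℚᵘ-injective (ℚᵘₚ.≃-trans (ℚᵘₚ.≃-reflexive (toℚᵘ-fromℕ (a ℕ.* b)))
    (ℚᵘₚ.≃-trans (ℚᵘ.*≡* (cong (ℤ._* (+ 1)) (ℤₚ.pos-* a b)))
      (ℚᵘₚ.≃-trans (ℚᵘₚ.≃-reflexive (cong₂ ℚᵘ._*_ (sym (toℚᵘ-fromℕ a)) (sym (toℚᵘ-fromℕ b))))
        (ℚᵘₚ.≃-sym (ℚₚ.toℚᵘ-homo-* (fromℕ a) (fromℕ b))))))

  fromℕ-mono : ∀ {a b} → a ℕ.≤ b → fromℕ a ≤ fromℕ b
  fromℕ-mono {a} {b} h = subst₂ _≤_ (sym (fromℕ-mk a)) (sym (fromℕ-mk b))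
    (*≤* (ℤₚ.*-monoʳ-≤-nonNeg (+ 1) (ℤ.+≤+ h)))

  fromℕ-mono-< : ∀ {a b} → a ℕ.< b → fromℕ a < fromℕ b
  fromℕ-mono-< {a} {b} h = subst₂ _<_ (sym (fromℕ-mk a)) (sym (fromℕ-mk b))
    (*<* (ℤₚ.*-monoʳ-<-pos (+ 1) (ℤ.+<+ h)))

  0≤fromℕ : ∀ a → 0ℚ ≤ fromℕ a
  0≤fromℕ a = fromℕ-mono {0} {a} ℕ.z≤n

  0<fromℕ : ∀ {a} → 1 ℕ.≤ a → 0ℚ < fromℕ a
  0<fromℕ h = fromℕ-mono-< h

  fromℕ-cancel : ∀ {a b} → fromℕ a ≤ fromℕ b → a ℕ.≤ b
  fromℕ-cancel {a} {b} h = ℕₚ.≮⇒≥ (λ lt → ℚₚ.<-irrefl refl (ℚₚ.<-≤-trans (fromℕ-mono-< lt) h))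

  fromℕ-sum : ∀ {n} (f : Fin n → ℕ) → fromℕ (sum f) ≡ ∑ (λ x → fromℕ (f x))
  fromℕ-sum {zero} f = refl
  fromℕ-sum {suc n} f = trans (fromℕ-+ (f zero) (sum (f ∘ suc))) (cong (_+_ (fromℕ (f zero))) (fromℕ-sum (f ∘ suc)))

  -- The denominator of ε works, since the numerator is at least 1.
  archimedean : ∀ {ε} → 0ℚ < ε → ∃[ w ] 1 ℕ.≤ w × 1ℚ ≤ fromℕ w * ε
  archimedean {mkℚ (+ suc a) b c} _ = suc b , ℕ.s≤s ℕ.z≤n , ℚₚ.toℚᵘ-cancel-≤
    (ℚᵘₚ.≤-respʳ-≃ (ℚᵘₚ.≃-sym (ℚᵘₚ.≃-trans (ℚₚ.toℚᵘ-homo-* (fromℕ (suc b)) (mkℚ (+ suc a) b c))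
        (ℚᵘₚ.≃-reflexive (cong (ℚᵘ._* ℚᵘ.mkℚᵘ (+ suc a) b) (toℚᵘ-fromℕ (suc b))))))
      (ℚᵘ.*≤* (ℤ.+≤+ (lem b a))))
    where
    lem : ∀ b a → 1 ℕ.* suc (0 ℕ.+ 0 ℕ.+ (b ℕ.+ 0)) ℕ.≤ (suc b ℕ.* suc a) ℕ.* 1
    lem b a = subst₂ ℕ._≤_ (sym (trans (ℕₚ.*-identityˡ _) (cong suc (ℕₚ.+-identityʳ b)))) (sym (ℕₚ.*-identityʳ _))
      (ℕₚ.m≤m*n (suc b) (suc a))
  archimedean {mkℚ (+ zero) b c} (*<* (ℤ.+<+ ()))
  archimedean {mkℚ (ℤ.-[1+ a ]) b c} (*<* ())

  ∑-mono : ∀ {n} {f g : Fin n → ℚ} → (∀ x → f x ≤ g x) → ∑ f ≤ ∑ g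
  ∑-mono {zero} h = ℚₚ.≤-refl
  ∑-mono {suc n} h = ℚₚ.+-mono-≤ (h zero) (∑-mono (h ∘ suc))

  0≤∑ : ∀ {n} {f : Fin n → ℚ} → (∀ x → 0ℚ ≤ f x) → 0ℚ ≤ ∑ f
  0≤∑ {n} {f} h = subst (_≤ ∑ f) (∑-0 n) (∑-mono h)

  ratio : ∀ a b → 0ℚ < b → ∃[ d ] a ≡ d * b
  ratio a b 0<b = a * inv , sym (trans (ℚₚ.*-assoc a inv b) (trans (cong (a *_) (ℚₚ.*-inverseˡ b {{nz}})) (ℚₚ.*-identityʳ a)))
    where
    nz = ℚ.>-nonZero 0<b
    inv = ℚ.1/_ b {{nz}}

  length-filterᵇ-map : ∀ {A B : Set} (p : B → Bool) (f : A → B) xs →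
    length (filterᵇ p (List.map f xs)) ≡ length (filterᵇ (p ∘ f) xs)
  length-filterᵇ-map p f [] = refl
  length-filterᵇ-map p f (x ∷ xs) with p (f x)
  ... | true = cong suc (length-filterᵇ-map p f xs)
  ... | false = length-filterᵇ-map p f xs

  length-filterᵇ-++ : ∀ {A : Set} (p : A → Bool) xs ys →
    length (filterᵇ p (xs ++ ys)) ≡ length (filterᵇ p xs) ℕ.+ length (filterᵇ p ys)
  length-filterᵇ-++ p [] ys = refl
  length-filterᵇ-++ p (x ∷ xs) ys with p x
  ... | true = cong suc (length-filterᵇ-++ p xs ys)
  ... | false = length-filterᵇ-++ p xs ys

  length-filterᵇ-product : ∀ {A : Set} {n m} (p : Fin m × A → Bool) (f : Fin n → Fin m) (ys : List A) →
    length (filterᵇ p (cartesianProduct (List.tabulate f) ys)) ≡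
    sum (λ x → length (filterᵇ (λ y → p (f x , y)) ys))
  length-filterᵇ-product {n = zero} p f ys = refl
  length-filterᵇ-product {n = suc n} p f ys = trans
    (length-filterᵇ-++ p (List.map (f zero ,_) ys) _)
    (cong₂ ℕ._+_ (length-filterᵇ-map p (f zero ,_) ys) (length-filterᵇ-product p (f ∘ suc) ys))

  length-filterᵇ-allFin : ∀ {n m} (p : Fin m → Bool) (f : Fin n → Fin m) →
    length (filterᵇ p (List.tabulate f)) ≡ # (p ∘ f)
  length-filterᵇ-allFin {zero} p f = refl
  length-filterᵇ-allFin {suc n} p f with p (f zero)
  ... | true = cong suc (length-filterᵇ-allFin p (f ∘ suc))
  ... | false = length-filterᵇ-allFin p (f ∘ suc)

  private
    variable
      n : ℕ

  size₃ : (F : Rel₃ n) (U V W : Fin n → Bool) → ℕ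
  size₃ F U V W = sum (λ x → sum (λ y → # (λ z → U x ∧ (V y ∧ (W z ∧ F x y z)))))

  size₂ : (E : Rel₂ n) (U W : Fin n → Bool) → ℕ
  size₂ E U W = sum (λ x → # (λ y → U x ∧ (W y ∧ E x y)))

  count-pairs : (p : Fin n × Fin n → Bool) →
    length (filterᵇ p (cartesianProduct (allFin n) (allFin n))) ≡ sum (λ x → # (λ y → p (x , y)))
  count-pairs {n} p = trans (length-filterᵇ-product p id (allFin n))
    (sum-cong {n} (λ x → length-filterᵇ-allFin (λ y → p (x , y)) id))

  count-triples : (p : Fin n × Fin n × Fin n → Bool) →
    length (filterᵇ p (cartesianProduct (allFin n) (cartesianProduct (allFin n) (allFin n)))) ≡
    sum (λ x → sum (λ y → # (λ z → p (x , y , z))))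
  count-triples {n} p = trans (length-filterᵇ-product p id (cartesianProduct (allFin n) (allFin n)))
    (sum-cong {n} (λ x → count-pairs (λ q → p (x , q))))

  count₃-size : (F : Rel₃ n) (U V W : Subset n) → count₃ F U V W ≡ size₃ F (lookup U) (lookup V) (lookup W)
  count₃-size {n} F U V W = count-triples {n} _

  count₂-size : (E : Rel₂ n) (U W : Subset n) → count₂ E U W ≡ size₂ E (lookup U) (lookup W)
  count₂-size {n} E U W = count-pairs {n} _

  ∣∣-size : (U : Subset n) → ∣ U ∣ ≡ # (lookup U)
  ∣∣-size [] = refl
  ∣∣-size (true ∷ U) = cong suc (∣∣-size U)
  ∣∣-size (false ∷ U) = ∣∣-size U

  size₃-cong : {F F′ : Rel₃ n} {U U′ V V′ W W′ : Fin n → Bool} → (∀ x y z → F x y z ≡ F′ x y z) →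
    (∀ x → U x ≡ U′ x) → (∀ x → V x ≡ V′ x) → (∀ x → W x ≡ W′ x) → size₃ F U V W ≡ size₃ F′ U′ V′ W′
  size₃-cong f u v w = sum-cong λ x → sum-cong λ y → sum-cong λ z →
    cong ⟦_⟧ (cong₂ _∧_ (u x) (cong₂ _∧_ (v y) (cong₂ _∧_ (w z) (f x y z))))

  size₂-cong : {E E′ : Rel₂ n} {U U′ W W′ : Fin n → Bool} → (∀ x y → E x y ≡ E′ x y) →
    (∀ x → U x ≡ U′ x) → (∀ x → W x ≡ W′ x) → size₂ E U W ≡ size₂ E′ U′ W′
  size₂-cong e u w = sum-cong λ x → sum-cong λ y →
    cong ⟦_⟧ (cong₂ _∧_ (u x) (cong₂ _∧_ (w y) (e x y)))

  size₃-full : (U V W : Fin n → Bool) → size₃ (λ _ _ _ → true) U V W ≡ # U ℕ.* # V ℕ.* # W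
  size₃-full U V W = begin
    sum (λ x → sum (λ y → # (λ z → U x ∧ (V y ∧ (W z ∧ true)))))
      ≡⟨ sum-cong (λ x → sum-cong (λ y → trans (sum-cong (λ z → pt (U x) (V y) (W z)))
           (sum-*ˡ (⟦ U x ⟧ ℕ.* ⟦ V y ⟧) (λ z → ⟦ W z ⟧)))) ⟩
    sum (λ x → sum (λ y → ⟦ U x ⟧ ℕ.* ⟦ V y ⟧ ℕ.* # W))
      ≡⟨ sum-cong (λ x → trans (sum-*ʳ (# W) (λ y → ⟦ U x ⟧ ℕ.* ⟦ V y ⟧)) (cong (ℕ._* # W) (sum-*ˡ ⟦ U x ⟧ (λ y → ⟦ V y ⟧)))) ⟩
    sum (λ x → ⟦ U x ⟧ ℕ.* # V ℕ.* # W)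
      ≡⟨ trans (sum-*ʳ (# W) (λ x → ⟦ U x ⟧ ℕ.* # V)) (cong (ℕ._* # W) (sum-*ʳ (# V) (λ x → ⟦ U x ⟧))) ⟩
    # U ℕ.* # V ℕ.* # W ∎
    where
    open ≡-Reasoning
    pt : ∀ a b c → ⟦ a ∧ (b ∧ (c ∧ true)) ⟧ ≡ ⟦ a ⟧ ℕ.* ⟦ b ⟧ ℕ.* ⟦ c ⟧
    pt false b c = refl
    pt true false c = refl
    pt true true false = refl
    pt true true true = refl

  size₃-const : ∀ b (F : Rel₃ n) (U V W : Fin n → Bool) →
    (∀ x y z → U x ≡ true → V y ≡ true → W z ≡ true → F x y z ≡ b) →
    size₃ F U V W ≡ ⟦ b ⟧ ℕ.* (# U ℕ.* # V ℕ.* # W)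
  size₃-const {n} b F U V W h = trans (sum-cong λ x → sum-cong λ y → sum-cong λ z →
      cong ⟦_⟧ (pt (U x) (V y) (W z) (h x y z))) (by b)
    where
    pt : ∀ u v w {f} → (u ≡ true → v ≡ true → w ≡ true → f ≡ b) → u ∧ (v ∧ (w ∧ f)) ≡ u ∧ (v ∧ (w ∧ b))
    pt false v w h = refl
    pt true false w h = refl
    pt true true false h = refl
    pt true true true h = h refl refl refl
    none : ∀ u v w → ⟦ u ∧ (v ∧ (w ∧ false)) ⟧ ≡ 0
    none false v w = refl
    none true false w = refl
    none true true false = refl
    none true true true = refl
    by : ∀ b → size₃ (λ _ _ _ → b) U V W ≡ ⟦ b ⟧ ℕ.* (# U ℕ.* # V ℕ.* # W)
    by true = trans (size₃-full U V W) (sym (ℕₚ.*-identityˡ _))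
    by false = trans (sum-cong λ x → trans (sum-cong λ y → trans (sum-cong λ z → none (U x) (V y) (W z)) (sum-0 n)) (sum-0 n)) (sum-0 n)

  lookup-tabulate : (P : Fin n → Bool) → ∀ x → lookup (tabulate P) x ≡ P x
  lookup-tabulate P x = Vecₚ.lookup∘tabulate P x

  tabulate-⊆ : {P Q : Fin n → Bool} → (∀ x → P x ≡ true → Q x ≡ true) → tabulate P ⊆ tabulate Q
  tabulate-⊆ {P = P} {Q} h {x} m = Vecₚ.lookup⇒[]= x (tabulate Q)
    (trans (lookup-tabulate Q x) (h x (trans (sym (lookup-tabulate P x)) (Vecₚ.[]=⇒lookup m))))

  ⊆-lookup : {U V : Subset n} → U ⊆ V → ∀ x → lookup U x ≡ true → lookup V x ≡ true
  ⊆-lookup {U = U} h x e = Vecₚ.[]=⇒lookup (h (Vecₚ.lookup⇒[]= x U e))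

  count₃-tabulate : (F : Rel₃ n) (U V W : Fin n → Bool) →
    count₃ F (tabulate U) (tabulate V) (tabulate W) ≡ size₃ F U V W
  count₃-tabulate F U V W = trans (count₃-size F (tabulate U) (tabulate V) (tabulate W))
    (size₃-cong (λ _ _ _ → refl) (lookup-tabulate U) (lookup-tabulate V) (lookup-tabulate W))

  ∣tabulate∣ : (U : Fin n → Bool) → ∣ tabulate U ∣ ≡ # U
  ∣tabulate∣ U = trans (∣∣-size (tabulate U)) (#-cong (lookup-tabulate U))

-- The embedding of counts into ℚ.

module Embedding where
  open Counting
  open Rationals
  open import Defs using (fromℕ)
  open import Data.Bool.Base using (Bool; true; false; _∧_)
  open import Data.Fin.Base using (Fin)
  open import Data.Nat.Base as ℕ using (ℕ)
  open import Data.Rational.Base using (ℚ; 0ℚ; 1ℚ; _+_; _*_; _-_; -_; _≤_; _<_)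

  -- fromℕ normalises fractions, so unfolding it during unification is very slow.
  opaque
    ι : ℕ → ℚ
    ι = fromℕ

    ι≡fromℕ : ∀ m → ι m ≡ fromℕ m
    ι≡fromℕ m = refl

    ι-0 : ι 0 ≡ 0ℚ
    ι-0 = refl

    ι-1 : ι 1 ≡ 1ℚ
    ι-1 = refl

    ι-+ : ∀ a b → ι (a ℕ.+ b) ≡ ι a + ι b
    ι-+ = fromℕ-+

    ι-* : ∀ a b → ι (a ℕ.* b) ≡ ι a * ι b
    ι-* = fromℕ-*

    ι-mono : ∀ {a b} → a ℕ.≤ b → ι a ≤ ι b
    ι-mono = fromℕ-mono

    0≤ι : ∀ a → 0ℚ ≤ ι a
    0≤ι = 0≤fromℕ

    0<ι : ∀ {a} → 1 ℕ.≤ a → 0ℚ < ι a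
    0<ι = 0<fromℕ

    ι-cancel : ∀ {a b} → ι a ≤ ι b → a ℕ.≤ b
    ι-cancel = fromℕ-cancel

    ι-sum : ∀ {n} (f : Fin n → ℕ) → ι (sum f) ≡ ∑ (λ x → ι (f x))
    ι-sum = fromℕ-sum

    [_] : Bool → ℚ
    [ b ] = fromℕ ⟦ b ⟧

    []≡ι : ∀ b → [ b ] ≡ ι ⟦ b ⟧
    []≡ι b = refl

    [true] : [ true ] ≡ 1ℚ
    [true] = refl

    [false] : [ false ] ≡ 0ℚ
    [false] = refl

    0≤[] : ∀ b → 0ℚ ≤ [ b ]
    0≤[] b = 0≤fromℕ ⟦ b ⟧

    [∧] : ∀ a b → [ a ∧ b ] ≡ [ a ] * [ b ]
    [∧] a b = trans (cong fromℕ (⟦∧⟧ a b)) (fromℕ-* ⟦ a ⟧ ⟦ b ⟧)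

  card : ∀ {N} → (Fin N → Bool) → ℚ
  card P = ι (# P)

  card-∑ : ∀ {N} (P : Fin N → Bool) → card P ≡ ∑ (λ x → [ P x ])
  card-∑ P = trans (ι-sum (λ x → ⟦ P x ⟧)) (∑-cong (λ x → sym ([]≡ι (P x))))

  0≤card : ∀ {N} (P : Fin N → Bool) → 0ℚ ≤ card P
  0≤card P = 0≤ι (# P)

  ∑-weighted : ∀ {N} (W : Fin N → Bool) {f g : Fin N → ℚ} → (∀ z → W z ≡ true → f z ≤ g z) →
    ∑ (λ z → [ W z ] * f z) ≤ ∑ (λ z → [ W z ] * g z)
  ∑-weighted W {f} {g} h = ∑-mono (λ z → pt z (W z) refl)
    where
    pt : ∀ z b → W z ≡ b → [ b ] * f z ≤ [ b ] * g z
    pt z true e = *-monoˡ [ true ] (0≤[] true) (h z e)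
    pt z false e rewrite [false] = ℚₚ.≤-reflexive (trans (ℚₚ.*-zeroˡ (f z)) (sym (ℚₚ.*-zeroˡ (g z))))

  ∑-card : ∀ {N} (W : Fin N → Bool) c → ∑ (λ z → [ W z ] * c) ≡ card W * c
  ∑-card W c = trans (∑-*ʳ c (λ z → [ W z ])) (cong (_* c) (sym (card-∑ W)))

-- Heredity excludes the half graph.

module ForbiddenHalfGraph where
  open Counting
  open SauerShelah using (half)
  open RowsAndColumns using (HalfGraph)
  open Partitions
  open HalfGraphPartitions
  open Rationals
  open import Defs
  open import Data.Bool.Base using (Bool; true; false; T; _∧_)
  open import Data.Fin.Base using (Fin; zero; suc; toℕ; remQuot; combine; inject≤)
  open import Data.Fin.Subset using (∣_∣)
  open import Data.Nat.Base as ℕ using (ℕ; zero; suc)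
  open import Data.Integer.Base using (+_)
  open import Data.Rational.Base as ℚ using (ℚ; 0ℚ; 1ℚ; _+_; _*_; _-_; -_; _≤_; _<_)
  open import Data.Vec.Base using (tabulate)

  private
    variable
      n : ℕ

  vol : (A B C : Fin n → Bool) → ℚ
  vol A B C = fromℕ (# A ℕ.* # B ℕ.* # C)

  -- vdisc₃ for subsets given by Boolean predicates.
  Vdisc : ℚ → (U V W : Fin n → Bool) → Rel₃ n → Set
  Vdisc ε U V W F = ∃[ d ] fromℕ (size₃ F U V W) ≡ d * vol U V W ×
    (∀ A B C → A ⊆ᵇ U → B ⊆ᵇ V → C ⊆ᵇ W →
      fromℕ (size₃ F A B C) ≈ d * vol A B C within (ε * vol U V W))

  vdisc-≤ : ∀ ε {U V W : Fin n → Bool} {F} (vd : Vdisc ε U V W F) A B C → A ⊆ᵇ U → B ⊆ᵇ V → C ⊆ᵇ W →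
    fromℕ (size₃ F A B C) ≤ proj₁ vd * vol A B C + ε * vol U V W
  vdisc-≤ ε {U} {V} {W} {F} (d , _ , reg) A B C A⊆ B⊆ C⊆ =
    proj₁ (within⇒ {fromℕ (size₃ F A B C)} {d * vol A B C} {ε * vol U V W} (reg A B C A⊆ B⊆ C⊆))

  vdisc-≥ : ∀ ε {U V W : Fin n → Bool} {F} (vd : Vdisc ε U V W F) A B C → A ⊆ᵇ U → B ⊆ᵇ V → C ⊆ᵇ W →
    proj₁ vd * vol A B C ≤ fromℕ (size₃ F A B C) + ε * vol U V W
  vdisc-≥ ε {U} {V} {W} {F} (d , _ , reg) A B C A⊆ B⊆ C⊆ =
    proj₂ (within⇒ {fromℕ (size₃ F A B C)} {d * vol A B C} {ε * vol U V W} (reg A B C A⊆ B⊆ C⊆))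

  ∣∣₃-tabulate : (A B C : Fin n → Bool) →
    fromℕ (∣ tabulate A ∣ ℕ.* ∣ tabulate B ∣ ℕ.* ∣ tabulate C ∣) ≡ vol A B C
  ∣∣₃-tabulate A B C = cong fromℕ (cong₂ ℕ._*_ (cong₂ ℕ._*_ (∣tabulate∣ A) (∣tabulate∣ B)) (∣tabulate∣ C))

  vdisc₃⇒Vdisc : ∀ ε (U V W : Fin n → Bool) F → vdisc₃ ε (tabulate U) (tabulate V) (tabulate W) F → Vdisc ε U V W F
  vdisc₃⇒Vdisc ε U V W F (d , density , reg) =
    d , trans (cong fromℕ (sym (count₃-tabulate F U V W))) (trans density (cong (d *_) (∣∣₃-tabulate U V W)))
    , λ A B C A⊆ B⊆ C⊆ → subst₂ (λ a e → a ≈ d * vol A B C within e)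
        (cong fromℕ (count₃-tabulate F A B C)) (cong (ε *_) (∣∣₃-tabulate U V W))
        (subst (λ b → fromℕ (count₃ F (tabulate A) (tabulate B) (tabulate C)) ≈ d * b within _) (∣∣₃-tabulate A B C)
          (reg (tabulate A) (tabulate B) (tabulate C) (tabulate-⊆ A⊆) (tabulate-⊆ B⊆) (tabulate-⊆ C⊆)))

  private
    -- With c bounding the ratio of the volumes, the full box forces d ≥ 1 - εc and the empty box d
    -- ≤ εc, so 1 ≤ 2cε.
    module _ (v v′ w d ε c : ℚ) (0<v : 0ℚ < v) (0<v′ : 0ℚ < v′) (0≤ε : 0ℚ ≤ ε)
      (w≤ : w ≤ c * v) (w≤′ : w ≤ c * v′) (full : v ≤ d * v + ε * w) (empty : d * v′ ≤ 0ℚ + ε * w) where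

      one≤ : 1ℚ ≤ d + ε * c
      one≤ = *-cancel v 0<v (0≤⇒≤ ((d * v + ε * w - v) + ε * (c * v - w))
        (0≤+ (≤⇒0≤ full) (0≤* 0≤ε (≤⇒0≤ w≤))) (l v w d ε c))
        where
        l : ∀ v w d ε c → v * (d + ε * c) - v * 1ℚ ≡ (d * v + ε * w - v) + ε * (c * v - w)
        l = RS.solve-∀ ℚ-ring

      d≤ : d ≤ ε * c
      d≤ = *-cancel v′ 0<v′ (0≤⇒≤ ((0ℚ + ε * w - d * v′) + ε * (c * v′ - w))
        (0≤+ (≤⇒0≤ empty) (0≤* 0≤ε (≤⇒0≤ w≤′))) (l v′ w d ε c))
        where
        l : ∀ v w d ε c → v * (ε * c) - v * d ≡ (0ℚ + ε * w - d * v) + ε * (c * v - w)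
        l = RS.solve-∀ ℚ-ring

      one≤2εc : 1ℚ ≤ (c + c) * ε
      one≤2εc = 0≤⇒≤ ((d + ε * c - 1ℚ) + (ε * c - d)) (0≤+ (≤⇒0≤ one≤) (≤⇒0≤ d≤)) (l d ε c)
        where
        l : ∀ d ε c → (c + c) * ε - 1ℚ ≡ (d + ε * c - 1ℚ) + (ε * c - d)
        l = RS.solve-∀ ℚ-ring

  cube : ∀ k x y z a b c → x ℕ.< k ℕ.* a → y ℕ.< k ℕ.* b → z ℕ.< k ℕ.* c →
    x ℕ.* y ℕ.* z ℕ.≤ k ℕ.* k ℕ.* k ℕ.* (a ℕ.* b ℕ.* c) × 1 ℕ.≤ a ℕ.* b ℕ.* c
  cube k x y z a b c p q r = ℕₚ.≤-trans (ℕₚ.*-mono-≤ (ℕₚ.*-mono-≤ (ℕₚ.<⇒≤ p) (ℕₚ.<⇒≤ q)) (ℕₚ.<⇒≤ r))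
    (ℕₚ.≤-reflexive (l k a b c)) , ℕₚ.*-mono-≤ {1} {a ℕ.* b} {1} {c} (ℕₚ.*-mono-≤ {1} {a} {1} {b} (pos a p) (pos b q)) (pos c r)
    where
    l : ∀ k a b c → k ℕ.* a ℕ.* (k ℕ.* b) ℕ.* (k ℕ.* c) ≡ k ℕ.* k ℕ.* k ℕ.* (a ℕ.* b ℕ.* c)
    l = ℕ-Solver.solve-∀
    pos : ∀ {x} a → x ℕ.< k ℕ.* a → 1 ℕ.≤ a
    pos (suc a) _ = ℕ.s≤s ℕ.z≤n
    pos {x} zero lt = ⊥-elim (ℕₚ.n≮0 (subst (x ℕ.<_) (ℕₚ.*-zeroʳ k) lt))

  irregular-bound : ∀ {t} ε (F : Rel₃ n) (part : Fin n → Fin t) → 0ℚ ≤ ε → Irregular F part →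
    (∀ i j k → Distinct i j k → Vdisc ε (cls part i) (cls part j) (cls part k) F) →
    ∀ k → k ≡ 48 → 1ℚ ≤ (fromℕ (k ℕ.* k ℕ.* k) + fromℕ (k ℕ.* k ℕ.* k)) * ε
  irregular-bound ε F part 0≤ε irr reg κ refl = contra (reg i j k (i≢j , i≢k , j≢k))
    where
    open Irregular irr
    contra : Vdisc ε (cls part i) (cls part j) (cls part k) F → _
    contra vd = helper 48 bigU bigU′ bigV bigV′ bigW
      where
      d = proj₁ vd
      w = vol (cls part i) (cls part j) (cls part k)
      full-size : fromℕ (size₃ F U V W) ≡ vol U V W
      full-size = cong fromℕ (trans (size₃-const true F U V W full) (ℕₚ.*-identityˡ (# U ℕ.* # V ℕ.* # W)))
      empty-size : fromℕ (size₃ F U′ V′ W) ≡ 0ℚ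
      empty-size = cong fromℕ (size₃-const false F U′ V′ W empty)
      helper : ∀ κ → # (cls part i) ℕ.< κ ℕ.* # U → # (cls part i) ℕ.< κ ℕ.* # U′ →
        # (cls part j) ℕ.< κ ℕ.* # V → # (cls part j) ℕ.< κ ℕ.* # V′ → # (cls part k) ℕ.< κ ℕ.* # W →
        1ℚ ≤ (fromℕ (κ ℕ.* κ ℕ.* κ) + fromℕ (κ ℕ.* κ ℕ.* κ)) * ε
      helper κ u u′ v v′ w′ = one≤2εc (vol U V W) (vol U′ V′ W) w d ε (fromℕ (κ ℕ.* κ ℕ.* κ))
        (0<fromℕ {# U ℕ.* # V ℕ.* # W} (proj₂ c₁)) (0<fromℕ {# U′ ℕ.* # V′ ℕ.* # W} (proj₂ c₂)) 0≤ε
        (subst (w ≤_) (fromℕ-* (κ ℕ.* κ ℕ.* κ) (# U ℕ.* # V ℕ.* # W)) (fromℕ-mono (proj₁ c₁)))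
        (subst (w ≤_) (fromℕ-* (κ ℕ.* κ ℕ.* κ) (# U′ ℕ.* # V′ ℕ.* # W)) (fromℕ-mono (proj₁ c₂)))
        (subst (_≤ d * vol U V W + ε * w) full-size (vdisc-≤ ε vd U V W U⊆ V⊆ W⊆))
        (subst (λ a → d * vol U′ V′ W ≤ a + ε * w) empty-size (vdisc-≥ ε vd U′ V′ W U′⊆ V′⊆ W⊆))
        where
        c₁ = cube κ (# (cls part i)) (# (cls part j)) (# (cls part k)) (# U) (# V) (# W) u v w′
        c₂ = cube κ (# (cls part i)) (# (cls part j)) (# (cls part k)) (# U′) (# V′) (# W) u′ v′ w′

  half-true : ∀ {h} (i j : Fin h) → toℕ i ℕ.≤ toℕ j → half i j ≡ true
  half-true i j = dec-true (i Finₚ.≤? j)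

  half-false : ∀ {h} (i j : Fin h) → toℕ j ℕ.< toℕ i → half i j ≡ false
  half-false i j lt = dec-false (i Finₚ.≤? j) (ℕₚ.<⇒≱ lt)

  half-≤ : ∀ {h} (i j : Fin h) → half i j ≡ true → toℕ i ℕ.≤ toℕ j
  half-≤ i j e = does⇒ (i Finₚ.≤? j) e

  -- G is induced on 3hm vertices of H: m copies of each aᵢ and each bⱼ, and hm copies of c. The
  -- half graph is taken with hm copies so that all three sides have the same size; a and b use only
  -- m of them per index. Triples not across the sides are whatever H has there.
  module Pattern {N : ℕ} (H : ThreeGraph N) (X Y Z : Fin N → Bool)
    (X∩Y : ∀ v → X v ≡ true → Y v ≡ true → ⊥) (X∩Z : ∀ v → X v ≡ true → Z v ≡ true → ⊥)
    (Y∩Z : ∀ v → Y v ≡ true → Z v ≡ true → ⊥)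
    (F : Fin N → Fin N → Fin N → Bool) (F-edge : ∀ z x y → F z x y ≡ edge H x y z)
    (h m : ℕ) (1≤h : 1 ℕ.≤ h) (hg : HalfGraph Z X Y F h (h ℕ.* m)) where

    open HalfGraph hg

    n₀ : ℕ
    n₀ = 3 ℕ.* (h ℕ.* m)

    side : Fin n₀ → Fin 3
    side v = proj₁ (remQuot {3} (h ℕ.* m) v)

    inner : Fin n₀ → Fin (h ℕ.* m)
    inner v = proj₂ (remQuot {3} (h ℕ.* m) v)

    group : Fin n₀ → Fin h
    group v = proj₁ (remQuot {h} m (inner v))

    m≤ : m ℕ.≤ h ℕ.* m
    m≤ = ℕₚ.m≤n*m m h {{ℕ.>-nonZero 1≤h}}

    place : Fin 3 → Fin (h ℕ.* m) → Fin N
    place zero u = a (proj₁ (remQuot {h} m u)) (inject≤ (proj₂ (remQuot {h} m u)) m≤)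
    place (suc zero) u = b (proj₁ (remQuot {h} m u)) (inject≤ (proj₂ (remQuot {h} m u)) m≤)
    place (suc (suc zero)) u = c u

    f : Fin n₀ → Fin N
    f v = place (side v) (inner v)

    -- Equal vertices have the same adjacency to every bⱼ. Comparing at j = i′ and at j = i gives i
    -- ≤ i′ and i′ ≤ i.
    row-injective : ∀ i i′ s s′ → a i s ≡ a i′ s′ → i ≡ i′
    row-injective i i′ s s′ e = Finₚ.toℕ-injective (ℕₚ.≤-antisym (half-≤ i i′ (trans (same i′) (half-true i′ i′ ℕₚ.≤-refl)))
        (half-≤ i′ i (trans (sym (same i)) (half-true i i ℕₚ.≤-refl))))
      where
      same : ∀ j → half i j ≡ half i′ j
      same j = trans (sym (edges i j s s s)) (trans (cong (λ x → F (c s) x (b j s)) e) (edges i′ j s′ s s))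

    column-injective : ∀ j j′ t t′ → b j t ≡ b j′ t′ → j ≡ j′
    column-injective j j′ t t′ e = Finₚ.toℕ-injective (ℕₚ.≤-antisym (half-≤ j j′ (trans (sym (same j)) (half-true j j ℕₚ.≤-refl)))
        (half-≤ j′ j (trans (same j′) (half-true j′ j′ ℕₚ.≤-refl))))
      where
      same : ∀ i → half i j ≡ half i j′
      same i = trans (sym (edges i j t t t)) (trans (cong (λ y → F (c t) (a i t) y) e) (edges i j′ t t′ t))

    remQuot-injective : ∀ {p} q (u u′ : Fin (p ℕ.* q)) → proj₁ (remQuot {p} q u) ≡ proj₁ (remQuot {p} q u′) →
      proj₂ (remQuot {p} q u) ≡ proj₂ (remQuot {p} q u′) → u ≡ u′
    remQuot-injective {p} q u u′ e₁ e₂ = trans (sym (Finₚ.combine-remQuot {p} q u))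
      (trans (cong₂ combine e₁ e₂) (Finₚ.combine-remQuot {p} q u′))

    place-injective : ∀ s s′ u u′ → place s u ≡ place s′ u′ → s ≡ s′ × u ≡ u′
    place-injective zero zero u u′ e = refl , remQuot-injective {h} m u u′ same-row
      (Finₚ.inject≤-injective m≤ m≤ (proj₂ (remQuot {h} m u)) (proj₂ (remQuot {h} m u′)) (a-inj _ _ _ (trans e (cong (λ i → a i _) (sym same-row)))))
      where same-row = row-injective _ _ _ _ e
    place-injective (suc zero) (suc zero) u u′ e = refl , remQuot-injective {h} m u u′ same-column
      (Finₚ.inject≤-injective m≤ m≤ (proj₂ (remQuot {h} m u)) (proj₂ (remQuot {h} m u′)) (b-inj _ _ _ (trans e (cong (λ i → b i _) (sym same-column)))))
      where same-column = column-injective _ _ _ _ e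
    place-injective (suc (suc zero)) (suc (suc zero)) u u′ e = refl , c-inj u u′ e
    place-injective zero (suc zero) u u′ e = ⊥-elim (X∩Y _ (a∈ _ _) (subst (λ v → Y v ≡ true) (sym e) (b∈ _ _)))
    place-injective zero (suc (suc zero)) u u′ e = ⊥-elim (X∩Z _ (a∈ _ _) (subst (λ v → Z v ≡ true) (sym e) (c∈ _)))
    place-injective (suc zero) zero u u′ e = ⊥-elim (X∩Y _ (a∈ _ _) (subst (λ v → Y v ≡ true) e (b∈ _ _)))
    place-injective (suc zero) (suc (suc zero)) u u′ e = ⊥-elim (Y∩Z _ (b∈ _ _) (subst (λ v → Z v ≡ true) (sym e) (c∈ _)))
    place-injective (suc (suc zero)) zero u u′ e = ⊥-elim (X∩Z _ (a∈ _ _) (subst (λ v → Z v ≡ true) e (c∈ _)))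
    place-injective (suc (suc zero)) (suc zero) u u′ e = ⊥-elim (Y∩Z _ (b∈ _ _) (subst (λ v → Z v ≡ true) e (c∈ _)))

    f-injective : ∀ {v w} → f v ≡ f w → v ≡ w
    f-injective {v} {w} e = let (s , u) = place-injective (side v) (side w) (inner v) (inner w) e in
      remQuot-injective {3} (h ℕ.* m) v w s u

    G : ThreeGraph n₀
    G = record
      { edge = λ x y z → edge H (f x) (f y) (f z)
      ; swap₁₂ = λ x y z → swap₁₂ H (f x) (f y) (f z)
      ; swap₂₃ = λ x y z → swap₂₃ H (f x) (f y) (f z)
      ; loopless = λ x z → loopless H (f x) (f z)
      }

    A B C : Fin n₀ → Bool
    A v = does (side v Finₚ.≟ zero)
    B v = does (side v Finₚ.≟ suc zero)
    C v = does (side v Finₚ.≟ suc (suc zero))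

    pos : Fin n₀ → ℕ
    pos v = toℕ (group v)

    edge-G : ∀ x y z → A x ≡ true → B y ≡ true → C z ≡ true → edge G x y z ≡ half (group x) (group y)
    edge-G x y z Ax By Cz = trans (cong₃ (edge H)
        (cong (λ s → place s (inner x)) (does⇒ (side x Finₚ.≟ zero) Ax))
        (cong (λ s → place s (inner y)) (does⇒ (side y Finₚ.≟ suc zero) By))
        (cong (λ s → place s (inner z)) (does⇒ (side z Finₚ.≟ suc (suc zero)) Cz)))
      (trans (sym (F-edge _ _ _)) (edges (group x) (group y) _ _ _))
      where
      cong₃ : ∀ (g : Fin N → Fin N → Fin N → Bool) {x x′ y y′ z z′} → x ≡ x′ → y ≡ y′ → z ≡ z′ → g x y z ≡ g x′ y′ z′
      cong₃ g refl refl refl = refl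

    sum-vertices : (φ : Fin 3 → Fin (h ℕ.* m) → ℕ) →
      sum (λ v → φ (side v) (inner v)) ≡ sum (λ s → sum (λ u → φ s u))
    sum-vertices φ = trans (sum-combine 3 {h ℕ.* m} (λ v → φ (side v) (inner v)))
      (sum-cong {3} (λ s → sum-cong {h ℕ.* m} (λ u → cong (λ p → φ (proj₁ p) (proj₂ p)) (Finₚ.remQuot-combine {3} s u))))

    sum-inner : (φ : Fin h → ℕ) → sum (λ u → φ (proj₁ (remQuot {h} m u))) ≡ m ℕ.* sum φ
    sum-inner φ = trans (sum-combine h {m} (λ u → φ (proj₁ (remQuot {h} m u))))
      (trans (sum-cong {h} (λ i → trans (sum-cong {m} (λ u → cong (λ p → φ (proj₁ p)) (Finₚ.remQuot-combine {h} i u))) (sum-const m (φ i))))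
        (sum-*ˡ m φ))

    layer-size : ∀ (s₀ : Fin 3) p → # (λ v → does (side v Finₚ.≟ s₀) ∧ (pos v ℕ.≡ᵇ p)) ≡ m ℕ.* sum {h} (λ i → ⟦ toℕ i ℕ.≡ᵇ p ⟧)
    layer-size s₀ p = begin
      # (λ v → does (side v Finₚ.≟ s₀) ∧ (pos v ℕ.≡ᵇ p))
        ≡⟨ sum-vertices (λ s u → ⟦ does (s Finₚ.≟ s₀) ∧ (toℕ (proj₁ (remQuot {h} m u)) ℕ.≡ᵇ p) ⟧) ⟩
      sum (λ s → # (λ u → does (s Finₚ.≟ s₀) ∧ (toℕ (proj₁ (remQuot {h} m u)) ℕ.≡ᵇ p)))
        ≡⟨ sum-cong (λ s → trans (sum-cong (λ u → ⟦∧⟧ (does (s Finₚ.≟ s₀)) (toℕ (proj₁ (remQuot {h} m u)) ℕ.≡ᵇ p)))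
             (trans (sum-*ˡ ⟦ does (s Finₚ.≟ s₀) ⟧ (λ u → ⟦ toℕ (proj₁ (remQuot {h} m u)) ℕ.≡ᵇ p ⟧))
               (cong (⟦ does (s Finₚ.≟ s₀) ⟧ ℕ.*_) (sum-inner (λ i → ⟦ toℕ i ℕ.≡ᵇ p ⟧))))) ⟩
      sum (λ s → ⟦ does (s Finₚ.≟ s₀) ⟧ ℕ.* L)
        ≡⟨ only s₀ L ⟩
      L ∎
      where
      open ≡-Reasoning
      L = m ℕ.* sum {h} (λ i → ⟦ toℕ i ℕ.≡ᵇ p ⟧)
      only : ∀ (s₀ : Fin 3) L → sum (λ s → ⟦ does (s Finₚ.≟ s₀) ⟧ ℕ.* L) ≡ L
      only zero L = trans (ℕₚ.+-identityʳ _) (ℕₚ.+-identityʳ L)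
      only (suc zero) L = trans (ℕₚ.+-identityʳ _) (ℕₚ.+-identityʳ L)
      only (suc (suc zero)) L = trans (ℕₚ.+-identityʳ _) (ℕₚ.+-identityʳ L)

    layer≤ : ∀ s₀ p → # (λ v → does (side v Finₚ.≟ s₀) ∧ (pos v ℕ.≡ᵇ p)) ℕ.≤ m
    layer≤ s₀ p = ℕₚ.≤-trans (ℕₚ.≤-reflexive (layer-size s₀ p))
      (ℕₚ.≤-trans (ℕₚ.*-monoʳ-≤ m (once h p)) (ℕₚ.≤-reflexive (ℕₚ.*-identityʳ m)))
      where
      once : ∀ h p → sum {h} (λ i → ⟦ toℕ i ℕ.≡ᵇ p ⟧) ℕ.≤ 1
      once zero p = ℕ.z≤n
      once (suc h) zero = ℕ.s≤s (ℕₚ.≤-reflexive (sum-0 h))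
      once (suc h) (suc p) = once h p

    layer≥ : ∀ s₀ (p : Fin h) → m ℕ.≤ # (λ v → does (side v Finₚ.≟ s₀) ∧ (pos v ℕ.≡ᵇ toℕ p))
    layer≥ s₀ p = ℕₚ.≤-trans (ℕₚ.≤-reflexive (sym (ℕₚ.*-identityʳ m)))
      (ℕₚ.≤-trans (ℕₚ.*-monoʳ-≤ m (once h p)) (ℕₚ.≤-reflexive (sym (layer-size s₀ (toℕ p)))))
      where
      once : ∀ h (p : Fin h) → 1 ℕ.≤ sum {h} (λ i → ⟦ toℕ i ℕ.≡ᵇ toℕ p ⟧)
      once (suc h) zero = ℕ.s≤s ℕ.z≤n
      once (suc h) (suc p) = once h p

    C-size : # C ≡ h ℕ.* m
    C-size = trans (sum-vertices (λ s u → ⟦ does (s Finₚ.≟ suc (suc zero)) ⟧))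
      (trans (cong₂ ℕ._+_ (sum-0 (h ℕ.* m)) (cong₂ ℕ._+_ (sum-0 (h ℕ.* m)) (cong (ℕ._+ 0) (trans (sum-const (h ℕ.* m) 1) (ℕₚ.*-identityʳ _)))))
        (ℕₚ.+-identityʳ _))

    pattern-irregular : ∀ {t} T → 1 ℕ.≤ m → 48 ℕ.≤ t → t ℕ.≤ T → h ≡ 8 ℕ.* suc T →
      (part : Fin n₀ → Fin t) → Equi part → Irregular (edge G) part
    pattern-irregular T 1≤m 48≤t t≤T h≡ part equi = irregular (edge G) (swap₁₂ G)
        (λ x y z Ax By Cz le → trans (edge-G x y z Ax By Cz) (half-true (group x) (group y) le))
        (λ x y z Ax By Cz lt → trans (edge-G x y z Ax By Cz) (half-false (group x) (group y) lt))
      where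
      open HalfGraphPartition T m 1≤m 48≤t t≤T part equi h h≡ refl A B C pos (λ v → Finₚ.toℕ<n (group v))
        (layer≤ zero) (layer≤ (suc zero)) (layer≥ zero) (layer≥ (suc zero)) C-size

  equipartition⇒Equi : ∀ {t} (part : Fin n → Fin t) → IsEquipartition part → Equi part
  equipartition⇒Equi part eq i j = subst₂ (λ a b → a ℕ.≤ b ℕ.+ 1) (∣tabulate∣ (cls part i)) (∣tabulate∣ (cls part j)) (eq i j)

  no-half-graph : ∀ {p} {𝓗 : Property p} → Hereditary 𝓗 → ZeroVdisc₃Error 𝓗 →
    ∃[ h ] ∃[ M ] 1 ℕ.≤ M × (∀ {N} (H : ThreeGraph N) → 𝓗 H → (X Y Z : Fin N → Bool) →
      (∀ v → X v ≡ true → Y v ≡ true → ⊥) → (∀ v → X v ≡ true → Z v ≡ true → ⊥) →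
      (∀ v → Y v ≡ true → Z v ≡ true → ⊥) →
      (F : Fin N → Fin N → Fin N → Bool) → (∀ z x y → F z x y ≡ edge H x y z) →
      HalfGraph Z X Y F h M → ⊥)
  no-half-graph {𝓗 = 𝓗} hereditary zero-error = pack (zero-error ε₀ 48 ε₀>0 (ℕ.s≤s ℕ.z≤n))
    where
    ε₀ : ℚ
    -- 442368 = 4 · 48³, so ε₀ is half of the least ε that `irregular-bound` allows.
    ε₀ = + 1 ℚ./ 442368
    ε₀>0 : 0ℚ < ε₀
    ε₀>0 = from-yes (0ℚ ℚₚ.<? ε₀)
    ε₀-small : (fromℕ 110592 + fromℕ 110592) * ε₀ < 1ℚ
    ε₀-small = from-yes ((fromℕ 110592 + fromℕ 110592) * ε₀ ℚₚ.<? 1ℚ)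
    pack : _ → _
    pack (T , N₀ , partition) = h , h ℕ.* m , 1≤M , contradiction
      where
      -- T bounds the number of parts for graphs of every size, so the length of the half graph may
      -- be chosen after T. Then m = N₀ + 1 makes the blow-up large enough to be partitioned.
      h = 8 ℕ.* suc T
      m = suc N₀
      1≤h : 1 ℕ.≤ h
      1≤h = ℕ.s≤s ℕ.z≤n
      1≤M : 1 ℕ.≤ h ℕ.* m
      1≤M = ℕₚ.*-mono-≤ {1} {h} {1} {m} 1≤h (ℕ.s≤s ℕ.z≤n)
      contradiction : _
      contradiction H H∈𝓗 X Y Z X∩Y X∩Z Y∩Z F F-edge hg = finish (partition G G∈𝓗 big)
        where
        open Pattern H X Y Z X∩Y X∩Z Y∩Z F F-edge h m 1≤h hg
        G∈𝓗 : 𝓗 G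
        G∈𝓗 = hereditary G H f f-injective (λ x y z → refl) H∈𝓗
        big : N₀ ℕ.≤ n₀
        big = ℕₚ.≤-trans (ℕₚ.n≤1+n N₀) (ℕₚ.≤-trans (ℕₚ.m≤n*m m h) (ℕₚ.m≤n*m (h ℕ.* m) 3))
        finish : _ → ⊥
        finish (t , 48≤t , t≤T , part , equi , reg) = ℚₚ.<-irrefl refl (ℚₚ.<-≤-trans ε₀-small
          (irregular-bound ε₀ (edge G) part (ℚₚ.<⇒≤ ε₀>0)
            (pattern-irregular T (ℕ.s≤s ℕ.z≤n) 48≤t t≤T refl part (equipartition⇒Equi part equi))
            (λ i j k dis → vdisc₃⇒Vdisc ε₀ (cls part i) (cls part j) (cls part k) (edge G) (reg i j k dis)) 48 refl))

-- Deviations of degrees from their expected value.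

module Deviations where
  open Counting
  open RowsAndColumns using (dist)
  open Partitions using (#-mono)
  open Rationals
  open Embedding
  open import Defs using (Rel₃)
  open import Data.Bool.Base using (Bool; true; false; _∧_; _xor_)
  open import Data.Fin.Base using (Fin)
  open import Data.Nat.Base as ℕ using (ℕ)
  open import Data.Rational.Base using (ℚ; 0ℚ; 1ℚ; _+_; _*_; _-_; -_; _≤_)

  module Deviation {N : ℕ} (E : Rel₃ N) (B : Fin N → Bool) (d : ℚ) where

    deg : Fin N → Fin N → ℕ
    deg x z = # (λ y → B y ∧ E x y z)

    b : ℚ
    b = card B

    D u : Fin N → Fin N → ℚ
    D x z = ι (deg x z)
    u x z = D x z - d * b

    size₃-deg : ∀ A W → size₃ E A B W ≡ sum (λ z → ⟦ W z ⟧ ℕ.* sum (λ x → ⟦ A x ⟧ ℕ.* deg x z))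
    size₃-deg A W = begin
      sum (λ x → sum (λ y → sum (λ z → ⟦ A x ∧ (B y ∧ (W z ∧ E x y z)) ⟧)))
        ≡⟨ sum-cong (λ x → sum-swap (λ y z → ⟦ A x ∧ (B y ∧ (W z ∧ E x y z)) ⟧)) ⟩
      sum (λ x → sum (λ z → sum (λ y → ⟦ A x ∧ (B y ∧ (W z ∧ E x y z)) ⟧)))
        ≡⟨ sum-swap (λ x z → sum (λ y → ⟦ A x ∧ (B y ∧ (W z ∧ E x y z)) ⟧)) ⟩
      sum (λ z → sum (λ x → sum (λ y → ⟦ A x ∧ (B y ∧ (W z ∧ E x y z)) ⟧)))
        ≡⟨ sum-cong (λ z → trans (sum-cong (λ x → inner x z)) (sum-*ˡ ⟦ W z ⟧ (λ x → ⟦ A x ⟧ ℕ.* deg x z))) ⟩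
      sum (λ z → ⟦ W z ⟧ ℕ.* sum (λ x → ⟦ A x ⟧ ℕ.* deg x z)) ∎
      where
      open ≡-Reasoning
      pt : ∀ a b w e → ⟦ a ∧ (b ∧ (w ∧ e)) ⟧ ≡ ⟦ w ⟧ ℕ.* ⟦ a ⟧ ℕ.* ⟦ b ∧ e ⟧
      pt false b w e = sym (cong (ℕ._* ⟦ b ∧ e ⟧) (ℕₚ.*-zeroʳ ⟦ w ⟧))
      pt true false w e = sym (ℕₚ.*-zeroʳ (⟦ w ⟧ ℕ.* 1))
      pt true true false e = refl
      pt true true true e = sym (ℕₚ.+-identityʳ ⟦ e ⟧)
      inner : ∀ x z → sum (λ y → ⟦ A x ∧ (B y ∧ (W z ∧ E x y z)) ⟧) ≡ ⟦ W z ⟧ ℕ.* (⟦ A x ⟧ ℕ.* deg x z)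
      inner x z = trans (sum-cong (λ y → pt (A x) (B y) (W z) (E x y z)))
        (trans (sum-*ˡ (⟦ W z ⟧ ℕ.* ⟦ A x ⟧) (λ y → ⟦ B y ∧ E x y z ⟧)) (ℕₚ.*-assoc ⟦ W z ⟧ ⟦ A x ⟧ (deg x z)))

    total-u : ∀ A W → ∑ (λ z → [ W z ] * ∑ (λ x → [ A x ] * u x z)) ≡ ι (size₃ E A B W) - d * (card A * b * card W)
    total-u A W = begin
      ∑ (λ z → [ W z ] * ∑ (λ x → [ A x ] * u x z))
        ≡⟨ ∑-cong (λ z → trans (cong ([ W z ] *_) (inner z)) (l₂ [ W z ] (ι (S z)) (c * card A))) ⟩
      ∑ (λ z → [ W z ] * ι (S z) + (c * card A) * [ W z ])
        ≡⟨ ∑-+ (λ z → [ W z ] * ι (S z)) (λ z → (c * card A) * [ W z ]) ⟩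
      ∑ (λ z → [ W z ] * ι (S z)) + ∑ (λ z → (c * card A) * [ W z ])
        ≡⟨ cong₂ _+_
             (trans (∑-cong (λ z → trans (cong (_* ι (S z)) ([]≡ι (W z))) (sym (ι-* ⟦ W z ⟧ (S z))))) (trans (sym (ι-sum (λ z → ⟦ W z ⟧ ℕ.* S z))) (cong ι (sym (size₃-deg A W)))))
             (trans (∑-*ˡ (c * card A) (λ z → [ W z ])) (cong (c * card A *_) (sym (card-∑ W)))) ⟩
      ι (size₃ E A B W) + c * card A * card W
        ≡⟨ l₃ (ι (size₃ E A B W)) d b (card A) (card W) ⟩
      ι (size₃ E A B W) - d * (card A * b * card W)
        ∎
      where
      open ≡-Reasoning
      c : ℚ
      c = - (d * b)
      S : Fin N → ℕ
      S z = sum (λ x → ⟦ A x ⟧ ℕ.* deg x z)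
      l₁ : ∀ a e db → a * (e - db) ≡ a * e + (- db) * a
      l₁ = RS.solve-∀ ℚ-ring
      l₂ : ∀ w s c → w * (s + c) ≡ w * s + c * w
      l₂ = RS.solve-∀ ℚ-ring
      l₃ : ∀ s d b a w → s + (- (d * b)) * a * w ≡ s - d * (a * b * w)
      l₃ = RS.solve-∀ ℚ-ring
      inner : ∀ z → ∑ (λ x → [ A x ] * u x z) ≡ ι (S z) + c * card A
      inner z = begin
        ∑ (λ x → [ A x ] * u x z)
          ≡⟨ ∑-cong (λ x → l₁ [ A x ] (D x z) (d * b)) ⟩
        ∑ (λ x → [ A x ] * D x z + c * [ A x ])
          ≡⟨ ∑-+ (λ x → [ A x ] * D x z) (λ x → c * [ A x ]) ⟩
        ∑ (λ x → [ A x ] * D x z) + ∑ (λ x → c * [ A x ])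
          ≡⟨ cong₂ _+_
               (trans (∑-cong (λ x → trans (cong (_* ι (deg x z)) ([]≡ι (A x))) (sym (ι-* ⟦ A x ⟧ (deg x z))))) (sym (ι-sum (λ x → ⟦ A x ⟧ ℕ.* deg x z))))
               (trans (∑-*ˡ c (λ x → [ A x ])) (cong (c *_) (sym (card-∑ A)))) ⟩
        ι (S z) + c * card A ∎

    deg≤ : ∀ x z → D x z ≤ b
    deg≤ x z = ι-mono (#-mono (λ y e → proj₁ (∧-elim {B y} e)))

    module _ (0≤d : 0ℚ ≤ d) (d≤1 : d ≤ 1ℚ) where

      u≤b : ∀ x z → u x z ≤ b
      u≤b x z = 0≤⇒≤ ((b - D x z) + d * b) (0≤+ (≤⇒0≤ (deg≤ x z)) (0≤* 0≤d (0≤card B))) (l b (D x z) d)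
        where
        l : ∀ b D d → b - (D - d * b) ≡ (b - D) + d * b
        l = RS.solve-∀ ℚ-ring

      -b≤u : ∀ x z → - b ≤ u x z
      -b≤u x z = 0≤⇒≤ (D x z + (1ℚ - d) * b) (0≤+ (0≤ι (deg x z)) (0≤* (≤⇒0≤ d≤1) (0≤card B))) (l b (D x z) d)
        where
        l : ∀ b D d → (D - d * b) - - b ≡ D + (1ℚ - d) * b
        l = RS.solve-∀ ℚ-ring

    -- The deviations summed along the neighbourhood of (y, z) in X. If the sum is large, this
    -- neighbourhood is a set on which the degrees into B are too big.
    h : (Fin N → Bool) → Fin N → Fin N → ℚ
    h X y z = ∑ (λ x → [ X x ∧ E x y z ] * u x z)

    h≤ : 0ℚ ≤ d → d ≤ 1ℚ → ∀ X y z → h X y z ≤ card X * b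
    h≤ 0≤d d≤1 X y z = subst (h X y z ≤_) (∑-card X b) (∑-mono (λ x → pt (X x) (E x y z) (u≤b 0≤d d≤1 x z)))
      where
      pt : ∀ a e {v} → v ≤ b → [ a ∧ e ] * v ≤ [ a ] * b
      pt true true le = *-monoˡ [ true ] (0≤[] true) le
      pt true false {v} le = subst₂ _≤_ (sym (trans (cong (_* v) [false]) (ℚₚ.*-zeroˡ v)))
        (sym (trans (cong (_* b) [true]) (ℚₚ.*-identityˡ b))) (0≤card B)
      pt false e {v} le rewrite [false] = ℚₚ.≤-reflexive (trans (ℚₚ.*-zeroˡ v) (sym (ℚₚ.*-zeroˡ b)))

    -- After exchanging the sums, u x z is counted once for each neighbour of (x, z) in B, that is u
    -- x z + d b times. This is where the second moment of u appears.
    total-h : ∀ X (W : Fin N → Bool) → ∑ (λ z → [ W z ] * ∑ (λ y → [ B y ] * h X y z)) ≡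
      ∑ (λ z → [ W z ] * ∑ (λ x → [ X x ] * (u x z * u x z))) + d * b * ∑ (λ z → [ W z ] * ∑ (λ x → [ X x ] * u x z))
    total-h X W = begin
      ∑ (λ z → [ W z ] * ∑ (λ y → [ B y ] * h X y z))
        ≡⟨ ∑-cong (λ z → trans (cong ([ W z ] *_) (slice z)) (l₃ [ W z ] (S₂ z) (d * b) (S₁ z))) ⟩
      ∑ (λ z → [ W z ] * S₂ z + d * b * ([ W z ] * S₁ z))
        ≡⟨ ∑-+ (λ z → [ W z ] * S₂ z) (λ z → d * b * ([ W z ] * S₁ z)) ⟩
      ∑ (λ z → [ W z ] * S₂ z) + ∑ (λ z → d * b * ([ W z ] * S₁ z))
        ≡⟨ cong (∑ (λ z → [ W z ] * S₂ z) +_) (∑-*ˡ (d * b) (λ z → [ W z ] * S₁ z)) ⟩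
      ∑ (λ z → [ W z ] * S₂ z) + d * b * ∑ (λ z → [ W z ] * S₁ z) ∎
      where
      open ≡-Reasoning
      S₁ S₂ : Fin N → ℚ
      S₁ z = ∑ (λ x → [ X x ] * u x z)
      S₂ z = ∑ (λ x → [ X x ] * (u x z * u x z))
      l₁ : ∀ β χ ε v → β * ((χ * ε) * v) ≡ χ * v * (β * ε)
      l₁ = RS.solve-∀ ℚ-ring
      l₂ : ∀ χ D db → χ * (D - db) * D ≡ χ * ((D - db) * (D - db)) + db * (χ * (D - db))
      l₂ = RS.solve-∀ ℚ-ring
      l₃ : ∀ w s₂ db s₁ → w * (s₂ + db * s₁) ≡ w * s₂ + db * (w * s₁)
      l₃ = RS.solve-∀ ℚ-ring
      slice : ∀ z → ∑ (λ y → [ B y ] * h X y z) ≡ S₂ z + d * b * S₁ z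
      slice z = begin
        ∑ (λ y → [ B y ] * h X y z)
          ≡⟨ ∑-cong (λ y → sym (∑-*ˡ [ B y ] (λ x → [ X x ∧ E x y z ] * u x z))) ⟩
        ∑ (λ y → ∑ (λ x → [ B y ] * ([ X x ∧ E x y z ] * u x z)))
          ≡⟨ ∑-swap (λ y x → [ B y ] * ([ X x ∧ E x y z ] * u x z)) ⟩
        ∑ (λ x → ∑ (λ y → [ B y ] * ([ X x ∧ E x y z ] * u x z)))
          ≡⟨ ∑-cong (λ x → trans (∑-cong (λ y → trans (cong (λ e → [ B y ] * (e * u x z)) ([∧] (X x) (E x y z)))
               (trans (l₁ [ B y ] [ X x ] [ E x y z ] (u x z)) (cong ([ X x ] * u x z *_) (sym ([∧] (B y) (E x y z)))))))
               (trans (∑-*ˡ ([ X x ] * u x z) (λ y → [ B y ∧ E x y z ])) (cong ([ X x ] * u x z *_) (sym (card-∑ (λ y → B y ∧ E x y z)))))) ⟩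
        ∑ (λ x → [ X x ] * u x z * D x z)
          ≡⟨ ∑-cong (λ x → l₂ [ X x ] (D x z) (d * b)) ⟩
        ∑ (λ x → [ X x ] * (u x z * u x z) + d * b * ([ X x ] * u x z))
          ≡⟨ ∑-+ (λ x → [ X x ] * (u x z * u x z)) (λ x → d * b * ([ X x ] * u x z)) ⟩
        S₂ z + ∑ (λ x → d * b * ([ X x ] * u x z))
          ≡⟨ cong (S₂ z +_) (∑-*ˡ (d * b) (λ x → [ X x ] * u x z)) ⟩
        S₂ z + d * b * S₁ z ∎

    -- Replacing the neighbourhood of (y, z) by that of (y, z₁) changes the sum only at the vertices
    -- where they differ, by at most b at each.
    h-stable : 0ℚ ≤ d → d ≤ 1ℚ → ∀ X y z₁ z →
      h X y z ≤ ∑ (λ x → [ X x ∧ E x y z₁ ] * u x z) + ι (dist X (λ x → E x y z₁) (λ x → E x y z)) * b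
    h-stable 0≤d d≤1 X y z₁ z = subst (h X y z ≤_) eq (∑-mono (λ x → pt (X x) (E x y z₁) (E x y z) (u x z) (u≤b 0≤d d≤1 x z) (-b≤u 0≤d d≤1 x z)))
      where
      open ≡-Reasoning
      eq : ∑ (λ x → [ X x ∧ E x y z₁ ] * u x z + [ X x ∧ (E x y z₁ xor E x y z) ] * b) ≡
        ∑ (λ x → [ X x ∧ E x y z₁ ] * u x z) + ι (dist X (λ x → E x y z₁) (λ x → E x y z)) * b
      eq = trans (∑-+ (λ x → [ X x ∧ E x y z₁ ] * u x z) (λ x → [ X x ∧ (E x y z₁ xor E x y z) ] * b))
        (cong (∑ (λ x → [ X x ∧ E x y z₁ ] * u x z) +_) (∑-card (λ x → X x ∧ (E x y z₁ xor E x y z)) b))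
      l₁ : ∀ v b → 1ℚ * v + 0ℚ * b - 1ℚ * v ≡ 0ℚ
      l₁ = RS.solve-∀ ℚ-ring
      l₂ : ∀ v b → 1ℚ * v + 1ℚ * b - 0ℚ * v ≡ v - - b
      l₂ = RS.solve-∀ ℚ-ring
      l₃ : ∀ v b → 0ℚ * v + 1ℚ * b - 1ℚ * v ≡ b - v
      l₃ = RS.solve-∀ ℚ-ring
      l₄ : ∀ v b → 0ℚ * v + 0ℚ * b - 0ℚ * v ≡ 0ℚ
      l₄ = RS.solve-∀ ℚ-ring
      pt : ∀ χ e₁ e v → v ≤ b → - b ≤ v → [ χ ∧ e ] * v ≤ [ χ ∧ e₁ ] * v + [ χ ∧ (e₁ xor e) ] * b
      pt true true true v p q rewrite [true] | [false] = 0≤⇒≤ 0ℚ ℚₚ.≤-refl (l₁ v b)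
      pt true true false v p q rewrite [true] | [false] = 0≤⇒≤ (v - - b) (≤⇒0≤ q) (l₂ v b)
      pt true false true v p q rewrite [true] | [false] = 0≤⇒≤ (b - v) (≤⇒0≤ p) (l₃ v b)
      pt true false false v p q rewrite [false] = 0≤⇒≤ 0ℚ ℚₚ.≤-refl (l₄ v b)
      pt false e₁ e v p q rewrite [false] = 0≤⇒≤ 0ℚ ℚₚ.≤-refl (l₄ v b)

-- A box of increased density.

module DensityIncrement where
  open Counting
  open RowsAndColumns using (close; dist)
  open ClusterLemma using (closePairs)
  open Partitions using (#-mono; #-cong; does⇒)
  open HalfGraphPartitions using (_⊆ᵇ_)
  open Averaging
  open Rationals
  open Embedding
  open Deviations
  open import Defs using (Rel₃)
  open import Data.Bool.Base using (Bool; true; false; T; _∧_; not)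
  open import Data.Fin.Base using (Fin; zero; suc)
  open import Data.Nat.Base as ℕ using (ℕ; zero; suc)
  open import Data.Rational.Base using (ℚ; 0ℚ; 1ℚ; _+_; _*_; _-_; -_; _≤_; _<_)

  square-large : ∀ {b v} → 0ℚ ≤ b → b ≤ v ⊎ b ≤ - v → b * b ≤ v * v
  square-large {b} {v} 0≤b (inj₁ p) = *-mono 0≤b (ℚₚ.≤-trans 0≤b p) p p
  square-large {b} {v} 0≤b (inj₂ p) = subst (b * b ≤_) (l v) (*-mono 0≤b (ℚₚ.≤-trans 0≤b p) p p)
    where
    l : ∀ v → - v * - v ≡ v * v
    l = RS.solve-∀ ℚ-ring

  -- For a typical pair (x₀, z₀), the neighbourhood in Y of (x₀, z) is for all z in a
  -- large set W almost equal to B or to Y ∖ B, with |B| ≥ |Y| / 2.  So it is that of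
  -- (x, z), for z ∈ W and many x.  The deviation u x z of the degree of (x, z) into B from
  -- d |B| therefore has a large second moment, and so Σₓ E x y z · u x z is large for many
  -- (y, z) ∈ B × W.  For a typical such pair (y₀, z₁), the neighbourhood A in X of (y₀, z₁)
  -- is almost that of (y₀, z) for all z in a large W′ ⊆ W, so A × B × W′ is too dense.
  module Increment {N : ℕ} (X Y Z : Fin N → Bool) (E : Rel₃ N) (d ε : ℚ)
    (0≤d : 0ℚ ≤ d) (d≤1 : d ≤ 1ℚ) (0≤ε : 0ℚ ≤ ε)
    (reg≥ : ∀ A B C → A ⊆ᵇ X → B ⊆ᵇ Y → C ⊆ᵇ Z →
      d * (card A * card B * card C) ≤ ι (size₃ E A B C) + ε * (card X * card Y * card Z))
    (reg≤ : ∀ A B C → A ⊆ᵇ X → B ⊆ᵇ Y → C ⊆ᵇ Z →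
      ι (size₃ E A B C) ≤ d * (card A * card B * card C) + ε * (card X * card Y * card Z))
    (w k₁ k₂ k₃ e θ e₃ : ℕ) (e≡ : e ≡ 8 ℕ.* w)
    (θ≡ : ι θ ≡ (ι k₁ + ι k₁) * ((ι w + ι w) * (ι w + ι w))) (e₃≡ : e₃ ≡ 4 ℕ.* θ ℕ.+ 4 ℕ.* θ)
    (sparse : 1ℚ ≤ ι w * d) (dense : 1ℚ ≤ ι w * (1ℚ - d))
    (0<X : 0 ℕ.< # X) (0<Y : 0 ℕ.< # Y) (0<Z : 0 ℕ.< # Z)
    (cl₁ : # Z ℕ.* (# X ℕ.* # X) ℕ.≤ k₁ ℕ.* closePairs Z Y (λ z x y → E x y z) (λ _ x → X x) e)
    (cl₂ : ∀ (R : Fin N → Fin N → Bool) → (∀ x z → R x z ≡ true → Z z ≡ true) →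
      # X ℕ.* # Z ℕ.≤ (2 ℕ.* k₁) ℕ.* sum (λ x → ⟦ X x ⟧ ℕ.* # (R x)) →
      # X ℕ.* (# Z ℕ.* # Z) ℕ.≤ k₂ ℕ.* closePairs X Y (λ x z y → E x y z) R e)
    (cl₃ : ∀ (R : Fin N → Fin N → Bool) → (∀ y z → R y z ≡ true → Z z ≡ true) →
      # Y ℕ.* # Z ℕ.≤ (2 ℕ.* k₂ ℕ.* (4 ℕ.* θ)) ℕ.* sum (λ y → ⟦ Y y ⟧ ℕ.* # (R y)) →
      # Y ℕ.* (# Z ℕ.* # Z) ℕ.≤ k₃ ℕ.* closePairs Y X (λ y z x → E x y z) R e₃)
    (ε-small₁ : ((ι θ + ι θ) + (ι θ + ι θ)) * ε * ι k₂ ≤ 1ℚ)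
    (ε-small₂ : (ι (4 ℕ.* θ) + ι (4 ℕ.* θ)) * ε * (ι k₃ + ι k₃) < 1ℚ) where

    n₁ V : ℚ
    n₁ = card X
    V = card X * card Y * card Z

    ball : Fin N → Fin N → ℕ
    ball z x = # (λ x′ → X x′ ∧ close e Y (λ y → E x y z) (λ y → E x′ y z))

    -- Dense in X × Z by the first clustering. The three clusterings compare x's in slices of z,
    -- then z's in slices of x (both through their neighbourhoods in Y), then z's in slices of y
    -- (through their neighbourhoods in X).
    R₂ : Fin N → Fin N → Bool
    R₂ x z = Z z ∧ (# X ℕ.≤ᵇ 2 ℕ.* k₁ ℕ.* ball z x)

    module First (x₀ z₀ : Fin N) (R₂-z₀ : R₂ x₀ z₀ ≡ true) (s : Bool)
      (majority-s : # Y ℕ.≤ 2 ℕ.* # (λ y → Y y ∧ (E x₀ y z₀ ≐ s)))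
      (W-large : # Z ℕ.≤ k₂ ℕ.* # (λ z → R₂ x₀ z ∧ close e Y (λ y → E x₀ y z₀) (λ y → E x₀ y z))) where

      W B : Fin N → Bool
      W z = R₂ x₀ z ∧ close e Y (λ y → E x₀ y z₀) (λ y → E x₀ y z)
      B y = Y y ∧ (E x₀ y z₀ ≐ s)

      open Deviation E B d

      ν : ℚ
      ν = card W

      W⊆Z : W ⊆ᵇ Z
      W⊆Z z t = proj₁ (∧-elim (proj₁ (∧-elim {R₂ x₀ z} t)))

      B⊆Y : B ⊆ᵇ Y
      B⊆Y y t = proj₁ (∧-elim t)

      0≤b : 0ℚ ≤ b
      0≤b = 0≤card B

      mis : Fin N → Fin N → ℕ
      mis x z = # (λ y → B y ∧ not (E x y z ≐ s))

      -- The choice e = 8w turns the bound 4b / e of `disagreement` into b / 2w.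
      mis-small : ∀ x z → W z ≡ true → close e Y (λ y → E x₀ y z) (λ y → E x y z) ≡ true →
        (ι w + ι w) * ι (mis x z) ≤ b
      mis-small x z Wz c = subst (_≤ b) (trans (ι-* (w ℕ.+ w) (mis x z)) (cong (_* ι (mis x z)) (ι-+ w w)))
        (ι-mono (ℕₚ.*-cancelˡ-≤ 4 (ℕₚ.≤-trans (ℕₚ.≤-reflexive (trans (l w (mis x z)) (cong (ℕ._* mis x z) (sym e≡))))
          (disagreement e Y (λ y → E x₀ y z₀) (λ y → E x₀ y z) (λ y → E x y z) s (proj₂ (∧-elim {R₂ x₀ z} Wz)) c majority-s))))
        where
        l : ∀ w m → 4 ℕ.* ((w ℕ.+ w) ℕ.* m) ≡ 8 ℕ.* w ℕ.* m
        l = ℕ-Solver.solve-∀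

      deg-mis : ∀ s′ → s ≡ s′ → ∀ x z → (D x z ≡ b - ι (mis x z) × s ≡ true) ⊎ D x z ≡ ι (mis x z)
      deg-mis true refl x z = inj₁ (trans (l (D x z) (ι (mis x z))) (cong (_- ι (mis x z)) (trans (sym (ι-+ (deg x z) (mis x z))) (cong ι total))) , refl)
        where
        l : ∀ D M → D ≡ (D + M) - M
        l = RS.solve-∀ ℚ-ring
        pt : ∀ b e → ⟦ b ∧ e ⟧ ℕ.+ ⟦ b ∧ not (e ≐ true) ⟧ ≡ ⟦ b ⟧
        pt false e = refl
        pt true true = refl
        pt true false = refl
        total : deg x z ℕ.+ mis x z ≡ # B
        total = trans (sym (sum-+ (λ y → ⟦ B y ∧ E x y z ⟧) (λ y → ⟦ B y ∧ not (E x y z ≐ true) ⟧)))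
          (sum-cong (λ y → pt (B y) (E x y z)))
      deg-mis false refl x z = inj₂ (cong ι (#-cong (λ y → pt (B y) (E x y z))))
        where
        pt : ∀ b e → b ∧ e ≡ b ∧ not (e ≐ false)
        pt false e = refl
        pt true true = refl
        pt true false = refl

      -- If s is true, u ≥ (1 - d) b - b / 2w ≥ b / 2w; if s is false, -u ≥ d b - b / 2w ≥ b / 2w.
      -- Squaring treats both cases alike.
      u-large : ∀ x z → W z ≡ true → close e Y (λ y → E x₀ y z) (λ y → E x y z) ≡ true →
        b * b ≤ ((ι w + ι w) * u x z) * ((ι w + ι w) * u x z)
      u-large x z Wz c = square-large 0≤b (cases (deg-mis s refl x z))
        where
        τ = ι w
        M = ι (mis x z)
        M-small = mis-small x z Wz c
        l₁ : ∀ τ b M d → (τ + τ) * ((b - M) - d * b) - b ≡ (b - (τ + τ) * M) + ((τ * (1ℚ - d) - 1ℚ) * b + (τ * (1ℚ - d) - 1ℚ) * b)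
        l₁ = RS.solve-∀ ℚ-ring
        l₂ : ∀ τ b M d → - ((τ + τ) * (M - d * b)) - b ≡ (b - (τ + τ) * M) + ((τ * d - 1ℚ) * b + (τ * d - 1ℚ) * b)
        l₂ = RS.solve-∀ ℚ-ring
        cases : (D x z ≡ b - M × s ≡ true) ⊎ D x z ≡ M → b ≤ (τ + τ) * u x z ⊎ b ≤ - ((τ + τ) * u x z)
        cases (inj₁ (eq , _)) = inj₁ (subst (λ v → b ≤ (τ + τ) * (v - d * b)) (sym eq)
          (0≤⇒≤ ((b - (τ + τ) * M) + ((τ * (1ℚ - d) - 1ℚ) * b + (τ * (1ℚ - d) - 1ℚ) * b))
            (0≤+ (≤⇒0≤ M-small) (0≤+ (0≤* (≤⇒0≤ dense) 0≤b) (0≤* (≤⇒0≤ dense) 0≤b))) (l₁ τ b M d)))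
        cases (inj₂ eq) = inj₂ (subst (λ v → b ≤ - ((τ + τ) * (v - d * b))) (sym eq)
          (0≤⇒≤ ((b - (τ + τ) * M) + ((τ * d - 1ℚ) * b + (τ * d - 1ℚ) * b))
            (0≤+ (≤⇒0≤ M-small) (0≤+ (0≤* (≤⇒0≤ sparse) 0≤b) (0≤* (≤⇒0≤ sparse) 0≤b))) (l₂ τ b M d)))

      S₂ : Fin N → ℚ
      S₂ z = ∑ (λ x → [ X x ] * (u x z * u x z))

      P Q κ₂ κ₃ : ℚ
      P = ι θ
      Q = ι (4 ℕ.* θ)
      κ₂ = ι k₂
      κ₃ = ι k₃

      0≤P : 0ℚ ≤ P
      0≤P = 0≤ι θ

      Q≡ : Q ≡ (P + P) + (P + P)
      Q≡ = trans (cong ι (l θ)) (trans (ι-+ (θ ℕ.+ θ) (θ ℕ.+ θ)) (cong₂ _+_ (ι-+ θ θ) (ι-+ θ θ)))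
        where
        l : ∀ θ → 4 ℕ.* θ ≡ (θ ℕ.+ θ) ℕ.+ (θ ℕ.+ θ)
        l = ℕ-Solver.solve-∀

      -- At least n₁ / 2k₁ vertices x are close to x₀ in the slice z, and each contributes at least
      -- (b / 2w)². This makes n₁ b² / θ with θ = 8 k₁ w².
      variance : ∀ z → W z ≡ true → n₁ * (b * b) ≤ P * S₂ z
      variance z Wz = subst (λ p → n₁ * (b * b) ≤ p * S₂ z) (sym θ≡) (ℚₚ.≤-trans
          (*-monoʳ (b * b) (0≤-square b) n₁≤)
          (subst₂ _≤_ (sym (ℚₚ.*-assoc (κ + κ) (card A) (b * b))) (sym (ℚₚ.*-assoc (κ + κ) t (S₂ z)))
            (*-monoˡ (κ + κ) (0≤+ (0≤ι k₁) (0≤ι k₁)) on-ball)))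
        where
        κ = ι k₁
        τ = ι w
        t = (τ + τ) * (τ + τ)
        A : Fin N → Bool
        A x = X x ∧ close e Y (λ y → E x₀ y z) (λ y → E x y z)
        n₁≤ : n₁ ≤ (κ + κ) * card A
        n₁≤ = subst (n₁ ≤_) (trans (ι-* (2 ℕ.* k₁) (# A)) (cong (_* card A) (trans (cong ι (l k₁)) (ι-+ k₁ k₁))))
          (ι-mono (ℕₚ.≤ᵇ⇒≤ (# X) (2 ℕ.* k₁ ℕ.* # A) (≡⇒T (proj₂ (∧-elim {Z z} (proj₁ (∧-elim {R₂ x₀ z} Wz)))))))
          where
          l : ∀ k → 2 ℕ.* k ≡ k ℕ.+ k
          l = ℕ-Solver.solve-∀
        l₁ : ∀ χ τ u → χ * (((τ + τ) * u) * ((τ + τ) * u)) ≡ ((τ + τ) * (τ + τ)) * (χ * (u * u))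
        l₁ = RS.solve-∀ ℚ-ring
        on-ball : card A * (b * b) ≤ t * S₂ z
        on-ball = subst₂ _≤_ (∑-card A (b * b))
          (trans (∑-cong (λ x → l₁ [ X x ] τ (u x z))) (∑-*ˡ t (λ x → [ X x ] * (u x z * u x z))))
          (∑-mono pt)
          where
          pt : ∀ x → [ A x ] * (b * b) ≤ [ X x ] * (((τ + τ) * u x z) * ((τ + τ) * u x z))
          pt x = go (X x) (close e Y (λ y → E x₀ y z) (λ y → E x y z)) refl
            where
            v = (τ + τ) * u x z
            go : ∀ χ c → close e Y (λ y → E x₀ y z) (λ y → E x y z) ≡ c → [ χ ∧ c ] * (b * b) ≤ [ χ ] * (v * v)
            go true true eq = *-monoˡ [ true ] (0≤[] true) (u-large x z Wz eq)
            go true false eq = subst (_≤ [ true ] * (v * v)) (sym (trans (cong (_* (b * b)) [false]) (ℚₚ.*-zeroˡ (b * b))))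
              (0≤* (0≤[] true) (0≤-square v))
            go false c eq = ℚₚ.≤-reflexive (trans (cong (_* (b * b)) [false]) (trans (ℚₚ.*-zeroˡ (b * b))
              (sym (trans (cong (_* (v * v)) [false]) (ℚₚ.*-zeroˡ (v * v))))))

      T₂ T₁ TH : ℚ
      T₂ = ∑ (λ z → [ W z ] * S₂ z)
      T₁ = ∑ (λ z → [ W z ] * ∑ (λ x → [ X x ] * u x z))
      TH = ∑ (λ z → [ W z ] * ∑ (λ y → [ B y ] * h X y z))

      T₂-large : ν * (n₁ * (b * b)) ≤ P * T₂
      T₂-large = subst₂ _≤_ (∑-card W (n₁ * (b * b)))
        (trans (∑-cong (λ z → l [ W z ] P (S₂ z))) (∑-*ˡ P (λ z → [ W z ] * S₂ z)))
        (∑-weighted W variance)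
        where
        l : ∀ w p s → w * (p * s) ≡ p * (w * s)
        l = RS.solve-∀ ℚ-ring

      T₁-large : 0ℚ ≤ T₁ + ε * V
      T₁-large = subst (λ t → 0ℚ ≤ t + ε * V) (sym (total-u X W))
        (subst (0ℚ ≤_) (l (ι (size₃ E X B W)) (d * (card X * b * card W)) (ε * V))
          (≤⇒0≤ (reg≥ X B W (λ _ t → t) B⊆Y W⊆Z)))
        where
        l : ∀ s v e → (s + e) - v ≡ (s - v) + e
        l = RS.solve-∀ ℚ-ring

      n₂≤ : card Y ≤ b + b
      n₂≤ = subst (card Y ≤_) (trans (cong ι (l (# B))) (ι-+ (# B) (# B))) (ι-mono majority-s)
        where
        l : ∀ k → 2 ℕ.* k ≡ k ℕ.+ k
        l = ℕ-Solver.solve-∀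

      n₃≤ : card Z ≤ κ₂ * ν
      n₃≤ = subst (card Z ≤_) (ι-* k₂ (# W)) (ι-mono W-large)

      V≤ : ∀ {c} → 0ℚ ≤ c → card Z ≤ c → V ≤ n₁ * (b + b) * c
      V≤ {c} 0≤c le = *-mono (0≤* (0≤card X) (0≤card Y)) 0≤c (*-monoˡ n₁ (0≤card X) n₂≤) le

      0≤V : 0ℚ ≤ V
      0≤V = 0≤* (0≤* (0≤card X) (0≤card Y)) (0≤card Z)

      0≤ν : 0ℚ ≤ ν
      0≤ν = 0≤card W

      -- TH = T₂ + d b T₁. The first term is at least ν n₁ b² / θ. Regularity from below bounds the
      -- second by -b ε V, where V ≤ 2 n₁ b κ₂ ν as B and W are large. By `ε-small₁` this loss is at
      -- most half of the gain.
      TH-large : ν * (n₁ * (b * b)) ≤ (P + P) * TH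
      TH-large = 0≤⇒≤
        ((((P * T₂ - ν * (n₁ * (b * b))) + (P * T₂ - ν * (n₁ * (b * b)))) + (P + P) * (d * b) * (T₁ + ε * V))
          + ((P + P) * b * ε * ((1ℚ - d) * V + (n₁ * (b + b) * (κ₂ * ν) - V))
            + ν * (n₁ * (b * b)) * (1ℚ - ((P + P) + (P + P)) * ε * κ₂)))
        (0≤+ (0≤+ (0≤+ (≤⇒0≤ T₂-large) (≤⇒0≤ T₂-large)) (0≤* (0≤* 0≤2P (0≤* 0≤d 0≤b)) T₁-large))
          (0≤+ (0≤* (0≤* (0≤* 0≤2P 0≤b) 0≤ε) (0≤+ (0≤* (≤⇒0≤ d≤1) 0≤V) (≤⇒0≤ (V≤ (0≤* (0≤ι k₂) 0≤ν) n₃≤))))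
            (0≤* (0≤* 0≤ν (0≤* (0≤card X) (0≤-square b))) (≤⇒0≤ ε-small₁))))
        (trans (cong (λ t → (P + P) * t - ν * (n₁ * (b * b))) (total-h X W)) (l P T₂ T₁ d b ε V ν n₁ κ₂))
        where
        0≤2P = 0≤+ 0≤P 0≤P
        l : ∀ P T₂ T₁ d b ε V ν n κ → (P + P) * (T₂ + d * b * T₁) - ν * (n * (b * b)) ≡
          (((P * T₂ - ν * (n * (b * b))) + (P * T₂ - ν * (n * (b * b)))) + (P + P) * (d * b) * (T₁ + ε * V))
          + ((P + P) * b * ε * ((1ℚ - d) * V + (n * (b + b) * (κ * ν) - V))
            + ν * (n * (b * b)) * (1ℚ - ((P + P) + (P + P)) * ε * κ))
        l = RS.solve-∀ ℚ-ring

      R₃ : Fin N → Fin N → Bool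
      R₃ y z = B y ∧ (W z ∧ does (n₁ * b ℚₚ.≤? Q * h X y z))

      R₃-sum : ℕ
      R₃-sum = sum (λ y → # (R₃ y))

      0<#B : 0 ℕ.< # B
      0<#B = positive 0<Y majority-s
        where
        positive : ∀ {a b} → 0 ℕ.< a → a ℕ.≤ 2 ℕ.* b → 0 ℕ.< b
        positive {b = suc b} _ _ = ℕ.s≤s ℕ.z≤n
        positive {b = zero} p q = ⊥-elim (ℕₚ.n≮0 (ℕₚ.<-≤-trans p q))

      0<n₁b : 0ℚ < n₁ * b
      0<n₁b = 0<* (0<ι 0<X) (0<ι 0<#B)

      -- Reverse Markov for the rational and possibly negative values of `h`: their mean over B × W
      -- is at least n₁ b / 2θ, none exceeds n₁ b, and those at pairs outside `R₃` are below n₁ b /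
      -- 4θ.
      R₃-large : ν * b ≤ Q * ι R₃-sum
      R₃-large = *-cancel (n₁ * b) 0<n₁b (0≤⇒≤
        ((Q * (n₁ * b) * γ + n₁ * b * (ν * b) - Q * TH)
          + (((P + P) * TH - ν * (n₁ * (b * b))) + ((P + P) * TH - ν * (n₁ * (b * b)))))
        (0≤+ (≤⇒0≤ upper) (0≤+ (≤⇒0≤ TH-large) (≤⇒0≤ TH-large)))
        (subst (λ q → n₁ * b * (q * γ) - n₁ * b * (ν * b) ≡ (q * (n₁ * b) * γ + n₁ * b * (ν * b) - q * TH)
          + (((P + P) * TH - ν * (n₁ * (b * b))) + ((P + P) * TH - ν * (n₁ * (b * b))))) (sym Q≡) (l P TH ν n₁ b γ)))
        where
        γ = ι R₃-sum
        l : ∀ P T ν n b γ → n * b * (((P + P) + (P + P)) * γ) - n * b * (ν * b) ≡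
          (((P + P) + (P + P)) * (n * b) * γ + n * b * (ν * b) - ((P + P) + (P + P)) * T)
          + (((P + P) * T - ν * (n * (b * b))) + ((P + P) * T - ν * (n * (b * b))))
        l = RS.solve-∀ ℚ-ring
        c : ℚ
        c = Q * (n₁ * b)
        pt : ∀ y z → [ W z ] * ([ B y ] * (Q * h X y z)) ≤ c * [ R₃ y z ] + [ W z ] * ([ B y ] * (n₁ * b))
        pt y z = go (W z) (B y) (n₁ * b ℚₚ.≤? Q * h X y z)
          where
          m₁ : ∀ g c m → c * 1ℚ + 1ℚ * (1ℚ * m) - 1ℚ * (1ℚ * g) ≡ (c - g) + m
          m₁ = RS.solve-∀ ℚ-ring
          m₂ : ∀ g c m → c * 0ℚ + 1ℚ * (1ℚ * m) - 1ℚ * (1ℚ * g) ≡ m - g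
          m₂ = RS.solve-∀ ℚ-ring
          m₃ : ∀ g c m → c * 0ℚ + 1ℚ * (0ℚ * m) - 1ℚ * (0ℚ * g) ≡ 0ℚ
          m₃ = RS.solve-∀ ℚ-ring
          m₄ : ∀ β g c m → c * 0ℚ + 0ℚ * (β * m) - 0ℚ * (β * g) ≡ 0ℚ
          m₄ = RS.solve-∀ ℚ-ring
          ∧-false : ∀ β → [ β ∧ false ] ≡ 0ℚ
          ∧-false true = [false]
          ∧-false false = [false]
          go : ∀ ω β (dec : Dec (n₁ * b ≤ Q * h X y z)) →
            [ ω ] * ([ β ] * (Q * h X y z)) ≤ c * [ β ∧ (ω ∧ does dec) ] + [ ω ] * ([ β ] * (n₁ * b))
          go true true (yes p) rewrite [true] = 0≤⇒≤ ((c - Q * h X y z) + n₁ * b)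
            (0≤+ (≤⇒0≤ (*-monoˡ Q (0≤ι (4 ℕ.* θ)) (h≤ 0≤d d≤1 X y z))) (ℚₚ.<⇒≤ 0<n₁b)) (m₁ (Q * h X y z) c (n₁ * b))
          go true true (no ¬p) rewrite [true] | [false] = 0≤⇒≤ (n₁ * b - Q * h X y z)
            (≤⇒0≤ (ℚₚ.<⇒≤ (ℚₚ.≰⇒> ¬p))) (m₂ (Q * h X y z) c (n₁ * b))
          go true false dec rewrite [true] | [false] = 0≤⇒≤ 0ℚ ℚₚ.≤-refl (m₃ (Q * h X y z) c (n₁ * b))
          go false β dec rewrite [false] | ∧-false β = 0≤⇒≤ 0ℚ ℚₚ.≤-refl (m₄ [ β ] (Q * h X y z) c (n₁ * b))
        l₁ : ∀ w q s → w * (q * s) ≡ q * (w * s)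
        l₁ = RS.solve-∀ ℚ-ring
        γ-sum : ∑ (λ z → ∑ (λ y → [ R₃ y z ])) ≡ γ
        γ-sum = trans (∑-swap (λ z y → [ R₃ y z ]))
          (trans (∑-cong (λ y → sym (card-∑ (R₃ y)))) (sym (ι-sum (λ y → # (R₃ y)))))
        upper : Q * TH ≤ c * γ + n₁ * b * (ν * b)
        upper = subst₂ _≤_ left right (∑-mono (λ z → ∑-mono (λ y → pt y z)))
          where
          open ≡-Reasoning
          left : ∑ (λ z → ∑ (λ y → [ W z ] * ([ B y ] * (Q * h X y z)))) ≡ Q * TH
          left = trans (∑-cong (λ z → trans (∑-*ˡ [ W z ] (λ y → [ B y ] * (Q * h X y z)))
              (trans (cong ([ W z ] *_) (trans (∑-cong (λ y → l₁ [ B y ] Q (h X y z))) (∑-*ˡ Q (λ y → [ B y ] * h X y z))))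
                (l₁ [ W z ] Q (∑ (λ y → [ B y ] * h X y z))))))
            (∑-*ˡ Q (λ z → [ W z ] * ∑ (λ y → [ B y ] * h X y z)))
          l₂ : ∀ ν b m → ν * (b * m) ≡ m * (ν * b)
          l₂ = RS.solve-∀ ℚ-ring
          right : ∑ (λ z → ∑ (λ y → c * [ R₃ y z ] + [ W z ] * ([ B y ] * (n₁ * b)))) ≡ c * γ + n₁ * b * (ν * b)
          right = begin
            ∑ (λ z → ∑ (λ y → c * [ R₃ y z ] + [ W z ] * ([ B y ] * (n₁ * b))))
              ≡⟨ ∑-cong (λ z → trans (∑-+ (λ y → c * [ R₃ y z ]) (λ y → [ W z ] * ([ B y ] * (n₁ * b))))
                   (cong₂ _+_ (∑-*ˡ c (λ y → [ R₃ y z ]))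
                     (trans (∑-*ˡ [ W z ] (λ y → [ B y ] * (n₁ * b))) (cong ([ W z ] *_) (∑-card B (n₁ * b)))))) ⟩
            ∑ (λ z → c * ∑ (λ y → [ R₃ y z ]) + [ W z ] * (b * (n₁ * b)))
              ≡⟨ ∑-+ (λ z → c * ∑ (λ y → [ R₃ y z ])) (λ z → [ W z ] * (b * (n₁ * b))) ⟩
            ∑ (λ z → c * ∑ (λ y → [ R₃ y z ])) + ∑ (λ z → [ W z ] * (b * (n₁ * b)))
              ≡⟨ cong₂ _+_ (trans (∑-*ˡ c (λ z → ∑ (λ y → [ R₃ y z ]))) (cong (c *_) γ-sum))
                   (trans (∑-card W (b * (n₁ * b))) (l₂ ν b (n₁ * b))) ⟩
            c * γ + n₁ * b * (ν * b) ∎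

      R₃⊆Z : ∀ y z → R₃ y z ≡ true → Z z ≡ true
      R₃⊆Z y z t = W⊆Z z (proj₁ (∧-elim (proj₂ (∧-elim {B y} t))))

      R₃-dense : # Y ℕ.* # Z ℕ.≤ (2 ℕ.* k₂ ℕ.* (4 ℕ.* θ)) ℕ.* sum (λ y → ⟦ Y y ⟧ ℕ.* # (R₃ y))
      R₃-dense = begin
        # Y ℕ.* # Z                                     ≤⟨ ℕₚ.*-mono-≤ majority-s W-large ⟩
        2 ℕ.* # B ℕ.* (k₂ ℕ.* # W)                      ≡⟨ l (# B) k₂ (# W) ⟩
        2 ℕ.* k₂ ℕ.* (# W ℕ.* # B)                      ≤⟨ ℕₚ.*-monoʳ-≤ (2 ℕ.* k₂) in-ℕ ⟩
        2 ℕ.* k₂ ℕ.* (4 ℕ.* θ ℕ.* R₃-sum)               ≡⟨ sym (ℕₚ.*-assoc (2 ℕ.* k₂) (4 ℕ.* θ) R₃-sum) ⟩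
        2 ℕ.* k₂ ℕ.* (4 ℕ.* θ) ℕ.* R₃-sum               ≡⟨ cong (2 ℕ.* k₂ ℕ.* (4 ℕ.* θ) ℕ.*_) (sum-cong (λ y → sym (inY y))) ⟩
        2 ℕ.* k₂ ℕ.* (4 ℕ.* θ) ℕ.* sum (λ y → ⟦ Y y ⟧ ℕ.* # (R₃ y)) ∎
        where
        open ℕₚ.≤-Reasoning
        l : ∀ b k w → 2 ℕ.* b ℕ.* (k ℕ.* w) ≡ 2 ℕ.* k ℕ.* (w ℕ.* b)
        l = ℕ-Solver.solve-∀
        in-ℕ : # W ℕ.* # B ℕ.≤ 4 ℕ.* θ ℕ.* R₃-sum
        in-ℕ = ι-cancel (subst₂ _≤_ (sym (ι-* (# W) (# B))) (sym (ι-* (4 ℕ.* θ) R₃-sum)) R₃-large)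
        inY : ∀ y → ⟦ Y y ⟧ ℕ.* # (R₃ y) ≡ # (R₃ y)
        inY y = trans (sym (sum-*ˡ ⟦ Y y ⟧ (λ z → ⟦ R₃ y z ⟧)))
          (sum-cong (λ z → lem (Y y) (R₃ y z) (λ t → B⊆Y y (proj₁ (∧-elim t)))))
          where
          lem : ∀ a b → (b ≡ true → a ≡ true) → ⟦ a ⟧ ℕ.* ⟦ b ⟧ ≡ ⟦ b ⟧
          lem true b _ = ℕₚ.+-identityʳ ⟦ b ⟧
          lem false false _ = refl
          lem false true imp with () ← imp refl

      module Second (y₀ z₁ : Fin N) (R₃-z₁ : R₃ y₀ z₁ ≡ true)
        (W′-large : # Z ℕ.≤ k₃ ℕ.* # (λ z → R₃ y₀ z ∧ close e₃ X (λ x → E x y₀ z₁) (λ x → E x y₀ z))) where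

        W′ A : Fin N → Bool
        W′ z = R₃ y₀ z ∧ close e₃ X (λ x → E x y₀ z₁) (λ x → E x y₀ z)
        A x = X x ∧ E x y₀ z₁

        ν′ : ℚ
        ν′ = card W′

        0<ν′ : 0ℚ < ν′
        0<ν′ = 0<ι (positive (# W′) W′-large)
          where
          positive : ∀ w → # Z ℕ.≤ k₃ ℕ.* w → 0 ℕ.< w
          positive (suc w) _ = ℕ.s≤s ℕ.z≤n
          positive zero le = ⊥-elim (ℕₚ.n≮0 (ℕₚ.<-≤-trans 0<Z (ℕₚ.≤-trans le (ℕₚ.≤-reflexive (ℕₚ.*-zeroʳ k₃)))))

        SA : Fin N → ℚ
        SA z = ∑ (λ x → [ A x ] * u x z)

        -- Fixing the neighbourhood A of (y₀, z₁) in place of that of (y₀, z) costs δ b by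
        -- `h-stable`. As e₃ = 2Q, δ ≤ n₁ / 2Q, so at most half of the lower bound n₁ b / Q for `h`
        -- is lost.
        SA-large : ∀ z → W′ z ≡ true → n₁ * b ≤ (Q + Q) * SA z
        SA-large z W′z = 0≤⇒≤
          ((((Q * H - n₁ * b) + (Q * H - n₁ * b)) + (Q + Q) * ((SA z + δ * b) - H)) + (n₁ - (Q + Q) * δ) * b)
          (0≤+ (0≤+ (0≤+ (≤⇒0≤ H-large) (≤⇒0≤ H-large)) (0≤* (0≤+ 0≤Q 0≤Q) (≤⇒0≤ (h-stable 0≤d d≤1 X y₀ z₁ z)))) (0≤* (≤⇒0≤ δ-small) 0≤b))
          (l Q (SA z) n₁ b H δ)
          where
          H = h X y₀ z
          δ = ι (dist X (λ x → E x y₀ z₁) (λ x → E x y₀ z))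
          0≤Q = 0≤ι (4 ℕ.* θ)
          l : ∀ Q S n b H δ → (Q + Q) * S - n * b ≡
            (((Q * H - n * b) + (Q * H - n * b)) + (Q + Q) * ((S + δ * b) - H)) + (n - (Q + Q) * δ) * b
          l = RS.solve-∀ ℚ-ring
          H-large : n₁ * b ≤ Q * H
          H-large = does⇒ (n₁ * b ℚₚ.≤? Q * H) (proj₂ (∧-elim {W z} (proj₂ (∧-elim {B y₀} (proj₁ (∧-elim {R₃ y₀ z} W′z))))))
          δ-small : (Q + Q) * δ ≤ n₁
          δ-small = subst (_≤ n₁) (trans (ι-* e₃ _) (cong (_* δ) (trans (cong ι e₃≡) (ι-+ (4 ℕ.* θ) (4 ℕ.* θ)))))
            (ι-mono (close⇒ e₃ X (λ x → E x y₀ z₁) (λ x → E x y₀ z) (proj₂ (∧-elim {R₃ y₀ z} W′z))))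

        A⊆X : A ⊆ᵇ X
        A⊆X x t = proj₁ (∧-elim t)

        W′⊆Z : W′ ⊆ᵇ Z
        W′⊆Z z t = R₃⊆Z y₀ z (proj₁ (∧-elim t))

        total-large : ν′ * (n₁ * b) ≤ (Q + Q) * ∑ (λ z → [ W′ z ] * SA z)
        total-large = subst₂ _≤_ (∑-card W′ (n₁ * b))
          (trans (∑-cong (λ z → l [ W′ z ] (Q + Q) (SA z))) (∑-*ˡ (Q + Q) (λ z → [ W′ z ] * SA z)))
          (∑-weighted W′ SA-large)
          where
          l : ∀ w p s → w * (p * s) ≡ p * (w * s)
          l = RS.solve-∀ ℚ-ring

        total-small : ∑ (λ z → [ W′ z ] * SA z) ≤ ε * (n₁ * (b + b) * (κ₃ * ν′))
        total-small = ℚₚ.≤-trans (subst (_≤ ε * V) (sym (total-u A W′))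
            (0≤⇒≤ (d * v + ε * V - ι (size₃ E A B W′)) (≤⇒0≤ (reg≤ A B W′ A⊆X B⊆Y W′⊆Z)) (l (ι (size₃ E A B W′)) (d * v) (ε * V))))
          (*-monoˡ ε 0≤ε (V≤ (0≤* (0≤ι k₃) (0≤card W′)) (subst (card Z ≤_) (ι-* k₃ (# W′)) (ι-mono W′-large))))
          where
          v = card A * b * card W′
          l : ∀ s v e → e - (s - v) ≡ (v + e) - s
          l = RS.solve-∀ ℚ-ring

        -- Regularity from above allows a total deviation of at most ε V on A × B × W′, but
        -- `SA-large` yields ν′ n₁ b / 2Q, which is more by `ε-small₂`.
        impossible : ⊥
        impossible = ℚₚ.<-irrefl refl (ℚₚ.<-≤-trans ε-small₂ (*-cancel (ν′ * (n₁ * b)) (0<* 0<ν′ 0<n₁b)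
          (subst₂ _≤_ (sym (ℚₚ.*-identityʳ (ν′ * (n₁ * b)))) (l Q ε n₁ b κ₃ ν′)
            (ℚₚ.≤-trans total-large (*-monoˡ (Q + Q) (0≤+ (0≤ι (4 ℕ.* θ)) (0≤ι (4 ℕ.* θ))) total-small)))))
          where
          l : ∀ Q ε n b κ ν → (Q + Q) * (ε * (n * (b + b) * (κ * ν))) ≡ ν * (n * b) * ((Q + Q) * ε * (κ + κ))
          l = RS.solve-∀ ℚ-ring

      first-impossible : ⊥
      first-impossible = go (popular Y Z X (λ y z x → E x y z) R₃ e₃ k₃ R₃⊆Z 0<Y 0<Z (cl₃ R₃ R₃⊆Z R₃-dense))
        where
        go : ∃[ y₀ ] ∃[ z₁ ] Y y₀ ≡ true × R₃ y₀ z₁ ≡ true ×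
          # Z ℕ.≤ k₃ ℕ.* # (λ z → R₃ y₀ z ∧ close e₃ X (λ x → E x y₀ z₁) (λ x → E x y₀ z)) → ⊥
        go (y₀ , z₁ , _ , r , large) = Second.impossible y₀ z₁ r large

    R₂⊆Z : ∀ x z → R₂ x z ≡ true → Z z ≡ true
    R₂⊆Z x z t = proj₁ (∧-elim t)

    impossible : ⊥
    impossible = go (popular X Z Y (λ x z y → E x y z) R₂ e k₂ R₂⊆Z 0<X 0<Z (cl₂ R₂ R₂⊆Z
        (swap-density Z X ball k₁ (λ z x → #-mono {N} {λ x′ → X x′ ∧ close e Y (λ y → E x y z) (λ y → E x′ y z)} {X} (λ x′ t → proj₁ (∧-elim {X x′} t))) 0<X cl₁)))
      where
      go : ∃[ x₀ ] ∃[ z₀ ] X x₀ ≡ true × R₂ x₀ z₀ ≡ true ×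
        # Z ℕ.≤ k₂ ℕ.* # (λ z → R₂ x₀ z ∧ close e Y (λ y → E x₀ y z₀) (λ y → E x₀ y z)) → ⊥
      go (x₀ , z₀ , _ , r , large) = go′ (majority Y (λ y → E x₀ y z₀))
        where
        go′ : ∃[ s ] # Y ℕ.≤ 2 ℕ.* # (λ y → Y y ∧ (E x₀ y z₀ ≐ s)) → ⊥
        go′ (s , maj) = First.first-impossible x₀ z₀ r s maj large

-- Regular triples are nearly empty or nearly complete.

module Homogeneity where
  open Counting
  open RowsAndColumns using (HalfGraph)
  open ClusterLemma using (closePairs; cluster)
  open HalfGraphPartitions using (_⊆ᵇ_)
  open ForbiddenHalfGraph using (vol; Vdisc; vdisc-≤; vdisc-≥; no-half-graph)
  open Averaging
  open Rationals
  open Embedding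
  open Deviations
  open DensityIncrement
  open import Defs hiding (P)
  open import Data.Bool.Base using (Bool; true; false; _∧_)
  open import Data.Fin.Base using (Fin; suc)
  open import Data.Nat.Base as ℕ using (ℕ; suc)
  open import Data.Rational.Base using (ℚ; 0ℚ; 1ℚ; _+_; _*_; _-_; -_; _≤_; _<_)

  vol≡ : ∀ {N} (A B C : Fin N → Bool) → vol A B C ≡ card A * card B * card C
  vol≡ A B C = trans (sym (ι≡fromℕ (# A ℕ.* # B ℕ.* # C)))
    (trans (ι-* (# A ℕ.* # B) (# C)) (cong (_* card C) (ι-* (# A) (# B))))

  reciprocal : ∀ c → 1 ℕ.≤ c → ∃[ ε ] 0ℚ < ε × ε * ι c ≡ 1ℚ
  reciprocal c 1≤c = positive (ratio 1ℚ (ι c) (0<ι 1≤c))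
    where
    positive : ∃[ d ] 1ℚ ≡ d * ι c → ∃[ ε ] 0ℚ < ε × ε * ι c ≡ 1ℚ
    positive (d , eq) = d , ℚₚ.≰⇒> (λ d≤0 → ℚₚ.<⇒≢ 0<1 (ℚₚ.≤-antisym (ℚₚ.<⇒≤ 0<1)
        (subst₂ _≤_ (sym eq) (ℚₚ.*-zeroˡ (ι c)) (*-monoʳ (ι c) (0≤ι c) d≤0)))) , sym eq
      where
      0<1 : 0ℚ < 1ℚ
      0<1 = subst (0ℚ <_) ι-1 (0<ι {1} (ℕ.s≤s ℕ.z≤n))

  -- The final ε is 1 / c, where c collects the coefficients in `ε-small₁` and `ε-small₂`; the + 1
  -- makes the second inequality strict. The successor of k₁ keeps θ positive, as `cluster` demands
  -- of the closeness parameter e₃.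
  module Constants (w k₁ : ℕ) where
    θ = 8 ℕ.* suc k₁ ℕ.* (w ℕ.* w)
    g₃ : ℕ → ℕ
    g₃ k₂ = 2 ℕ.* k₂ ℕ.* (4 ℕ.* θ)
    e₃ = 4 ℕ.* θ ℕ.+ 4 ℕ.* θ
    c : ℕ → ℕ → ℕ
    c k₂ k₃ = 4 ℕ.* θ ℕ.* k₂ ℕ.+ 16 ℕ.* θ ℕ.* k₃ ℕ.+ 1

    θ≡ : ι θ ≡ (ι (suc k₁) + ι (suc k₁)) * ((ι w + ι w) * (ι w + ι w))
    θ≡ = trans (cong ι (l (suc k₁) w)) (trans (ι-* (suc k₁ ℕ.+ suc k₁) _)
      (cong₂ _*_ (ι-+ (suc k₁) (suc k₁)) (trans (ι-* (w ℕ.+ w) (w ℕ.+ w)) (cong₂ _*_ (ι-+ w w) (ι-+ w w)))))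
      where
      l : ∀ k w → 8 ℕ.* k ℕ.* (w ℕ.* w) ≡ (k ℕ.+ k) ℕ.* ((w ℕ.+ w) ℕ.* (w ℕ.+ w))
      l = ℕ-Solver.solve-∀

    1≤θ : 1 ℕ.≤ w → 1 ℕ.≤ θ
    1≤θ 1≤w = ℕₚ.*-mono-≤ {1} {8 ℕ.* suc k₁} {1} {w ℕ.* w} (ℕ.s≤s ℕ.z≤n) (ℕₚ.*-mono-≤ {1} {w} {1} {w} 1≤w 1≤w)

    module _ (k₂ k₃ : ℕ) (ε : ℚ) (0<ε : 0ℚ < ε) (ε≡ : ε * ι (c k₂ k₃) ≡ 1ℚ) where

      private
        P = ι θ
        C≡ : ι (c k₂ k₃) ≡ ((P + P) + (P + P)) * ι k₂ +
          (((P + P) + (P + P)) + ((P + P) + (P + P))) * (ι k₃ + ι k₃) + 1ℚ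
        C≡ = trans (cong ι (l θ k₂ k₃)) (trans (ι-+ _ 1) (cong₂ _+_ (trans (ι-+ (f₄ ℕ.* k₂) _)
          (cong₂ _+_ (trans (ι-* f₄ k₂) (cong (_* ι k₂) F₄)) (trans (ι-* (f₄ ℕ.+ f₄) (k₃ ℕ.+ k₃))
            (cong₂ _*_ (trans (ι-+ f₄ f₄) (cong₂ _+_ F₄ F₄)) (ι-+ k₃ k₃))))) ι-1))
          where
          f₄ = (θ ℕ.+ θ) ℕ.+ (θ ℕ.+ θ)
          F₄ : ι f₄ ≡ (P + P) + (P + P)
          F₄ = trans (ι-+ (θ ℕ.+ θ) (θ ℕ.+ θ)) (cong₂ _+_ (ι-+ θ θ) (ι-+ θ θ))
          l : ∀ θ a b → 4 ℕ.* θ ℕ.* a ℕ.+ 16 ℕ.* θ ℕ.* b ℕ.+ 1 ≡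
            ((θ ℕ.+ θ) ℕ.+ (θ ℕ.+ θ)) ℕ.* a ℕ.+ (((θ ℕ.+ θ) ℕ.+ (θ ℕ.+ θ)) ℕ.+ ((θ ℕ.+ θ) ℕ.+ (θ ℕ.+ θ))) ℕ.* (b ℕ.+ b) ℕ.+ 1
          l = ℕ-Solver.solve-∀
        0≤ε = ℚₚ.<⇒≤ 0<ε
        0≤P = 0≤ι θ
        0≤4P = 0≤+ (0≤+ 0≤P 0≤P) (0≤+ 0≤P 0≤P)
        unit : ε * (((P + P) + (P + P)) * ι k₂ +
          (((P + P) + (P + P)) + ((P + P) + (P + P))) * (ι k₃ + ι k₃) + 1ℚ) ≡ 1ℚ
        unit = trans (cong (ε *_) (sym C≡)) ε≡

      ε-small₁ : ((ι θ + ι θ) + (ι θ + ι θ)) * ε * ι k₂ ≤ 1ℚ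
      ε-small₁ = subst (((P + P) + (P + P)) * ε * ι k₂ ≤_) unit (0≤⇒≤
        (ε * ((((P + P) + (P + P)) + ((P + P) + (P + P))) * (ι k₃ + ι k₃)) + ε)
        (0≤+ (0≤* 0≤ε (0≤* (0≤+ 0≤4P 0≤4P) (0≤+ (0≤ι k₃) (0≤ι k₃)))) 0≤ε) (l P ε (ι k₂) (ι k₃)))
        where
        l : ∀ P ε a b → ε * (((P + P) + (P + P)) * a + (((P + P) + (P + P)) + ((P + P) + (P + P))) * (b + b) + 1ℚ)
          - ((P + P) + (P + P)) * ε * a ≡ ε * ((((P + P) + (P + P)) + ((P + P) + (P + P))) * (b + b)) + ε
        l = RS.solve-∀ ℚ-ring

      ε-small₂ : (ι (4 ℕ.* θ) + ι (4 ℕ.* θ)) * ε * (ι k₃ + ι k₃) < 1ℚ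
      ε-small₂ = ℚₚ.≤-<-trans (subst (λ q → (q + q) * ε * (ι k₃ + ι k₃) ≤ 1ℚ - ε) (sym Q≡)
          (subst (λ o → ((4P + 4P) * ε * (ι k₃ + ι k₃)) ≤ o - ε) unit
            (0≤⇒≤ (ε * (4P * ι k₂)) (0≤* 0≤ε (0≤* 0≤4P (0≤ι k₂))) (l P ε (ι k₂) (ι k₃)))))
        (subst (1ℚ - ε <_) (ℚₚ.+-identityʳ 1ℚ) (ℚₚ.+-monoʳ-< 1ℚ (ℚₚ.neg-antimono-< 0<ε)))
        where
        4P = (P + P) + (P + P)
        Q≡ : ι (4 ℕ.* θ) ≡ 4P
        Q≡ = trans (cong ι (l₄ θ)) (trans (ι-+ (θ ℕ.+ θ) (θ ℕ.+ θ)) (cong₂ _+_ (ι-+ θ θ) (ι-+ θ θ)))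
          where
          l₄ : ∀ θ → 4 ℕ.* θ ≡ (θ ℕ.+ θ) ℕ.+ (θ ℕ.+ θ)
          l₄ = ℕ-Solver.solve-∀
        l : ∀ P ε a b → ε * (((P + P) + (P + P)) * a + (((P + P) + (P + P)) + ((P + P) + (P + P))) * (b + b) + 1ℚ) - ε
          - ((((P + P) + (P + P)) + ((P + P) + (P + P))) * ε * (b + b)) ≡ ε * (((P + P) + (P + P)) * a)
        l = RS.solve-∀ ℚ-ring

  Homogeneous : ∀ {N} → ℕ → (X Y Z : Fin N → Bool) → Rel₃ N → Set
  Homogeneous w X Y Z E =
    ι w * ι (size₃ E X Y Z) ≤ card X * card Y * card Z ⊎
    ι w * (card X * card Y * card Z - ι (size₃ E X Y Z)) ≤ card X * card Y * card Z

  size₃≤ : ∀ {N} (E : Rel₃ N) (X Y Z : Fin N → Bool) → size₃ E X Y Z ℕ.≤ # X ℕ.* # Y ℕ.* # Z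
  size₃≤ E X Y Z = ℕₚ.≤-trans
    (sum-mono λ x → sum-mono λ y → sum-mono λ z → pt (X x) (Y y) (Z z) (E x y z))
    (ℕₚ.≤-reflexive (size₃-full X Y Z))
    where
    pt : ∀ a b c e → ⟦ a ∧ (b ∧ (c ∧ e)) ⟧ ℕ.≤ ⟦ a ∧ (b ∧ (c ∧ true)) ⟧
    pt false b c e = ℕ.z≤n
    pt true false c e = ℕ.z≤n
    pt true true false e = ℕ.z≤n
    pt true true true e = ⟦⟧≤1 e

  density-bounds : ∀ s V d → 0ℚ < V → 0ℚ ≤ s → s ≤ V → s ≡ d * V → 0ℚ ≤ d × d ≤ 1ℚ
  density-bounds s V d 0<V 0≤s s≤V eq =
    *-cancel V 0<V (subst₂ _≤_ (sym (ℚₚ.*-zeroʳ V)) (trans eq (ℚₚ.*-comm d V)) 0≤s) ,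
    *-cancel V 0<V (subst₂ _≤_ (trans eq (ℚₚ.*-comm d V)) (sym (ℚₚ.*-identityʳ V)) s≤V)

  Disjoint : ∀ {N} → (X Y : Fin N → Bool) → Set
  Disjoint X Y = ∀ v → X v ≡ true → Y v ≡ true → ⊥

  -- The constants arise in the order k₁, k₂, k₃, ε: each clustering is applied to a relation whose
  -- density depends on the constants before it, and ε must be small in terms of them all. A density
  -- strictly between 1 / w and 1 - 1 / w is refuted by `Increment`.
  homogeneous : ∀ {p} {𝓗 : Property p} → Hereditary 𝓗 → ZeroVdisc₃Error 𝓗 → ∀ w → 1 ℕ.≤ w →
    ∃[ ε ] 0ℚ < ε × ∃[ N₀ ] 1 ℕ.≤ N₀ × (∀ {N} (H : ThreeGraph N) → 𝓗 H → (X Y Z : Fin N → Bool) →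
      Disjoint X Y → Disjoint X Z → Disjoint Y Z → N₀ ℕ.≤ # X → N₀ ℕ.≤ # Y → N₀ ℕ.≤ # Z →
      Vdisc ε X Y Z (edge H) → Homogeneous w X Y Z (edge H))
  homogeneous {𝓗 = 𝓗} hereditary zero-error w 1≤w = step₀ (no-half-graph hereditary zero-error)
    where
    Result : Set _
    Result = ∃[ ε ] 0ℚ < ε × ∃[ N₀ ] 1 ℕ.≤ N₀ × (∀ {N} (H : ThreeGraph N) → 𝓗 H → (X Y Z : Fin N → Bool) →
      Disjoint X Y → Disjoint X Z → Disjoint Y Z → N₀ ℕ.≤ # X → N₀ ℕ.≤ # Y → N₀ ℕ.≤ # Z →
      Vdisc ε X Y Z (edge H) → Homogeneous w X Y Z (edge H))
    NoHalfGraph : ℕ → ℕ → Set _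
    NoHalfGraph h M = ∀ {N} (H : ThreeGraph N) → 𝓗 H → (X Y Z : Fin N → Bool) →
      Disjoint X Y → Disjoint X Z → Disjoint Y Z →
      (F : Fin N → Fin N → Fin N → Bool) → (∀ z x y → F z x y ≡ edge H x y z) → HalfGraph Z X Y F h M → ⊥
    Cluster : ℕ → ℕ → ℕ → ℕ → Set
    Cluster h M g e = Σ[ k ∈ ℕ ] Σ[ N₀ ∈ ℕ ] 1 ℕ.≤ N₀ ×
      (∀ {N} (Z X Y : Fin N → Bool) (F : Fin N → Fin N → Fin N → Bool) (R : Fin N → Fin N → Bool) →
        (∀ z x → R z x ≡ true → X x ≡ true) → N₀ ℕ.≤ # Z → N₀ ℕ.≤ # X → N₀ ℕ.≤ # Y →
        # Z ℕ.* # X ℕ.≤ g ℕ.* sum (λ z → ⟦ Z z ⟧ ℕ.* # (R z)) →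
        # Z ℕ.* (# X ℕ.* # X) ℕ.≤ k ℕ.* closePairs Z Y F R e ⊎ HalfGraph Z X Y F h M)
    step₀ : (∃[ h ] ∃[ M ] 1 ℕ.≤ M × NoHalfGraph h M) → Result
    step₀ (h , M , 1≤M , none) = step₁ (cluster h M 1 (8 ℕ.* w) 1≤e 1≤M)
      where
      1≤e = ℕₚ.*-mono-≤ {1} {8} {1} {w} (ℕ.s≤s ℕ.z≤n) 1≤w
      step₁ : Cluster h M 1 (8 ℕ.* w) → Result
      step₁ (k₁ , N₁ , 1≤N₁ , cl₁) = step₂ (cluster h M (2 ℕ.* suc k₁) (8 ℕ.* w) 1≤e 1≤M)
        where
        open Constants w k₁
        step₂ : Cluster h M (2 ℕ.* suc k₁) (8 ℕ.* w) → Result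
        step₂ (k₂ , N₂ , 1≤N₂ , cl₂) = step₃ (cluster h M (g₃ k₂) e₃
            (ℕₚ.≤-trans (1≤θ 1≤w) (ℕₚ.≤-trans (ℕₚ.m≤n*m θ 4) (ℕₚ.m≤m+n (4 ℕ.* θ) (4 ℕ.* θ)))) 1≤M)
          where
          step₃ : Cluster h M (g₃ k₂) e₃ → Result
          step₃ (k₃ , N₃ , 1≤N₃ , cl₃) = step₄ (reciprocal (c k₂ k₃) (ℕₚ.m≤n+m 1 _))
            where
            N₀ = N₁ ℕ.+ N₂ ℕ.+ N₃
            step₄ : ∃[ ε ] 0ℚ < ε × ε * ι (c k₂ k₃) ≡ 1ℚ → Result
            step₄ (ε , 0<ε , ε≡) = ε , 0<ε , N₀ , ℕₚ.≤-trans 1≤N₁ (ℕₚ.≤-trans (ℕₚ.m≤m+n N₁ N₂) (ℕₚ.m≤m+n _ N₃)) , conclude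
              where
              N₁≤ : N₁ ℕ.≤ N₀
              N₁≤ = ℕₚ.≤-trans (ℕₚ.m≤m+n N₁ N₂) (ℕₚ.m≤m+n (N₁ ℕ.+ N₂) N₃)
              N₂≤ : N₂ ℕ.≤ N₀
              N₂≤ = ℕₚ.≤-trans (ℕₚ.m≤n+m N₂ N₁) (ℕₚ.m≤m+n (N₁ ℕ.+ N₂) N₃)
              N₃≤ : N₃ ℕ.≤ N₀
              N₃≤ = ℕₚ.m≤n+m N₃ (N₁ ℕ.+ N₂)
              conclude : ∀ {N} (H : ThreeGraph N) → 𝓗 H → (X Y Z : Fin N → Bool) →
                Disjoint X Y → Disjoint X Z → Disjoint Y Z → N₀ ℕ.≤ # X → N₀ ℕ.≤ # Y → N₀ ℕ.≤ # Z →
                Vdisc ε X Y Z (edge H) → Homogeneous w X Y Z (edge H)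
              conclude {N} H H∈𝓗 X Y Z XY XZ YZ bigX bigY bigZ vd = cases (ι w * d ℚₚ.≤? 1ℚ) (ι w * (1ℚ - d) ℚₚ.≤? 1ℚ)
                where
                E = edge H
                d = proj₁ vd
                V = card X * card Y * card Z
                0<# : ∀ {a} → N₀ ℕ.≤ a → 0 ℕ.< a
                0<# le = ℕₚ.≤-trans 1≤N₁ (ℕₚ.≤-trans N₁≤ le)
                density : ι (size₃ E X Y Z) ≡ d * V
                density = trans (ι≡fromℕ (size₃ E X Y Z)) (trans (proj₁ (proj₂ vd)) (cong (d *_) (vol≡ X Y Z)))
                0<V : 0ℚ < V
                0<V = 0<* (0<* (0<ι (0<# bigX)) (0<ι (0<# bigY))) (0<ι (0<# bigZ))
                bounds = density-bounds (ι (size₃ E X Y Z)) V d 0<V (0≤ι (size₃ E X Y Z))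
                  (subst (ι (size₃ E X Y Z) ≤_) (trans (ι≡fromℕ _) (vol≡ X Y Z)) (ι-mono (size₃≤ E X Y Z))) density
                reg≥ : ∀ A B C → A ⊆ᵇ X → B ⊆ᵇ Y → C ⊆ᵇ Z →
                  d * (card A * card B * card C) ≤ ι (size₃ E A B C) + ε * V
                reg≥ A B C A⊆ B⊆ C⊆ = subst₂ _≤_ (cong (d *_) (vol≡ A B C))
                  (cong₂ (λ a v → a + ε * v) (sym (ι≡fromℕ (size₃ E A B C))) (vol≡ X Y Z)) (vdisc-≥ ε vd A B C A⊆ B⊆ C⊆)
                reg≤ : ∀ A B C → A ⊆ᵇ X → B ⊆ᵇ Y → C ⊆ᵇ Z →
                  ι (size₃ E A B C) ≤ d * (card A * card B * card C) + ε * V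
                reg≤ A B C A⊆ B⊆ C⊆ = subst₂ _≤_ (sym (ι≡fromℕ (size₃ E A B C)))
                  (cong₂ (λ a v → d * a + ε * v) (vol≡ A B C) (vol≡ X Y Z)) (vdisc-≤ ε vd A B C A⊆ B⊆ C⊆)
                -- Clustering in slices of x and of y needs the absence of half graphs with the
                -- roles of the parts permuted; the symmetry of the edge set supplies it.
                symmetric : ∀ x y z → E x y z ≡ E z y x
                symmetric x y z = trans (swap₁₂ H x y z) (trans (swap₂₃ H y x z) (swap₁₂ H y z x))
                rotate : ∀ x y z → E x y z ≡ E z x y
                rotate x y z = trans (swap₂₃ H x y z) (swap₁₂ H x z y)
                flip : ∀ {A B : Fin N → Bool} → Disjoint A B → Disjoint B A
                flip dis v a b = dis v b a
                l₁ : ∀ w d V → w * (d * V) ≡ (w * d) * V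
                l₁ = RS.solve-∀ ℚ-ring
                l₂ : ∀ w d V → w * (V - d * V) ≡ (w * (1ℚ - d)) * V
                l₂ = RS.solve-∀ ℚ-ring
                scale : ∀ {a b} → a ≤ 1ℚ → b ≡ a * V → b ≤ V
                scale le eq = subst₂ _≤_ (sym eq) (ℚₚ.*-identityˡ V) (*-monoʳ V (ℚₚ.<⇒≤ 0<V) le)
                cases : Dec (ι w * d ≤ 1ℚ) → Dec (ι w * (1ℚ - d) ≤ 1ℚ) → Homogeneous w X Y Z E
                cases (yes p) _ = inj₁ (scale p (trans (cong (ι w *_) density) (l₁ (ι w) d V)))
                cases (no _) (yes q) = inj₂ (scale q (trans (cong (λ s → ι w * (V - s)) density) (l₂ (ι w) d V)))
                cases (no p) (no q) = ⊥-elim (Increment.impossible X Y Z E d ε (proj₁ bounds) (proj₂ bounds) (ℚₚ.<⇒≤ 0<ε)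
                  reg≥ reg≤ w (suc k₁) k₂ k₃ (8 ℕ.* w) θ e₃ refl θ≡ refl
                  (ℚₚ.<⇒≤ (ℚₚ.≰⇒> p)) (ℚₚ.<⇒≤ (ℚₚ.≰⇒> q)) (0<# bigX) (0<# bigY) (0<# bigZ)
                  clus₁ clus₂ clus₃ (ε-small₁ k₂ k₃ ε 0<ε ε≡) (ε-small₂ k₂ k₃ ε 0<ε ε≡))
                  where
                  only : ∀ {A B : Set} → A ⊎ B → (B → ⊥) → A
                  only (inj₁ a) _ = a
                  only (inj₂ b) f = ⊥-elim (f b)
                  clus₁ : # Z ℕ.* (# X ℕ.* # X) ℕ.≤ suc k₁ ℕ.* closePairs Z Y (λ z x y → E x y z) (λ _ x → X x) (8 ℕ.* w)
                  clus₁ = ℕₚ.≤-trans (only (cl₁ Z X Y (λ z x y → E x y z) (λ _ x → X x) (λ _ _ t → t)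
                      (ℕₚ.≤-trans N₁≤ bigZ) (ℕₚ.≤-trans N₁≤ bigX) (ℕₚ.≤-trans N₁≤ bigY)
                      (ℕₚ.≤-reflexive (sym (trans (ℕₚ.*-identityˡ _) (sum-*ʳ (# X) (λ z → ⟦ Z z ⟧))))))
                    (none H H∈𝓗 X Y Z XY XZ YZ (λ z x y → E x y z) (λ z x y → refl)))
                    (ℕₚ.*-monoˡ-≤ (closePairs Z Y (λ z x y → E x y z) (λ _ x → X x) (8 ℕ.* w)) (ℕₚ.n≤1+n k₁))
                  clus₂ : ∀ (R : Fin N → Fin N → Bool) → (∀ x z → R x z ≡ true → Z z ≡ true) →
                    # X ℕ.* # Z ℕ.≤ (2 ℕ.* suc k₁) ℕ.* sum (λ x → ⟦ X x ⟧ ℕ.* # (R x)) →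
                    # X ℕ.* (# Z ℕ.* # Z) ℕ.≤ k₂ ℕ.* closePairs X Y (λ x z y → E x y z) R (8 ℕ.* w)
                  clus₂ R R⊆ dense = only (cl₂ X Z Y (λ x z y → E x y z) R R⊆
                      (ℕₚ.≤-trans N₂≤ bigX) (ℕₚ.≤-trans N₂≤ bigZ) (ℕₚ.≤-trans N₂≤ bigY) dense)
                    (none H H∈𝓗 Z Y X (flip YZ) (flip XZ) (flip XY) (λ x z y → E x y z) (λ x z y → symmetric x y z))
                  clus₃ : ∀ (R : Fin N → Fin N → Bool) → (∀ y z → R y z ≡ true → Z z ≡ true) →
                    # Y ℕ.* # Z ℕ.≤ g₃ k₂ ℕ.* sum (λ y → ⟦ Y y ⟧ ℕ.* # (R y)) →
                    # Y ℕ.* (# Z ℕ.* # Z) ℕ.≤ k₃ ℕ.* closePairs Y X (λ y z x → E x y z) R e₃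
                  clus₃ R R⊆ dense = only (cl₃ Y Z X (λ y z x → E x y z) R R⊆
                      (ℕₚ.≤-trans N₃≤ bigY) (ℕₚ.≤-trans N₃≤ bigZ) (ℕₚ.≤-trans N₃≤ bigX) dense)
                    (none H H∈𝓗 Z X Y (flip XZ) (flip YZ) XY (λ y z x → E x y z) (λ y z x → rotate x y z))

-- Even splittings, second moments and Cauchy-Schwarz.

module SecondMoments where
  open Counting
  open Partitions using (cls; #-partition; sum-const; #-cong)
  open Rationals
  open Embedding
  open import Data.Bool.Base using (Bool; true; false; _∧_)
  open import Data.Fin.Base using (Fin; zero; suc; combine; finToFun)
  open import Data.Nat.Base as ℕ using (ℕ; zero; suc)
  open import Data.Rational.Base using (ℚ; 0ℚ; 1ℚ; _+_; _*_; _-_; -_; _≤_; _<_)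
  open import Function.Base using (_∘_)

  block : ∀ {n t K} → (Fin n → Fin t) → (Fin n → Fin K) → Fin t → Fin K → Fin n → Bool
  block part σ i b x = cls part i x ∧ does (σ x Finₚ.≟ b)

  -- Vertices are inserted one at a time. In the class of a new vertex some block has at most the
  -- average size, and the vertex is put there.
  even-blocks : ∀ K → 1 ℕ.≤ K → ∀ n {t} (part : Fin n → Fin t) →
    Σ[ σ ∈ (Fin n → Fin K) ] (∀ i b → K ℕ.* # (block part σ i b) ℕ.≤ # (cls part i) ℕ.+ K)
  even-blocks K 1≤K zero part = (λ ()) , λ i b → ℕₚ.≤-trans (ℕₚ.≤-reflexive (ℕₚ.*-zeroʳ K)) ℕ.z≤n
  even-blocks K 1≤K (suc n) {t} part = extend (even-blocks K 1≤K n (part ∘ suc))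
    where
    extend : Σ[ σ ∈ (Fin n → Fin K) ] (∀ i b → K ℕ.* # (block (part ∘ suc) σ i b) ℕ.≤ # (cls (part ∘ suc) i) ℕ.+ K) → _
    extend (σ , even) = place (sum-exists-< {f = λ b → K ℕ.* c b} {g = λ _ → suc #₀} lt)
      where
      i₀ = part zero
      #₀ = # (cls (part ∘ suc) i₀)
      c : Fin K → ℕ
      c b = # (block (part ∘ suc) σ i₀ b)
      total : sum c ≡ #₀
      total = trans (sum-cong (λ b → #-cong (λ x → swap (cls (part ∘ suc) i₀ x) (does (σ x Finₚ.≟ b)))))
        (sym (#-partition σ (cls (part ∘ suc) i₀)))
        where
        swap : ∀ a b → a ∧ b ≡ b ∧ a
        swap true true = refl
        swap true false = refl
        swap false true = refl
        swap false false = refl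
      lt : sum (λ b → K ℕ.* c b) ℕ.< sum {K} (λ _ → suc #₀)
      lt = begin-strict
        sum (λ b → K ℕ.* c b)     ≡⟨ sum-*ˡ K c ⟩
        K ℕ.* sum c               ≡⟨ cong (K ℕ.*_) total ⟩
        K ℕ.* #₀                 <⟨ ℕₚ.*-monoʳ-< K {{ℕ.>-nonZero 1≤K}} (ℕₚ.n<1+n #₀) ⟩
        K ℕ.* suc #₀             ≡⟨ sym (sum-const K (suc #₀)) ⟩
        sum {K} (λ _ → suc #₀)   ∎
        where open ℕₚ.≤-Reasoning
      place : ∃[ b ] K ℕ.* c b ℕ.< suc #₀ → _
      place (b₀ , small) = σ′ , even′
        where
        σ′ : Fin (suc n) → Fin K
        σ′ zero = b₀
        σ′ (suc x) = σ x
        even′ : ∀ i b → K ℕ.* # (block part σ′ i b) ℕ.≤ # (cls part i) ℕ.+ K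
        even′ i b = go (i₀ Finₚ.≟ i) (b₀ Finₚ.≟ b)
          where
          open ℕₚ.≤-Reasoning
          other : ∀ d → K ℕ.* # (block (part ∘ suc) σ i b) ℕ.≤ d ℕ.+ # (cls (part ∘ suc) i) ℕ.+ K
          other d = ℕₚ.≤-trans (even i b) (ℕₚ.+-monoˡ-≤ K (ℕₚ.m≤n+m (# (cls (part ∘ suc) i)) d))
          go : (p : Dec (i₀ ≡ i)) (q : Dec (b₀ ≡ b)) →
            K ℕ.* (⟦ does p ∧ does q ⟧ ℕ.+ # (block (part ∘ suc) σ i b)) ℕ.≤ ⟦ does p ⟧ ℕ.+ # (cls (part ∘ suc) i) ℕ.+ K
          go (yes refl) (yes refl) = begin
            K ℕ.* (1 ℕ.+ c b₀)         ≡⟨ l K (c b₀) ⟩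
            K ℕ.* c b₀ ℕ.+ K           ≤⟨ ℕₚ.+-monoˡ-≤ K (ℕₚ.<⇒≤ small) ⟩
            suc #₀ ℕ.+ K              ∎
            where
            l : ∀ K c → K ℕ.* (1 ℕ.+ c) ≡ K ℕ.* c ℕ.+ K
            l = ℕ-Solver.solve-∀
          go (yes _) (no _) = other 1
          go (no _) q = other 0

  -- Variances of independent variables add up. The index v runs through all words of length M over
  -- ℓ colours; when the first letter is split off, ∑ β ≡ 0 kills the cross term.
  second-moment : ∀ ℓ (β : Fin ℓ → ℚ) γ → ∑ β ≡ 0ℚ → ∑ (λ a → β a * β a) ≡ ι ℓ * γ →
    ∀ M (w : Fin M → ℚ) → let S = λ v → ∑ (λ y → w y * β (finToFun {ℓ} {M} v y)) in
    ∑ (λ v → S v * S v) ≡ ι (ℓ ℕ.^ M) * γ * ∑ (λ y → w y * w y)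
  second-moment ℓ β γ β₁ β₂ zero w = trans {j = 0ℚ} refl (sym (ℚₚ.*-zeroʳ (ι 1 * γ)))
  second-moment ℓ β γ β₁ β₂ (suc M) w = begin
    ∑ (λ v → S v * S v)
      ≡⟨ ∑-combine ℓ {K} (λ v → S v * S v) ⟩
    ∑ (λ a → ∑ (λ v → S (combine {ℓ} {K} a v) * S (combine {ℓ} {K} a v)))
      ≡⟨ ∑-cong {ℓ} (λ a → trans (∑-cong {K} (λ v → trans (cong (λ s → s * s) (S-combine a v)) (l₁ w₀ (β a) (S′ v))))
           (trans (∑-+ (λ v → w₀ * w₀ * (β a * β a)) (λ v → (w₀ + w₀) * β a * S′ v + S′ v * S′ v))
             (cong₂ _+_ (∑-const K (w₀ * w₀ * (β a * β a)))
               (trans (∑-+ (λ v → (w₀ + w₀) * β a * S′ v) (λ v → S′ v * S′ v))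
                 (cong (_+ Q) (∑-*ˡ ((w₀ + w₀) * β a) S′)))))) ⟩
    ∑ (λ a → ι K * (w₀ * w₀ * (β a * β a)) + ((w₀ + w₀) * β a * L + Q))
      ≡⟨ ∑-cong (λ a → l₂ (ι K) w₀ (β a) L Q) ⟩
    ∑ (λ a → (ι K * (w₀ * w₀)) * (β a * β a) + ((w₀ + w₀) * L * β a + Q))
      ≡⟨ trans (∑-+ (λ a → (ι K * (w₀ * w₀)) * (β a * β a)) (λ a → (w₀ + w₀) * L * β a + Q))
           (cong₂ _+_ (trans (∑-*ˡ (ι K * (w₀ * w₀)) (λ a → β a * β a)) (cong (ι K * (w₀ * w₀) *_) β₂))
             (trans (∑-+ (λ a → (w₀ + w₀) * L * β a) (λ _ → Q))
               (cong₂ _+_ (trans (∑-*ˡ ((w₀ + w₀) * L) β) (cong ((w₀ + w₀) * L *_) β₁)) (∑-const ℓ Q)))) ⟩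
    ι K * (w₀ * w₀) * (ι ℓ * γ) + ((w₀ + w₀) * L * 0ℚ + ι ℓ * Q)
      ≡⟨ cong (λ q → ι K * (w₀ * w₀) * (ι ℓ * γ) + ((w₀ + w₀) * L * 0ℚ + ι ℓ * q)) (second-moment ℓ β γ β₁ β₂ M (w ∘ suc)) ⟩
    ι K * (w₀ * w₀) * (ι ℓ * γ) + ((w₀ + w₀) * L * 0ℚ + ι ℓ * (ι K * γ * R))
      ≡⟨ l₃ (ι K) (ι ℓ) γ w₀ L R ⟩
    (ι ℓ * ι K) * γ * (w₀ * w₀ + R)
      ≡⟨ cong (λ k → k * γ * (w₀ * w₀ + R)) (sym (ι-* ℓ K)) ⟩
    ι (ℓ ℕ.* K) * γ * (w₀ * w₀ + R) ∎
    where
    open ≡-Reasoning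
    K = ℓ ℕ.^ M
    w₀ = w zero
    S : Fin (ℓ ℕ.^ suc M) → ℚ
    S v = ∑ (λ y → w y * β (finToFun {ℓ} {suc M} v y))
    S′ : Fin K → ℚ
    S′ v = ∑ (λ y → w (suc y) * β (finToFun {ℓ} {M} v y))
    L Q R : ℚ
    L = ∑ S′
    Q = ∑ (λ v → S′ v * S′ v)
    R = ∑ (λ y → w (suc y) * w (suc y))
    S-combine : ∀ a v → S (combine {ℓ} {K} a v) ≡ w₀ * β a + S′ v
    S-combine a v = cong (λ p → w₀ * β (proj₁ p) + ∑ (λ y → w (suc y) * β (finToFun {ℓ} {M} (proj₂ p) y)))
      (Finₚ.remQuot-combine {ℓ} a v)
    ∑-const : ∀ n c → ∑ {n} (λ _ → c) ≡ ι n * c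
    ∑-const zero c = sym (trans (cong (_* c) ι-0) (ℚₚ.*-zeroˡ c))
    ∑-const (suc n) c = trans (cong (c +_) (∑-const n c)) (trans (l c (ι n)) (cong (_* c) (trans (cong (_+ ι n) (sym ι-1)) (sym (ι-+ 1 n)))))
      where
      l : ∀ c n → c + n * c ≡ (1ℚ + n) * c
      l = RS.solve-∀ ℚ-ring
    l₁ : ∀ w b s → (w * b + s) * (w * b + s) ≡ w * w * (b * b) + ((w + w) * b * s + s * s)
    l₁ = RS.solve-∀ ℚ-ring
    l₂ : ∀ k w b L Q → k * (w * w * (b * b)) + ((w + w) * b * L + Q) ≡ (k * (w * w)) * (b * b) + ((w + w) * L * b + Q)
    l₂ = RS.solve-∀ ℚ-ring
    l₃ : ∀ k l g w L R → k * (w * w) * (l * g) + ((w + w) * L * 0ℚ + l * (k * g * R)) ≡ (l * k) * g * (w * w + R)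
    l₃ = RS.solve-∀ ℚ-ring

  -- Half of Σ_x Σ_y a_x a_y (s_x − s_y)² is the difference of the two sides.
  cauchy-schwarz : ∀ {n} (a s : Fin n → ℚ) → (∀ x → 0ℚ ≤ a x) →
    ∑ (λ x → a x * s x) * ∑ (λ x → a x * s x) ≤ ∑ a * ∑ (λ x → a x * (s x * s x))
  cauchy-schwarz {n} a s 0≤a = *-cancel 2ℚ 0<2 (0≤⇒≤ D 0≤D (trans (l₀ A Q L) (sym D≡)))
    where
    open ≡-Reasoning
    2ℚ = 1ℚ + 1ℚ
    0<2 : 0ℚ < 2ℚ
    0<2 = subst (0ℚ <_) (trans (ι-+ 1 1) (cong₂ _+_ ι-1 ι-1)) (0<ι {2} (ℕ.s≤s ℕ.z≤n))
    A Q L D : ℚ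
    A = ∑ a
    Q = ∑ (λ x → a x * (s x * s x))
    L = ∑ (λ x → a x * s x)
    D = ∑ (λ x → a x * ∑ (λ y → a y * ((s x - s y) * (s x - s y))))
    0≤D : 0ℚ ≤ D
    0≤D = 0≤∑ (λ x → 0≤* (0≤a x) (0≤∑ (λ y → 0≤* (0≤a y) (0≤-square (s x - s y)))))
    l₀ : ∀ A Q L → (1ℚ + 1ℚ) * (A * Q) - (1ℚ + 1ℚ) * (L * L) ≡ A * Q + (- (L + L) * L + Q * A)
    l₀ = RS.solve-∀ ℚ-ring
    l₁ : ∀ a s t → a * ((s - t) * (s - t)) ≡ (s * s) * a + (- (s + s) * (a * t) + a * (t * t))
    l₁ = RS.solve-∀ ℚ-ring
    l₂ : ∀ a s A L Q → a * ((s * s) * A + (- (s + s) * L + Q)) ≡ A * (a * (s * s)) + (- (L + L) * (a * s) + Q * a)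
    l₂ = RS.solve-∀ ℚ-ring
    inner : ∀ x → ∑ (λ y → a y * ((s x - s y) * (s x - s y))) ≡ (s x * s x) * A + (- (s x + s x) * L + Q)
    inner x = trans (∑-cong (λ y → l₁ (a y) (s x) (s y)))
      (trans (∑-+ (λ y → (s x * s x) * a y) (λ y → - (s x + s x) * (a y * s y) + a y * (s y * s y)))
        (cong₂ _+_ (∑-*ˡ (s x * s x) a) (trans (∑-+ (λ y → - (s x + s x) * (a y * s y)) (λ y → a y * (s y * s y)))
          (cong (_+ Q) (∑-*ˡ (- (s x + s x)) (λ y → a y * s y))))))
    D≡ : D ≡ A * Q + (- (L + L) * L + Q * A)
    D≡ = trans (∑-cong (λ x → trans (cong (a x *_) (inner x)) (l₂ (a x) (s x) A L Q)))
      (trans (∑-+ (λ x → A * (a x * (s x * s x))) (λ x → - (L + L) * (a x * s x) + Q * a x))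
        (cong₂ _+_ (∑-*ˡ A (λ x → a x * (s x * s x)))
          (trans (∑-+ (λ x → - (L + L) * (a x * s x)) (λ x → Q * a x))
            (cong₂ _+_ (∑-*ˡ (- (L + L)) (λ x → a x * s x)) (∑-*ˡ Q a)))))

-- Colours from pairwise independent values.

module QuasirandomColouring where
  open Counting
  open Partitions using (cls; #-mono)
  open HalfGraphPartitions using (_⊆ᵇ_)
  open Rationals
  open Embedding
  open SecondMoments
  open import Data.Bool.Base using (Bool; true; false; _∧_)
  open import Data.Fin.Base using (Fin; zero; suc; finToFun)
  open import Data.Nat.Base as ℕ using (ℕ; zero; suc)
  open import Data.Rational.Base as ℚ using (ℚ; 0ℚ; 1ℚ; _+_; _*_; _-_; -_; _≤_; _<_)
  open import Function.Base using (_∘_)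

  private
    variable
      n t : ℕ

  square-cancel : ∀ {a b} → 0ℚ ≤ b → a * a ≤ b * b → a ≤ b
  square-cancel {a} {b} 0≤b h = ℚₚ.≮⇒≥ λ b<a → ℚₚ.<-irrefl refl (ℚₚ.<-≤-trans
    (ℚₚ.≤-<-trans (*-monoˡ b 0≤b (ℚₚ.<⇒≤ b<a)) (ℚₚ.*-monoˡ-<-pos a {{ℚ.positive (ℚₚ.≤-<-trans 0≤b b<a)}} b<a)) h)

  ∑-pick : ∀ {m} (b₀ : Fin m) (f : Fin m → ℚ) → ∑ (λ b → [ does (b₀ Finₚ.≟ b) ] * f b) ≡ f b₀
  ∑-pick {suc m} zero f = trans (cong₂ _+_ (trans (cong (_* f zero) [true]) (ℚₚ.*-identityˡ (f zero)))
      (trans (∑-cong (λ b → trans (cong (_* f (suc b)) [false]) (ℚₚ.*-zeroˡ (f (suc b))))) (∑-0 m)))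
    (ℚₚ.+-identityʳ (f zero))
  ∑-pick {suc m} (suc b₀) f = trans (cong₂ _+_ (trans (cong (_* f zero) [false]) (ℚₚ.*-zeroˡ (f zero))) (∑-pick b₀ (f ∘ suc)))
    (ℚₚ.+-identityˡ (f (suc b₀)))

  ∑-group : ∀ {m} (σ : Fin n → Fin m) (W : Fin n → Bool) (f : Fin m → ℚ) →
    ∑ (λ y → [ W y ] * f (σ y)) ≡ ∑ (λ b → card (λ y → W y ∧ does (σ y Finₚ.≟ b)) * f b)
  ∑-group σ W f = begin
    ∑ (λ y → [ W y ] * f (σ y))
      ≡⟨ ∑-cong (λ y → trans (cong ([ W y ] *_) (sym (∑-pick (σ y) f)))
           (sym (∑-*ˡ [ W y ] (λ b → [ does (σ y Finₚ.≟ b) ] * f b)))) ⟩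
    ∑ (λ y → ∑ (λ b → [ W y ] * ([ does (σ y Finₚ.≟ b) ] * f b)))
      ≡⟨ ∑-swap (λ y b → [ W y ] * ([ does (σ y Finₚ.≟ b) ] * f b)) ⟩
    ∑ (λ b → ∑ (λ y → [ W y ] * ([ does (σ y Finₚ.≟ b) ] * f b)))
      ≡⟨ ∑-cong (λ b → trans (∑-cong (λ y → trans (sym (ℚₚ.*-assoc [ W y ] [ does (σ y Finₚ.≟ b) ] (f b)))
             (cong (_* f b) (sym ([∧] (W y) (does (σ y Finₚ.≟ b)))))))
           (∑-card (λ y → W y ∧ does (σ y Finₚ.≟ b)) (f b))) ⟩
    ∑ (λ b → card (λ y → W y ∧ does (σ y Finₚ.≟ b)) * f b) ∎
    where open ≡-Reasoning

  hits : ∀ {ℓ} → Fin ℓ → Fin ℓ → Bool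
  hits α a = does (a Finₚ.≟ α)

  hits-sum : ∀ {ℓ} (α : Fin ℓ) → ∑ (λ a → [ hits α a ]) ≡ 1ℚ
  hits-sum {suc ℓ} zero = trans (cong₂ _+_ [true] (trans (∑-cong {ℓ} (λ a → [false])) (∑-0 ℓ))) (ℚₚ.+-identityʳ 1ℚ)
  hits-sum {suc ℓ} (suc α) = trans (cong₂ _+_ [false] (hits-sum α)) (ℚₚ.+-identityˡ 1ℚ)

  ∑-ι : ∀ n c → ∑ {n} (λ _ → c) ≡ ι n * c
  ∑-ι zero c = sym (trans (cong (_* c) ι-0) (ℚₚ.*-zeroˡ c))
  ∑-ι (suc n) c = trans (cong (c +_) (∑-ι n c)) (trans (l c (ι n)) (cong (_* c) (trans (cong (_+ ι n) (sym ι-1)) (sym (ι-+ 1 n)))))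
    where
    l : ∀ c n → c + n * c ≡ (1ℚ + n) * c
    l = RS.solve-∀ ℚ-ring

  module Quasirandom (part : Fin n → Fin t) (ℓ q : ℕ) (1≤ℓ : 1 ℕ.≤ ℓ) (1≤q : 1 ℕ.≤ q)
    (M : ℕ) (M≡ : M ≡ 4 ℕ.* ℓ ℕ.* (q ℕ.* q)) (K : ℕ) (K≡ : K ≡ ℓ ℕ.^ M) (1≤K : 1 ℕ.≤ K)
    (σ : Fin n → Fin M) (σ-even : ∀ i b → M ℕ.* # (block part σ i b) ℕ.≤ # (cls part i) ℕ.+ M)
    (τ : Fin n → Fin (ℓ ℕ.^ M)) (τ-even : ∀ i b → K ℕ.* # (block part τ i b) ℕ.≤ # (cls part i) ℕ.+ K) where

    -- `τ x` encodes a word of length M over ℓ colours, and the pair (x, y) receives its letter at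
    -- the block of y. Over all words the letters at different blocks are independent. That no word
    -- and no block is much more frequent than average in a part is enough, as only sums of squares
    -- are bounded.
    base : Fin n → Fin n → Fin ℓ
    base x y = finToFun {ℓ} {M} (τ x) (σ y)

    module _ (α : Fin ℓ) where

      -- The indicator of α, normalised to mean 0; its mean square is γ = ℓ - 1.
      β : Fin ℓ → ℚ
      β a = ι ℓ * [ hits α a ] - 1ℚ

      γ : ℚ
      γ = ι ℓ - 1ℚ

      β-sum : ∑ β ≡ 0ℚ
      β-sum = trans (∑-+ (λ a → ι ℓ * [ hits α a ]) (λ _ → - 1ℚ))
        (trans (cong₂ _+_ (trans (∑-*ˡ (ι ℓ) (λ a → [ hits α a ])) (cong (ι ℓ *_) (hits-sum α))) (∑-ι ℓ (- 1ℚ))) (l (ι ℓ)))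
        where
        l : ∀ l → l * 1ℚ + l * - 1ℚ ≡ 0ℚ
        l = RS.solve-∀ ℚ-ring

      β-square : ∑ (λ a → β a * β a) ≡ ι ℓ * γ
      β-square = trans (∑-cong (λ a → trans (l₁ (ι ℓ) [ hits α a ]) (cong (λ s → ι ℓ * ι ℓ * s + ((- (ι ℓ + ι ℓ)) * [ hits α a ] + 1ℚ)) (idem (hits α a)))))
        (trans (∑-+ (λ a → ι ℓ * ι ℓ * [ hits α a ]) (λ a → (- (ι ℓ + ι ℓ)) * [ hits α a ] + 1ℚ))
          (trans (cong₂ _+_ (trans (∑-*ˡ (ι ℓ * ι ℓ) (λ a → [ hits α a ])) (cong (ι ℓ * ι ℓ *_) (hits-sum α)))
              (trans (∑-+ (λ a → (- (ι ℓ + ι ℓ)) * [ hits α a ]) (λ _ → 1ℚ))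
                (cong₂ _+_ (trans (∑-*ˡ (- (ι ℓ + ι ℓ)) (λ a → [ hits α a ])) (cong ((- (ι ℓ + ι ℓ)) *_) (hits-sum α))) (∑-ι ℓ 1ℚ))))
            (l₂ (ι ℓ))))
        where
        l₁ : ∀ l h → (l * h - 1ℚ) * (l * h - 1ℚ) ≡ l * l * (h * h) + ((- (l + l)) * h + 1ℚ)
        l₁ = RS.solve-∀ ℚ-ring
        l₂ : ∀ l → l * l * 1ℚ + ((- (l + l)) * 1ℚ + l * 1ℚ) ≡ l * (l - 1ℚ)
        l₂ = RS.solve-∀ ℚ-ring
        idem : ∀ b → [ b ] * [ b ] ≡ [ b ]
        idem b = trans (sym ([∧] b b)) (cong [_] (Data.Bool.Properties.∧-idem b))
          where import Data.Bool.Properties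

      module _ (i j : Fin t) (U W : Fin n → Bool) (U⊆ : U ⊆ᵇ cls part i) (W⊆ : W ⊆ᵇ cls part j)
        (bigU : K ℕ.≤ # (cls part i)) (bigW : M ℕ.≤ # (cls part j)) where

        private
          cᵢ cⱼ : ℚ
          cᵢ = card (cls part i)
          cⱼ = card (cls part j)
          0≤cᵢ = 0≤card (cls part i)
          0≤cⱼ = 0≤card (cls part j)

          w : Fin M → ℚ
          w b = card (λ y → W y ∧ does (σ y Finₚ.≟ b))

          Φ : Fin (ℓ ℕ.^ M) → ℚ
          Φ v = ∑ (λ b → w b * β (finToFun {ℓ} {M} v b))

          s : Fin n → ℚ
          s x = ∑ (λ y → [ W y ] * β (base x y))

          dev : ℚ
          dev = ∑ (λ x → [ U x ] * s x)

          s≡ : ∀ x → s x ≡ Φ (τ x)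
          s≡ x = ∑-group σ W (λ b → β (finToFun {ℓ} {M} (τ x) b))

          -- In a part with at least k vertices, rounding costs each of k blocks at most a factor 2.
          double-bound : ∀ {k a c} → k ℕ.* a ℕ.≤ c ℕ.+ k → k ℕ.≤ c → ι k * ι a ≤ ι c + ι c
          double-bound {k} {a} {c} h k≤c = subst₂ _≤_ (ι-* k a) (ι-+ c c) (ι-mono (ℕₚ.≤-trans h (ℕₚ.+-monoʳ-≤ c k≤c)))

          w-sum : ∑ w ≡ card W
          w-sum = trans (∑-cong (λ b → sym (ℚₚ.*-identityʳ (w b))))
            (trans (sym (∑-group σ W (λ _ → 1ℚ))) (trans (∑-card W 1ℚ) (ℚₚ.*-identityʳ (card W))))

          W≤ : card W ≤ cⱼ
          W≤ = ι-mono (#-mono W⊆)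

          w-bound : ∀ b → ι M * w b ≤ cⱼ + cⱼ
          w-bound b = double-bound {M} {# (λ y → W y ∧ does (σ y Finₚ.≟ b))} {# (cls part j)}
            (ℕₚ.≤-trans (ℕₚ.*-monoʳ-≤ M (#-mono (λ y e → pt (W y) (does (σ y Finₚ.≟ b)) (W⊆ y) e))) (σ-even j b)) bigW
            where
            pt : ∀ a c {d} → (a ≡ true → d ≡ true) → a ∧ c ≡ true → d ∧ c ≡ true
            pt true true h _ rewrite h refl = refl

          w-square : ι M * ∑ (λ b → w b * w b) ≤ (cⱼ + cⱼ) * cⱼ
          w-square = ℚₚ.≤-trans (subst₂ _≤_ (trans (∑-cong (λ b → ℚₚ.*-assoc (ι M) (w b) (w b))) (∑-*ˡ (ι M) (λ b → w b * w b)))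
              (trans (∑-*ˡ (cⱼ + cⱼ) w) (cong ((cⱼ + cⱼ) *_) w-sum))
              (∑-mono (λ b → *-monoʳ (w b) (0≤card (λ y → W y ∧ does (σ y Finₚ.≟ b))) (w-bound b))))
            (*-monoˡ (cⱼ + cⱼ) (0≤+ 0≤cⱼ 0≤cⱼ) W≤)

          S : ℚ
          S = ∑ (λ x → [ cls part i x ] * (s x * s x))

          -- Summing over the whole part instead of U allows grouping its vertices by their words,
          -- so that `second-moment` over all words applies.
          S-bound : S ≤ (cᵢ + cᵢ) * (γ * ∑ (λ b → w b * w b))
          S-bound = *-cancel (ι K) (0<ι 1≤K) (subst₂ _≤_ left right (∑-mono (λ v → *-monoʳ (Φ v * Φ v) (0≤-square (Φ v))
              (double-bound {K} {# (block part τ i v)} {# (cls part i)} (τ-even i v) bigU))))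
            where
            left : ∑ (λ v → ι K * card (block part τ i v) * (Φ v * Φ v)) ≡ ι K * S
            left = trans (∑-cong (λ v → ℚₚ.*-assoc (ι K) (card (block part τ i v)) (Φ v * Φ v)))
              (trans (∑-*ˡ (ι K) (λ v → card (block part τ i v) * (Φ v * Φ v)))
                (cong (ι K *_) (trans (sym (∑-group τ (cls part i) (λ v → Φ v * Φ v)))
                  (∑-cong (λ x → cong (λ z → [ cls part i x ] * (z * z)) (sym (s≡ x)))))))
            l : ∀ c k g r → c * (k * g * r) ≡ k * (c * (g * r))
            l = RS.solve-∀ ℚ-ring
            right : ∑ (λ v → (cᵢ + cᵢ) * (Φ v * Φ v)) ≡ ι K * ((cᵢ + cᵢ) * (γ * ∑ (λ b → w b * w b)))
            right = trans (∑-*ˡ (cᵢ + cᵢ) (λ v → Φ v * Φ v))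
              (trans (cong ((cᵢ + cᵢ) *_) (second-moment ℓ β γ β-sum β-square M w))
                (trans (cong (λ k → (cᵢ + cᵢ) * (ι k * γ * ∑ (λ b → w b * w b))) (sym K≡))
                  (l (cᵢ + cᵢ) (ι K) γ (∑ (λ b → w b * w b)))))

          dev-square : dev * dev ≤ cᵢ * S
          dev-square = ℚₚ.≤-trans (cauchy-schwarz (λ x → [ U x ]) s (λ x → 0≤[] (U x)))
            (*-mono (subst (0ℚ ≤_) (card-∑ U) (0≤card U)) (0≤∑ (λ x → 0≤* (0≤[] (cls part i x)) (0≤-square (s x))))
              (subst (_≤ cᵢ) (card-∑ U) (ι-mono (#-mono U⊆)))
              (∑-mono (λ x → *-monoʳ (s x * s x) (0≤-square (s x)) (subst₂ _≤_ (sym ([]≡ι (U x))) (sym ([]≡ι (cls part i x))) (ι-mono (pt (U x) (U⊆ x)))))))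
            where
            pt : ∀ a {b} → (a ≡ true → b ≡ true) → ⟦ a ⟧ ℕ.≤ ⟦ b ⟧
            pt true h rewrite h refl = ℕₚ.≤-refl
            pt false h = ℕ.z≤n

          1≤ιℓ : 1ℚ ≤ ι ℓ
          1≤ιℓ = subst (_≤ ι ℓ) ι-1 (ι-mono 1≤ℓ)

          M-value : ι M ≡ ((ι ℓ + ι ℓ) + (ι ℓ + ι ℓ)) * (ι q * ι q)
          M-value = trans (cong ι (trans M≡ (cong (ℕ._* (q ℕ.* q)) (l ℓ)))) (trans (ι-* _ (q ℕ.* q))
            (cong₂ _*_ (trans (ι-+ (ℓ ℕ.+ ℓ) (ℓ ℕ.+ ℓ)) (cong₂ _+_ (ι-+ ℓ ℓ) (ι-+ ℓ ℓ))) (ι-* q q)))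
            where
            l : ∀ k → 4 ℕ.* k ≡ (k ℕ.+ k) ℕ.+ (k ℕ.+ k)
            l = ℕ-Solver.solve-∀

          -- The bounds combine to dev² ≤ 4 γ (cᵢ cⱼ)² / M. The number of blocks M = 4 ℓ q² is
          -- chosen so that, with γ < ℓ, this is at most (cᵢ cⱼ / q)².
          scaled-square : (ι q * dev) * (ι q * dev) ≤ (cᵢ * cⱼ) * (cᵢ * cⱼ)
          scaled-square = *-cancel 4ℓ (0<+ 0<2ℓ 0<2ℓ) (0≤⇒≤
            ((ι M * (cᵢ * S - dev * dev) + ι M * cᵢ * ((cᵢ + cᵢ) * (γ * R) - S))
              + (cᵢ * (cᵢ + cᵢ) * γ * ((cⱼ + cⱼ) * cⱼ - ι M * R) + ((cᵢ * cⱼ) * (cᵢ * cⱼ) + (cᵢ * cⱼ) * (cᵢ * cⱼ) + ((cᵢ * cⱼ) * (cᵢ * cⱼ) + (cᵢ * cⱼ) * (cᵢ * cⱼ)))))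
            (0≤+ (0≤+ (0≤* (0≤ι M) (≤⇒0≤ dev-square)) (0≤* (0≤* (0≤ι M) 0≤cᵢ) (≤⇒0≤ S-bound)))
              (0≤+ (0≤* (0≤* (0≤* 0≤cᵢ (0≤+ 0≤cᵢ 0≤cᵢ)) (≤⇒0≤ 1≤ιℓ)) (≤⇒0≤ w-square))
                (0≤+ (0≤+ 0≤sq 0≤sq) (0≤+ 0≤sq 0≤sq))))
            (subst (λ m → 4ℓ * ((cᵢ * cⱼ) * (cᵢ * cⱼ)) - 4ℓ * ((ι q * dev) * (ι q * dev)) ≡
                ((m * (cᵢ * S - dev * dev) + m * cᵢ * ((cᵢ + cᵢ) * (γ * R) - S))
              + (cᵢ * (cᵢ + cᵢ) * γ * ((cⱼ + cⱼ) * cⱼ - m * R) + ((cᵢ * cⱼ) * (cᵢ * cⱼ) + (cᵢ * cⱼ) * (cᵢ * cⱼ) + ((cᵢ * cⱼ) * (cᵢ * cⱼ) + (cᵢ * cⱼ) * (cᵢ * cⱼ))))))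
              (sym M-value) (l (ι ℓ) (ι q) dev cᵢ cⱼ S R)))
            where
            R = ∑ (λ b → w b * w b)
            4ℓ = (ι ℓ + ι ℓ) + (ι ℓ + ι ℓ)
            0≤sq = 0≤-square (cᵢ * cⱼ)
            0<+ : ∀ {a b} → 0ℚ < a → 0ℚ < b → 0ℚ < a + b
            0<+ {a} {b} p r = subst (_< a + b) (ℚₚ.+-identityˡ 0ℚ) (ℚₚ.+-mono-< p r)
            0<2ℓ = 0<+ (0<ι 1≤ℓ) (0<ι 1≤ℓ)
            l : ∀ ℓ q δ a b S R → ((ℓ + ℓ) + (ℓ + ℓ)) * ((a * b) * (a * b)) - ((ℓ + ℓ) + (ℓ + ℓ)) * ((q * δ) * (q * δ)) ≡
              (((((ℓ + ℓ) + (ℓ + ℓ)) * (q * q)) * (a * S - δ * δ) + (((ℓ + ℓ) + (ℓ + ℓ)) * (q * q)) * a * ((a + a) * ((ℓ - 1ℚ) * R) - S))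
              + (a * (a + a) * (ℓ - 1ℚ) * ((b + b) * b - (((ℓ + ℓ) + (ℓ + ℓ)) * (q * q)) * R) + ((a * b) * (a * b) + (a * b) * (a * b) + ((a * b) * (a * b) + (a * b) * (a * b)))))
            l = RS.solve-∀ ℚ-ring

        hit-total : ℚ
        hit-total = ∑ (λ x → [ U x ] * ∑ (λ y → [ W y ] * [ hits α (base x y) ]))

        private
          dev≡ : dev ≡ ι ℓ * hit-total - card U * card W
          dev≡ = trans (∑-cong (λ x → trans (cong ([ U x ] *_) (inner x)) (l₂ [ U x ] (ι ℓ) (h x) (card W))))
            (trans (∑-+ (λ x → ι ℓ * ([ U x ] * h x)) (λ x → (- card W) * [ U x ]))
              (trans (cong₂ _+_ (∑-*ˡ (ι ℓ) (λ x → [ U x ] * h x)) (trans (∑-*ˡ (- card W) (λ x → [ U x ])) (cong ((- card W) *_) (sym (card-∑ U)))))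
                (l₃ (ι ℓ * hit-total) (card W) (card U))))
            where
            h : Fin n → ℚ
            h x = ∑ (λ y → [ W y ] * [ hits α (base x y) ])
            l₁ : ∀ w ℓ h → w * (ℓ * h - 1ℚ) ≡ ℓ * (w * h) + (- 1ℚ) * w
            l₁ = RS.solve-∀ ℚ-ring
            l₂ : ∀ u ℓ h w → u * (ℓ * h + (- 1ℚ) * w) ≡ ℓ * (u * h) + (- w) * u
            l₂ = RS.solve-∀ ℚ-ring
            l₃ : ∀ a w u → a + (- w) * u ≡ a - u * w
            l₃ = RS.solve-∀ ℚ-ring
            inner : ∀ x → s x ≡ ι ℓ * h x + (- 1ℚ) * card W
            inner x = trans (∑-cong (λ y → l₁ [ W y ] (ι ℓ) [ hits α (base x y) ]))
              (trans (∑-+ (λ y → ι ℓ * ([ W y ] * [ hits α (base x y) ])) (λ y → (- 1ℚ) * [ W y ]))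
                (cong₂ _+_ (∑-*ˡ (ι ℓ) (λ y → [ W y ] * [ hits α (base x y) ]))
                  (trans (∑-*ˡ (- 1ℚ) (λ y → [ W y ])) (cong ((- 1ℚ) *_) (sym (card-∑ W))))))

        deviation-upper : ι q * (ι ℓ * hit-total - card U * card W) ≤ cᵢ * cⱼ
        deviation-upper = subst (λ d → ι q * d ≤ cᵢ * cⱼ) dev≡ (square-cancel (0≤* 0≤cᵢ 0≤cⱼ) scaled-square)

        deviation-lower : ι q * (card U * card W - ι ℓ * hit-total) ≤ cᵢ * cⱼ
        deviation-lower = subst (_≤ cᵢ * cⱼ) (trans (cong (λ d → - (ι q * d)) dev≡) (l (ι q) (ι ℓ * hit-total) (card U * card W)))
          (square-cancel (0≤* 0≤cᵢ 0≤cⱼ) (subst (_≤ (cᵢ * cⱼ) * (cᵢ * cⱼ)) (sym (l₂ (ι q * dev))) scaled-square))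
          where
          l : ∀ q a b → - (q * (a - b)) ≡ q * (b - a)
          l = RS.solve-∀ ℚ-ring
          l₂ : ∀ v → - v * - v ≡ v * v
          l₂ = RS.solve-∀ ℚ-ring

-- The colour classes have disc₂.

module ColourClasses where
  open Counting
  open Partitions using (cls; #-mono; #-cong; does⇒)
  open HalfGraphPartitions using (_⊆ᵇ_)
  open Rationals
  open Embedding
  open SecondMoments
  open QuasirandomColouring
  open import Defs
  open import Data.Bool.Base using (Bool; true; false; _∧_)
  open import Data.Fin.Base as Fin using (Fin; suc)
  open import Data.Fin.Subset using (Subset; _⊆_; ∣_∣)
  open import Data.Integer.Base using (+_)
  open import Data.Nat.Base as ℕ using (ℕ; suc; NonZero)
  import Data.Nat.Coprimality as Coprime
  open import Data.Rational.Base as ℚ using (ℚ; 0ℚ; 1ℚ; _/_; _+_; _*_; _-_; -_; _≤_; _<_)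
  import Data.Rational.Unnormalised.Base as ℚᵘ
  import Data.Rational.Unnormalised.Properties as ℚᵘₚ
  open import Data.Vec.Base using (lookup; tabulate)
  open import Relation.Binary.Definitions using (Tri; tri<; tri≈; tri>)

  private
    variable
      n t : ℕ

  unit-fraction : ∀ ℓ .{{_ : NonZero ℓ}} → (+ 1 / ℓ) * ι ℓ ≡ 1ℚ
  unit-fraction ℓ@(suc k) = trans (cong ((+ 1 / ℓ) *_) (ι≡fromℕ ℓ))
    (ℚₚ.toℚᵘ-injective (ℚᵘₚ.≃-trans (ℚₚ.toℚᵘ-homo-* (+ 1 / ℓ) (fromℕ ℓ))
      (ℚᵘₚ.≃-trans (ℚᵘₚ.≃-reflexive (cong₂ ℚᵘ._*_ (cong ℚ.toℚᵘ (ℚₚ.normalize-coprime (Coprime.1-coprimeTo ℓ))) (toℚᵘ-fromℕ ℓ)))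
        (ℚᵘ.*≡* (cong +_ (trans (ℕₚ.*-identityʳ _) (trans (ℕₚ.+-identityʳ ℓ) (sym (trans (ℕₚ.*-identityˡ _) (ℕₚ.*-identityʳ ℓ))))))))))

  count₂-tabulate : (E : Rel₂ n) (U W : Fin n → Bool) → count₂ E (tabulate U) (tabulate W) ≡ size₂ E U W
  count₂-tabulate E U W = trans (count₂-size E (tabulate U) (tabulate W))
    (size₂-cong (λ _ _ → refl) (lookup-tabulate U) (lookup-tabulate W))

  fromℕ-∣∣₂ : (U W : Subset n) → fromℕ (∣ U ∣ ℕ.* ∣ W ∣) ≡ card (lookup U) * card (lookup W)
  fromℕ-∣∣₂ U W = trans (cong fromℕ (cong₂ ℕ._*_ (∣∣-size U) (∣∣-size W)))
    (trans (sym (ι≡fromℕ _)) (ι-* (# (lookup U)) (# (lookup W))))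

  -- disc₂ and its density for subsets given by Boolean predicates.
  record Disc₂ (ε r : ℚ) (U W : Fin n → Bool) (E : Rel₂ n) : Set where
    field
      d : ℚ
      density : ι (size₂ E U W) ≡ d * (card U * card W)
      upper : ∀ A B → A ⊆ᵇ U → B ⊆ᵇ W → ι (size₂ E A B) ≤ d * (card A * card B) + ε * (card U * card W)
      lower : ∀ A B → A ⊆ᵇ U → B ⊆ᵇ W → d * (card A * card B) ≤ ι (size₂ E A B) + ε * (card U * card W)
      near-upper : ι (size₂ E U W) ≤ r * (card U * card W) + ε * (card U * card W)
      near-lower : r * (card U * card W) ≤ ι (size₂ E U W) + ε * (card U * card W)

  card-tabulate : (U : Fin n → Bool) → card (lookup (tabulate U)) ≡ card U
  card-tabulate U = cong ι (#-cong (lookup-tabulate U))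

  area-tabulate : (U W : Fin n → Bool) → fromℕ (∣ tabulate U ∣ ℕ.* ∣ tabulate W ∣) ≡ card U * card W
  area-tabulate U W = trans (fromℕ-∣∣₂ (tabulate U) (tabulate W)) (cong₂ _*_ (card-tabulate U) (card-tabulate W))

  Disc₂⇒disc₂ : ∀ ε r (U W : Fin n → Bool) E → Disc₂ ε r U W E → disc₂[ ε ⨾ r ] (tabulate U) (tabulate W) E
  Disc₂⇒disc₂ ε r U W E D = (d , trans (trans count₀ density) (cong (d *_) (sym area₀)) , regular) ,
      subst₂ (λ s a → s ≈ r * a within (ε * a)) (sym count₀) (sym area₀) (⇒within near-upper near-lower)
    where
    open Disc₂ D
    count₀ : fromℕ (count₂ E (tabulate U) (tabulate W)) ≡ ι (size₂ E U W)
    count₀ = trans (cong fromℕ (count₂-tabulate E U W)) (sym (ι≡fromℕ _))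
    area₀ = area-tabulate U W
    regular : ∀ U′ W′ → U′ ⊆ tabulate U → W′ ⊆ tabulate W →
      fromℕ (count₂ E U′ W′) ≈ d * fromℕ (∣ U′ ∣ ℕ.* ∣ W′ ∣) within (ε * fromℕ (∣ tabulate U ∣ ℕ.* ∣ tabulate W ∣))
    regular U′ W′ U⊆ W⊆ = subst₂ (λ s a → s ≈ d * a within (ε * fromℕ (∣ tabulate U ∣ ℕ.* ∣ tabulate W ∣)))
      (trans (ι≡fromℕ _) (cong fromℕ (sym (count₂-size E U′ W′)))) (sym (fromℕ-∣∣₂ U′ W′))
      (subst (λ a → ι (size₂ E A B) ≈ d * (card A * card B) within (ε * a)) (sym area₀)
        (⇒within (upper A B A⊆ B⊆) (lower A B A⊆ B⊆)))
      where
      A = lookup U′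
      B = lookup W′
      A⊆ : A ⊆ᵇ U
      A⊆ x e = trans (sym (lookup-tabulate U x)) (⊆-lookup {U = U′} {tabulate U} U⊆ x e)
      B⊆ : B ⊆ᵇ W
      B⊆ x e = trans (sym (lookup-tabulate W x)) (⊆-lookup {U = W′} {tabulate W} W⊆ x e)

  disc₂⇒Disc₂ : ∀ ε r (U W : Fin n → Bool) E → disc₂[ ε ⨾ r ] (tabulate U) (tabulate W) E → Disc₂ ε r U W E
  disc₂⇒Disc₂ ε r U W E ((d , density , regular) , near) = record
    { d = d
    ; density = trans (sym count₀) (trans density (cong (d *_) area₀))
    ; upper = λ A B A⊆ B⊆ → proj₁ (bounds A B A⊆ B⊆)
    ; lower = λ A B A⊆ B⊆ → proj₂ (bounds A B A⊆ B⊆)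
    ; near-upper = proj₁ near′
    ; near-lower = proj₂ near′
    }
    where
    count₀ : fromℕ (count₂ E (tabulate U) (tabulate W)) ≡ ι (size₂ E U W)
    count₀ = trans (cong fromℕ (count₂-tabulate E U W)) (sym (ι≡fromℕ _))
    area₀ = area-tabulate U W
    near′ = within⇒ {ι (size₂ E U W)} {r * (card U * card W)} {ε * (card U * card W)}
      (subst₂ (λ s a → s ≈ r * a within (ε * a)) count₀ area₀ near)
    bounds : ∀ A B → A ⊆ᵇ U → B ⊆ᵇ W → _
    bounds A B A⊆ B⊆ = within⇒ {ι (size₂ E A B)} {d * (card A * card B)} {ε * (card U * card W)}
      (subst₂ (λ s a → s ≈ d * a within (ε * (card U * card W)))
        (trans (cong fromℕ (count₂-tabulate E A B)) (sym (ι≡fromℕ _))) (area-tabulate A B)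
        (subst (λ a → fromℕ (count₂ E (tabulate A) (tabulate B)) ≈ d * fromℕ (∣ tabulate A ∣ ℕ.* ∣ tabulate B ∣) within (ε * a)) area₀
          (regular (tabulate A) (tabulate B) (tabulate-⊆ A⊆) (tabulate-⊆ B⊆))))

  private
    module _ (κ area d r ε : ℚ) (0<κ : 0ℚ < κ) (κε : 1ℚ ≤ κ * ε) (0<area : 0ℚ < area)
      (F₁ : (κ + κ) * (d * area - r * area) ≤ area) (F₂ : (κ + κ) * (r * area - d * area) ≤ area) where

      d-r : (κ + κ) * (d - r) ≤ 1ℚ
      d-r = *-cancel area 0<area (subst₂ _≤_ (l κ d r area) (sym (ℚₚ.*-identityʳ area)) F₁)
        where
        l : ∀ κ d r a → (κ + κ) * (d * a - r * a) ≡ a * ((κ + κ) * (d - r))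
        l = RS.solve-∀ ℚ-ring

      r-d : (κ + κ) * (r - d) ≤ 1ℚ
      r-d = *-cancel area 0<area (subst₂ _≤_ (l κ d r area) (sym (ℚₚ.*-identityʳ area)) F₂)
        where
        l : ∀ κ d r a → (κ + κ) * (r * a - d * a) ≡ a * ((κ + κ) * (r - d))
        l = RS.solve-∀ ℚ-ring

      0<2κ : 0ℚ < κ + κ
      0<2κ = subst (_< κ + κ) (ℚₚ.+-identityˡ 0ℚ) (ℚₚ.+-mono-< 0<κ 0<κ)

      combine-bounds : ∀ s v → 0ℚ ≤ v → v ≤ area → (κ + κ) * (s - r * v) ≤ area → (κ + κ) * (r * v - s) ≤ area →
        s ≤ d * v + ε * area × d * v ≤ s + ε * area
      combine-bounds s v 0≤v v≤ B₁ B₂ =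
        *-cancel (κ + κ) 0<2κ (0≤⇒≤ (((area - (κ + κ) * (s - r * v)) + (1ℚ - (κ + κ) * (r - d)) * v)
            + ((area - v) + ((κ * ε - 1ℚ) * area + (κ * ε - 1ℚ) * area)))
          (0≤+ (0≤+ (≤⇒0≤ B₁) (0≤* (≤⇒0≤ r-d) 0≤v)) rest) (l₁ κ s d r v area ε)) ,
        *-cancel (κ + κ) 0<2κ (0≤⇒≤ (((area - (κ + κ) * (r * v - s)) + (1ℚ - (κ + κ) * (d - r)) * v)
            + ((area - v) + ((κ * ε - 1ℚ) * area + (κ * ε - 1ℚ) * area)))
          (0≤+ (0≤+ (≤⇒0≤ B₂) (0≤* (≤⇒0≤ d-r) 0≤v)) rest) (l₂ κ s d r v area ε))
        where
        0≤area = ℚₚ.<⇒≤ 0<area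
        rest : 0ℚ ≤ (area - v) + ((κ * ε - 1ℚ) * area + (κ * ε - 1ℚ) * area)
        rest = 0≤+ (≤⇒0≤ v≤) (0≤+ (0≤* (≤⇒0≤ κε) 0≤area) (0≤* (≤⇒0≤ κε) 0≤area))
        l₁ : ∀ κ s d r v a ε → (κ + κ) * (d * v + ε * a) - (κ + κ) * s ≡
          ((a - (κ + κ) * (s - r * v)) + (1ℚ - (κ + κ) * (r - d)) * v) + ((a - v) + ((κ * ε - 1ℚ) * a + (κ * ε - 1ℚ) * a))
        l₁ = RS.solve-∀ ℚ-ring
        l₂ : ∀ κ s d r v a ε → (κ + κ) * (s + ε * a) - (κ + κ) * (d * v) ≡
          ((a - (κ + κ) * (r * v - s)) + (1ℚ - (κ + κ) * (d - r)) * v) + ((a - v) + ((κ * ε - 1ℚ) * a + (κ * ε - 1ℚ) * a))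
        l₂ = RS.solve-∀ ℚ-ring

      near-bounds : d * area ≤ r * area + ε * area × r * area ≤ d * area + ε * area
      near-bounds =
        *-cancel (κ + κ) 0<2κ (0≤⇒≤ ((area - (κ + κ) * (d * area - r * area)) + (((κ * ε - 1ℚ) * area + (κ * ε - 1ℚ) * area) + area))
          (0≤+ (≤⇒0≤ F₁) rest) (l₁ κ d r area ε)) ,
        *-cancel (κ + κ) 0<2κ (0≤⇒≤ ((area - (κ + κ) * (r * area - d * area)) + (((κ * ε - 1ℚ) * area + (κ * ε - 1ℚ) * area) + area))
          (0≤+ (≤⇒0≤ F₂) rest) (l₁ κ r d area ε))
        where
        0≤area = ℚₚ.<⇒≤ 0<area
        rest : 0ℚ ≤ ((κ * ε - 1ℚ) * area + (κ * ε - 1ℚ) * area) + area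
        rest = 0≤+ (0≤+ (0≤* (≤⇒0≤ κε) 0≤area) (0≤* (≤⇒0≤ κε) 0≤area)) 0≤area
        l₁ : ∀ κ d r a ε → (κ + κ) * (r * a + ε * a) - (κ + κ) * (d * a) ≡
          (a - (κ + κ) * (d * a - r * a)) + (((κ * ε - 1ℚ) * a + (κ * ε - 1ℚ) * a) + a)
        l₁ = RS.solve-∀ ℚ-ring

  -- The hypothesis compares with r, but `disc₂` with the density d of E. The full box gives |d - r|
  -- ≤ 1 / 2κ, and the box itself another 1 / 2κ; hence κ + κ there against 1 ≤ κ ε.
  deviation⇒Disc₂ : ∀ κ r ε (U W : Fin n → Bool) E → 0ℚ < κ → 1ℚ ≤ κ * ε → 0ℚ < card U * card W →
    (∀ A B → A ⊆ᵇ U → B ⊆ᵇ W → (κ + κ) * (ι (size₂ E A B) - r * (card A * card B)) ≤ card U * card W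
      × (κ + κ) * (r * (card A * card B) - ι (size₂ E A B)) ≤ card U * card W) →
    Disc₂ ε r U W E
  deviation⇒Disc₂ κ r ε U W E 0<κ κε 0<area dev = record
    { d = d
    ; density = density
    ; upper = λ A B A⊆ B⊆ → proj₁ (bounds A B A⊆ B⊆)
    ; lower = λ A B A⊆ B⊆ → proj₂ (bounds A B A⊆ B⊆)
    ; near-upper = subst (_≤ r * area + ε * area) (sym density) (proj₁ near)
    ; near-lower = subst (λ s → r * area ≤ s + ε * area) (sym density) (proj₂ near)
    }
    where
    area = card U * card W
    rat = ratio (ι (size₂ E U W)) area 0<area
    d = proj₁ rat
    density = proj₂ rat
    full = dev U W (λ _ e → e) (λ _ e → e)
    F₁ : (κ + κ) * (d * area - r * area) ≤ area
    F₁ = subst (λ s → (κ + κ) * (s - r * area) ≤ area) density (proj₁ full)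
    F₂ : (κ + κ) * (r * area - d * area) ≤ area
    F₂ = subst (λ s → (κ + κ) * (r * area - s) ≤ area) density (proj₂ full)
    near = near-bounds κ area d r ε 0<κ κε 0<area F₁ F₂
    bounds : ∀ A B → A ⊆ᵇ U → B ⊆ᵇ W → _
    bounds A B A⊆ B⊆ = combine-bounds κ area d r ε 0<κ κε 0<area F₁ F₂ (ι (size₂ E A B)) (card A * card B)
      (0≤* (0≤card A) (0≤card B)) (*-mono (0≤card A) (0≤card W) (ι-mono (#-mono A⊆)) (ι-mono (#-mono B⊆)))
      (proj₁ (dev A B A⊆ B⊆)) (proj₂ (dev A B A⊆ B⊆))

  size₂-∑ : (E : Rel₂ n) (U W : Fin n → Bool) → ι (size₂ E U W) ≡ ∑ (λ x → [ U x ] * ∑ (λ y → [ W y ] * [ E x y ]))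
  size₂-∑ E U W = trans (ι-sum (λ x → # (λ y → U x ∧ (W y ∧ E x y))))
    (∑-cong (λ x → trans (card-∑ (λ y → U x ∧ (W y ∧ E x y)))
      (trans (∑-cong (λ y → trans ([∧] (U x) (W y ∧ E x y)) (cong ([ U x ] *_) ([∧] (W y) (E x y)))))
        (∑-*ˡ [ U x ] (λ y → [ W y ] * [ E x y ])))))

  size₂-agree : (E E′ : Rel₂ n) (U W : Fin n → Bool) → (∀ x y → U x ≡ true → W y ≡ true → E x y ≡ E′ x y) →
    size₂ E U W ≡ size₂ E′ U W
  size₂-agree E E′ U W h = sum-cong λ x → sum-cong λ y → cong ⟦_⟧ (pt (U x) (W y) (h x y))
    where
    pt : ∀ u w {e e′} → (u ≡ true → w ≡ true → e ≡ e′) → u ∧ (w ∧ e) ≡ u ∧ (w ∧ e′)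
    pt false w h = refl
    pt true false h = refl
    pt true true h = h refl refl

  size₂-transpose : (E : Rel₂ n) (U W : Fin n → Bool) → size₂ E U W ≡ size₂ (λ y x → E x y) W U
  size₂-transpose E U W = trans (sum-swap (λ x y → ⟦ U x ∧ (W y ∧ E x y) ⟧))
    (sum-cong λ y → sum-cong λ x → cong ⟦_⟧ (pt (U x) (W y) (E x y)))
    where
    pt : ∀ u w e → u ∧ (w ∧ e) ≡ w ∧ (u ∧ e)
    pt true w e = refl
    pt false true e = refl
    pt false false e = refl

  module Colouring (part : Fin n → Fin t) (ℓ : ℕ) {{nz : NonZero ℓ}} (q : ℕ) (ε : ℚ) (1≤q : 1 ℕ.≤ q) (qε : 1ℚ ≤ ι q * ε) where

    1≤ℓ : 1 ℕ.≤ ℓ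
    1≤ℓ = ℕ.>-nonZero⁻¹ ℓ

    M K : ℕ
    -- Accuracy 2q instead of q pays for the passage from 1 / ℓ to the actual density in
    -- `deviation⇒Disc₂`.
    M = 4 ℕ.* ℓ ℕ.* ((q ℕ.+ q) ℕ.* (q ℕ.+ q))
    K = ℓ ℕ.^ M

    1≤2q : 1 ℕ.≤ q ℕ.+ q
    1≤2q = ℕₚ.≤-trans 1≤q (ℕₚ.m≤m+n q q)

    1≤M : 1 ℕ.≤ M
    1≤M = ℕₚ.*-mono-≤ {1} {4 ℕ.* ℓ} {1} (ℕₚ.≤-trans 1≤ℓ (ℕₚ.m≤n*m ℓ 4))
      (ℕₚ.*-mono-≤ {1} {q ℕ.+ q} {1} {q ℕ.+ q} 1≤2q 1≤2q)

    1≤K : 1 ℕ.≤ K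
    1≤K = ℕₚ.m^n>0 ℓ M

    σ-blocks : Σ[ σ ∈ (Fin n → Fin M) ] (∀ i b → M ℕ.* # (block part σ i b) ℕ.≤ # (cls part i) ℕ.+ M)
    σ-blocks = even-blocks M 1≤M n part

    τ-blocks : Σ[ τ ∈ (Fin n → Fin K) ] (∀ i b → K ℕ.* # (block part τ i b) ℕ.≤ # (cls part i) ℕ.+ K)
    τ-blocks = even-blocks K 1≤K n part

    module QR = Quasirandom part ℓ (q ℕ.+ q) 1≤ℓ 1≤2q M refl K refl 1≤K
      (proj₁ σ-blocks) (proj₂ σ-blocks) (proj₁ τ-blocks) (proj₂ τ-blocks)

    -- `QR.base` is not symmetric: one end supplies the word, the other the block. The order of the
    -- parts decides which is which. Pairs inside a part get a default colour that is never read.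
    colour-by : ∀ {i j : Fin t} → Tri (i Fin.< j) (i ≡ j) (j Fin.< i) → Fin n → Fin n → Fin ℓ
    colour-by (tri< _ _ _) x y = QR.base x y
    colour-by (tri≈ _ _ _) x y = Fin.fromℕ< 1≤ℓ
    colour-by (tri> _ _ _) x y = QR.base y x

    colour : Fin n → Fin n → Fin ℓ
    colour x y = colour-by (Finₚ.<-cmp (part x) (part y)) x y

    colour-sym : ∀ x y → colour x y ≡ colour y x
    colour-sym x y = go (Finₚ.<-cmp (part x) (part y)) (Finₚ.<-cmp (part y) (part x))
      where
      go : (a : Tri (part x Fin.< part y) (part x ≡ part y) (part y Fin.< part x))
        (b : Tri (part y Fin.< part x) (part y ≡ part x) (part x Fin.< part y)) → colour-by a x y ≡ colour-by b y x
      go (tri< _ _ _) (tri> _ _ _) = refl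
      go (tri≈ _ _ _) (tri≈ _ _ _) = refl
      go (tri> _ _ _) (tri< _ _ _) = refl
      go (tri< lt _ _) (tri< lt′ _ _) = ⊥-elim (ℕₚ.<-asym lt lt′)
      go (tri< lt _ _) (tri≈ _ e _) = ⊥-elim (ℕₚ.<-irrefl (cong Fin.toℕ (sym e)) lt)
      go (tri≈ _ e _) (tri< lt _ _) = ⊥-elim (ℕₚ.<-irrefl (cong Fin.toℕ (sym e)) lt)
      go (tri≈ _ e _) (tri> _ _ lt) = ⊥-elim (ℕₚ.<-irrefl (cong Fin.toℕ e) lt)
      go (tri> _ _ lt) (tri≈ _ e _) = ⊥-elim (ℕₚ.<-irrefl (cong Fin.toℕ e) lt)
      go (tri> _ _ lt) (tri> _ _ lt′) = ⊥-elim (ℕₚ.<-asym lt lt′)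

    colour-< : ∀ x y → part x Fin.< part y → colour x y ≡ QR.base x y
    colour-< x y lt = go (Finₚ.<-cmp (part x) (part y))
      where
      go : (a : Tri (part x Fin.< part y) (part x ≡ part y) (part y Fin.< part x)) → colour-by a x y ≡ QR.base x y
      go (tri< _ _ _) = refl
      go (tri≈ ¬lt _ _) = ⊥-elim (¬lt lt)
      go (tri> ¬lt _ _) = ⊥-elim (¬lt lt)

    module _ (big : ∀ i → K ℕ.≤ # (cls part i) × M ℕ.≤ # (cls part i)) where

      private
        r : ℚ
        r = + 1 / ℓ

        Bounds : (i j : Fin t) (A B : Fin n → Bool) → ℚ → Set
        Bounds i j A B s = ι (q ℕ.+ q) * (ι ℓ * s - card A * card B) ≤ card (cls part i) * card (cls part j)
          × ι (q ℕ.+ q) * (card A * card B - ι ℓ * s) ≤ card (cls part i) * card (cls part j)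

        base-bounds : ∀ α i j A B → A ⊆ᵇ cls part i → B ⊆ᵇ cls part j →
          Bounds i j A B (ι (size₂ (λ x y → hits α (QR.base x y)) A B))
        base-bounds α i j A B A⊆ B⊆ = subst (Bounds i j A B) (sym (size₂-∑ (λ x y → hits α (QR.base x y)) A B))
          (QR.deviation-upper α i j A B A⊆ B⊆ (proj₁ (big i)) (proj₂ (big j)) ,
           QR.deviation-lower α i j A B A⊆ B⊆ (proj₁ (big i)) (proj₂ (big j)))

        P-value : ∀ i j α x y → cls part i x ≡ true → cls part j y ≡ true →
          P part colour i j α x y ≡ does (colour x y Finₚ.≟ α)
        P-value i j α x y e e′ = cong₂ (λ a b → a ∧ (b ∧ does (colour x y Finₚ.≟ α))) e e′

        P-bounds : ∀ i j → i ≢ j → ∀ α A B → A ⊆ᵇ cls part i → B ⊆ᵇ cls part j →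
          Bounds i j A B (ι (size₂ (P part colour i j α) A B))
        P-bounds i j i≢j α A B A⊆ B⊆ = go (Finₚ.<-cmp i j)
          where
          go : Tri (i Fin.< j) (i ≡ j) (j Fin.< i) → Bounds i j A B (ι (size₂ (P part colour i j α) A B))
          go (tri< i<j _ _) = subst (Bounds i j A B) (cong ι (size₂-agree _ _ A B agree)) (base-bounds α i j A B A⊆ B⊆)
            where
            agree : ∀ x y → A x ≡ true → B y ≡ true → hits α (QR.base x y) ≡ P part colour i j α x y
            agree x y a b = sym (trans (P-value i j α x y (A⊆ x a) (B⊆ y b))
              (cong (λ c → does (c Finₚ.≟ α)) (colour-< x y
                (subst₂ Fin._<_ (sym (does⇒ (part x Finₚ.≟ i) (A⊆ x a))) (sym (does⇒ (part y Finₚ.≟ j) (B⊆ y b))) i<j))))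
          go (tri≈ _ i≡j _) = ⊥-elim (i≢j i≡j)
          go (tri> _ _ j<i) = subst (Bounds i j A B) (cong ι (trans (size₂-agree _ _ B A agree) (sym (size₂-transpose (P part colour i j α) A B))))
              (flip (base-bounds α j i B A B⊆ A⊆))
            where
            s = ι (size₂ (λ x y → hits α (QR.base x y)) B A)
            flip : Bounds j i B A s → Bounds i j A B s
            flip (p , p′) = subst₂ (λ u v → ι (q ℕ.+ q) * (ι ℓ * s - u) ≤ v) (ℚₚ.*-comm (card B) (card A)) (ℚₚ.*-comm (card (cls part j)) (card (cls part i))) p ,
              subst₂ (λ u v → ι (q ℕ.+ q) * (u - ι ℓ * s) ≤ v) (ℚₚ.*-comm (card B) (card A)) (ℚₚ.*-comm (card (cls part j)) (card (cls part i))) p′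
            agree : ∀ y x → B y ≡ true → A x ≡ true → hits α (QR.base y x) ≡ P part colour i j α x y
            agree y x b a = sym (trans (P-value i j α x y (A⊆ x a) (B⊆ y b))
              (cong (λ c → does (c Finₚ.≟ α)) (trans (colour-sym x y) (colour-< y x
                (subst₂ Fin._<_ (sym (does⇒ (part y Finₚ.≟ j) (B⊆ y b))) (sym (does⇒ (part x Finₚ.≟ i) (A⊆ x a))) j<i)))))

      colour-disc₂ : ∀ i j → i ≢ j → ∀ α → disc₂[ ε ⨾ + 1 / ℓ ] (class part i) (class part j) (P part colour i j α)
      colour-disc₂ i j i≢j α = Disc₂⇒disc₂ ε r (cls part i) (cls part j) (P part colour i j α)
        (deviation⇒Disc₂ κ r ε (cls part i) (cls part j) (P part colour i j α) 0<κ κε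
          (0<* (0<ι (ℕₚ.≤-trans 1≤K (proj₁ (big i)))) (0<ι (ℕₚ.≤-trans 1≤K (proj₁ (big j))))) dev)
        where
        κ : ℚ
        κ = ι q * ι ℓ
        0<κ : 0ℚ < κ
        0<κ = 0<* (0<ι 1≤q) (0<ι 1≤ℓ)
        1≤ιℓ : 1ℚ ≤ ι ℓ
        1≤ιℓ = subst (_≤ ι ℓ) ι-1 (ι-mono 1≤ℓ)
        κε : 1ℚ ≤ κ * ε
        κε = 0≤⇒≤ ((ι q * ε - 1ℚ) + (ι ℓ - 1ℚ) * (ι q * ε))
          (0≤+ (≤⇒0≤ qε) (0≤* (≤⇒0≤ 1≤ιℓ) (ℚₚ.≤-trans 0≤1 qε))) (l (ι q) (ι ℓ) ε)
          where
          0≤1 : 0ℚ ≤ 1ℚ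
          0≤1 = subst (0ℚ ≤_) ι-1 (0≤ι 1)
          l : ∀ q l e → (q * l) * e - 1ℚ ≡ (q * e - 1ℚ) + (l - 1ℚ) * (q * e)
          l = RS.solve-∀ ℚ-ring
        unit : r * ι ℓ ≡ 1ℚ
        unit = unit-fraction ℓ
        l₁ : ∀ q l s r v → (q * l + q * l) * (s - r * v) ≡ (q + q) * (l * s - (r * l) * v)
        l₁ = RS.solve-∀ ℚ-ring
        l₂ : ∀ q l s r v → (q * l + q * l) * (r * v - s) ≡ (q + q) * ((r * l) * v - l * s)
        l₂ = RS.solve-∀ ℚ-ring
        dev : ∀ A B → A ⊆ᵇ cls part i → B ⊆ᵇ cls part j →
          (κ + κ) * (ι (size₂ (P part colour i j α) A B) - r * (card A * card B)) ≤ card (cls part i) * card (cls part j) ×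
          (κ + κ) * (r * (card A * card B) - ι (size₂ (P part colour i j α) A B)) ≤ card (cls part i) * card (cls part j)
        dev A B A⊆ B⊆ =
          subst (_≤ card (cls part i) * card (cls part j)) (sym (trans (l₁ (ι q) (ι ℓ) s r v)
            (cong₂ (λ a b → a * (ι ℓ * s - b)) (sym (ι-+ q q)) (trans (cong (_* v) unit) (ℚₚ.*-identityˡ v))))) (proj₁ bounds) ,
          subst (_≤ card (cls part i) * card (cls part j)) (sym (trans (l₂ (ι q) (ι ℓ) s r v)
            (cong₂ (λ a b → a * (b - ι ℓ * s)) (sym (ι-+ q q)) (trans (cong (_* v) unit) (ℚₚ.*-identityˡ v))))) (proj₂ bounds)
          where
          s = ι (size₂ (P part colour i j α) A B)
          v = card A * card B
          bounds = P-bounds i j i≢j α A B A⊆ B⊆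

-- Homogeneous triples make regular triads.

module TriadsOfHomogeneousTriples where
  open Counting
  open RowsAndColumns using (∧-intro; ∈-filterᵇ)
  open Partitions using (cls; Equi; class-upper; sum-const)
  open Rationals
  open Embedding
  open Homogeneity
  open ColourClasses
  open import Defs
  open import Data.Bool.Base using (Bool; true; false; T; _∧_; _∨_)
  open import Data.Fin.Base as Fin using (Fin; zero; suc)
  open import Data.Fin.Permutation as Perm using (Permutation′; _⟨$⟩ʳ_; _⟨$⟩ˡ_; _∘ₚ_; lift₀; transpose; inverseˡ; inverseʳ)
  open import Data.Fin.Subset using (∣_∣)
  open import Data.Integer.Base using (+_)
  open import Data.List.Base using (List; length; filterᵇ; allFin; cartesianProduct)
  open import Data.List.Membership.Propositional using (_∈_; _∉_)
  import Data.List.Membership.Propositional.Properties as ∈ₚ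
  open import Data.Nat.Base as ℕ using (ℕ; zero; suc)
  open import Data.Rational.Base using (ℚ; 0ℚ; 1ℚ; _+_; _*_; _-_; -_; _≤_; _<_)
  open import Data.Vec.Base using (tabulate)
  open import Function.Base using (_∘_; id)

  private
    variable
      n t : ℕ

  argmin : ∀ {t} (f : Fin (suc t) → ℕ) → ∃[ i ] ∀ j → f i ℕ.≤ f j
  argmin {zero} f = zero , λ { zero → ℕₚ.≤-refl }
  argmin {suc t} f with argmin (f ∘ suc)
  ... | i , least with ℕₚ.≤-total (f zero) (f (suc i))
  ...   | inj₁ p = zero , λ { zero → ℕₚ.≤-refl ; (suc j) → ℕₚ.≤-trans p (least j) }
  ...   | inj₂ p = suc i , λ { zero → p ; (suc j) → least j }

  Sorted : (f : Fin t → ℕ) → Permutation′ t → Set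
  Sorted f π = ∀ i j → i Fin.≤ j → f (π ⟨$⟩ʳ i) ℕ.≤ f (π ⟨$⟩ʳ j)

  -- Selection sort: the transposition brings a least value to the front. A decomposition lists its
  -- parts by size, whereas an equipartition comes in any order.
  sorting : ∀ t (f : Fin t → ℕ) → Σ[ π ∈ Permutation′ t ] Sorted f π
  sorting zero f = Perm.id , λ ()
  sorting (suc t) f = step (argmin f)
    where
    step : ∃[ i ] (∀ j → f i ℕ.≤ f j) → Σ[ π ∈ Permutation′ (suc t) ] Sorted f π
    step (i₀ , least) = finish (sorting t (λ j → f (swap ⟨$⟩ʳ suc j)))
      where
      swap : Permutation′ (suc t)
      swap = transpose zero i₀
      finish : Σ[ π ∈ Permutation′ t ] Sorted (λ j → f (swap ⟨$⟩ʳ suc j)) π → Σ[ π ∈ Permutation′ (suc t) ] Sorted f π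
      finish (π , sorted) = lift₀ π ∘ₚ swap , λ
        { zero j _ → least (swap ⟨$⟩ʳ (lift₀ π ⟨$⟩ʳ j))
        ; (suc i) (suc j) (ℕ.s≤s le) → sorted i j le
        ; (suc i) zero () }

  relabel : ∀ {t} → Permutation′ t → (Fin n → Fin t) → Fin n → Fin t
  relabel π part x = π ⟨$⟩ˡ part x

  cls-relabel : ∀ {t} (π : Permutation′ t) (part : Fin n → Fin t) i x →
    cls (relabel π part) i x ≡ cls part (π ⟨$⟩ʳ i) x
  cls-relabel π part i x = go (part x Finₚ.≟ (π ⟨$⟩ʳ i))
    where
    go : Dec (part x ≡ π ⟨$⟩ʳ i) → cls (relabel π part) i x ≡ cls part (π ⟨$⟩ʳ i) x
    go (yes e) = trans (dec-true (_ Finₚ.≟ i) (trans (cong (π ⟨$⟩ˡ_) e) (inverseˡ π))) (sym (dec-true (_ Finₚ.≟ _) e))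
    go (no ne) = trans (dec-false (_ Finₚ.≟ i) (λ e → ne (trans (sym (inverseʳ π)) (cong (π ⟨$⟩ʳ_) e)))) (sym (dec-false (_ Finₚ.≟ _) ne))

  size₃-mono : {F F′ : Rel₃ n} (U V W : Fin n → Bool) → (∀ x y z → F x y z ≡ true → F′ x y z ≡ true) →
    size₃ F U V W ℕ.≤ size₃ F′ U V W
  size₃-mono U V W h = sum-mono λ x → sum-mono λ y → sum-mono λ z → pt (U x) (V y) (W z) (h x y z)
    where
    pt : ∀ a b c {f f′} → (f ≡ true → f′ ≡ true) → ⟦ a ∧ (b ∧ (c ∧ f)) ⟧ ℕ.≤ ⟦ a ∧ (b ∧ (c ∧ f′)) ⟧
    pt true true true {true} h rewrite h refl = ℕₚ.≤-refl
    pt true true true {false} h = ℕ.z≤n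
    pt true true false h = ℕ.z≤n
    pt true false c h = ℕ.z≤n
    pt false b c h = ℕ.z≤n

  -- |T ∖ E| ≤ |V ∖ E| for T = T ∩ S, without subtraction.
  size₃-complement : (E T S : Rel₃ n) (U V W : Fin n → Bool) →
    (∀ x y z → T x y z ≡ true → E x y z ≡ true → S x y z ≡ true) →
    size₃ T U V W ℕ.+ size₃ E U V W ℕ.≤ # U ℕ.* # V ℕ.* # W ℕ.+ size₃ S U V W
  size₃-complement E T S U V W h = subst₂ ℕ._≤_
    (sum₃-+ (λ x y z → U x ∧ (V y ∧ (W z ∧ T x y z))) (λ x y z → U x ∧ (V y ∧ (W z ∧ E x y z))))
    (trans (sum₃-+ (λ x y z → U x ∧ (V y ∧ (W z ∧ true))) (λ x y z → U x ∧ (V y ∧ (W z ∧ S x y z))))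
      (cong (ℕ._+ size₃ S U V W) (size₃-full U V W)))
    (sum-mono λ x → sum-mono λ y → sum-mono λ z → pt (U x) (V y) (W z) (h x y z))
    where
    sum₃-+ : (f g : Rel₃ _) →
      sum (λ x → sum (λ y → sum (λ z → ⟦ f x y z ⟧ ℕ.+ ⟦ g x y z ⟧))) ≡
      sum (λ x → sum (λ y → # (f x y))) ℕ.+ sum (λ x → sum (λ y → # (g x y)))
    sum₃-+ f g = trans (sum-cong λ x → trans (sum-cong λ y → sum-+ (λ z → ⟦ f x y z ⟧) (λ z → ⟦ g x y z ⟧))
        (sum-+ (λ y → # (f x y)) (λ y → # (g x y))))
      (sum-+ (λ x → sum (λ y → # (f x y))) (λ x → sum (λ y → # (g x y))))
    pt : ∀ a b c {t e s} → (t ≡ true → e ≡ true → s ≡ true) →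
      ⟦ a ∧ (b ∧ (c ∧ t)) ⟧ ℕ.+ ⟦ a ∧ (b ∧ (c ∧ e)) ⟧ ℕ.≤ ⟦ a ∧ (b ∧ (c ∧ true)) ⟧ ℕ.+ ⟦ a ∧ (b ∧ (c ∧ s)) ⟧
    pt true true true {true} {true} h rewrite h refl refl = ℕₚ.≤-refl
    pt true true true {true} {false} {s} h = ℕ.s≤s ℕ.z≤n
    pt true true true {false} {e} {s} h = ℕₚ.≤-trans (⟦⟧≤1 e) (ℕₚ.m≤m+n 1 ⟦ s ⟧)
    pt true true false h = ℕ.z≤n
    pt true false c h = ℕ.z≤n
    pt false b c h = ℕ.z≤n

  bounded-ratio : ∀ s m → s ℕ.≤ m → ∃[ d ] ι s ≡ d * ι m × 0ℚ ≤ d × d ≤ 1ℚ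
  -- Without triangles the density is undetermined; 0 keeps it in [0, 1].
  bounded-ratio zero zero _ = 0ℚ , trans ι-0 (sym (ℚₚ.*-zeroˡ (ι 0))) , ℚₚ.≤-refl , subst (0ℚ ≤_) ι-1 (0≤ι 1)
  bounded-ratio s m@(suc _) s≤m = bounded (ratio (ι s) (ι m) (0<ι (ℕ.s≤s ℕ.z≤n)))
    where
    bounded : ∃[ d ] ι s ≡ d * ι m → ∃[ d ] ι s ≡ d * ι m × 0ℚ ≤ d × d ≤ 1ℚ
    bounded (d , e) = d , e , density-bounds (ι s) (ι m) d (0<ι (ℕ.s≤s ℕ.z≤n)) (0≤ι s) (ι-mono s≤m) e

  T⇒true : ∀ {b} → T b → b ≡ true
  T⇒true {true} _ = refl

  true⇒T : ∀ {b} → b ≡ true → T b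
  true⇒T refl = _

  triangles-⊆ : (G G′ : Edges n) → G′ ⊆ᵍ G → ∀ x y z → triangles G′ x y z ≡ true → triangles G x y z ≡ true
  triangles-⊆ G G′ (s₁₂ , s₁₃ , s₂₃) x y z e = ∧-intro (T⇒true (s₁₂ x y (true⇒T (proj₁ e₁))))
      (∧-intro (T⇒true (s₁₃ x z (true⇒T (proj₁ e₂)))) (T⇒true (s₂₃ y z (true⇒T (proj₂ e₂)))))
    where
    e₁ = ∧-elim {E₁₂ G′ x y} e
    e₂ = ∧-elim {E₁₃ G′ x z} (proj₂ e₁)

  count₃-ι : (F : Rel₃ n) (U V W : Fin n → Bool) → fromℕ (count₃ F (tabulate U) (tabulate V) (tabulate W)) ≡ ι (size₃ F U V W)
  count₃-ι F U V W = trans (cong fromℕ (count₃-tabulate F U V W)) (sym (ι≡fromℕ _))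

  module TriadRegular (E : Rel₃ n) (U V W : Fin n → Bool) (w : ℕ) (hom : Homogeneous w U V W E)
    (ε₁ r : ℚ) (0<ε₁ : 0ℚ < ε₁) (0<r : 0ℚ < r) (wε : 1ℚ ≤ ι w * (ε₁ * (r * r * r))) (G : Edges n) where

    private
      B vol₀ : ℚ
      vol₀ = card U * card V * card W
      B = ε₁ * (r * r * r) * vol₀

      e = ι (size₃ E U V W)

      0≤c : 0ℚ ≤ ε₁ * (r * r * r)
      0≤c = ℚₚ.<⇒≤ (0<* 0<ε₁ (0<* (0<* 0<r 0<r) 0<r))

      below-B : ∀ a → 0ℚ ≤ a → ι w * a ≤ vol₀ → a ≤ B
      below-B a 0≤a le = 0≤⇒≤ ((ι w * (ε₁ * (r * r * r)) - 1ℚ) * a + ε₁ * (r * r * r) * (vol₀ - ι w * a))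
        (0≤+ (0≤* (≤⇒0≤ wε) 0≤a) (0≤* 0≤c (≤⇒0≤ le))) (l (ι w) (ε₁ * (r * r * r)) a vol₀)
        where
        l : ∀ w c a v → c * v - a ≡ (w * c - 1ℚ) * a + c * (v - w * a)
        l = RS.solve-∀ ℚ-ring

      F′ T₀ : Rel₃ n
      T₀ = triangles G
      F′ = E ∩₃ T₀

      s m : ℕ
      s = size₃ F′ U V W
      m = size₃ T₀ U V W

      s≤m : s ℕ.≤ m
      s≤m = size₃-mono U V W (λ x y z t → proj₂ (∧-elim {E x y z} t))

      s≤e : ι s ≤ e
      s≤e = ι-mono (size₃-mono U V W (λ x y z t → proj₁ (∧-elim {E x y z} t)))

      rat = bounded-ratio s m s≤m

      ι-vol : ι (# U ℕ.* # V ℕ.* # W) ≡ vol₀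
      ι-vol = trans (ι-* (# U ℕ.* # V) (# W)) (cong (_* card W) (ι-* (# U) (# V)))

    d₃ : ℚ
    d₃ = proj₁ rat

    density : ι s ≡ d₃ * ι m
    density = proj₁ (proj₂ rat)

    module _ (G′ : Edges n) (G′⊆G : G′ ⊆ᵍ G) where
      private
        T′ : Rel₃ n
        T′ = triangles G′

        s′ m′ : ℚ
        s′ = ι (size₃ (F′ ∩₃ T′) U V W)
        m′ = ι (size₃ T′ U V W)

        0≤d = proj₁ (proj₂ (proj₂ rat))
        d≤1 = proj₂ (proj₂ (proj₂ rat))

        m′≤m : m′ ≤ ι m
        m′≤m = ι-mono (size₃-mono U V W (triangles-⊆ G G′ G′⊆G))

        s′≤m′ : s′ ≤ m′
        s′≤m′ = ι-mono (size₃-mono U V W (λ x y z t → proj₂ (∧-elim {F′ x y z} t)))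

        s′≤s : s′ ≤ ι s
        s′≤s = ι-mono (size₃-mono U V W (λ x y z t → proj₁ (∧-elim {F′ x y z} t)))

        0≤s′ : 0ℚ ≤ s′
        0≤s′ = 0≤ι _

        0≤m′ : 0ℚ ≤ m′
        0≤m′ = 0≤ι _

        complement : m′ + e ≤ vol₀ + s′
        complement = subst₂ _≤_ (ι-+ _ _) (trans (ι-+ _ _) (cong (_+ s′) ι-vol))
          (ι-mono (size₃-complement E T′ (F′ ∩₃ T′) U V W
            (λ x y z t ee → ∧-intro (∧-intro ee (triangles-⊆ G G′ G′⊆G x y z t)) t)))

        complement₀ : ι m + e ≤ vol₀ + ι s
        complement₀ = subst₂ _≤_ (ι-+ _ _) (trans (ι-+ _ _) (cong (_+ ι s) ι-vol))
          (ι-mono (size₃-complement E T₀ F′ U V W (λ x y z t ee → ∧-intro ee t)))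

        e≤vol : e ≤ vol₀
        e≤vol = subst (e ≤_) ι-vol (ι-mono (size₃≤ E U V W))

      -- In a nearly empty triple, s′ and d₃ m′ ≤ d₃ m = s are at most the number of edges. In a
      -- nearly complete one, m′ - s′ and (1 - d₃) m′ ≤ m - s are at most the number of non-edges.
      -- Since 1 / w ≤ ε₁ r³, that number is at most B in either case.
      regular : s′ ≤ d₃ * m′ + B × d₃ * m′ ≤ s′ + B
      regular = by hom
        where
        l₁ : ∀ s′ d m′ B → d * m′ + B - s′ ≡ (B - s′) + d * m′
        l₁ = RS.solve-∀ ℚ-ring
        l₂ : ∀ s′ d m′ m B e → s′ + B - d * m′ ≡ d * (m - m′) + (e - d * m) + (B - e) + s′
        l₂ = RS.solve-∀ ℚ-ring
        l₃ : ∀ s′ d m′ m B e v → d * m′ + B - s′ ≡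
          ((m′ - s′) + (1ℚ - d) * (m - m′)) + (((v + d * m) - (m + e)) + (B - (v - e)))
        l₃ = RS.solve-∀ ℚ-ring
        l₄ : ∀ s′ d m′ B e v → s′ + B - d * m′ ≡ ((1ℚ - d) * m′ + ((v + s′) - (m′ + e))) + (B - (v - e))
        l₄ = RS.solve-∀ ℚ-ring
        by : Homogeneous w U V W E → s′ ≤ d₃ * m′ + B × d₃ * m′ ≤ s′ + B
        by (inj₁ small) =
          0≤⇒≤ ((B - s′) + d₃ * m′) (0≤+ (≤⇒0≤ (ℚₚ.≤-trans s′≤s (ℚₚ.≤-trans s≤e e≤B))) (0≤* 0≤d 0≤m′)) (l₁ s′ d₃ m′ B) ,
          0≤⇒≤ (d₃ * (ι m - m′) + (e - d₃ * ι m) + (B - e) + s′)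
            (0≤+ (0≤+ (0≤+ (0≤* 0≤d (≤⇒0≤ m′≤m)) (≤⇒0≤ (subst (_≤ e) density s≤e))) (≤⇒0≤ e≤B)) 0≤s′)
            (l₂ s′ d₃ m′ (ι m) B e)
          where
          e≤B : e ≤ B
          e≤B = below-B e (0≤ι _) small
        by (inj₂ large) =
          0≤⇒≤ (((m′ - s′) + (1ℚ - d₃) * (ι m - m′)) + (((vol₀ + d₃ * ι m) - (ι m + e)) + (B - (vol₀ - e))))
            (0≤+ (0≤+ (≤⇒0≤ s′≤m′) (0≤* (≤⇒0≤ d≤1) (≤⇒0≤ m′≤m)))
              (0≤+ (≤⇒0≤ (subst (λ q → ι m + e ≤ vol₀ + q) density complement₀)) (≤⇒0≤ v-e≤B))) (l₃ s′ d₃ m′ (ι m) B e vol₀) ,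
          0≤⇒≤ (((1ℚ - d₃) * m′ + ((vol₀ + s′) - (m′ + e))) + (B - (vol₀ - e)))
            (0≤+ (0≤+ (0≤* (≤⇒0≤ d≤1) 0≤m′) (≤⇒0≤ complement)) (≤⇒0≤ v-e≤B)) (l₄ s′ d₃ m′ B e vol₀)
          where
          v-e≤B : vol₀ - e ≤ B
          v-e≤B = below-B (vol₀ - e) (≤⇒0≤ e≤vol) large

    fromℕ-∣∣₃ : fromℕ (∣ tabulate U ∣ ℕ.* ∣ tabulate V ∣ ℕ.* ∣ tabulate W ∣) ≡ vol₀
    fromℕ-∣∣₃ = trans (cong fromℕ (cong₂ ℕ._*_ (cong₂ ℕ._*_ (∣tabulate∣ U) (∣tabulate∣ V)) (∣tabulate∣ W)))
      (trans (sym (ι≡fromℕ _)) ι-vol)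

    triad-disc₂,₃ : ∀ ε₂ → r ≤ 1ℚ → disc₂[ ε₂ ⨾ r ] (tabulate U) (tabulate V) (E₁₂ G) →
      disc₂[ ε₂ ⨾ r ] (tabulate U) (tabulate W) (E₁₃ G) → disc₂[ ε₂ ⨾ r ] (tabulate V) (tabulate W) (E₂₃ G) →
      disc₂,₃ ε₁ ε₂ (tabulate U) (tabulate V) (tabulate W) (E ∩₃ triangles G) G
    triad-disc₂,₃ ε₂ r≤1 D₁₂ D₁₃ D₂₃ =
      d₃ , trans (count₃-ι F′ U V W) (trans density (cong (d₃ *_) (sym (count₃-ι T₀ U V W)))) ,
      r , 0<r , r≤1 , D₁₂ , D₁₃ , D₂₃ , λ G′ G′⊆G →
        subst₂ (λ a b → a ≈ d₃ * b within (ε₁ * (r * r * r) * fromℕ (∣ tabulate U ∣ ℕ.* ∣ tabulate V ∣ ℕ.* ∣ tabulate W ∣)))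
          (sym (count₃-ι (F′ ∩₃ triangles G′) U V W)) (sym (count₃-ι (triangles G′) U V W))
          (subst (λ v → ι (size₃ (F′ ∩₃ triangles G′) U V W) ≈ d₃ * ι (size₃ (triangles G′) U V W) within (ε₁ * (r * r * r) * v))
            (sym fromℕ-∣∣₃) (⇒within (proj₁ (regular G′ G′⊆G)) (proj₂ (regular G′ G′⊆G))))

  module Exceptional (part : Fin n → Fin t) (equi : Equi part) where

    same : Fin n × Fin n × Fin n → Bool
    same (x , y , z) = cls part (part x) y ∨ (cls part (part x) z ∨ cls part (part y) z)

    exceptional : List (Fin n × Fin n × Fin n)
    exceptional = filterᵇ same (cartesianProduct (allFin n) (cartesianProduct (allFin n) (allFin n)))

    not-exceptional : ∀ x y z → (x , y , z) ∉ exceptional → part x ≢ part y × part x ≢ part z × part y ≢ part z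
    not-exceptional x y z ∉ex =
      (λ e → absurd (cong (_∨ (cls part (part x) z ∨ cls part (part y) z)) (dec-true (part y Finₚ.≟ part x) (sym e)))) ,
      (λ e → absurd (trans (cong (λ b → cls part (part x) y ∨ (b ∨ cls part (part y) z)) (dec-true (part z Finₚ.≟ part x) (sym e))) (∨-true (cls part (part x) y)))) ,
      (λ e → absurd (trans (cong (λ b → cls part (part x) y ∨ (cls part (part x) z ∨ b)) (dec-true (part z Finₚ.≟ part y) (sym e)))
        (trans (cong (cls part (part x) y ∨_) (∨-true (cls part (part x) z))) (∨-true (cls part (part x) y)))))
      where
      ∨-true : ∀ b → b ∨ true ≡ true
      ∨-true true = refl
      ∨-true false = refl
      absurd : same (x , y , z) ≡ true → ⊥
      absurd e = ∉ex (∈-filterᵇ same _ (∈ₚ.∈-cartesianProduct⁺ (∈ₚ.∈-allFin x) (∈ₚ.∈-cartesianProduct⁺ (∈ₚ.∈-allFin y) (∈ₚ.∈-allFin z))) e)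

    -- Two of three vertices can share a part in three ways, each contributing at most n C triples,
    -- where C adds up the class sizes over all vertices. As t ≤ n, a class has at most 2n / t
    -- vertices.
    count : t ℕ.≤ n → t ℕ.* length exceptional ℕ.≤ 6 ℕ.* (n ℕ.^ 3)
    count t≤n = begin
      t ℕ.* length exceptional
        ≡⟨ cong (t ℕ.*_) (count-triples same) ⟩
      t ℕ.* sum (λ x → sum (λ y → # (λ z → same (x , y , z))))
        ≤⟨ ℕₚ.*-monoʳ-≤ t (sum-mono bound) ⟩
      t ℕ.* sum (λ x → n ℕ.* c x ℕ.+ (n ℕ.* c x ℕ.+ C))
        ≡⟨ cong (t ℕ.*_) (trans (sum-+ (λ x → n ℕ.* c x) (λ x → n ℕ.* c x ℕ.+ C))
             (cong₂ ℕ._+_ (sum-*ˡ n c) (trans (sum-+ (λ x → n ℕ.* c x) (λ _ → C)) (cong₂ ℕ._+_ (sum-*ˡ n c) (sum-const n C))))) ⟩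
      t ℕ.* (n ℕ.* C ℕ.+ (n ℕ.* C ℕ.+ n ℕ.* C))
        ≡⟨ l₁ t n C ⟩
      3 ℕ.* (n ℕ.* (t ℕ.* C))
        ≤⟨ ℕₚ.*-monoʳ-≤ 3 (ℕₚ.*-monoʳ-≤ n C-bound) ⟩
      3 ℕ.* (n ℕ.* (n ℕ.* (n ℕ.+ n)))
        ≡⟨ l₂ n ⟩
      6 ℕ.* (n ℕ.* (n ℕ.* (n ℕ.* 1))) ∎
      where
      open ℕₚ.≤-Reasoning
      c : Fin n → ℕ
      c x = # (cls part (part x))
      C : ℕ
      C = sum c
      l₁ : ∀ t n C → t ℕ.* (n ℕ.* C ℕ.+ (n ℕ.* C ℕ.+ n ℕ.* C)) ≡ 3 ℕ.* (n ℕ.* (t ℕ.* C))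
      l₁ = ℕ-Solver.solve-∀
      l₂ : ∀ n → 3 ℕ.* (n ℕ.* (n ℕ.* (n ℕ.+ n))) ≡ 6 ℕ.* (n ℕ.* (n ℕ.* (n ℕ.* 1)))
      l₂ = ℕ-Solver.solve-∀
      C-bound : t ℕ.* C ℕ.≤ n ℕ.* (n ℕ.+ n)
      C-bound = subst₂ ℕ._≤_ (sum-*ˡ t c) (sum-const n (n ℕ.+ n))
        (sum-mono (λ x → ℕₚ.≤-trans (class-upper part equi (part x)) (ℕₚ.+-monoʳ-≤ n t≤n)))
      or : ∀ a b d → ⟦ a ∨ (b ∨ d) ⟧ ℕ.≤ ⟦ a ⟧ ℕ.+ (⟦ b ⟧ ℕ.+ ⟦ d ⟧)
      or true b d = ℕ.s≤s ℕ.z≤n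
      or false true d = ℕ.s≤s ℕ.z≤n
      or false false d = ℕₚ.≤-refl
      bound : ∀ x → sum (λ y → # (λ z → same (x , y , z))) ℕ.≤ n ℕ.* c x ℕ.+ (n ℕ.* c x ℕ.+ C)
      bound x = begin
        sum (λ y → # (λ z → same (x , y , z)))
          ≤⟨ sum-mono (λ y → sum-mono (λ z → or (cls part (part x) y) (cls part (part x) z) (cls part (part y) z))) ⟩
        sum (λ y → sum (λ z → ⟦ cls part (part x) y ⟧ ℕ.+ (⟦ cls part (part x) z ⟧ ℕ.+ ⟦ cls part (part y) z ⟧)))
          ≡⟨ sum-cong (λ y → trans (sum-+ {n} (λ z → ⟦ cls part (part x) y ⟧) (λ z → ⟦ cls part (part x) z ⟧ ℕ.+ ⟦ cls part (part y) z ⟧))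
               (cong₂ ℕ._+_ (sum-const n ⟦ cls part (part x) y ⟧) (sum-+ (λ z → ⟦ cls part (part x) z ⟧) (λ z → ⟦ cls part (part y) z ⟧)))) ⟩
        sum (λ y → n ℕ.* ⟦ cls part (part x) y ⟧ ℕ.+ (c x ℕ.+ c y))
          ≡⟨ trans (sum-+ (λ y → n ℕ.* ⟦ cls part (part x) y ⟧) (λ y → c x ℕ.+ c y))
               (cong₂ ℕ._+_ (sum-*ˡ n (λ y → ⟦ cls part (part x) y ⟧))
                 (trans (sum-+ (λ _ → c x) c) (cong (ℕ._+ C) (sum-const n (c x))))) ⟩
        n ℕ.* c x ℕ.+ (n ℕ.* c x ℕ.+ C) ∎

-- From vdisc₃ to disc₂,₃.

module FromVdisc where
  open Counting
  open RowsAndColumns using (∧-intro)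
  open Partitions using (cls; does⇒; class-lower)
  open ForbiddenHalfGraph using (Vdisc; vdisc₃⇒Vdisc; equipartition⇒Equi)
  open Rationals
  open Embedding
  open Homogeneity
  open ColourClasses
  open TriadsOfHomogeneousTriples
  open import Defs
  open import Data.Bool.Base using (Bool; T; _∧_)
  open import Data.Fin.Base as Fin using (Fin; suc)
  open import Data.Fin.Permutation using (Permutation′; _⟨$⟩ʳ_; _⟨$⟩ˡ_; inverseˡ)
  open import Data.Fin.Subset using (∣_∣)
  open import Data.Integer.Base using (+_)
  open import Data.List.Base using (length)
  open import Data.List.Membership.Propositional using (_∈_; _∉_)
  open import Data.Nat.Base as ℕ using (ℕ; suc; NonZero)
  open import Data.Rational.Base using (ℚ; 0ℚ; 1ℚ; _/_; _+_; _*_; _-_; -_; _≤_; _<_)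

  positive-inverse : ∀ {a b} → 0ℚ ≤ b → a * b ≡ 1ℚ → 0ℚ < a
  positive-inverse {a} {b} 0≤b e = ℚₚ.≰⇒> λ a≤0 →
    ℚₚ.<-irrefl refl (ℚₚ.<-≤-trans (subst (0ℚ <_) ι-1 (0<ι {1} (ℕ.s≤s ℕ.z≤n)))
      (subst₂ _≤_ e (ℚₚ.*-zeroˡ b) (*-monoʳ b 0≤b a≤0)))

  archimedean-ι : ∀ {ε} → 0ℚ < ε → ∃[ w ] 1 ℕ.≤ w × 1ℚ ≤ ι w * ε
  archimedean-ι {ε} 0<ε = convert (archimedean 0<ε)
    where
    convert : ∃[ w ] 1 ℕ.≤ w × 1ℚ ≤ fromℕ w * ε → ∃[ w ] 1 ℕ.≤ w × 1ℚ ≤ ι w * ε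
    convert (w , 1≤w , le) = w , 1≤w , subst (λ a → 1ℚ ≤ a * ε) (sym (ι≡fromℕ w)) le

  module Assemble {n t ℓ : ℕ} {{nz : NonZero ℓ}} (H : ThreeGraph n) (part : Fin n → Fin t)
    (ordered : ∀ i j → i Fin.≤ j → ∣ class part i ∣ ℕ.≤ ∣ class part j ∣)
    (equipartition : IsEquipartition part) (t≤n : t ℕ.≤ n)
    (ε₁ ε₂ : ℚ) (0<ε₁ : 0ℚ < ε₁) (v : ℕ) (vε : 1ℚ ≤ ι v * ε₁) (6v≤t : 6 ℕ.* v ℕ.≤ t)
    (q : ℕ) (1≤q : 1 ℕ.≤ q) (qε : 1ℚ ≤ ι q * ε₂)
    (big : ∀ i → Colouring.K part ℓ q ε₂ 1≤q qε ℕ.≤ # (cls part i) × Colouring.M part ℓ q ε₂ 1≤q qε ℕ.≤ # (cls part i))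
    (w : ℕ) (wε : 1ℚ ≤ ι w * (ε₁ * ((+ 1 / ℓ) * (+ 1 / ℓ) * (+ 1 / ℓ))))
    (0<r : 0ℚ < + 1 / ℓ) (r≤1 : + 1 / ℓ ≤ 1ℚ)
    (hom : ∀ i j k → Distinct i j k → Homogeneous w (cls part i) (cls part j) (cls part k) (edge H)) where

    open Colouring part ℓ q ε₂ 1≤q qε using (colour; colour-sym; colour-disc₂)
    open Exceptional part (equipartition⇒Equi part equipartition)

    -- By `count` there are at most 6 n³ / t exceptional triples. With 6v ≤ t and 1 / v ≤ ε₁ this is
    -- at most ε₁ n³, which is why t₀ + 6v parts are requested later.
    few : fromℕ (length exceptional) ≤ ε₁ * fromℕ (n ℕ.^ 3)
    few = subst₂ (λ a b → a ≤ ε₁ * b) (ι≡fromℕ (length exceptional)) (ι≡fromℕ (n ℕ.^ 3))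
      (0≤⇒≤ ((ι v * ε₁ - 1ℚ) * ι (length exceptional) + ε₁ * (ι (n ℕ.^ 3) - ι v * ι (length exceptional)))
        (0≤+ (0≤* (≤⇒0≤ vε) (0≤ι (length exceptional))) (0≤* (ℚₚ.<⇒≤ 0<ε₁) (≤⇒0≤ v-bound)))
        (l (ι v) ε₁ (ι (length exceptional)) (ι (n ℕ.^ 3))))
      where
      l : ∀ v e c m → e * m - c ≡ (v * e - 1ℚ) * c + e * (m - v * c)
      l = RS.solve-∀ ℚ-ring
      l₂ : ∀ v c → 6 ℕ.* (v ℕ.* c) ≡ 6 ℕ.* v ℕ.* c
      l₂ = ℕ-Solver.solve-∀
      in-ℕ : v ℕ.* length exceptional ℕ.≤ n ℕ.^ 3
      in-ℕ = ℕₚ.*-cancelˡ-≤ 6 (ℕₚ.≤-trans (ℕₚ.≤-reflexive (l₂ v (length exceptional)))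
        (ℕₚ.≤-trans (ℕₚ.*-monoˡ-≤ (length exceptional) 6v≤t) (count t≤n)))
      v-bound : ι v * ι (length exceptional) ≤ ι (n ℕ.^ 3)
      v-bound = subst (_≤ ι (n ℕ.^ 3)) (ι-* v (length exceptional)) (ι-mono in-ℕ)

    P-self : ∀ x y → T (P part colour (part x) (part y) (colour x y) x y)
    P-self x y = true⇒T (∧-intro (dec-true (part x Finₚ.≟ part x) refl)
      (∧-intro (dec-true (part y Finₚ.≟ part y) refl) (dec-true (colour x y Finₚ.≟ colour x y) refl)))

    decomposition : Decomposition n t ℓ ε₁ ε₂
    decomposition = record
      { part = part
      ; parts-ordered = ordered
      ; equipartition = equipartition
      ; colour = colour
      ; colour-sym = colour-sym
      ; exceptional = exceptional
      ; few = few
      ; regular = λ x y z _ _ ∉ex → let (xy , xz , yz) = not-exceptional x y z ∉ex in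
          part x , part y , part z , (xy , xz , yz) , colour x y , colour x z , colour y z ,
          (P-self x y , P-self x z , P-self y z) ,
          colour-disc₂ big (part x) (part y) xy (colour x y) ,
          colour-disc₂ big (part x) (part z) xz (colour x z) ,
          colour-disc₂ big (part y) (part z) yz (colour y z)
      }

    triads-regular : TriadsRegular H decomposition
    triads-regular i j k (i≢j , i≢k , j≢k) α β γ =
      TriadRegular.triad-disc₂,₃ (edge H) (cls part i) (cls part j) (cls part k) w (hom i j k (i≢j , i≢k , j≢k))
        ε₁ (+ 1 / ℓ) 0<ε₁ 0<r wε (triad part colour i j k α β γ) ε₂ r≤1
        (colour-disc₂ big i j i≢j α) (colour-disc₂ big i k i≢k β) (colour-disc₂ big j k j≢k γ)

  -- As ℓ is ℓ₀ itself, r = 1 / ℓ₀ and the required homogeneity w ≥ 1 / (ε₁ r³) are known before ε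
  -- is chosen and a partition requested. That partition is kept, with its parts relabelled by size;
  -- only the colouring of the pairs is new.
  vdisc₃⇒disc₂,₃ : ∀ {p} {𝓗 : Property p} → Hereditary 𝓗 → ZeroVdisc₃Error 𝓗 → ZeroDisc₂,₃Error 𝓗
  vdisc₃⇒disc₂,₃ {𝓗 = 𝓗} hereditary zero-error t₀ ℓ₀ ε₁ ε₂ 1≤t₀ 1≤ℓ₀ 0<ε₁ ε₂-bounds =
    step₁ (archimedean-ι 0<ε₁) (archimedean-ι (proj₁ (ε₂-bounds ℓ₀))) (archimedean-ι 0<c)
    where
    instance
      nz : NonZero ℓ₀
      nz = ℕ.>-nonZero 1≤ℓ₀
    r : ℚ
    r = + 1 / ℓ₀
    0<r : 0ℚ < r
    0<r = positive-inverse (0≤ι ℓ₀) (unit-fraction ℓ₀)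
    r≤1 : r ≤ 1ℚ
    r≤1 = subst₂ _≤_ (ℚₚ.*-identityʳ r) (unit-fraction ℓ₀)
      (*-monoˡ r (ℚₚ.<⇒≤ 0<r) (subst (_≤ ι ℓ₀) ι-1 (ι-mono 1≤ℓ₀)))
    0<c : 0ℚ < ε₁ * (r * r * r)
    0<c = 0<* 0<ε₁ (0<* (0<* 0<r 0<r) 0<r)
    Result : Set _
    Result = ∃[ N ] ∃[ T ] ∃[ L ] ∀ {n} (H : ThreeGraph n) → 𝓗 H → N ℕ.≤ n →
      ∃[ t ] ∃[ ℓ ] (t₀ ℕ.≤ t) × (t ℕ.≤ T) × (ℓ₀ ℕ.≤ ℓ) × (ℓ ℕ.≤ L) ×
      Σ (Decomposition n t ℓ ε₁ (ε₂ ℓ)) (TriadsRegular H)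
    step₁ : ∃[ v ] 1 ℕ.≤ v × 1ℚ ≤ ι v * ε₁ → ∃[ q ] 1 ℕ.≤ q × 1ℚ ≤ ι q * ε₂ ℓ₀ →
      ∃[ w ] 1 ℕ.≤ w × 1ℚ ≤ ι w * (ε₁ * (r * r * r)) → Result
    step₁ (v , 1≤v , vε) (q , 1≤q , qε) (w , 1≤w , wε) = step₂ (homogeneous hereditary zero-error w 1≤w)
      where
      M₀ K₀ : ℕ
      M₀ = 4 ℕ.* ℓ₀ ℕ.* ((q ℕ.+ q) ℕ.* (q ℕ.+ q))
      K₀ = ℓ₀ ℕ.^ M₀
      step₂ : ∃[ ε ] 0ℚ < ε × ∃[ N₀ ] 1 ℕ.≤ N₀ × (∀ {N} (H : ThreeGraph N) → 𝓗 H → (X Y Z : Fin N → Bool) →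
        Disjoint X Y → Disjoint X Z → Disjoint Y Z → N₀ ℕ.≤ # X → N₀ ℕ.≤ # Y → N₀ ℕ.≤ # Z →
        Vdisc ε X Y Z (edge H) → Homogeneous w X Y Z (edge H)) → Result
      step₂ (ε , 0<ε , N₁ , 1≤N₁ , homog) = step₃ (zero-error ε (t₀ ℕ.+ 6 ℕ.* v) 0<ε (ℕₚ.≤-trans 1≤t₀ (ℕₚ.m≤m+n t₀ (6 ℕ.* v))))
        where
        S₀ : ℕ
        -- Parts must be large enough for `homogeneous` and for splitting into K₀ words and M₀
        -- blocks; n ≥ T (S₀ + 1) ensures this.
        S₀ = N₁ ℕ.+ (K₀ ℕ.+ M₀)
        step₃ : ∃[ T ] ∃[ N ] (∀ {n} (H : ThreeGraph n) → 𝓗 H → N ℕ.≤ n →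
          ∃[ t ] (t₀ ℕ.+ 6 ℕ.* v ℕ.≤ t) × (t ℕ.≤ T) ×
          (Σ[ part ∈ (Fin n → Fin t) ] IsEquipartition part ×
            (∀ i j k → Distinct i j k → vdisc₃ ε (class part i) (class part j) (class part k) (edge H)))) → Result
        step₃ (T , N₂ , partition) = N₂ ℕ.+ T ℕ.* suc S₀ , T , ℓ₀ , construct
          where
          construct : ∀ {n} (H : ThreeGraph n) → 𝓗 H → N₂ ℕ.+ T ℕ.* suc S₀ ℕ.≤ n →
            ∃[ t ] ∃[ ℓ ] (t₀ ℕ.≤ t) × (t ℕ.≤ T) × (ℓ₀ ℕ.≤ ℓ) × (ℓ ℕ.≤ ℓ₀) ×
            Σ (Decomposition n t ℓ ε₁ (ε₂ ℓ)) (TriadsRegular H)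
          construct {n} H H∈𝓗 N≤n = step₄ (partition H H∈𝓗 (ℕₚ.≤-trans (ℕₚ.m≤m+n N₂ (T ℕ.* suc S₀)) N≤n))
            where
            step₄ : ∃[ t ] (t₀ ℕ.+ 6 ℕ.* v ℕ.≤ t) × (t ℕ.≤ T) ×
              (Σ[ part ∈ (Fin n → Fin t) ] IsEquipartition part ×
                (∀ i j k → Distinct i j k → vdisc₃ ε (class part i) (class part j) (class part k) (edge H))) → _
            step₄ (t , t₀+6v≤t , t≤T , part₀ , equi₀ , reg) = step₅ (sorting t (λ i → # (cls part₀ i)))
              where
              t₀≤t : t₀ ℕ.≤ t
              t₀≤t = ℕₚ.≤-trans (ℕₚ.m≤m+n t₀ (6 ℕ.* v)) t₀+6v≤t
              large : T ℕ.* suc S₀ ℕ.≤ n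
              large = ℕₚ.≤-trans (ℕₚ.m≤n+m (T ℕ.* suc S₀) N₂) N≤n
              t≤n : t ℕ.≤ n
              t≤n = ℕₚ.≤-trans t≤T (ℕₚ.≤-trans (ℕₚ.m≤m*n T (suc S₀)) large)
              step₅ : Σ[ π ∈ Permutation′ t ] Sorted (λ i → # (cls part₀ i)) π → _
              step₅ (π , sorted) = t , ℓ₀ , t₀≤t , t≤T , ℕₚ.≤-refl , ℕₚ.≤-refl , decomposition , triads-regular
                where
                part : Fin n → Fin t
                part = relabel π part₀
                class≡ : ∀ i → class part i ≡ class part₀ (π ⟨$⟩ʳ i)
                class≡ i = Vecₚ.tabulate-cong (cls-relabel π part₀ i)
                ordered : ∀ i j → i Fin.≤ j → ∣ class part i ∣ ℕ.≤ ∣ class part j ∣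
                ordered i j le = subst₂ ℕ._≤_
                  (sym (trans (cong ∣_∣ (class≡ i)) (∣tabulate∣ (cls part₀ (π ⟨$⟩ʳ i)))))
                  (sym (trans (cong ∣_∣ (class≡ j)) (∣tabulate∣ (cls part₀ (π ⟨$⟩ʳ j))))) (sorted i j le)
                equipartition : IsEquipartition part
                equipartition i j = subst₂ (λ a b → ∣ a ∣ ℕ.≤ ∣ b ∣ ℕ.+ 1) (sym (class≡ i)) (sym (class≡ j))
                  (equi₀ (π ⟨$⟩ʳ i) (π ⟨$⟩ʳ j))
                size-large : ∀ i → S₀ ℕ.≤ # (cls part i)
                size-large i = ℕ.s≤s⁻¹ (ℕₚ.*-cancelˡ-≤ T {{ℕ.>-nonZero (ℕₚ.≤-trans 1≤t₀ (ℕₚ.≤-trans t₀≤t t≤T))}}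
                  (ℕₚ.≤-trans large (ℕₚ.≤-trans (class-lower part (equipartition⇒Equi part equipartition) i)
                    (ℕₚ.≤-trans (ℕₚ.≤-reflexive (l t (# (cls part i)))) (ℕₚ.*-monoˡ-≤ (suc (# (cls part i))) t≤T)))))
                  where
                  l : ∀ t c → t ℕ.* c ℕ.+ t ≡ t ℕ.* (1 ℕ.+ c)
                  l = ℕ-Solver.solve-∀
                π-distinct : ∀ {i j} → i ≢ j → (π ⟨$⟩ʳ i) ≢ (π ⟨$⟩ʳ j)
                π-distinct ne e = ne (trans (sym (inverseˡ π)) (trans (cong (π ⟨$⟩ˡ_) e) (inverseˡ π)))
                regular : ∀ i j k → Distinct i j k → vdisc₃ ε (class part i) (class part j) (class part k) (edge H)
                regular i j k (ij , ik , jk) = subst (λ U → vdisc₃ ε U (class part j) (class part k) (edge H)) (sym (class≡ i))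
                  (subst₂ (λ V W → vdisc₃ ε (class part₀ (π ⟨$⟩ʳ i)) V W (edge H)) (sym (class≡ j)) (sym (class≡ k))
                    (reg (π ⟨$⟩ʳ i) (π ⟨$⟩ʳ j) (π ⟨$⟩ʳ k) (π-distinct ij , π-distinct ik , π-distinct jk)))
                disjoint : ∀ i j → i ≢ j → Disjoint (cls part i) (cls part j)
                disjoint i j ne x e e′ = ne (trans (sym (does⇒ (part x Finₚ.≟ i) e)) (does⇒ (part x Finₚ.≟ j) e′))
                N₁≤ : ∀ i → N₁ ℕ.≤ # (cls part i)
                N₁≤ i = ℕₚ.≤-trans (ℕₚ.m≤m+n N₁ (K₀ ℕ.+ M₀)) (size-large i)
                hom : ∀ i j k → Distinct i j k → Homogeneous w (cls part i) (cls part j) (cls part k) (edge H)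
                hom i j k (ij , ik , jk) = homog H H∈𝓗 (cls part i) (cls part j) (cls part k)
                  (disjoint i j ij) (disjoint i k ik) (disjoint j k jk) (N₁≤ i) (N₁≤ j) (N₁≤ k)
                  (vdisc₃⇒Vdisc ε (cls part i) (cls part j) (cls part k) (edge H) (regular i j k (ij , ik , jk)))
                big : ∀ i → K₀ ℕ.≤ # (cls part i) × M₀ ℕ.≤ # (cls part i)
                big i = ℕₚ.≤-trans (ℕₚ.m≤m+n K₀ M₀) rest , ℕₚ.≤-trans (ℕₚ.m≤n+m M₀ K₀) rest
                  where
                  rest = ℕₚ.≤-trans (ℕₚ.m≤n+m (K₀ ℕ.+ M₀) N₁) (size-large i)
                open Assemble {ℓ = ℓ₀} H part ordered equipartition t≤n ε₁ (ε₂ ℓ₀) 0<ε₁ v vε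
                  (ℕₚ.≤-trans (ℕₚ.m≤n+m (6 ℕ.* v) t₀) t₀+6v≤t) q 1≤q qε big w wε 0<r r≤1 hom
                  using (decomposition; triads-regular)

-- Counting triangles in boxes of a triad.

module TriangleCounting where
  open Counting
  open RowsAndColumns using (∧-intro)
  open Partitions using (#-mono)
  open HalfGraphPartitions using (_⊆ᵇ_)
  open Rationals
  open Embedding
  open Homogeneity using (density-bounds; vol≡)
  open ColourClasses
  open TriadsOfHomogeneousTriples using (count₃-ι; size₃-mono)
  open import Defs
  open import Data.Bool.Base using (Bool; true; false; T; _∧_)
  open import Data.Fin.Base using (Fin; zero; suc)
  open import Data.Fin.Subset using (∣_∣; _⊆_)
  open import Data.Nat.Base as ℕ using (ℕ; zero; suc)
  open import Data.Rational.Base using (ℚ; 0ℚ; 1ℚ; _+_; _*_; _-_; -_; _≤_; _<_)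
  open import Data.Vec.Base using (tabulate)

  private
    variable
      n t : ℕ

  card-mono : {A U : Fin n → Bool} → A ⊆ᵇ U → card A ≤ card U
  card-mono h = ι-mono (#-mono h)

  Regular₂ : ℚ → ℚ → (U W : Fin n → Bool) → Rel₂ n → Set
  Regular₂ ε p U W E = ∀ A B → A ⊆ᵇ U → B ⊆ᵇ W →
    ι (size₂ E A B) ≤ p * (card A * card B) + ε * (card U * card W) ×
    p * (card A * card B) ≤ ι (size₂ E A B) + ε * (card U * card W)

  size₃-∑ : (F : Rel₃ n) (A B C : Fin n → Bool) →
    ι (size₃ F A B C) ≡ ∑ (λ x → ∑ (λ y → ∑ (λ z → [ A x ∧ (B y ∧ (C z ∧ F x y z)) ])))
  size₃-∑ F A B C = trans (ι-sum (λ x → sum (λ y → # (λ z → A x ∧ (B y ∧ (C z ∧ F x y z))))))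
    (∑-cong λ x → trans (ι-sum (λ y → # (λ z → A x ∧ (B y ∧ (C z ∧ F x y z)))))
      (∑-cong λ y → card-∑ (λ z → A x ∧ (B y ∧ (C z ∧ F x y z)))))

  ∑-weighted-bound : (W : Fin n → Bool) (f g : Fin n → ℚ) (e : ℚ) → (∀ z → W z ≡ true → f z ≤ g z + e) →
    ∑ (λ z → [ W z ] * f z) ≤ ∑ (λ z → [ W z ] * g z) + card W * e
  ∑-weighted-bound W f g e h = subst (∑ (λ z → [ W z ] * f z) ≤_)
    (trans (∑-cong (λ z → ℚₚ.*-distribˡ-+ [ W z ] (g z) e))
      (trans (∑-+ (λ z → [ W z ] * g z) (λ z → [ W z ] * e)) (cong (∑ (λ z → [ W z ] * g z) +_) (∑-card W e))))
    (∑-weighted W h)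

  -- The bipartite graphs are replaced by their densities one at a time, each at a cost of ε v₀: f
  -- is gone in `m₁`, and only h is left in `m₂`. For f, regularity is applied for each z between
  -- its neighbourhoods in A and B; for g, for each y between A and its neighbourhood in C.
  module Triangles (ε p q r : ℚ) (0≤ε : 0ℚ ≤ ε) (0≤p : 0ℚ ≤ p) (p≤1 : p ≤ 1ℚ) (0≤q : 0ℚ ≤ q) (q≤1 : q ≤ 1ℚ)
    (U V W : Fin n → Bool) (f g h : Rel₂ n)
    (f-reg : Regular₂ ε p U V f) (g-reg : Regular₂ ε q U W g) (h-reg : Regular₂ ε r V W h)
    (A B C : Fin n → Bool) (A⊆ : A ⊆ᵇ U) (B⊆ : B ⊆ᵇ V) (C⊆ : C ⊆ᵇ W) where

    private
      v₀ a b c : ℚ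
      v₀ = card U * card V * card W
      a = card A
      b = card B
      c = card C

      Ag Bh Ch : Fin n → Fin n → Bool
      Ag z x = A x ∧ g x z
      Bh z y = B y ∧ h y z
      Ch y z = C z ∧ h y z

      m m₁ m₂ : ℚ
      m = ι (size₃ (λ x y z → f x y ∧ (g x z ∧ h y z)) A B C)
      m₁ = ∑ (λ z → [ C z ] * (card (Ag z) * card (Bh z)))
      m₂ = ∑ (λ y → [ B y ] * (a * card (Ch y)))

      m≡ : m ≡ ∑ (λ z → [ C z ] * ι (size₂ f (Ag z) (Bh z)))
      m≡ = begin
        m
          ≡⟨ size₃-∑ (λ x y z → f x y ∧ (g x z ∧ h y z)) A B C ⟩
        ∑ (λ x → ∑ (λ y → ∑ (λ z → [ A x ∧ (B y ∧ (C z ∧ (f x y ∧ (g x z ∧ h y z)))) ])))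
          ≡⟨ ∑-cong (λ x → ∑-swap (λ y z → [ A x ∧ (B y ∧ (C z ∧ (f x y ∧ (g x z ∧ h y z)))) ])) ⟩
        ∑ (λ x → ∑ (λ z → ∑ (λ y → [ A x ∧ (B y ∧ (C z ∧ (f x y ∧ (g x z ∧ h y z)))) ])))
          ≡⟨ ∑-swap (λ x z → ∑ (λ y → [ A x ∧ (B y ∧ (C z ∧ (f x y ∧ (g x z ∧ h y z)))) ])) ⟩
        ∑ (λ z → ∑ (λ x → ∑ (λ y → [ A x ∧ (B y ∧ (C z ∧ (f x y ∧ (g x z ∧ h y z)))) ])))
          ≡⟨ ∑-cong (λ z → trans (∑-cong λ x → trans (∑-cong λ y → trans (cong [_] (pt (A x) (B y) (C z) (f x y) (g x z) (h y z)))
               (trans ([∧] (C z) _) (cong ([ C z ] *_) (trans ([∧] (Ag z x) _) (cong ([ Ag z x ] *_) ([∧] (Bh z y) (f x y)))))))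
               (trans (∑-*ˡ [ C z ] (λ y → [ Ag z x ] * ([ Bh z y ] * [ f x y ]))) (cong ([ C z ] *_) (∑-*ˡ [ Ag z x ] (λ y → [ Bh z y ] * [ f x y ])))))
               (trans (∑-*ˡ [ C z ] (λ x → [ Ag z x ] * ∑ (λ y → [ Bh z y ] * [ f x y ]))) (cong ([ C z ] *_) (sym (size₂-∑ f (Ag z) (Bh z)))))) ⟩
        ∑ (λ z → [ C z ] * ι (size₂ f (Ag z) (Bh z))) ∎
        where
        open ≡-Reasoning
        pt : ∀ a b c f g h → a ∧ (b ∧ (c ∧ (f ∧ (g ∧ h)))) ≡ c ∧ ((a ∧ g) ∧ ((b ∧ h) ∧ f))
        pt false b false f g h = refl
        pt false b true f g h = refl
        pt true false false f g h = refl
        pt true false true f false h = refl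
        pt true false true f true h = refl
        pt true true false f g h = refl
        pt true true true false false h = refl
        pt true true true false true false = refl
        pt true true true false true true = refl
        pt true true true true false h = refl
        pt true true true true true false = refl
        pt true true true true true true = refl

      m₁≡ : m₁ ≡ ∑ (λ y → [ B y ] * ι (size₂ g A (Ch y)))
      m₁≡ = begin
        ∑ (λ z → [ C z ] * (card (Ag z) * card (Bh z)))
          ≡⟨ ∑-cong (λ z → trans (trans (cong (λ s → [ C z ] * (card (Ag z) * s)) (card-∑ (Bh z)))
               (trans (sym (ℚₚ.*-assoc [ C z ] (card (Ag z)) (∑ (λ y → [ Bh z y ]))))
                 (sym (∑-*ˡ ([ C z ] * card (Ag z)) (λ y → [ Bh z y ])))))
               (∑-cong (λ y → trans (cong (λ s → [ C z ] * s * [ Bh z y ]) (card-∑ (Ag z))) (trans (cong ([ C z ] * ∑ (λ x → [ Ag z x ]) *_) ([∧] (B y) (h y z)))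
                 (l₁ [ C z ] (∑ (λ x → [ Ag z x ])) [ B y ] [ h y z ]))))) ⟩
        ∑ (λ z → ∑ (λ y → [ B y ] * (∑ (λ x → [ Ag z x ]) * ([ C z ] * [ h y z ]))))
          ≡⟨ ∑-swap (λ z y → [ B y ] * (∑ (λ x → [ Ag z x ]) * ([ C z ] * [ h y z ]))) ⟩
        ∑ (λ y → ∑ (λ z → [ B y ] * (∑ (λ x → [ Ag z x ]) * ([ C z ] * [ h y z ]))))
          ≡⟨ ∑-cong (λ y → trans (∑-*ˡ [ B y ] (λ z → ∑ (λ x → [ Ag z x ]) * ([ C z ] * [ h y z ])))
               (cong ([ B y ] *_) (trans (∑-cong (λ z → sym (∑-*ʳ ([ C z ] * [ h y z ]) (λ x → [ Ag z x ]))))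
                 (trans (∑-swap (λ z x → [ Ag z x ] * ([ C z ] * [ h y z ])))
                   (trans (∑-cong (λ x → trans (∑-cong (λ z → trans (cong₂ _*_ ([∧] (A x) (g x z)) (sym ([∧] (C z) (h y z)))) (l₂ [ A x ] [ g x z ] [ Ch y z ])))
                       (∑-*ˡ [ A x ] (λ z → [ Ch y z ] * [ g x z ]))))
                     (sym (size₂-∑ g A (Ch y)))))))) ⟩
        ∑ (λ y → [ B y ] * ι (size₂ g A (Ch y))) ∎
        where
        open ≡-Reasoning
        l₁ : ∀ c s b h → c * s * (b * h) ≡ b * (s * (c * h))
        l₁ = RS.solve-∀ ℚ-ring
        l₂ : ∀ a g c → (a * g) * c ≡ a * (c * g)
        l₂ = RS.solve-∀ ℚ-ring

      m₂≡ : m₂ ≡ a * ι (size₂ h B C)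
      m₂≡ = trans (∑-cong (λ y → trans (cong (λ s → [ B y ] * (a * s)) (trans (card-∑ (Ch y)) (∑-cong (λ z → [∧] (C z) (h y z)))))
          (l [ B y ] a (∑ (λ z → [ C z ] * [ h y z ])))))
        (trans (∑-*ˡ a (λ y → [ B y ] * ∑ (λ z → [ C z ] * [ h y z ]))) (cong (a *_) (sym (size₂-∑ h B C))))
        where
        l : ∀ b a s → b * (a * s) ≡ a * (b * s)
        l = RS.solve-∀ ℚ-ring

      0≤U = 0≤card U
      0≤V = 0≤card V
      0≤W = 0≤card W

      pull : ∀ p (w s : Fin n → ℚ) → ∑ (λ z → w z * (p * s z)) ≡ p * ∑ (λ z → w z * s z)
      pull p w s = trans (∑-cong (λ z → l (w z) p (s z))) (∑-*ˡ p (λ z → w z * s z))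
        where
        l : ∀ w p s → w * (p * s) ≡ p * (w * s)
        l = RS.solve-∀ ℚ-ring

      l₀ : ∀ c e u v w → e * (u * v * w) - c * (e * (u * v)) ≡ e * (u * v) * (w - c)
      l₀ = RS.solve-∀ ℚ-ring
      l₁ : ∀ b e u v w → e * (u * v * w) - b * (e * (u * w)) ≡ e * (u * w) * (v - b)
      l₁ = RS.solve-∀ ℚ-ring
      l₂ : ∀ a e u v w → e * (u * v * w) - a * (e * (v * w)) ≡ e * (v * w) * (u - a)
      l₂ = RS.solve-∀ ℚ-ring

      Ag⊆ : ∀ z → Ag z ⊆ᵇ U
      Ag⊆ z x e = A⊆ x (proj₁ (∧-elim e))
      Bh⊆ : ∀ z → Bh z ⊆ᵇ V
      Bh⊆ z y e = B⊆ y (proj₁ (∧-elim e))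
      Ch⊆ : ∀ y → Ch y ⊆ᵇ W
      Ch⊆ y z e = C⊆ z (proj₁ (∧-elim e))

      err₀ : c * (ε * (card U * card V)) ≤ ε * v₀
      err₀ = 0≤⇒≤ (ε * (card U * card V) * (card W - c)) (0≤* (0≤* 0≤ε (0≤* 0≤U 0≤V)) (≤⇒0≤ (card-mono C⊆)))
        (l₀ c ε (card U) (card V) (card W))
      err₁ : b * (ε * (card U * card W)) ≤ ε * v₀
      err₁ = 0≤⇒≤ (ε * (card U * card W) * (card V - b)) (0≤* (0≤* 0≤ε (0≤* 0≤U 0≤W)) (≤⇒0≤ (card-mono B⊆)))
        (l₁ b ε (card U) (card V) (card W))
      err₂ : a * (ε * (card V * card W)) ≤ ε * v₀
      err₂ = 0≤⇒≤ (ε * (card V * card W) * (card U - a)) (0≤* (0≤* 0≤ε (0≤* 0≤V 0≤W)) (≤⇒0≤ (card-mono A⊆)))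
        (l₂ a ε (card U) (card V) (card W))

      m-upper : m ≤ p * m₁ + ε * v₀
      m-upper = ℚₚ.≤-trans (subst₂ _≤_ (sym m≡) (cong (_+ c * (ε * (card U * card V))) (pull p (λ z → [ C z ]) (λ z → card (Ag z) * card (Bh z))))
          (∑-weighted-bound C (λ z → ι (size₂ f (Ag z) (Bh z))) (λ z → p * (card (Ag z) * card (Bh z))) (ε * (card U * card V))
            (λ z _ → proj₁ (f-reg (Ag z) (Bh z) (Ag⊆ z) (Bh⊆ z)))))
        (ℚₚ.+-monoʳ-≤ (p * m₁) err₀)

      m-lower : p * m₁ ≤ m + ε * v₀
      m-lower = ℚₚ.≤-trans (subst₂ _≤_ (pull p (λ z → [ C z ]) (λ z → card (Ag z) * card (Bh z))) (cong (_+ c * (ε * (card U * card V))) (sym m≡))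
          (∑-weighted-bound C (λ z → p * (card (Ag z) * card (Bh z))) (λ z → ι (size₂ f (Ag z) (Bh z))) (ε * (card U * card V))
            (λ z _ → proj₂ (f-reg (Ag z) (Bh z) (Ag⊆ z) (Bh⊆ z)))))
        (ℚₚ.+-monoʳ-≤ m err₀)

      m₁-upper : m₁ ≤ q * m₂ + ε * v₀
      m₁-upper = ℚₚ.≤-trans (subst₂ _≤_ (sym m₁≡) (cong (_+ b * (ε * (card U * card W))) (pull q (λ y → [ B y ]) (λ y → a * card (Ch y))))
          (∑-weighted-bound B (λ y → ι (size₂ g A (Ch y))) (λ y → q * (a * card (Ch y))) (ε * (card U * card W))
            (λ y _ → proj₁ (g-reg A (Ch y) A⊆ (Ch⊆ y)))))
        (ℚₚ.+-monoʳ-≤ (q * m₂) err₁)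

      m₁-lower : q * m₂ ≤ m₁ + ε * v₀
      m₁-lower = ℚₚ.≤-trans (subst₂ _≤_ (pull q (λ y → [ B y ]) (λ y → a * card (Ch y))) (cong (_+ b * (ε * (card U * card W))) (sym m₁≡))
          (∑-weighted-bound B (λ y → q * (a * card (Ch y))) (λ y → ι (size₂ g A (Ch y))) (ε * (card U * card W))
            (λ y _ → proj₂ (g-reg A (Ch y) A⊆ (Ch⊆ y)))))
        (ℚₚ.+-monoʳ-≤ m₁ err₁)

      s : ℚ
      s = ι (size₂ h B C)

      m₂-upper : m₂ ≤ r * (a * b * c) + ε * v₀
      m₂-upper = subst (_≤ r * (a * b * c) + ε * v₀) (sym m₂≡) (0≤⇒≤
        (a * ((r * (b * c) + ε * (card V * card W)) - s) + (ε * v₀ - a * (ε * (card V * card W))))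
        (0≤+ (0≤* (0≤card A) (≤⇒0≤ (proj₁ (h-reg B C B⊆ C⊆)))) (≤⇒0≤ err₂)) (l a b c r s (ε * v₀) (ε * (card V * card W))))
        where
        l : ∀ a b c r s e e′ → r * (a * b * c) + e - a * s ≡ a * ((r * (b * c) + e′) - s) + (e - a * e′)
        l = RS.solve-∀ ℚ-ring

      m₂-lower : r * (a * b * c) ≤ m₂ + ε * v₀
      m₂-lower = subst (λ m → r * (a * b * c) ≤ m + ε * v₀) (sym m₂≡) (0≤⇒≤
        (a * ((s + ε * (card V * card W)) - r * (b * c)) + (ε * v₀ - a * (ε * (card V * card W))))
        (0≤+ (0≤* (0≤card A) (≤⇒0≤ (proj₂ (h-reg B C B⊆ C⊆)))) (≤⇒0≤ err₂)) (l a b c r s (ε * v₀) (ε * (card V * card W))))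
        where
        l : ∀ a b c r s e e′ → (a * s + e) - r * (a * b * c) ≡ a * ((s + e′) - r * (b * c)) + (e - a * e′)
        l = RS.solve-∀ ℚ-ring

      0≤e : 0ℚ ≤ ε * v₀
      0≤e = 0≤* 0≤ε (0≤* (0≤* 0≤U 0≤V) 0≤W)

    upper : m ≤ (p * q * r) * (a * b * c) + (ε + ε + ε) * v₀
    upper = 0≤⇒≤
      (((p * m₁ + ε * v₀ - m) + p * ((q * m₂ + ε * v₀) - m₁)) + (p * q * ((r * (a * b * c) + ε * v₀) - m₂)
        + ((1ℚ - p) * (ε * v₀) + ((1ℚ - p) * (ε * v₀) + p * (1ℚ - q) * (ε * v₀)))))
      (0≤+ (0≤+ (≤⇒0≤ m-upper) (0≤* 0≤p (≤⇒0≤ m₁-upper))) (0≤+ (0≤* (0≤* 0≤p 0≤q) (≤⇒0≤ m₂-upper))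
        (0≤+ (0≤* (≤⇒0≤ p≤1) 0≤e) (0≤+ (0≤* (≤⇒0≤ p≤1) 0≤e) (0≤* (0≤* 0≤p (≤⇒0≤ q≤1)) 0≤e)))))
      (l p q r (a * b * c) ε v₀ m m₁ m₂)
      where
      l : ∀ p q r k ε v m m₁ m₂ → (p * q * r) * k + (ε + ε + ε) * v - m ≡
        (((p * m₁ + ε * v - m) + p * ((q * m₂ + ε * v) - m₁)) + (p * q * ((r * k + ε * v) - m₂)
        + ((1ℚ - p) * (ε * v) + ((1ℚ - p) * (ε * v) + p * (1ℚ - q) * (ε * v)))))
      l = RS.solve-∀ ℚ-ring

    lower : (p * q * r) * (a * b * c) ≤ m + (ε + ε + ε) * v₀
    lower = 0≤⇒≤
      (((m + ε * v₀ - p * m₁) + p * ((m₁ + ε * v₀) - q * m₂)) + (p * q * ((m₂ + ε * v₀) - r * (a * b * c))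
        + ((1ℚ - p) * (ε * v₀) + ((1ℚ - p) * (ε * v₀) + p * (1ℚ - q) * (ε * v₀)))))
      (0≤+ (0≤+ (≤⇒0≤ m-lower) (0≤* 0≤p (≤⇒0≤ m₁-lower))) (0≤+ (0≤* (0≤* 0≤p 0≤q) (≤⇒0≤ m₂-lower))
        (0≤+ (0≤* (≤⇒0≤ p≤1) 0≤e) (0≤+ (0≤* (≤⇒0≤ p≤1) 0≤e) (0≤* (0≤* 0≤p (≤⇒0≤ q≤1)) 0≤e)))))
      (l p q r (a * b * c) ε v₀ m m₁ m₂)
      where
      l : ∀ p q r k ε v m m₁ m₂ → m + (ε + ε + ε) * v - (p * q * r) * k ≡
        (((m + ε * v - p * m₁) + p * ((m₁ + ε * v) - q * m₂)) + (p * q * ((m₂ + ε * v) - r * k)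
        + ((1ℚ - p) * (ε * v) + ((1ℚ - p) * (ε * v) + p * (1ℚ - q) * (ε * v)))))
      l = RS.solve-∀ ℚ-ring

  -- disc₂,₃ applied to the subgraphs of G induced on boxes.
  record TriadBoxes (ε₁ ε₂ : ℚ) (U V W : Fin n → Bool) (E : Rel₃ n) (G : Edges n) : Set where
    field
      d₃ d₂ : ℚ
      0≤d₃ : 0ℚ ≤ d₃
      d₃≤1 : d₃ ≤ 1ℚ
      0≤d₂ : 0ℚ ≤ d₂
      D₁₂ : Disc₂ ε₂ d₂ U V (E₁₂ G)
      D₁₃ : Disc₂ ε₂ d₂ U W (E₁₃ G)
      D₂₃ : Disc₂ ε₂ d₂ V W (E₂₃ G)
      box-upper : ∀ A B C → A ⊆ᵇ U → B ⊆ᵇ V → C ⊆ᵇ W →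
        ι (size₃ (E ∩₃ triangles G) A B C) ≤ d₃ * ι (size₃ (triangles G) A B C) + ε₁ * (d₂ * d₂ * d₂) * (card U * card V * card W)
      box-lower : ∀ A B C → A ⊆ᵇ U → B ⊆ᵇ V → C ⊆ᵇ W →
        d₃ * ι (size₃ (triangles G) A B C) ≤ ι (size₃ (E ∩₃ triangles G) A B C) + ε₁ * (d₂ * d₂ * d₂) * (card U * card V * card W)

  size₃-⊆ : (F : Rel₃ n) {A U B V C W : Fin n → Bool} → A ⊆ᵇ U → B ⊆ᵇ V → C ⊆ᵇ W → size₃ F A B C ℕ.≤ size₃ F U V W
  size₃-⊆ F {A} {U} {B} {V} {C} {W} A⊆ B⊆ C⊆ = sum-mono λ x → sum-mono λ y → sum-mono λ z →
    pt (A x) (B y) (C z) (F x y z) (A⊆ x) (B⊆ y) (C⊆ z)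
    where
    pt : ∀ a b c f {u v w} → (a ≡ true → u ≡ true) → (b ≡ true → v ≡ true) → (c ≡ true → w ≡ true) →
      ⟦ a ∧ (b ∧ (c ∧ f)) ⟧ ℕ.≤ ⟦ u ∧ (v ∧ (w ∧ f)) ⟧
    pt true true true f p q r rewrite p refl | q refl | r refl = ℕₚ.≤-refl
    pt true true false f p q r = ℕ.z≤n
    pt true false c f p q r = ℕ.z≤n
    pt false b c f p q r = ℕ.z≤n

  private
    ∧-true : ∀ b → b ∧ true ≡ b
    ∧-true true = refl
    ∧-true false = refl

    none-∧ : ∀ u v w → u ∧ (v ∧ (w ∧ false)) ≡ false
    none-∧ false v w = refl
    none-∧ true false w = refl
    none-∧ true true false = refl
    none-∧ true true true = refl

    restrict-∧ : ∀ a b c f g h {u v w} → (a ≡ true → u ≡ true) → (b ≡ true → v ≡ true) → (c ≡ true → w ≡ true) →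
      u ∧ (v ∧ (w ∧ ((f ∧ (a ∧ b)) ∧ ((g ∧ (a ∧ c)) ∧ (h ∧ (b ∧ c)))))) ≡ a ∧ (b ∧ (c ∧ (f ∧ (g ∧ h))))
    restrict-∧ true true true f g h p q r rewrite p refl | q refl | r refl =
      cong₂ _∧_ (∧-true f) (cong₂ _∧_ (∧-true g) (∧-true h))
    restrict-∧ true true false f g h {u} {v} {w} p q r = trans (cong (λ s → u ∧ (v ∧ (w ∧ s))) (gone f g)) (none-∧ u v w)
      where
      gone : ∀ f g {s} → (f ∧ true) ∧ ((g ∧ false) ∧ s) ≡ false
      gone false g = refl
      gone true false = refl
      gone true true = refl
    restrict-∧ true false c f g h {u} {v} {w} p q r = trans (cong (λ s → u ∧ (v ∧ (w ∧ s))) (gone f)) (none-∧ u v w)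
      where
      gone : ∀ f {s} → (f ∧ false) ∧ s ≡ false
      gone false = refl
      gone true = refl
    restrict-∧ false b c f g h {u} {v} {w} p q r = trans (cong (λ s → u ∧ (v ∧ (w ∧ s))) (gone f)) (none-∧ u v w)
      where
      gone : ∀ f {s} → (f ∧ false) ∧ s ≡ false
      gone false = refl
      gone true = refl

    move-∧ : ∀ u v w e t t′ → (t′ ≡ true → t ≡ true) → u ∧ (v ∧ (w ∧ ((e ∧ t) ∧ t′))) ≡ e ∧ (u ∧ (v ∧ (w ∧ t′)))
    move-∧ u v w false t t′ h = none-∧ u v w
    move-∧ false v w true t t′ h = refl
    move-∧ true false w true t t′ h = refl
    move-∧ true true false true t t′ h = refl
    move-∧ true true true true true t′ h = refl
    move-∧ true true true true false false h = refl
    move-∧ true true true true false true h = h refl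

    back-∧ : ∀ a b c e t → e ∧ (a ∧ (b ∧ (c ∧ t))) ≡ a ∧ (b ∧ (c ∧ (e ∧ t)))
    back-∧ a b c true t = refl
    back-∧ a b c false t = sym (none-∧ a b c)

  -- The subgraph of all edges with both ends in a box has as triangles exactly those of G inside
  -- the box.
  disc₂,₃⇒boxes : ∀ ε₁ ε₂ (U V W : Fin n → Bool) E G → 0ℚ ≤ ε₁ →
    disc₂,₃ ε₁ ε₂ (tabulate U) (tabulate V) (tabulate W) (E ∩₃ triangles G) G → TriadBoxes ε₁ ε₂ U V W E G
  disc₂,₃⇒boxes {n} ε₁ ε₂ U V W E G 0≤ε₁ (d₃ , density , d₂ , 0<d₂ , d₂≤1 , D₁₂ , D₁₃ , D₂₃ , regular) =
    build (size₃ T₀ U V W) refl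
    where
    T₀ F′ : Rel₃ n
    T₀ = triangles G
    F′ = E ∩₃ T₀
    v₀ e : ℚ
    v₀ = card U * card V * card W
    e = ε₁ * (d₂ * d₂ * d₂) * v₀
    0≤e : 0ℚ ≤ e
    0≤e = 0≤* (0≤* 0≤ε₁ (0≤* (0≤* (ℚₚ.<⇒≤ 0<d₂) (ℚₚ.<⇒≤ 0<d₂)) (ℚₚ.<⇒≤ 0<d₂))) (0≤* (0≤* (0≤card U) (0≤card V)) (0≤card W))
    density′ : ι (size₃ F′ U V W) ≡ d₃ * ι (size₃ T₀ U V W)
    density′ = trans (sym (count₃-ι F′ U V W)) (trans density (cong (d₃ *_) (count₃-ι T₀ U V W)))
    Boxes : ℚ → Set
    Boxes d = ∀ A B C → A ⊆ᵇ U → B ⊆ᵇ V → C ⊆ᵇ W →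
      ι (size₃ F′ A B C) ≤ d * ι (size₃ T₀ A B C) + e × d * ι (size₃ T₀ A B C) ≤ ι (size₃ F′ A B C) + e
    fill : ∀ d → 0ℚ ≤ d → d ≤ 1ℚ → Boxes d → TriadBoxes ε₁ ε₂ U V W E G
    fill d 0≤d d≤1 boxes = record
      { d₃ = d ; d₂ = d₂ ; 0≤d₃ = 0≤d ; d₃≤1 = d≤1 ; 0≤d₂ = ℚₚ.<⇒≤ 0<d₂
      ; D₁₂ = disc₂⇒Disc₂ ε₂ d₂ U V (E₁₂ G) D₁₂ ; D₁₃ = disc₂⇒Disc₂ ε₂ d₂ U W (E₁₃ G) D₁₃ ; D₂₃ = disc₂⇒Disc₂ ε₂ d₂ V W (E₂₃ G) D₂₃
      ; box-upper = λ A B C A⊆ B⊆ C⊆ → proj₁ (boxes A B C A⊆ B⊆ C⊆)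
      ; box-lower = λ A B C A⊆ B⊆ C⊆ → proj₂ (boxes A B C A⊆ B⊆ C⊆) }
    F′≤T₀ : ∀ A B C → size₃ F′ A B C ℕ.≤ size₃ T₀ A B C
    F′≤T₀ A B C = size₃-mono A B C (λ x y z t → proj₂ (∧-elim {E x y z} t))
    build : ∀ m → size₃ T₀ U V W ≡ m → TriadBoxes ε₁ ε₂ U V W E G
    -- If G has no triangles, the given d₃ may lie outside [0, 1]; it is replaced by 0.
    build zero none = fill 0ℚ ℚₚ.≤-refl (subst (0ℚ ≤_) ι-1 (0≤ι 1)) λ A B C A⊆ B⊆ C⊆ →
      let F′≡0 = ℕₚ.n≤0⇒n≡0 (ℕₚ.≤-trans (F′≤T₀ A B C) (ℕₚ.≤-trans (size₃-⊆ T₀ A⊆ B⊆ C⊆) (ℕₚ.≤-reflexive none)))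
          zero-left = trans (cong ι F′≡0) ι-0
          0≤0*+e = subst (0ℚ ≤_) (sym (trans (cong (_+ e) (ℚₚ.*-zeroˡ (ι (size₃ T₀ A B C)))) (ℚₚ.+-identityˡ e))) 0≤e
          0≤s+e = subst (0ℚ ≤_) (sym (trans (cong (_+ e) zero-left) (ℚₚ.+-identityˡ e))) 0≤e
      in subst (_≤ 0ℚ * ι (size₃ T₀ A B C) + e) (sym zero-left) 0≤0*+e ,
         subst (_≤ ι (size₃ F′ A B C) + e) (sym (ℚₚ.*-zeroˡ (ι (size₃ T₀ A B C)))) 0≤s+e
    build m@(suc _) some = fill d₃ (proj₁ bounds) (proj₂ bounds) boxes
      where
      bounds : 0ℚ ≤ d₃ × d₃ ≤ 1ℚ
      bounds = density-bounds (ι (size₃ F′ U V W)) (ι (size₃ T₀ U V W)) d₃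
        (0<ι (ℕₚ.≤-trans (ℕ.s≤s ℕ.z≤n) (ℕₚ.≤-reflexive (sym some)))) (0≤ι _) (ι-mono (F′≤T₀ U V W)) density′
      module _ (A B C : Fin n → Bool) (A⊆ : A ⊆ᵇ U) (B⊆ : B ⊆ᵇ V) (C⊆ : C ⊆ᵇ W) where
        G′ : Edges n
        G′ = record
          { E₁₂ = λ x y → E₁₂ G x y ∧ (A x ∧ B y)
          ; E₁₃ = λ x z → E₁₃ G x z ∧ (A x ∧ C z)
          ; E₂₃ = λ y z → E₂₃ G y z ∧ (B y ∧ C z) }
        first : ∀ {a b} → T (a ∧ b) → T a
        first {true} _ = _
        G′⊆G : G′ ⊆ᵍ G
        G′⊆G = (λ x y → first) , (λ x z → first) , (λ y z → first)
        T-box : size₃ (triangles G′) U V W ≡ size₃ T₀ A B C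
        T-box = sum-cong λ x → sum-cong λ y → sum-cong λ z →
          cong ⟦_⟧ (restrict-∧ (A x) (B y) (C z) (E₁₂ G x y) (E₁₃ G x z) (E₂₃ G y z) (A⊆ x) (B⊆ y) (C⊆ z))
        F-box : size₃ (F′ ∩₃ triangles G′) U V W ≡ size₃ F′ A B C
        F-box = sum-cong λ x → sum-cong λ y → sum-cong λ z → cong ⟦_⟧ (begin
            U x ∧ (V y ∧ (W z ∧ ((E x y z ∧ T₀ x y z) ∧ triangles G′ x y z)))
              ≡⟨ move-∧ (U x) (V y) (W z) (E x y z) (T₀ x y z) (triangles G′ x y z) (λ t → sub x y z t) ⟩
            E x y z ∧ (U x ∧ (V y ∧ (W z ∧ triangles G′ x y z)))
              ≡⟨ cong (E x y z ∧_) (restrict-∧ (A x) (B y) (C z) (E₁₂ G x y) (E₁₃ G x z) (E₂₃ G y z) (A⊆ x) (B⊆ y) (C⊆ z)) ⟩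
            E x y z ∧ (A x ∧ (B y ∧ (C z ∧ T₀ x y z)))
              ≡⟨ back-∧ (A x) (B y) (C z) (E x y z) (T₀ x y z) ⟩
            A x ∧ (B y ∧ (C z ∧ (E x y z ∧ T₀ x y z))) ∎)
          where
          open ≡-Reasoning
          sub : ∀ x y z → triangles G′ x y z ≡ true → T₀ x y z ≡ true
          sub x y z t = ∧-intro (proj₁ (∧-elim {E₁₂ G x y} (proj₁ t₁)))
            (∧-intro (proj₁ (∧-elim {E₁₃ G x z} (proj₁ t₂))) (proj₁ (∧-elim {E₂₃ G y z} (proj₂ t₂))))
            where
            t₁ = ∧-elim {E₁₂ G′ x y} t
            t₂ = ∧-elim {E₁₃ G′ x z} (proj₂ t₁)
      vol-fromℕ : fromℕ (∣ tabulate U ∣ ℕ.* ∣ tabulate V ∣ ℕ.* ∣ tabulate W ∣) ≡ v₀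
      vol-fromℕ = trans (cong fromℕ (cong₂ ℕ._*_ (cong₂ ℕ._*_ (∣tabulate∣ U) (∣tabulate∣ V)) (∣tabulate∣ W))) (vol≡ U V W)
      boxes : Boxes d₃
      boxes A B C A⊆ B⊆ C⊆ = within⇒ {ι (size₃ F′ A B C)} {d₃ * ι (size₃ T₀ A B C)} {e}
        (subst (λ v → ι (size₃ F′ A B C) ≈ d₃ * ι (size₃ T₀ A B C) within (ε₁ * (d₂ * d₂ * d₂) * v)) vol-fromℕ
          (subst₂ (λ s m → s ≈ d₃ * m within (ε₁ * (d₂ * d₂ * d₂) * fromℕ (∣ tabulate U ∣ ℕ.* ∣ tabulate V ∣ ℕ.* ∣ tabulate W ∣)))
            (trans (count₃-ι (F′ ∩₃ triangles (G′ A B C A⊆ B⊆ C⊆)) U V W) (cong ι (F-box A B C A⊆ B⊆ C⊆)))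
            (trans (count₃-ι (triangles (G′ A B C A⊆ B⊆ C⊆)) U V W) (cong ι (T-box A B C A⊆ B⊆ C⊆)))
            (regular (G′ A B C A⊆ B⊆ C⊆) (G′⊆G A B C A⊆ B⊆ C⊆))))

-- Box densities as averages over triads.

module BoxDensities where
  open Counting
  open HalfGraphPartitions using (_⊆ᵇ_)
  open Rationals
  open Embedding
  open Homogeneity using (density-bounds)
  open QuasirandomColouring using (∑-ι; ∑-pick)
  open ColourClasses
  open TriangleCounting
  open import Defs hiding (P)
  open import Data.Bool.Base using (Bool; true; false; _∧_)
  open import Data.Fin.Base using (Fin)
  open import Data.Nat.Base as ℕ using (ℕ)
  open import Data.Rational.Base using (ℚ; 0ℚ; 1ℚ; _+_; _*_; _-_; -_; _≤_; _<_)

  private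
    variable
      n ℓ : ℕ

  ∑₃ : (Fin ℓ → Fin ℓ → Fin ℓ → ℚ) → ℚ
  ∑₃ f = ∑ (λ α → ∑ (λ β → ∑ (λ γ → f α β γ)))

  ∑₃-cong : {f g : Fin ℓ → Fin ℓ → Fin ℓ → ℚ} → (∀ α β γ → f α β γ ≡ g α β γ) → ∑₃ f ≡ ∑₃ g
  ∑₃-cong h = ∑-cong λ α → ∑-cong λ β → ∑-cong λ γ → h α β γ

  ∑₃-mono : {f g : Fin ℓ → Fin ℓ → Fin ℓ → ℚ} → (∀ α β γ → f α β γ ≤ g α β γ) → ∑₃ f ≤ ∑₃ g
  ∑₃-mono h = ∑-mono λ α → ∑-mono λ β → ∑-mono λ γ → h α β γ

  ∑₃-+ : (f g : Fin ℓ → Fin ℓ → Fin ℓ → ℚ) → ∑₃ (λ α β γ → f α β γ + g α β γ) ≡ ∑₃ f + ∑₃ g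
  ∑₃-+ f g = trans (∑-cong λ α → trans (∑-cong λ β → ∑-+ (f α β) (g α β))
      (∑-+ (λ β → ∑ (f α β)) (λ β → ∑ (g α β))))
    (∑-+ (λ α → ∑ (λ β → ∑ (f α β))) (λ α → ∑ (λ β → ∑ (g α β))))

  ∑₃-*ʳ : ∀ c (f : Fin ℓ → Fin ℓ → Fin ℓ → ℚ) → ∑₃ (λ α β γ → f α β γ * c) ≡ ∑₃ f * c
  ∑₃-*ʳ c f = trans (∑-cong λ α → trans (∑-cong λ β → ∑-*ʳ c (f α β)) (∑-*ʳ c (λ β → ∑ (f α β))))
    (∑-*ʳ c (λ α → ∑ (λ β → ∑ (f α β))))

  ∑₃-product : ∀ c (f g h : Fin ℓ → ℚ) → ∑₃ (λ α β γ → c * (f α * g β * h γ)) ≡ c * (∑ f * ∑ g * ∑ h)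
  ∑₃-product c f g h = trans
    (∑-cong λ α → trans (∑-cong λ β → trans (∑-cong λ γ → l₁ c (f α) (g β) (h γ)) (trans (∑-*ˡ (c * f α * g β) h) (l₂ c (f α) (g β) (∑ h))))
      (trans (∑-*ˡ (c * f α * ∑ h) g) (l₃ c (f α) (∑ g) (∑ h))))
    (trans (∑-*ˡ (c * ∑ g * ∑ h) f) (l₄ c (∑ f) (∑ g) (∑ h)))
    where
    l₁ : ∀ c f g h → c * (f * g * h) ≡ c * f * g * h
    l₁ = RS.solve-∀ ℚ-ring
    l₂ : ∀ c f g h → c * f * g * h ≡ c * f * h * g
    l₂ = RS.solve-∀ ℚ-ring
    l₃ : ∀ c f g h → c * f * h * g ≡ c * g * h * f
    l₃ = RS.solve-∀ ℚ-ring
    l₄ : ∀ c f g h → c * g * h * f ≡ c * (f * g * h)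
    l₄ = RS.solve-∀ ℚ-ring

  ∑₃-swap : (f : Fin ℓ → Fin ℓ → Fin ℓ → Fin n → ℚ) →
    ∑₃ (λ α β γ → ∑ (f α β γ)) ≡ ∑ (λ x → ∑₃ (λ α β γ → f α β γ x))
  ∑₃-swap f = trans
    (∑-cong λ α → trans (∑-cong λ β → ∑-swap (λ γ x → f α β γ x)) (∑-swap (λ β x → ∑ (λ γ → f α β γ x))))
    (∑-swap (λ α x → ∑ (λ β → ∑ (λ γ → f α β γ x))))

  *-cancel-≡ : ∀ c {a b} → 0ℚ < c → a * c ≡ b * c → a ≡ b
  *-cancel-≡ c {a} {b} 0<c e = ℚₚ.≤-antisym
    (*-cancel c 0<c (ℚₚ.≤-reflexive (trans (ℚₚ.*-comm c a) (trans e (ℚₚ.*-comm b c)))))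
    (*-cancel c 0<c (ℚₚ.≤-reflexive (trans (ℚₚ.*-comm c b) (trans (sym e) (ℚₚ.*-comm a c)))))

  size₂≤ : (E : Rel₂ n) (U W : Fin n → Bool) → ι (size₂ E U W) ≤ card U * card W
  size₂≤ E U W = subst₂ _≤_ (sym (size₂-∑ E U W))
    (∑-card U (card W))
    (∑-weighted U (λ x _ → subst (∑ (λ y → [ W y ] * [ E x y ]) ≤_)
      (trans (∑-card W 1ℚ) (ℚₚ.*-identityʳ (card W)))
      (∑-weighted W (λ y _ → subst₂ _≤_ (sym ([]≡ι (E x y))) ι-1 (ι-mono (⟦⟧≤1 (E x y)))))))

  -- Each pair between U and V has exactly one colour, so the actual densities p of the colour
  -- classes add up to 1.
  module Classes (c : Fin n → Fin n → Fin ℓ) (f : Fin ℓ → Rel₂ n) (U V : Fin n → Bool) (ε : ℚ) (0≤ε : 0ℚ ≤ ε)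
    (f-colour : ∀ α x y → U x ≡ true → V y ≡ true → f α x y ≡ does (c x y Finₚ.≟ α))
    (0<area : 0ℚ < card U * card V) where

    area : ℚ
    area = card U * card V

    rat : ∀ α → ∃[ d ] ι (size₂ (f α) U V) ≡ d * area
    rat α = ratio (ι (size₂ (f α) U V)) area 0<area

    p : Fin ℓ → ℚ
    p α = proj₁ (rat α)

    bounds : ∀ α → 0ℚ ≤ p α × p α ≤ 1ℚ
    bounds α = density-bounds (ι (size₂ (f α) U V)) area (p α) 0<area (0≤ι _) (size₂≤ (f α) U V) (proj₂ (rat α))

    total : ∀ x y → U x ≡ true → V y ≡ true → ∑ (λ α → [ f α x y ]) ≡ 1ℚ
    total x y Ux Vy = trans (∑-cong (λ α → trans (cong [_] (f-colour α x y Ux Vy)) (sym (ℚₚ.*-identityʳ _))))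
      (∑-pick (c x y) (λ _ → 1ℚ))

    p-sum : ∑ p ≡ 1ℚ
    p-sum = *-cancel-≡ area 0<area (trans (sym (∑-*ʳ area p)) (trans (∑-cong (λ α → sym (proj₂ (rat α))))
      (trans (∑-cong (λ α → size₂-∑ (f α) U V))
        (trans (∑-swap (λ α x → [ U x ] * ∑ (λ y → [ V y ] * [ f α x y ])))
          (trans (∑-cong row) (trans (∑-card U (card V)) (sym (ℚₚ.*-identityˡ area))))))))
      where
      guard : ∀ b {s t : ℚ} → (b ≡ true → s ≡ t) → [ b ] * s ≡ [ b ] * t
      guard true h = cong ([ true ] *_) (h refl)
      guard false {s} {t} _ = trans (cong (_* s) [false]) (trans (ℚₚ.*-zeroˡ s) (sym (trans (cong (_* t) [false]) (ℚₚ.*-zeroˡ t))))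
      row : ∀ x → ∑ (λ α → [ U x ] * ∑ (λ y → [ V y ] * [ f α x y ])) ≡ [ U x ] * card V
      row x = trans (∑-*ˡ [ U x ] (λ α → ∑ (λ y → [ V y ] * [ f α x y ])))
        (guard (U x) (λ Ux → trans (∑-swap (λ α y → [ V y ] * [ f α x y ]))
          (trans (∑-cong (λ y → trans (∑-*ˡ [ V y ] (λ α → [ f α x y ])) (guard (V y) (λ Vy → total x y Ux Vy))))
            (trans (∑-card V 1ℚ) (ℚₚ.*-identityʳ (card V))))))

    regular : ∀ α d → Disc₂ ε d U V (f α) → Regular₂ ε (p α) U V (f α)
    regular α d D A B A⊆ B⊆ =
      subst (λ d → ι (size₂ (f α) A B) ≤ d * (card A * card B) + ε * area) d≡p (Disc₂.upper D A B A⊆ B⊆) ,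
      subst (λ d → d * (card A * card B) ≤ ι (size₂ (f α) A B) + ε * area) d≡p (Disc₂.lower D A B A⊆ B⊆)
      where
      d≡p : Disc₂.d D ≡ p α
      d≡p = *-cancel-≡ area 0<area (trans (sym (Disc₂.density D)) (proj₂ (rat α)))

    -- The d₂ of a triad is only known to be near p α. An upper bound is what the error term ε₁ d₂³
    -- calls for.
    near : ∀ α d → Disc₂ ε d U V (f α) → d ≤ p α + ε
    near α d D = *-cancel area 0<area (subst₂ _≤_ (ℚₚ.*-comm d area) (trans (cong (_+ ε * area) (proj₂ (rat α))) (l (p α) ε area))
      (Disc₂.near-lower D))
      where
      l : ∀ p e a → p * a + e * a ≡ a * (p + e)
      l = RS.solve-∀ ℚ-ring

  cube-mono : ∀ {d a b c} → 0ℚ ≤ d → d ≤ a → d ≤ b → d ≤ c → d * d * d ≤ a * b * c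
  cube-mono {d} {a} {b} {c} 0≤d da db dc =
    *-mono (0≤* 0≤d 0≤d) (ℚₚ.≤-trans 0≤d dc) (*-mono 0≤d (ℚₚ.≤-trans 0≤d db) da db) dc

  edges : (f g h : Rel₂ n) → Edges n
  edges f g h = record { E₁₂ = f ; E₁₃ = g ; E₂₃ = h }

  module Box (ε₁ ε : ℚ) (0≤ε₁ : 0ℚ ≤ ε₁) (0≤ε : 0ℚ ≤ ε) (U V W : Fin n → Bool) (E : Rel₃ n) (c : Fin n → Fin n → Fin ℓ)
    (f g h : Fin ℓ → Rel₂ n)
    (f-colour : ∀ α x y → U x ≡ true → V y ≡ true → f α x y ≡ does (c x y Finₚ.≟ α))
    (g-colour : ∀ α x z → U x ≡ true → W z ≡ true → g α x z ≡ does (c x z Finₚ.≟ α))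
    (h-colour : ∀ α y z → V y ≡ true → W z ≡ true → h α y z ≡ does (c y z Finₚ.≟ α))
    (0<U : 0 ℕ.< # U) (0<V : 0 ℕ.< # V) (0<W : 0 ℕ.< # W)
    (boxes : ∀ α β γ → TriadBoxes ε₁ ε U V W E (edges (f α) (g β) (h γ))) where

    module Cf = Classes c f U V ε 0≤ε f-colour (0<* (0<ι 0<U) (0<ι 0<V))
    module Cg = Classes c g U W ε 0≤ε g-colour (0<* (0<ι 0<U) (0<ι 0<W))
    module Ch = Classes c h V W ε 0≤ε h-colour (0<* (0<ι 0<V) (0<ι 0<W))

    v₀ : ℚ
    v₀ = card U * card V * card W

    0<v₀ : 0ℚ < v₀
    0<v₀ = 0<* (0<* (0<ι 0<U) (0<ι 0<V)) (0<ι 0<W)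

    G : Fin ℓ → Fin ℓ → Fin ℓ → Edges n
    G α β γ = edges (f α) (g β) (h γ)

    d₃ : Fin ℓ → Fin ℓ → Fin ℓ → ℚ
    d₃ α β γ = TriadBoxes.d₃ (boxes α β γ)

    -- D is the average of the d₃ with weights p α · p β · p γ. The error keeps a product of
    -- densities instead of bounding d₂ by 1: summed over all triads it factors into ε₁ (1 + ℓ ε)³,
    -- while ε₁ ℓ³ would be useless, as ε₁ is fixed before ℓ.
    main err : Fin ℓ → Fin ℓ → Fin ℓ → ℚ
    main α β γ = d₃ α β γ * (Cf.p α * Cg.p β * Ch.p γ)
    err α β γ = (ε + ε + ε) + ε₁ * ((Cf.p α + ε) * (Cg.p β + ε) * (Ch.p γ + ε))

    D Err : ℚ
    D = ∑₃ main
    Err = ∑₃ err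

    module _ (A B C : Fin n → Bool) (A⊆ : A ⊆ᵇ U) (B⊆ : B ⊆ᵇ V) (C⊆ : C ⊆ᵇ W) where

      private
        k : ℚ
        k = card A * card B * card C

        s m : Fin ℓ → Fin ℓ → Fin ℓ → ℚ
        s α β γ = ι (size₃ (E ∩₃ triangles (G α β γ)) A B C)
        m α β γ = ι (size₃ (triangles (G α β γ)) A B C)

        term : ∀ α β γ → s α β γ ≤ main α β γ * k + err α β γ * v₀ × main α β γ * k ≤ s α β γ + err α β γ * v₀
        term α β γ =
          0≤⇒≤ (((d * m₀ + ε₁ * (d₂ * d₂ * d₂) * v₀ - s₀) + d * ((pqr * k + (ε + ε + ε) * v₀) - m₀))
              + (ε₁ * (t - d₂ * d₂ * d₂) * v₀ + (1ℚ - d) * ((ε + ε + ε) * v₀)))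
            (0≤+ (0≤+ (≤⇒0≤ (TriadBoxes.box-upper b A B C A⊆ B⊆ C⊆)) (0≤* 0≤d (≤⇒0≤ m-upper))) rest)
            (l₁ d m₀ s₀ pqr k ε ε₁ (d₂ * d₂ * d₂) t v₀) ,
          0≤⇒≤ (((s₀ + ε₁ * (d₂ * d₂ * d₂) * v₀ - d * m₀) + d * ((m₀ + (ε + ε + ε) * v₀) - pqr * k))
              + (ε₁ * (t - d₂ * d₂ * d₂) * v₀ + (1ℚ - d) * ((ε + ε + ε) * v₀)))
            (0≤+ (0≤+ (≤⇒0≤ (TriadBoxes.box-lower b A B C A⊆ B⊆ C⊆)) (0≤* 0≤d (≤⇒0≤ m-lower))) rest)
            (l₂ d m₀ s₀ pqr k ε ε₁ (d₂ * d₂ * d₂) t v₀)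
          where
          b = boxes α β γ
          d = d₃ α β γ
          d₂ = TriadBoxes.d₂ b
          0≤d = TriadBoxes.0≤d₃ b
          s₀ = s α β γ
          m₀ = m α β γ
          pqr = Cf.p α * Cg.p β * Ch.p γ
          t = (Cf.p α + ε) * (Cg.p β + ε) * (Ch.p γ + ε)
          d₂≤ : d₂ * d₂ * d₂ ≤ t
          d₂≤ = cube-mono (TriadBoxes.0≤d₂ b) (Cf.near α d₂ (TriadBoxes.D₁₂ b)) (Cg.near β d₂ (TriadBoxes.D₁₃ b)) (Ch.near γ d₂ (TriadBoxes.D₂₃ b))
          rest : 0ℚ ≤ ε₁ * (t - d₂ * d₂ * d₂) * v₀ + (1ℚ - d) * ((ε + ε + ε) * v₀)
          rest = 0≤+ (0≤* (0≤* 0≤ε₁ (≤⇒0≤ d₂≤)) (ℚₚ.<⇒≤ 0<v₀))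
            (0≤* (≤⇒0≤ (TriadBoxes.d₃≤1 b)) (0≤* (0≤+ (0≤+ 0≤ε 0≤ε) 0≤ε) (ℚₚ.<⇒≤ 0<v₀)))
          open Triangles ε (Cf.p α) (Cg.p β) (Ch.p γ) 0≤ε (proj₁ (Cf.bounds α)) (proj₂ (Cf.bounds α)) (proj₁ (Cg.bounds β)) (proj₂ (Cg.bounds β))
            U V W (f α) (g β) (h γ) (Cf.regular α d₂ (TriadBoxes.D₁₂ b)) (Cg.regular β d₂ (TriadBoxes.D₁₃ b)) (Ch.regular γ d₂ (TriadBoxes.D₂₃ b))
            A B C A⊆ B⊆ C⊆ renaming (upper to m-upper; lower to m-lower)
          l₁ : ∀ d m s p k e e₁ c t v → d * p * k + ((e + e + e) + e₁ * t) * v - s ≡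
            ((d * m + e₁ * c * v - s) + d * ((p * k + (e + e + e) * v) - m)) + (e₁ * (t - c) * v + (1ℚ - d) * ((e + e + e) * v))
          l₁ = RS.solve-∀ ℚ-ring
          l₂ : ∀ d m s p k e e₁ c t v → s + ((e + e + e) + e₁ * t) * v - d * p * k ≡
            ((s + e₁ * c * v - d * m) + d * ((m + (e + e + e) * v) - p * k)) + (e₁ * (t - c) * v + (1ℚ - d) * ((e + e + e) * v))
          l₂ = RS.solve-∀ ℚ-ring

        -- A triple across the parts lies in exactly one triad. The sum over the triads factors into
        -- three sums over colours, each equal to 1.
        partition : ∑₃ s ≡ ι (size₃ E A B C)
        partition = trans (∑₃-cong (λ α β γ → size₃-∑ (E ∩₃ triangles (G α β γ)) A B C))
          (trans (∑₃-swap (λ α β γ x → ∑ (λ y → ∑ (λ z → φ α β γ x y z))))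
            (trans (∑-cong λ x → trans (∑₃-swap (λ α β γ y → ∑ (λ z → φ α β γ x y z)))
                (∑-cong λ y → trans (∑₃-swap (λ α β γ z → φ α β γ x y z)) (∑-cong λ z → pointwise x y z)))
              (sym (size₃-∑ E A B C))))
          where
          φ : Fin ℓ → Fin ℓ → Fin ℓ → Fin n → Fin n → Fin n → ℚ
          φ α β γ x y z = [ A x ∧ (B y ∧ (C z ∧ (E x y z ∧ triangles (G α β γ) x y z))) ]
          pointwise : ∀ x y z → ∑₃ (λ α β γ → φ α β γ x y z) ≡ [ A x ∧ (B y ∧ (C z ∧ E x y z)) ]
          pointwise x y z = trans (∑₃-cong (λ α β γ → split (A x) (B y) (C z) (E x y z) (f α x y) (g β x z) (h γ y z)))
            (trans (∑₃-product e (λ α → [ f α x y ]) (λ β → [ g β x z ]) (λ γ → [ h γ y z ]))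
              (collapse (A x) (B y) (C z) (E x y z) (λ a b → Cf.total x y (A⊆ x a) (B⊆ y b))
                (λ a c → Cg.total x z (A⊆ x a) (C⊆ z c)) (λ b c → Ch.total y z (B⊆ y b) (C⊆ z c))))
            where
            e = [ A x ∧ (B y ∧ (C z ∧ E x y z)) ]
            assoc : ∀ a b c e t → a ∧ (b ∧ (c ∧ (e ∧ t))) ≡ (a ∧ (b ∧ (c ∧ e))) ∧ t
            assoc false b c e t = refl
            assoc true false c e t = refl
            assoc true true false e t = refl
            assoc true true true e t = refl
            split : ∀ a b c e f g h → [ a ∧ (b ∧ (c ∧ (e ∧ (f ∧ (g ∧ h))))) ] ≡ [ a ∧ (b ∧ (c ∧ e)) ] * ([ f ] * [ g ] * [ h ])
            split a b c e f g h = trans (cong [_] (assoc a b c e (f ∧ (g ∧ h)))) (trans ([∧] (a ∧ (b ∧ (c ∧ e))) (f ∧ (g ∧ h)))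
              (cong ([ a ∧ (b ∧ (c ∧ e)) ] *_) (trans ([∧] f (g ∧ h)) (trans (cong ([ f ] *_) ([∧] g h)) (sym (ℚₚ.*-assoc [ f ] [ g ] [ h ]))))))
            vanish : ∀ X → [ false ] * X ≡ [ false ]
            vanish X = trans (cong (_* X) [false]) (trans (ℚₚ.*-zeroˡ X) (sym [false]))
            collapse : ∀ a b c e {F G H} → (a ≡ true → b ≡ true → F ≡ 1ℚ) → (a ≡ true → c ≡ true → G ≡ 1ℚ) → (b ≡ true → c ≡ true → H ≡ 1ℚ) →
              [ a ∧ (b ∧ (c ∧ e)) ] * (F * G * H) ≡ [ a ∧ (b ∧ (c ∧ e)) ]
            collapse true true true e hF hG hH = trans (cong₂ (λ fg h → [ e ] * (fg * h)) (cong₂ _*_ (hF refl refl) (hG refl refl)) (hH refl refl)) (l [ e ])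
              where
              l : ∀ e → e * (1ℚ * 1ℚ * 1ℚ) ≡ e
              l = RS.solve-∀ ℚ-ring
            collapse true true false e _ _ _ = vanish _
            collapse true false c e _ _ _ = vanish _
            collapse false b c e _ _ _ = vanish _

      box-upper : ι (size₃ E A B C) ≤ D * k + Err * v₀
      box-upper = subst₂ _≤_ partition
        (trans (∑₃-+ (λ α β γ → main α β γ * k) (λ α β γ → err α β γ * v₀)) (cong₂ _+_ (∑₃-*ʳ k main) (∑₃-*ʳ v₀ err)))
        (∑₃-mono (λ α β γ → proj₁ (term α β γ)))

      box-lower : D * k ≤ ι (size₃ E A B C) + Err * v₀
      box-lower = subst₂ _≤_ (∑₃-*ʳ k main)
        (trans (∑₃-+ s (λ α β γ → err α β γ * v₀)) (cong₂ _+_ partition (∑₃-*ʳ v₀ err)))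
        (∑₃-mono (λ α β γ → proj₂ (term α β γ)))

    Err≡ : Err ≡ ι ℓ * (ι ℓ * (ι ℓ * (ε + ε + ε))) + ε₁ * ((1ℚ + ι ℓ * ε) * (1ℚ + ι ℓ * ε) * (1ℚ + ι ℓ * ε))
    Err≡ = trans (∑₃-+ {ℓ} (λ _ _ _ → ε + ε + ε) (λ α β γ → ε₁ * ((Cf.p α + ε) * (Cg.p β + ε) * (Ch.p γ + ε))))
      (cong₂ _+_ constant (trans (∑₃-product ε₁ (λ α → Cf.p α + ε) (λ β → Cg.p β + ε) (λ γ → Ch.p γ + ε))
        (cong (ε₁ *_) (cong₂ _*_ (cong₂ _*_ (shift Cf.p Cf.p-sum) (shift Cg.p Cg.p-sum)) (shift Ch.p Ch.p-sum)))))
      where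
      constant : ∑₃ {ℓ} (λ _ _ _ → ε + ε + ε) ≡ ι ℓ * (ι ℓ * (ι ℓ * (ε + ε + ε)))
      constant = trans (∑-cong {ℓ} (λ _ → trans (∑-cong {ℓ} (λ _ → ∑-ι ℓ (ε + ε + ε))) (∑-ι ℓ (ι ℓ * (ε + ε + ε))))) (∑-ι ℓ (ι ℓ * (ι ℓ * (ε + ε + ε))))
      shift : (p : Fin ℓ → ℚ) → ∑ p ≡ 1ℚ → ∑ (λ α → p α + ε) ≡ 1ℚ + ι ℓ * ε
      shift p e = trans (∑-+ p (λ _ → ε)) (cong₂ _+_ e (∑-ι ℓ ε))

    d : ℚ
    d = proj₁ (ratio (ι (size₃ E U V W)) v₀ 0<v₀)

    density : ι (size₃ E U V W) ≡ d * v₀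
    density = proj₂ (ratio (ι (size₃ E U V W)) v₀ 0<v₀)

    private
      -- `vdisc₃` compares with the density d of the triple, the boxes with D. The full box shows |d
      -- - D| ≤ Err, so the total error becomes 2 Err.
      full-upper : d - D ≤ Err
      full-upper = *-cancel v₀ 0<v₀ (0≤⇒≤ (D * v₀ + Err * v₀ - d * v₀)
        (≤⇒0≤ (subst (_≤ D * v₀ + Err * v₀) density (box-upper U V W (λ _ e → e) (λ _ e → e) (λ _ e → e)))) (l v₀ d D Err))
        where
        l : ∀ v d D e → v * e - v * (d - D) ≡ D * v + e * v - d * v
        l = RS.solve-∀ ℚ-ring
      full-lower : D - d ≤ Err
      full-lower = *-cancel v₀ 0<v₀ (0≤⇒≤ (d * v₀ + Err * v₀ - D * v₀)
        (≤⇒0≤ (subst (λ s → D * v₀ ≤ s + Err * v₀) density (box-lower U V W (λ _ e → e) (λ _ e → e) (λ _ e → e)))) (l v₀ d D Err))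
        where
        l : ∀ v d D e → v * e - v * (D - d) ≡ d * v + e * v - D * v
        l = RS.solve-∀ ℚ-ring

    module _ (η : ℚ) (2Err≤ : Err + Err ≤ η) (A B C : Fin n → Bool) (A⊆ : A ⊆ᵇ U) (B⊆ : B ⊆ᵇ V) (C⊆ : C ⊆ᵇ W) where

      private
        k : ℚ
        k = card A * card B * card C

        0≤k : 0ℚ ≤ k
        0≤k = 0≤* (0≤* (0≤card A) (0≤card B)) (0≤card C)

        k≤v₀ : k ≤ v₀
        k≤v₀ = *-mono (0≤* (0≤card A) (0≤card B)) (0≤card W) (*-mono (0≤card A) (0≤card V) (card-mono A⊆) (card-mono B⊆)) (card-mono C⊆)

        0≤Err : 0ℚ ≤ Err
        0≤Err = ℚₚ.≮⇒≥ λ Err<0 → ℚₚ.<-irrefl refl (ℚₚ.≤-<-trans (0≤⇒≤ ((Err - (d - D)) + (Err - (D - d)))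
          (0≤+ (≤⇒0≤ full-upper) (≤⇒0≤ full-lower)) (l d D Err))
          (subst (Err + Err <_) (ℚₚ.+-identityˡ 0ℚ) (ℚₚ.+-mono-< {Err} {0ℚ} {Err} {0ℚ} Err<0 Err<0)))
          where
          l : ∀ d D e → (e + e) - 0ℚ ≡ (e - (d - D)) + (e - (D - d))
          l = RS.solve-∀ ℚ-ring

      vdisc-upper : ι (size₃ E A B C) ≤ d * k + η * v₀
      vdisc-upper = 0≤⇒≤
        (((D * k + Err * v₀ - s) + (Err - (D - d)) * k) + (Err * (v₀ - k) + (η - (Err + Err)) * v₀))
        (0≤+ (0≤+ (≤⇒0≤ (box-upper A B C A⊆ B⊆ C⊆)) (0≤* (≤⇒0≤ full-lower) 0≤k))
          (0≤+ (0≤* 0≤Err (≤⇒0≤ k≤v₀)) (0≤* (≤⇒0≤ 2Err≤) (ℚₚ.<⇒≤ 0<v₀)))) (l s d D Err k v₀ η)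
        where
        s = ι (size₃ E A B C)
        l : ∀ s d D e k v η → d * k + η * v - s ≡ ((D * k + e * v - s) + (e - (D - d)) * k) + (e * (v - k) + (η - (e + e)) * v)
        l = RS.solve-∀ ℚ-ring

      vdisc-lower : d * k ≤ ι (size₃ E A B C) + η * v₀
      vdisc-lower = 0≤⇒≤
        (((s + Err * v₀ - D * k) + (Err - (d - D)) * k) + (Err * (v₀ - k) + (η - (Err + Err)) * v₀))
        (0≤+ (0≤+ (≤⇒0≤ (box-lower A B C A⊆ B⊆ C⊆)) (0≤* (≤⇒0≤ full-upper) 0≤k))
          (0≤+ (0≤* 0≤Err (≤⇒0≤ k≤v₀)) (0≤* (≤⇒0≤ 2Err≤) (ℚₚ.<⇒≤ 0<v₀)))) (l s d D Err k v₀ η)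
        where
        s = ι (size₃ E A B C)
        l : ∀ s d D e k v η → s + η * v - d * k ≡ ((s + e * v - D * k) + (e - (d - D)) * k) + (e * (v - k) + (η - (e + e)) * v)
        l = RS.solve-∀ ℚ-ring

-- From disc₂,₃ to vdisc₃.

module FromDisc where
  open Counting
  open Partitions using (cls; class-lower)
  open HalfGraphPartitions using (_⊆ᵇ_)
  open ForbiddenHalfGraph using (equipartition⇒Equi)
  open Rationals
  open Embedding
  open Homogeneity using (vol≡; reciprocal)
  open ColourClasses
  open TriadsOfHomogeneousTriples using (count₃-ι)
  open FromVdisc using (archimedean-ι)
  open TriangleCounting
  open BoxDensities
  open import Defs
  open import Data.Bool.Base using (Bool; true; T; _∧_)
  open import Data.Fin.Base using (Fin; suc)
  open import Data.Fin.Subset using (Subset; ∣_∣; _⊆_)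
  open import Data.Nat.Base as ℕ using (ℕ; suc)
  open import Data.Rational.Base using (ℚ; 0ℚ; 1ℚ; _+_; _*_; _-_; -_; _≤_; _<_)
  open import Data.Vec.Base using (lookup; tabulate)

  private
    variable
      n : ℕ

  fromℕ-∣∣₃ : (A B C : Subset n) → fromℕ (∣ A ∣ ℕ.* ∣ B ∣ ℕ.* ∣ C ∣) ≡ card (lookup A) * card (lookup B) * card (lookup C)
  fromℕ-∣∣₃ A B C = trans (cong fromℕ (cong₂ ℕ._*_ (cong₂ ℕ._*_ (∣∣-size A) (∣∣-size B)) (∣∣-size C))) (vol≡ (lookup A) (lookup B) (lookup C))

  boxes⇒vdisc₃ : ∀ η d (U V W : Fin n → Bool) E → ι (size₃ E U V W) ≡ d * (card U * card V * card W) →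
    (∀ A B C → A ⊆ᵇ U → B ⊆ᵇ V → C ⊆ᵇ W →
      ι (size₃ E A B C) ≤ d * (card A * card B * card C) + η * (card U * card V * card W) ×
      d * (card A * card B * card C) ≤ ι (size₃ E A B C) + η * (card U * card V * card W)) →
    vdisc₃ η (tabulate U) (tabulate V) (tabulate W) E
  boxes⇒vdisc₃ η d U V W E density boxes =
    d , trans (count₃-ι E U V W) (trans density (cong (d *_) (sym vol₀))) , regular
    where
    vol₀ : fromℕ (∣ tabulate U ∣ ℕ.* ∣ tabulate V ∣ ℕ.* ∣ tabulate W ∣) ≡ card U * card V * card W
    vol₀ = trans (fromℕ-∣∣₃ (tabulate U) (tabulate V) (tabulate W))
      (cong₂ _*_ (cong₂ _*_ (card-tabulate U) (card-tabulate V)) (card-tabulate W))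
    regular : ∀ U′ V′ W′ → U′ ⊆ tabulate U → V′ ⊆ tabulate V → W′ ⊆ tabulate W →
      fromℕ (count₃ E U′ V′ W′) ≈ d * fromℕ (∣ U′ ∣ ℕ.* ∣ V′ ∣ ℕ.* ∣ W′ ∣)
        within (η * fromℕ (∣ tabulate U ∣ ℕ.* ∣ tabulate V ∣ ℕ.* ∣ tabulate W ∣))
    regular U′ V′ W′ U⊆ V⊆ W⊆ = subst₂ (λ s a → s ≈ d * a within (η * fromℕ (∣ tabulate U ∣ ℕ.* ∣ tabulate V ∣ ℕ.* ∣ tabulate W ∣)))
      (trans (ι≡fromℕ _) (cong fromℕ (sym (count₃-size E U′ V′ W′)))) (sym (fromℕ-∣∣₃ U′ V′ W′))
      (subst (λ v → ι (size₃ E A B C) ≈ d * (card A * card B * card C) within (η * v)) (sym vol₀)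
        (⇒within (proj₁ bounds) (proj₂ bounds)))
      where
      A = lookup U′
      B = lookup V′
      C = lookup W′
      inside : ∀ (X : Fin _ → Bool) (Y : Subset _) → Y ⊆ tabulate X → lookup Y ⊆ᵇ X
      inside X Y h x e = trans (sym (lookup-tabulate X x)) (⊆-lookup {U = Y} {tabulate X} h x e)
      bounds = boxes A B C (inside U U′ U⊆) (inside V V′ V⊆) (inside W W′ W⊆)

  boxError : ℕ → ℚ → ℚ → ℚ
  boxError ℓ ε₁ ε₂ = ι ℓ * (ι ℓ * (ι ℓ * (ε₂ + ε₂ + ε₂))) + ε₁ * ((1ℚ + ι ℓ * ε₂) * (1ℚ + ι ℓ * ε₂) * (1ℚ + ι ℓ * ε₂))

  module Assemble {n t ℓ : ℕ} (H : ThreeGraph n) (ε₁ ε₂ ε : ℚ) (0≤ε₁ : 0ℚ ≤ ε₁) (0≤ε₂ : 0ℚ ≤ ε₂)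
    (𝓟 : Decomposition n t ℓ ε₁ ε₂) (regular : TriadsRegular H 𝓟)
    (nonempty : ∀ i → 0 ℕ.< # (cls (Decomposition.part 𝓟) i))
    (error : boxError ℓ ε₁ ε₂ + boxError ℓ ε₁ ε₂ ≤ ε) where

    open Decomposition 𝓟 using (part; colour)

    P-colour : ∀ i j α x y → cls part i x ≡ true → cls part j y ≡ true → P part colour i j α x y ≡ does (colour x y Finₚ.≟ α)
    P-colour i j α x y e e′ = cong₂ (λ a b → a ∧ (b ∧ does (colour x y Finₚ.≟ α))) e e′

    part-vdisc₃ : ∀ i j k → Distinct i j k → vdisc₃ ε (class part i) (class part j) (class part k) (edge H)
    part-vdisc₃ i j k dis = boxes⇒vdisc₃ ε B.d (cls part i) (cls part j) (cls part k) (edge H) B.density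
      (λ A B C A⊆ B⊆ C⊆ → B.vdisc-upper ε 2Err≤ A B C A⊆ B⊆ C⊆ , B.vdisc-lower ε 2Err≤ A B C A⊆ B⊆ C⊆)
      where
      module B = Box ε₁ ε₂ 0≤ε₁ 0≤ε₂ (cls part i) (cls part j) (cls part k) (edge H) colour
        (P part colour i j) (P part colour i k) (P part colour j k)
        (P-colour i j) (P-colour i k) (P-colour j k) (nonempty i) (nonempty j) (nonempty k)
        (λ α β γ → disc₂,₃⇒boxes ε₁ ε₂ (cls part i) (cls part j) (cls part k) (edge H) (triad part colour i j k α β γ) 0≤ε₁
          (regular i j k dis α β γ))
      2Err≤ : B.Err + B.Err ≤ ε
      2Err≤ = subst (λ e → e + e ≤ ε) (sym B.Err≡) error

  -- Each of the two summands is at most 3 ε₁ from triangle counting plus 2³ ε₁ from the cube, as 1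
  -- + ℓ ε₂ ≤ 2. Hence 22 = 2 (3 + 8).
  error-bound : ∀ ℓ ε₁ ε₂ → 0ℚ ≤ ε₁ → 0ℚ ≤ ι ℓ * ε₂ → ι ℓ * ε₂ ≤ 1ℚ → ι ℓ * (ι ℓ * (ι ℓ * ε₂)) ≤ ε₁ →
    boxError ℓ ε₁ ε₂ + boxError ℓ ε₁ ε₂ ≤ ι 22 * ε₁
  error-bound ℓ ε₁ ε₂ 0≤ε₁ 0≤x x≤1 small = ℚₚ.≤-trans (ℚₚ.+-mono-≤ half half) (ℚₚ.≤-reflexive (sym twenty-two))
    where
    x X : ℚ
    x = ι ℓ * ε₂
    X = ι ℓ * (ι ℓ * (ι ℓ * ε₂))
    two : ℚ
    two = 1ℚ + 1ℚ
    0≤two : 0ℚ ≤ two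
    0≤two = 0≤+ (subst (0ℚ ≤_) ι-1 (0≤ι 1)) (subst (0ℚ ≤_) ι-1 (0≤ι 1))
    1+x≤ : 1ℚ + x ≤ two
    1+x≤ = ℚₚ.+-monoʳ-≤ 1ℚ x≤1
    0≤1+x : 0ℚ ≤ 1ℚ + x
    0≤1+x = 0≤+ (subst (0ℚ ≤_) ι-1 (0≤ι 1)) 0≤x
    cube≤ : (1ℚ + x) * (1ℚ + x) * (1ℚ + x) ≤ two * two * two
    cube≤ = *-mono (0≤* 0≤1+x 0≤1+x) 0≤two (*-mono 0≤1+x 0≤two 1+x≤ 1+x≤) 1+x≤
    l₁ : ∀ a e → a * (a * (a * (e + e + e))) ≡ a * (a * (a * e)) + a * (a * (a * e)) + a * (a * (a * e))
    l₁ = RS.solve-∀ ℚ-ring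
    half : ι ℓ * (ι ℓ * (ι ℓ * (ε₂ + ε₂ + ε₂))) + ε₁ * ((1ℚ + x) * (1ℚ + x) * (1ℚ + x)) ≤ (ε₁ + ε₁ + ε₁) + ε₁ * (two * two * two)
    half = ℚₚ.+-mono-≤ (subst (_≤ ε₁ + ε₁ + ε₁) (sym (l₁ (ι ℓ) ε₂)) (ℚₚ.+-mono-≤ (ℚₚ.+-mono-≤ small small) small))
      (*-monoˡ ε₁ 0≤ε₁ cube≤)
    ι-two : ι 2 ≡ two
    ι-two = trans (ι-+ 1 1) (cong₂ _+_ ι-1 ι-1)
    ι-22 : ι 22 ≡ (ι 2 * ι 2 * ι 2 + ι 3) + (ι 2 * ι 2 * ι 2 + ι 3)
    ι-22 = trans (ι-+ 11 11) (cong₂ _+_ eleven eleven)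
      where
      eleven : ι 11 ≡ ι 2 * ι 2 * ι 2 + ι 3
      eleven = trans (ι-+ 8 3) (cong (_+ ι 3) (trans (ι-* 4 2) (cong (_* ι 2) (ι-* 2 2))))
    twenty-two : ι 22 * ε₁ ≡ ((ε₁ + ε₁ + ε₁) + ε₁ * (two * two * two)) + ((ε₁ + ε₁ + ε₁) + ε₁ * (two * two * two))
    twenty-two = trans (cong (_* ε₁) (trans ι-22 (cong₂ (λ a b → (a * a * a + b) + (a * a * a + b)) ι-two
        (trans (ι-+ 2 1) (cong₂ _+_ ι-two ι-1))))) (l ε₁)
      where
      l : ∀ e → (((1ℚ + 1ℚ) * (1ℚ + 1ℚ) * (1ℚ + 1ℚ) + ((1ℚ + 1ℚ) + 1ℚ)) + ((1ℚ + 1ℚ) * (1ℚ + 1ℚ) * (1ℚ + 1ℚ) + ((1ℚ + 1ℚ) + 1ℚ))) * e ≡ ((e + e + e) + e * ((1ℚ + 1ℚ) * (1ℚ + 1ℚ) * (1ℚ + 1ℚ))) + ((e + e + e) + e * ((1ℚ + 1ℚ) * (1ℚ + 1ℚ) * (1ℚ + 1ℚ)))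
      l = RS.solve-∀ ℚ-ring

  disc₂,₃⇒vdisc₃ : ∀ {p} {𝓗 : Property p} → ZeroDisc₂,₃Error 𝓗 → ZeroVdisc₃Error 𝓗
  disc₂,₃⇒vdisc₃ {𝓗 = 𝓗} zero-error ε t₀ 0<ε 1≤t₀ = step₁ (archimedean-ι 0<ε)
    where
    Result : Set _
    Result = ∃[ T ] ∃[ N ] ∀ {n} (H : ThreeGraph n) → 𝓗 H → N ℕ.≤ n →
      ∃[ t ] (t₀ ℕ.≤ t) × (t ℕ.≤ T) ×
      (Σ[ part ∈ (Fin n → Fin t) ] IsEquipartition part ×
        (∀ i j k → Distinct i j k → vdisc₃ ε (class part i) (class part j) (class part k) (edge H)))
    step₁ : ∃[ v ] 1 ℕ.≤ v × 1ℚ ≤ ι v * ε → Result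
    step₁ (v , 1≤v , vε) = step₂ (zero-error t₀ 1 ε₁ ε₂ 1≤t₀ (ℕ.s≤s ℕ.z≤n) 0<ε₁ (λ ℓ → 0<ε₂ ℓ , ε₂≤1 ℓ))
      where
      c : ℕ → ℕ
      -- ε₁ = 1 / 22v and ε₂ ℓ = 1 / c ℓ. The cube absorbs the ℓ³ triads, and ℓ + 1 in place of ℓ
      -- keeps c positive at ℓ = 0.
      c ℓ = 22 ℕ.* v ℕ.* (suc ℓ ℕ.* (suc ℓ ℕ.* suc ℓ))
      1≤22v : 1 ℕ.≤ 22 ℕ.* v
      1≤22v = ℕₚ.≤-trans 1≤v (ℕₚ.m≤n*m v 22)
      1≤c : ∀ ℓ → 1 ℕ.≤ c ℓ
      1≤c ℓ = ℕₚ.*-mono-≤ {1} {22 ℕ.* v} {1} 1≤22v (ℕ.s≤s ℕ.z≤n)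
      rec₁ = reciprocal (22 ℕ.* v) 1≤22v
      rec₂ : ∀ ℓ → ∃[ ε ] 0ℚ < ε × ε * ι (c ℓ) ≡ 1ℚ
      rec₂ ℓ = reciprocal (c ℓ) (1≤c ℓ)
      ε₁ : ℚ
      ε₁ = proj₁ rec₁
      0<ε₁ : 0ℚ < ε₁
      0<ε₁ = proj₁ (proj₂ rec₁)
      ε₂ : ℕ → ℚ
      ε₂ ℓ = proj₁ (rec₂ ℓ)
      0<ε₂ : ∀ ℓ → 0ℚ < ε₂ ℓ
      0<ε₂ ℓ = proj₁ (proj₂ (rec₂ ℓ))
      scaled : ∀ ℓ a → a ℕ.≤ c ℓ → ι a * ε₂ ℓ ≤ 1ℚ
      scaled ℓ a le = subst (ι a * ε₂ ℓ ≤_) (trans (ℚₚ.*-comm (ι (c ℓ)) (ε₂ ℓ)) (proj₂ (proj₂ (rec₂ ℓ))))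
        (*-monoʳ (ε₂ ℓ) (ℚₚ.<⇒≤ (0<ε₂ ℓ)) (ι-mono le))
      ε₂≤1 : ∀ ℓ → ε₂ ℓ ≤ 1ℚ
      ε₂≤1 ℓ = subst (_≤ 1ℚ) (trans (cong (_* ε₂ ℓ) ι-1) (ℚₚ.*-identityˡ (ε₂ ℓ))) (scaled ℓ 1 (1≤c ℓ))
      ℓε₂≤1 : ∀ ℓ → ι ℓ * ε₂ ℓ ≤ 1ℚ
      ℓε₂≤1 ℓ = scaled ℓ ℓ (ℕₚ.≤-trans (ℕₚ.n≤1+n ℓ) (ℕₚ.≤-trans (ℕₚ.m≤m*n (suc ℓ) (suc ℓ ℕ.* suc ℓ))
        (ℕₚ.m≤n*m (suc ℓ ℕ.* (suc ℓ ℕ.* suc ℓ)) (22 ℕ.* v) {{ℕ.>-nonZero 1≤22v}})))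
      ℓ³ε₂≤ε₁ : ∀ ℓ → ι ℓ * (ι ℓ * (ι ℓ * ε₂ ℓ)) ≤ ε₁
      ℓ³ε₂≤ε₁ ℓ = *-cancel (ι (22 ℕ.* v)) (0<ι 1≤22v) (subst₂ _≤_ left (sym (trans (ℚₚ.*-comm (ι (22 ℕ.* v)) ε₁) (proj₂ (proj₂ rec₁))))
        (scaled ℓ (22 ℕ.* v ℕ.* (ℓ ℕ.* (ℓ ℕ.* ℓ))) (ℕₚ.*-monoʳ-≤ (22 ℕ.* v)
          (ℕₚ.*-mono-≤ (ℕₚ.n≤1+n ℓ) (ℕₚ.*-mono-≤ (ℕₚ.n≤1+n ℓ) (ℕₚ.n≤1+n ℓ))))))
        where
        l : ∀ a b e → (a * (b * (b * b))) * e ≡ a * (b * (b * (b * e)))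
        l = RS.solve-∀ ℚ-ring
        left : ι (22 ℕ.* v ℕ.* (ℓ ℕ.* (ℓ ℕ.* ℓ))) * ε₂ ℓ ≡ ι (22 ℕ.* v) * (ι ℓ * (ι ℓ * (ι ℓ * ε₂ ℓ)))
        left = trans (cong (_* ε₂ ℓ) (trans (ι-* (22 ℕ.* v) (ℓ ℕ.* (ℓ ℕ.* ℓ))) (cong (ι (22 ℕ.* v) *_) (trans (ι-* ℓ (ℓ ℕ.* ℓ)) (cong (ι ℓ *_) (ι-* ℓ ℓ))))))
          (l (ι (22 ℕ.* v)) (ι ℓ) (ε₂ ℓ))
      22ε₁≤ε : ι 22 * ε₁ ≤ ε
      22ε₁≤ε = *-cancel (ι v) (0<ι 1≤v) (subst (_≤ ι v * ε) (sym (trans (l (ι v) (ι 22) ε₁)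
        (trans (cong (ε₁ *_) (sym (ι-* 22 v))) (proj₂ (proj₂ rec₁))))) vε)
        where
        l : ∀ v k e → v * (k * e) ≡ e * (k * v)
        l = RS.solve-∀ ℚ-ring
      step₂ : ∃[ N ] ∃[ T ] ∃[ L ] (∀ {n} (H : ThreeGraph n) → 𝓗 H → N ℕ.≤ n →
        ∃[ t ] ∃[ ℓ ] (t₀ ℕ.≤ t) × (t ℕ.≤ T) × (1 ℕ.≤ ℓ) × (ℓ ℕ.≤ L) ×
        Σ (Decomposition n t ℓ ε₁ (ε₂ ℓ)) (TriadsRegular H)) → Result
      -- n ≥ 2T leaves no part empty, so that the densities of the colour classes are defined.
      step₂ (N , T , L , decompose) = T , N ℕ.+ T ℕ.* 2 , construct
        where
        construct : ∀ {n} (H : ThreeGraph n) → 𝓗 H → N ℕ.+ T ℕ.* 2 ℕ.≤ n → _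
        construct {n} H H∈𝓗 N≤n = step₃ (decompose H H∈𝓗 (ℕₚ.≤-trans (ℕₚ.m≤m+n N (T ℕ.* 2)) N≤n))
          where
          step₃ : ∃[ t ] ∃[ ℓ ] (t₀ ℕ.≤ t) × (t ℕ.≤ T) × (1 ℕ.≤ ℓ) × (ℓ ℕ.≤ L) ×
            Σ (Decomposition n t ℓ ε₁ (ε₂ ℓ)) (TriadsRegular H) →
            ∃[ t ] (t₀ ℕ.≤ t) × (t ℕ.≤ T) ×
            (Σ[ part ∈ (Fin n → Fin t) ] IsEquipartition part ×
              (∀ i j k → Distinct i j k → vdisc₃ ε (class part i) (class part j) (class part k) (edge H)))
          step₃ (t , ℓ , t₀≤t , t≤T , _ , _ , 𝓟 , regular) = t , t₀≤t , t≤T , part , equipartition ,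
              Assemble.part-vdisc₃ H ε₁ (ε₂ ℓ) ε (ℚₚ.<⇒≤ 0<ε₁) (ℚₚ.<⇒≤ (0<ε₂ ℓ)) 𝓟 regular nonempty
                (ℚₚ.≤-trans (error-bound ℓ ε₁ (ε₂ ℓ) (ℚₚ.<⇒≤ 0<ε₁) (0≤* (0≤ι ℓ) (ℚₚ.<⇒≤ (0<ε₂ ℓ))) (ℓε₂≤1 ℓ) (ℓ³ε₂≤ε₁ ℓ)) 22ε₁≤ε)
            where
            open Decomposition 𝓟 using (part; equipartition)
            nonempty : ∀ i → 0 ℕ.< # (cls part i)
            nonempty i = ℕ.s≤s⁻¹ (ℕₚ.*-cancelˡ-≤ T {{ℕ.>-nonZero (ℕₚ.≤-trans 1≤t₀ (ℕₚ.≤-trans t₀≤t t≤T))}}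
              (ℕₚ.≤-trans (ℕₚ.≤-trans (ℕₚ.m≤n+m (T ℕ.* 2) N) N≤n) (ℕₚ.≤-trans (class-lower part (equipartition⇒Equi part equipartition) i)
                (ℕₚ.≤-trans (ℕₚ.≤-reflexive (l t (# (cls part i)))) (ℕₚ.*-monoˡ-≤ (suc (# (cls part i))) t≤T)))))
              where
              l : ∀ t c → t ℕ.* c ℕ.+ t ≡ t ℕ.* (1 ℕ.+ c)
              l = ℕ-Solver.solve-∀

theorem2p48 : {p : Level} (𝓗 : Property p) → Hereditary 𝓗 →
    ZeroDisc₂,₃Error 𝓗 ⇔ ZeroVdisc₃Error 𝓗
theorem2p48 𝓗 hereditary = mk⇔ FromDisc.disc₂,₃⇒vdisc₃ (FromVdisc.vdisc₃⇒disc₂,₃ hereditary)
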